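{- Let $x,y,z$ be non-negative integers with $x\equiv y\pmod 2$, and let $\mathbf a=(a_1,\dots,a_m)$, $\mathbf b=(b_1,\dots,b_n)$ be two sequences of non-negative integers. Put $a=\sum_i a_i$ and $b=\sum_j b_j$. (a) If $a_1$ is even, then $$M(S^{(1)}_{x,y,z}(\mathbf a;\mathbf b))=2^{y+z+a+b-a_1}\,M\Big(H^{(2)}_{\lfloor x/2\rfloor,\lceil y/2\rceil,z}\big(\tfrac{a_1}{2},a_2,\dots,a_m;\mathbf b\big)\Big)\,M\Big(W^{(1)}_{\lceil x/2\rceil,\lfloor y/2\rfloor,z}\big(\tfrac{a_1}{2},a_2,\dots,a_m;\mathbf b\big)\Big).$$ (b) If $a_1$ is odd, then $$M(S^{(1)}_{x,y,z}(\mathbf a;\mathbf b))=2^{y+z+a+b-a_1}\,M\Big(N^{(4)}_{\lfloor x/2\rfloor,\lceil y/2\rceil,z}\big(\tfrac{a_1+1}{2},a_2,\dots,a_m;\mathbf b\big)\Big)\,M\Big(N^{(1)}_{\lceil x/2\rceil,\lfloor y/2\rfloor,z}\big(\tfrac{a_1-1}{2},a_2,\dots,a_m;\mathbf b\big)\Big).$$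
   Context: Lattice and tilings. For real $u,k$ let $[u;k]$ be the point of the plane with Cartesian coordinates $(u,\frac{\sqrt3}{2}k)$. The triangular lattice has as vertices all $[u;k]$ with $k\in\mathbb Z$, $u-k/2\in\mathbb Z$ (or a horizontal translate of this set by $\frac12$, where needed); its faces are unit equilateral triangles, up-pointing or down-pointing. A region is a finite union of unit triangles. A lozenge is the union of two unit triangles sharing an edge; it is vertical if that edge is horizontal. A tiling of a region is a covering of it by lozenges contained in it, without gaps or overlaps. $M(R)$ is the sum of the weights of all tilings of $R$, the weight of a tiling being the product of the weights of its lozenges; lozenges have weight $1$ unless stated otherwise (so $M(R)$ is the number of tilings of an unweighted $R$); $M(\emptyset)=1$. Sequences. For a sequence $\mathbf a=(a_1,\dots,a_m)$: $a=\sum a_i$, and $o_a,e_a$ are the sums of the $a_i$ with $i$ odd, resp. even; similarly $b,o_b,e_b$ for $\mathbf b=(b_1,\dots,b_n)$. An empty sequence is treated as the one-term sequence $(0)$. The symmetric hexagon with three ferns removed, $S^{(1)}_{x,y,z}(\mathbf a;\mathbf b)$ ($x\equiv y$ mod 2). Let $W=x+y+2a-a_1+2b$ and take the lattice containing $[W/2;0]$. Consider the hexagon, symmetric about the vertical axis $u=0$, with side lengths, clockwise from the north side, $x+2e_a+2e_b$, $y+z+2o_a-a_1+2o_b$, $y+z+2e_a+2e_b$, $x+2o_a-a_1+2o_b$, $y+z+2e_a+2e_b$, $y+z+2o_a-a_1+2o_b$, placed so that its east and west vertices are $[\pm\frac{W+z}{2};-z]$; thus the line $\ell:k=0$, at level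 $z$ above these vertices, meets the hexagon in the segment from $[-\frac W2;0]$ to $[\frac W2;0]$. Remove: the up-pointing triangle of side $a_1$ with base from $[-\frac{a_1}2;0]$ to $[\frac{a_1}2;0]$; for $2\le i\le m$, the triangle of side $a_i$ with a side on $\ell$ from $[\frac{a_1}2+a_2+\dots+a_{i-1};0]$ to $[\frac{a_1}2+a_2+\dots+a_i;0]$ and its mirror image in $u=0$, down-pointing (below $\ell$) if $i$ is even, up-pointing (above $\ell$) if $i$ is odd; for $1\le j\le n$, the triangle of side $b_j$ with a side on $\ell$ from $[\frac W2-b_1-\dots-b_j;0]$ to $[\frac W2-b_1-\dots-b_{j-1};0]$ and its mirror image in $u=0$, up-pointing (above $\ell$) if $j$ is odd, down-pointing (below $\ell$) if $j$ is even. All lozenges have weight $1$. The halved-hexagon regions $X_{x,y,z}(\mathbf a;\mathbf b)$, $X\in\{H^{(2)},W^{(1)},N^{(1)},N^{(4)}\}$ (here $x,y,z,\mathbf a,\mathbf b$ are generic arguments: non-negative integers and sequences of non-negative integers, with $a_1\ge1$ for $N^{(4)}$). Let $L=x+y+a+b$, $h=y+o_a+o_b$, $g=y+z+e_a+e_b$, and $\ell$ the line $k=0$. Each region is determined by integers $A,B\ge-1$ and functions $\alpha,\beta$ as follows. Upper part (empty if $A=-1$): bounded by $\ell$ between $[\alpha(0);0]$ and $[L;0]$, the segment from $[L;0]$ to $[L-\frac A2;A]$, the horizontal north side at height $k=A$, and the west zigzag through $[\alpha(k);k]$, $0\le k\le A$. Lower part (empty if $B=-1$): bounded by $\ell$ between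 $[\beta(0);0]$ and $[L;0]$, the segments from $[L;0]$ to $[L+\frac z2;-z]$ and from there to $[L+z-\frac B2;-B]$, the horizontal south side at $k=-B$, and the west zigzag through $[\beta(k);-k]$, $0\le k\le B$. The region is the union of the two parts (lozenges may cross $\ell$) after removing: (i) from the upper part, everything at points $[u;k]$ with $u<a_1-k/2$; (ii) for $2\le i\le m$, the triangle of side $a_i$ with a side on $\ell$ from $[a_1+\dots+a_{i-1};0]$ to $[a_1+\dots+a_i;0]$, down-pointing (below $\ell$) if $i$ is even, up-pointing (above $\ell$) if $i$ is odd; (iii) for $1\le j\le n$, the triangle of side $b_j$ with a side on $\ell$ from $[L-b_1-\dots-b_j;0]$ to $[L-b_1-\dots-b_{j-1};0]$, up-pointing if $j$ is odd, down-pointing if $j$ is even. Data: - $H^{(2)}$: $A=2h-1$, $B=2g-1$; $\alpha=\beta=0$ at even $k$, $\frac12$ at odd $k$; unweighted. - $W^{(1)}$: $A=2h$, $B=2g$; $\alpha=\beta=0$ at even $k$, $-\frac12$ at odd $k$; every vertical lozenge whose two western (left) sides both lie on the west zigzags (upper or lower) has weight $\frac12$. - $N^{(1)}$: $A=2h+1$, $\alpha=-1$ at even $k$, $-\frac12$ at odd $k$; $B=2g$, $\beta=0$ at even $k$, $-\frac12$ at odd $k$; every vertical lozenge whose two western sides both lie on the upper west zigzag has weight $\frac12$. - $N^{(4)}$ ($a_1\ge1$): $A=2h-2$, $\alpha=1$ at even $k$, $\frac12$ at odd $k$; $B=2g-1$, $\beta=0$ at even $k$, $\frac12$ at odd $k$;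 every vertical lozenge whose two western sides both lie on the lower west zigzag has weight $\frac12$. -}

module Defs where

open import Data.Integer as ℤ using (ℤ; +_; ∣_∣)
open import Data.List using
  (List; []; _∷_; _++_; map; concatMap; filter; foldr; length; applyUpTo; cartesianProductWith; drop)
open import Data.List.Membership.Propositional using (_∈_)
open import Data.List.Relation.Unary.All using (All; all?)
open import Data.List.Relation.Unary.Any using (Any; any?)
open import Data.Nat as ℕ using (ℕ; zero; suc)
open import Data.Nat.Divisibility using (_∣_; _∣?_)
open import Data.Nat.ListAction using (sum)
open import Data.Product using (_×_; _,_)
open import Data.Rational as ℚ using (ℚ; 0ℚ; 1ℚ; ½)
open import Data.Sum using (_⊎_)
open import Relation.Binary.Definitions using (DecidableEquality)
open import Relation.Binary.PropositionalEquality using (_≡_; refl; cong)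
open import Relation.Nullary using (¬_; Dec; yes; no; ¬?; _×-dec_; _⊎-dec_)
open import Relation.Nullary.Decidable using (map′)
open import Relation.Unary using (Decidable)
import Data.List.Membership.DecPropositional as DecMembership

------------------------------------------------------------------------
-- Sequences

-- The empty sequence is identified with the one-term sequence (0).
first : List ℕ → ℕ
first []       = 0
first (s ∷ _) = s

replaceFirst : ℕ → List ℕ → List ℕ
replaceFirst s ss = s ∷ drop 1 ss

-- oddSum (s₁ , s₂ , …) = s₁ + s₃ + …  and  evenSum (s₁ , s₂ , …) = s₂ + s₄ + …
oddSum evenSum : List ℕ → ℕ
oddSum []        = 0
oddSum (s ∷ ss)  = s ℕ.+ evenSum ss
evenSum []       = 0
evenSum (_ ∷ ss) = oddSum ss

------------------------------------------------------------------------
-- The triangular lattice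

-- ⟦ U ⨾ k ⟧ is the point [U/2;k], with Cartesian coordinates
-- (U/2 , (√3/2)k).  The horizontal coordinate is doubled so that all
-- lattice vertices are integral.
record Point : Set where
  constructor ⟦_⨾_⟧
  field
    2u : ℤ
    k  : ℤ

open Point public

module _ where
  open import Data.Integer using (_+_; _-_)

  east northEast northWest southEast : Point → Point
  east      ⟦ U ⨾ k ⟧ = ⟦ U + + 2 ⨾ k ⟧
  northEast ⟦ U ⨾ k ⟧ = ⟦ U + + 1 ⨾ k + + 1 ⟧
  northWest ⟦ U ⨾ k ⟧ = ⟦ U - + 1 ⨾ k + + 1 ⟧
  southEast ⟦ U ⨾ k ⟧ = ⟦ U + + 1 ⨾ k - + 1 ⟧

  -- The vertices of the lattice containing [σ/2;0].
  LatticeVertex : ℤ → Point → Set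
  LatticeVertex σ P = 2 ∣ ∣ 2u P - k P - σ ∣

  latticeVertex? : ∀ σ → Decidable (LatticeVertex σ)
  latticeVertex? σ P = 2 ∣? ∣ 2u P - k P - σ ∣

-- The unit triangle whose horizontal side has west endpoint P and which
-- lies above (△ P) or below (▽ P) that side.
data Cell : Set where
  △ ▽ : Point → Cell

corners : Cell → List Point
corners (△ P) = P ∷ east P ∷ northEast P ∷ []
corners (▽ P) = P ∷ east P ∷ southEast P ∷ []

-- A lozenge consists of an up-pointing cell together with the
-- down-pointing cell across one of its three sides.  It is vertical
-- exactly if that side is the base.
data Side : Set where
  base westSide eastSide : Side

record Lozenge : Set where
  constructor lozenge
  field
    corner : Point
    glued  : Side

upCell downCell : Lozenge → Cell
upCell   (lozenge P _)        = △ P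
downCell (lozenge P base)     = ▽ P
downCell (lozenge P westSide) = ▽ (northWest P)
downCell (lozenge P eastSide) = ▽ (northEast P)

_≟ᵖ_ : DecidableEquality Point
⟦ U ⨾ k ⟧ ≟ᵖ ⟦ V ⨾ l ⟧ =
  map′ (λ { (refl , refl) → refl }) (λ { refl → refl , refl }) (U ℤ.≟ V ×-dec k ℤ.≟ l)

_≟ᶜ_ : DecidableEquality Cell
△ P ≟ᶜ △ Q = map′ (cong △) (λ { refl → refl }) (P ≟ᵖ Q)
▽ P ≟ᶜ ▽ Q = map′ (cong ▽) (λ { refl → refl }) (P ≟ᵖ Q)
△ _ ≟ᶜ ▽ _ = no λ ()
▽ _ ≟ᶜ △ _ = no λ ()

open DecMembership _≟ᶜ_ using (_∈?_)

------------------------------------------------------------------------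
-- Tilings

-- The list of cells is meant to be free of repetitions.
record Region : Set where
  field
    cells  : List Cell
    weight : Lozenge → ℚ

open Region public

lozengesIn : List Cell → List Lozenge
lozengesIn cs = filter (λ l → downCell l ∈? cs) (concatMap over cs)
  where
  over : Cell → List Lozenge
  over (△ P) = map (lozenge P) (base ∷ westSide ∷ eastSide ∷ [])
  over (▽ _) = []

Covers : Cell → Lozenge → Set
Covers c l = c ∈ upCell l ∷ downCell l ∷ []

covers? : ∀ c → Decidable (Covers c)
covers? c l = c ∈? upCell l ∷ downCell l ∷ []

-- Every cell is covered (no gaps) by just one lozenge (no overlaps).
IsTiling : List Cell → List Lozenge → Set
IsTiling cs T = All (λ c → length (filter (covers? c) T) ≡ 1) cs

isTiling? : ∀ cs → Decidable (IsTiling cs)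
isTiling? cs T = all? (λ c → length (filter (covers? c) T) ℕ.≟ 1) cs

sublists : ∀ {A : Set} → List A → List (List A)
sublists []       = [] ∷ []
sublists (x ∷ xs) = sublists xs ++ map (x ∷_) (sublists xs)

tilings : List Cell → List (List Lozenge)
tilings cs = filter (isTiling? cs) (sublists (lozengesIn cs))

M : Region → ℚ
M R = foldr ℚ._+_ 0ℚ (map tilingWeight (tilings (cells R)))
  where
  tilingWeight : List Lozenge → ℚ
  tilingWeight T = foldr ℚ._*_ 1ℚ (map (weight R) T)

------------------------------------------------------------------------
-- Selecting the cells of a region

interval : ℤ → ℤ → List ℤ
interval lo hi = applyUpTo (λ i → lo ℤ.+ + i) (suc ∣ hi ℤ.- lo ∣)

-- All cells of the lattice through [σ/2;0] whose horizontal side has its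
-- west endpoint in the given box (bounds on 2u, then bounds on k).
cellsInBox : (σ : ℤ) → (ℤ × ℤ) → (ℤ × ℤ) → List Cell
cellsInBox σ (Umin , Umax) (kmin , kmax) =
  concatMap (λ P → △ P ∷ ▽ P ∷ [])
    (filter (latticeVertex? σ)
      (cartesianProductWith (λ k U → ⟦ U ⨾ k ⟧) (interval kmin kmax) (interval Umin Umax)))

-- For a convex set bounded by lattice lines (and, strip by strip, for the
-- sides of the zigzags below) a cell is contained in the set exactly if
-- its three corners are.
_⊑_ : Cell → (Point → Set) → Set
c ⊑ X = All X (corners c)

⊑? : ∀ {X} → Decidable X → Decidable (_⊑ X)
⊑? X? c = all? X? (corners c)

------------------------------------------------------------------------
-- Ferns

data Orientation : Set where
  up down : Orientation

flip : Orientation → Orientation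
flip up   = down
flip down = up

-- A lattice triangle with a side on the line k = 0, going from [U/2;0] to
-- [U/2 + side;0], where U = left.
record FernTriangle : Set where
  constructor tri
  field
    orientation : Orientation
    left        : ℤ
    side        : ℕ

module _ where
  open import Data.Integer using (_+_; _-_; -_; _*_; _≤_; _≤?_)

  _∈△_ : Point → FernTriangle → Set
  ⟦ U ⨾ k ⟧ ∈△ tri up   l s = + 0 ≤ k × l + k ≤ U × U ≤ l + + 2 * + s - k
  ⟦ U ⨾ k ⟧ ∈△ tri down l s = k ≤ + 0 × l - k ≤ U × U ≤ l + + 2 * + s + k

  _∈△?_ : ∀ P T → Dec (P ∈△ T)
  ⟦ U ⨾ k ⟧ ∈△? tri up   l s = + 0 ≤? k ×-dec l + k ≤? U ×-dec U ≤? l + + 2 * + s - k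
  ⟦ U ⨾ k ⟧ ∈△? tri down l s = k ≤? + 0 ×-dec l - k ≤? U ×-dec U ≤? l + + 2 * + s + k

  -- Consecutive triangles of alternating orientations, the first having
  -- the given orientation: eastward from [U/2;0], resp. westward from
  -- [U/2;0], where U is the second argument.
  fernEast fernWest : Orientation → ℤ → List ℕ → List FernTriangle
  fernEast o U []       = []
  fernEast o U (s ∷ ss) = tri o U s ∷ fernEast (flip o) (U + + 2 * + s) ss
  fernWest o U []       = []
  fernWest o U (s ∷ ss) = tri o (U - + 2 * + s) s ∷ fernWest (flip o) (U - + 2 * + s) ss

  -- Reflection in the line u = 0.
  mirror : FernTriangle → FernTriangle
  mirror (tri o l s) = tri o (- (l + + 2 * + s)) s

Removed : List FernTriangle → Cell → Set
Removed Ts c = Any (λ T → c ⊑ (_∈△ T)) Ts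

removed? : ∀ Ts → Decidable (Removed Ts)
removed? Ts c = any? (λ T → ⊑? (_∈△? T) c) Ts

------------------------------------------------------------------------
-- The symmetric hexagon with three ferns removed

module SymmetricHexagon (x y z : ℕ) (a b : List ℕ) where

  module _ where
    open import Data.Nat using (_+_; _*_; _∸_)

    -- Lengths of the segment cut out on k = 0 and of the north-eastern
    -- (= north-western) and south-eastern (= south-western) sides.
    W NE SE : ℕ
    W  = x + y + (2 * sum a ∸ first a) + 2 * sum b
    NE = y + z + (2 * oddSum a ∸ first a) + 2 * oddSum b
    SE = y + z + 2 * evenSum a + 2 * evenSum b

  open import Data.Integer using (_+_; _-_; -_; _*_; _≤_; _≤?_)

  top bottom : ℤ
  top    = - + z + + NE
  bottom = - + z - + SE

  -- The hexagon with east and west vertices [±(W+z)/2;-z] and the above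
  -- sides.  Its north and south sides then have the lengths
  -- W + z - NE = x + 2 eₐ + 2 e_b  and  W + z - SE = x + 2 oₐ - a₁ + 2 o_b.
  InHexagon : Point → Set
  InHexagon ⟦ U ⨾ k ⟧ =
    bottom ≤ k × k ≤ top ×
    U ≤ + W - k × U ≤ + W + + 2 * + z + k ×
    - U ≤ + W - k × - U ≤ + W + + 2 * + z + k

  inHexagon? : Decidable InHexagon
  inHexagon? ⟦ U ⨾ k ⟧ =
    bottom ≤? k ×-dec k ≤? top ×-dec
    U ≤? + W - k ×-dec U ≤? + W + + 2 * + z + k ×-dec
    - U ≤? + W - k ×-dec - U ≤? + W + + 2 * + z + k

  eastFerns ferns : List FernTriangle
  eastFerns = fernEast down (+ first a) (drop 1 a) ++ fernWest up (+ W) b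
  ferns     = tri up (- + first a) (first a) ∷ eastFerns ++ map mirror eastFerns

  InRegion : Cell → Set
  InRegion c = c ⊑ InHexagon × ¬ Removed ferns c

  inRegion? : Decidable InRegion
  inRegion? c = ⊑? inHexagon? c ×-dec ¬? (removed? ferns c)

  region : Region
  region = record
    { cells  = filter inRegion?
                 (cellsInBox (+ W) (- (+ W + + z) , + W + + z) (bottom , top))
    ; weight = λ _ → 1ℚ
    }

S¹ : (x y z : ℕ) (a b : List ℕ) → Region
S¹ = SymmetricHexagon.region

------------------------------------------------------------------------
-- The halved hexagons

data Part : Set where
  upper lower : Part

-- α and β give doubled horizontal coordinates: the upper west zigzag runs
-- through [α(k)/2;k], 0 ≤ k ≤ A, and the lower one through [β(k)/2;-k],
-- 0 ≤ k ≤ B.  Vertical lozenges with both western sides on the zigzags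
-- listed in `halving` have weight ½.
record Profile : Set where
  field
    A B     : ℤ
    α β     : ℕ → ℤ
    halving : List Part

-- The value e at even numbers and o at odd ones.
byParity : (e o : ℤ) → ℕ → ℤ
byParity e o zero    = e
byParity e o (suc n) = byParity o e n

module HalvedHexagon (x y z : ℕ) (a b : List ℕ) where

  module _ where
    open import Data.Nat using (_+_)

    L h g : ℕ
    L = x + y + sum a + sum b
    h = y + oddSum a + oddSum b
    g = y + z + evenSum a + evenSum b

  open import Data.Integer using (_+_; _-_; -_; _*_; _≤_; _≤?_)

  module _ (D : Profile) where
    open Profile D

    OnZigzag : Part → Point → Set
    OnZigzag upper ⟦ U ⨾ k ⟧ = + 0 ≤ k × k ≤ A × U ≡ α ∣ k ∣
    OnZigzag lower ⟦ U ⨾ k ⟧ = k ≤ + 0 × - B ≤ k × U ≡ β ∣ k ∣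

    onZigzag? : ∀ p → Decidable (OnZigzag p)
    onZigzag? upper ⟦ U ⨾ k ⟧ = + 0 ≤? k ×-dec k ≤? A ×-dec U ℤ.≟ α ∣ k ∣
    onZigzag? lower ⟦ U ⨾ k ⟧ = k ≤? + 0 ×-dec - B ≤? k ×-dec U ℤ.≟ β ∣ k ∣

    -- The parts of the region before removal of the triangles.  The last
    -- two inequalities for the lower part describe its broken eastern
    -- boundary through [L;0], [L+z/2;-z] and [L+z-B/2;-B].
    InPart : Part → Point → Set
    InPart upper ⟦ U ⨾ k ⟧ =
      + 0 ≤ k × k ≤ A × α ∣ k ∣ ≤ U × U ≤ + 2 * + L - k
    InPart lower ⟦ U ⨾ k ⟧ =
      k ≤ + 0 × - B ≤ k × β ∣ k ∣ ≤ U ×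
      U ≤ + 2 * + L - k × U ≤ + 2 * + L + + 2 * + z + k

    inPart? : ∀ p → Decidable (InPart p)
    inPart? upper ⟦ U ⨾ k ⟧ =
      + 0 ≤? k ×-dec k ≤? A ×-dec α ∣ k ∣ ≤? U ×-dec U ≤? + 2 * + L - k
    inPart? lower ⟦ U ⨾ k ⟧ =
      k ≤? + 0 ×-dec - B ≤? k ×-dec β ∣ k ∣ ≤? U ×-dec
      U ≤? + 2 * + L - k ×-dec U ≤? + 2 * + L + + 2 * + z + k

    -- The closed half-plane u ≤ a₁ - k/2, removed from the upper part.
    WestOfFern : Point → Set
    WestOfFern ⟦ U ⨾ k ⟧ = U ≤ + 2 * + first a - k

    westOfFern? : Decidable WestOfFern
    westOfFern? ⟦ U ⨾ k ⟧ = U ≤? + 2 * + first a - k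

    ferns : List FernTriangle
    ferns = fernEast down (+ 2 * + first a) (drop 1 a) ++ fernWest up (+ 2 * + L) b

    InRegion : Cell → Set
    InRegion c =
      ((c ⊑ InPart upper × ¬ c ⊑ WestOfFern) ⊎ c ⊑ InPart lower) × ¬ Removed ferns c

    inRegion? : Decidable InRegion
    inRegion? c =
      ((⊑? (inPart? upper) c ×-dec ¬? (⊑? westOfFern? c)) ⊎-dec ⊑? (inPart? lower) c)
        ×-dec ¬? (removed? ferns c)

    -- The segment between vertices P and Q of consecutive levels lies on
    -- one of the zigzags that carry weights.
    OnHalving : Point → Point → Set
    OnHalving P Q = Any (λ p → OnZigzag p P × OnZigzag p Q) halving

    onHalving? : ∀ P Q → Dec (OnHalving P Q)
    onHalving? P Q = any? (λ p → onZigzag? p P ×-dec onZigzag? p Q) halving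

    -- The western sides of the vertical lozenge with west vertex P join P
    -- to northEast P and to southEast P.
    lozengeWeight : Lozenge → ℚ
    lozengeWeight (lozenge P base)
      with onHalving? P (northEast P) ×-dec onHalving? P (southEast P)
    ... | yes _ = ½
    ... | no  _ = 1ℚ
    lozengeWeight (lozenge _ westSide) = 1ℚ
    lozengeWeight (lozenge _ eastSide) = 1ℚ

    -- The box is large enough: α, β ≥ -2 in all cases below, and the
    -- points of the region have 2u ≤ 2L + z and -B ≤ k ≤ A or k = 0.
    region : Region
    region = record
      { cells  = filter inRegion?
                   (cellsInBox (+ 0) (- + 2 , + 2 * + L + + z) (- B - + 1 , A + + 1))
      ; weight = lozengeWeight
      }

  profileH² profileW¹ profileN¹ profileN⁴ : Profile

  profileH² = record
    { A = + 2 * + h - + 1 ; α = byParity (+ 0) (+ 1)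
    ; B = + 2 * + g - + 1 ; β = byParity (+ 0) (+ 1)
    ; halving = []
    }

  profileW¹ = record
    { A = + 2 * + h ; α = byParity (+ 0) (- + 1)
    ; B = + 2 * + g ; β = byParity (+ 0) (- + 1)
    ; halving = upper ∷ lower ∷ []
    }

  profileN¹ = record
    { A = + 2 * + h + + 1 ; α = byParity (- + 2) (- + 1)
    ; B = + 2 * + g       ; β = byParity (+ 0) (- + 1)
    ; halving = upper ∷ []
    }

  profileN⁴ = record
    { A = + 2 * + h - + 2 ; α = byParity (+ 2) (+ 1)
    ; B = + 2 * + g - + 1 ; β = byParity (+ 0) (+ 1)
    ; halving = lower ∷ []
    }

-- N⁴ is only meaningful if a₁ ≥ 1.
H² W¹ N¹ N⁴ : (x y z : ℕ) (a b : List ℕ) → Region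
H² x y z a b = region profileH² where open HalvedHexagon x y z a b
W¹ x y z a b = region profileW¹ where open HalvedHexagon x y z a b
N¹ x y z a b = region profileN¹ where open HalvedHexagon x y z a b
N⁴ x y z a b = region profileN⁴ where open HalvedHexagon x y z a b

{-# OPTIONS --safe #-}

-- Folding S¹ along its axis of symmetry turns a tiling into two tilings of
-- the same half plane, coupled at the cells bisected by the axis.  Read
-- strip by strip, the vertical lozenges between two strips form a pair of
-- words, one for each side, and a strip maps functions of such pairs to
-- functions of such pairs.  Regarding words as basis vectors of an exterior
-- algebra, this map commutes with the rotation that sends the two copies
-- (x , y) to (x + y , x - y), and after the rotation an axis cell is joined
-- to only one copy, which alternates along the axis, an edge on the axis
-- having weight 1/2.  Hence the number of tilings is a power of 2 times a
-- product of one-sided counts (this is Ciucu's factorization theorem, for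
-- which no planarity argument is needed).  The one-sided counts are those of
-- the two halved hexagons, up to strips of forced lozenges at the north and
-- south sides.
module Submission where

module Transfer where

  open import Data.Bool using (Bool; true; false; not; _xor_; _∧_; if_then_else_)
  open import Data.Bool.Properties using (xor-assoc; xor-comm)
  open import Data.List using (List; []; _∷_; _++_; map)
  open import Data.Nat using (ℕ; zero; suc)
  open import Data.Product using (_×_; _,_; proj₁; proj₂)
  open import Data.Rational using (ℚ; 0ℚ; 1ℚ; ½; _+_; _*_; -_)
  open import Data.Rational.Properties hiding (_≟_)
  import Data.Rational.Properties as ℚP
  open import Data.Vec using (Vec; []; _∷_)
  open import Relation.Binary.PropositionalEquality
  open import Relation.Nullary using (Dec; yes; does)
  open import Function using (_∘_)

  open ≡-Reasoning

  Combination : Set → Set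
  Combination A = List (ℚ × A)

  Bits : Set
  Bits = Bool × Bool

  private variable
    A B C : Set

  ⟦_⟧ : Combination A → (A → ℚ) → ℚ
  ⟦ [] ⟧ f = 0ℚ
  ⟦ (q , a) ∷ xs ⟧ f = q * f a + ⟦ xs ⟧ f

  ⟦⟧-cong : (xs : Combination A) {f g : A → ℚ} → (∀ a → f a ≡ g a) → ⟦ xs ⟧ f ≡ ⟦ xs ⟧ g
  ⟦⟧-cong [] e = refl
  ⟦⟧-cong ((q , a) ∷ xs) e = cong₂ _+_ (cong (q *_) (e a)) (⟦⟧-cong xs e)

  +-interchange : ∀ a b c d → (a + b) + (c + d) ≡ (a + c) + (b + d)
  +-interchange a b c d = begin
    (a + b) + (c + d) ≡⟨ +-assoc a b (c + d) ⟩
    a + (b + (c + d)) ≡⟨ cong (a +_) (+-assoc b c d) ⟨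
    a + ((b + c) + d) ≡⟨ cong (λ t → a + (t + d)) (+-comm b c) ⟩
    a + ((c + b) + d) ≡⟨ cong (a +_) (+-assoc c b d) ⟩
    a + (c + (b + d)) ≡⟨ +-assoc a c (b + d) ⟨
    (a + c) + (b + d) ∎

  *-leftComm : ∀ a b c → a * (b * c) ≡ b * (a * c)
  *-leftComm a b c = trans (sym (*-assoc a b c)) (trans (cong (_* c) (*-comm a b)) (*-assoc b a c))

  ⟦⟧-zero : (xs : Combination A) → ⟦ xs ⟧ (λ _ → 0ℚ) ≡ 0ℚ
  ⟦⟧-zero [] = refl
  ⟦⟧-zero ((q , _) ∷ xs) = cong₂ _+_ (*-zeroʳ q) (⟦⟧-zero xs)

  ⟦⟧-+ : (xs : Combination A) (f g : A → ℚ) → ⟦ xs ⟧ (λ a → f a + g a) ≡ ⟦ xs ⟧ f + ⟦ xs ⟧ g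
  ⟦⟧-+ [] f g = refl
  ⟦⟧-+ ((q , a) ∷ xs) f g =
    trans (cong₂ _+_ (*-distribˡ-+ q (f a) (g a)) (⟦⟧-+ xs f g)) (+-interchange (q * f a) _ _ _)

  ⟦⟧-* : (xs : Combination A) (k : ℚ) (f : A → ℚ) → ⟦ xs ⟧ (λ a → k * f a) ≡ k * ⟦ xs ⟧ f
  ⟦⟧-* [] k f = sym (*-zeroʳ k)
  ⟦⟧-* ((q , a) ∷ xs) k f =
    trans (cong₂ _+_ (*-leftComm q k (f a)) (⟦⟧-* xs k f)) (sym (*-distribˡ-+ k _ _))

  ⟦⟧-swap : (xs : Combination A) (ys : Combination B) (f : A → B → ℚ) →
    ⟦ xs ⟧ (λ a → ⟦ ys ⟧ (f a)) ≡ ⟦ ys ⟧ (λ b → ⟦ xs ⟧ (λ a → f a b))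
  ⟦⟧-swap [] ys f = sym (⟦⟧-zero ys)
  ⟦⟧-swap ((q , a) ∷ xs) ys f =
    trans (cong₂ _+_ (sym (⟦⟧-* ys q (f a))) (⟦⟧-swap xs ys f)) (sym (⟦⟧-+ ys _ _))

  _>>=_ : Combination A → (A → Combination B) → Combination B
  [] >>= k = []
  ((q , a) ∷ xs) >>= k = map (λ { (r , b) → q * r , b }) (k a) ++ (xs >>= k)

  ⟦⟧-++ : (xs ys : Combination A) (f : A → ℚ) → ⟦ xs ++ ys ⟧ f ≡ ⟦ xs ⟧ f + ⟦ ys ⟧ f
  ⟦⟧-++ [] ys f = sym (+-identityˡ _)
  ⟦⟧-++ ((q , a) ∷ xs) ys f = trans (cong (q * f a +_) (⟦⟧-++ xs ys f)) (sym (+-assoc (q * f a) _ _))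

  ⟦⟧->>= : (xs : Combination A) (k : A → Combination B) (f : B → ℚ) →
    ⟦ xs >>= k ⟧ f ≡ ⟦ xs ⟧ (λ a → ⟦ k a ⟧ f)
  ⟦⟧->>= [] k f = refl
  ⟦⟧->>= ((q , a) ∷ xs) k f =
    trans (⟦⟧-++ (map _ (k a)) (xs >>= k) f) (cong₂ _+_ (scaled (k a)) (⟦⟧->>= xs k f))
    where
    scaled : ∀ ys → ⟦ map (λ { (r , b) → q * r , b }) ys ⟧ f ≡ q * ⟦ ys ⟧ f
    scaled [] = sym (*-zeroʳ q)
    scaled ((r , b) ∷ ys) =
      trans (cong₂ _+_ (*-assoc q r (f b)) (scaled ys)) (sym (*-distribˡ-+ q _ _))

  one : A → Combination A
  one a = (1ℚ , a) ∷ []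

  ⟦⟧-one : ∀ (a : A) f → ⟦ one a ⟧ f ≡ f a
  ⟦⟧-one a f = trans (+-identityʳ _) (*-identityˡ _)

  everywhere : ∀ n → (Vec Bool n → Bool) → Bool
  everywhere zero    P = P []
  everywhere (suc n) P = everywhere n (λ v → P (true ∷ v)) ∧ everywhere n (λ v → P (false ∷ v))

  ∧-left : ∀ a {b} → a ∧ b ≡ true → a ≡ true
  ∧-left true e = refl

  ∧-right : ∀ a {b} → a ∧ b ≡ true → b ≡ true
  ∧-right true e = e

  everywhere-sound : ∀ n P → everywhere n P ≡ true → ∀ v → P v ≡ true
  everywhere-sound zero    P e []          = e
  everywhere-sound (suc n) P e (true  ∷ v) = everywhere-sound n _ (∧-left _ e) v
  everywhere-sound (suc n) P e (false ∷ v) = everywhere-sound n _ (∧-right (everywhere n (λ v → P (true ∷ v))) e) v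

  does-sound : (a? : Dec A) → does a? ≡ true → A
  does-sound (yes a) e = a

  bitVectors : ∀ n → Combination (Vec Bool n)
  bitVectors zero    = one []
  bitVectors (suc n) = map (λ x → proj₁ x , true ∷ proj₂ x) (bitVectors n) ++ map (λ x → proj₁ x , false ∷ proj₂ x) (bitVectors n)

  ⟦⟧-map : ∀ (h : A → B) xs f → ⟦ map (λ x → proj₁ x , h (proj₂ x)) xs ⟧ f ≡ ⟦ xs ⟧ (f ∘ h)
  ⟦⟧-map h []             f = refl
  ⟦⟧-map h ((q , a) ∷ xs) f = cong (q * f (h a) +_) (⟦⟧-map h xs f)

  indicator : ∀ {n} → Vec Bool n → Vec Bool n → ℚ
  indicator []      []      = 1ℚ
  indicator (a ∷ v) (b ∷ w) = if a xor b then 0ℚ else indicator v w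

  sift : ∀ {n} (f : Vec Bool n → ℚ) w → f w ≡ ⟦ bitVectors n ⟧ (λ v → f v * indicator v w)
  sift f []      = sym (trans (⟦⟧-one [] (λ v → f v * indicator v [])) (*-identityʳ _))
  sift {suc n} f (b ∷ w) = sym (begin
    _ ≡⟨ ⟦⟧-++ (map (λ x → proj₁ x , true ∷ proj₂ x) (bitVectors n)) _ g ⟩
    _ ≡⟨ cong₂ _+_ (⟦⟧-map (true ∷_) (bitVectors n) g) (⟦⟧-map (false ∷_) (bitVectors n) g) ⟩
    ⟦ bitVectors n ⟧ (g ∘ (true ∷_)) + ⟦ bitVectors n ⟧ (g ∘ (false ∷_)) ≡⟨ half b ⟩
    f (b ∷ w) ∎)
    where
    g : Vec Bool _ → ℚ
    g v = f v * indicator v (b ∷ w)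
    vanish : ∀ (h : Vec Bool n → ℚ) → ⟦ bitVectors n ⟧ (λ v → h v * 0ℚ) ≡ 0ℚ
    vanish h = trans (⟦⟧-cong (bitVectors n) (λ v → *-zeroʳ (h v))) (⟦⟧-zero (bitVectors n))
    half : ∀ b → ⟦ bitVectors n ⟧ (λ v → f (true ∷ v) * indicator (true ∷ v) (b ∷ w))
               + ⟦ bitVectors n ⟧ (λ v → f (false ∷ v) * indicator (false ∷ v) (b ∷ w)) ≡ f (b ∷ w)
    half true  = trans (cong₂ _+_ (sym (sift (f ∘ (true ∷_)) w)) (vanish (f ∘ (false ∷_)))) (+-identityʳ _)
    half false = trans (cong₂ _+_ (vanish (f ∘ (true ∷_))) (sym (sift (f ∘ (false ∷_)) w))) (+-identityˡ _)

  -- Two combinations over a type coded by bit vectors may be interchanged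
  -- once their (finitely many) coefficients are equal.
  module Coded {A : Set} {n} (encode : A → Vec Bool n) (decode : Vec Bool n → A)
               (decode-encode : ∀ a → decode (encode a) ≡ a) where

    coefficient : Combination A → Vec Bool n → ℚ
    coefficient xs v = ⟦ xs ⟧ (λ a → indicator v (encode a))

    expand : ∀ xs f → ⟦ xs ⟧ f ≡ ⟦ bitVectors n ⟧ (λ v → f (decode v) * coefficient xs v)
    expand xs f = begin
      ⟦ xs ⟧ f                          ≡⟨ ⟦⟧-cong xs (λ a → cong f (sym (decode-encode a))) ⟩
      ⟦ xs ⟧ (f ∘ decode ∘ encode)      ≡⟨ ⟦⟧-cong xs (λ a → sift (f ∘ decode) (encode a)) ⟩
      _                                 ≡⟨ ⟦⟧-swap xs (bitVectors n) (λ a v → f (decode v) * indicator v (encode a)) ⟩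
      _                                 ≡⟨ ⟦⟧-cong (bitVectors n) (λ v → ⟦⟧-* xs (f (decode v)) (λ a → indicator v (encode a))) ⟩
      _ ∎

    agree : Combination A → Combination A → Bool
    agree xs ys = everywhere n (λ v → does (coefficient xs v ℚP.≟ coefficient ys v))

    agree-sound : ∀ xs ys → agree xs ys ≡ true → ∀ f → ⟦ xs ⟧ f ≡ ⟦ ys ⟧ f
    agree-sound xs ys e f = trans (expand xs f) (trans
      (⟦⟧-cong (bitVectors n) λ v → cong (f (decode v) *_)
        (does-sound (coefficient xs v ℚP.≟ coefficient ys v) (everywhere-sound n _ e v)))
      (sym (expand ys f)))

  -- A strip alternates between down- and up-pointing cells, and a kind is
  -- that of its first cell.  A word tells which down-pointing cells are
  -- joined to the strip above.
  data Kind : Set where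
    dn up : Kind

  opposite : Kind → Kind
  opposite dn = up
  opposite up = dn

  downs : Kind → ℕ → ℕ
  downs _  zero    = 0
  downs dn (suc n) = suc (downs up n)
  downs up (suc n) = downs dn n

  Word : Kind → ℕ → Set
  Word K n = Vec Bool (downs K n)

  merge : (p c t : Bool) → Combination Bool
  merge true  false false = one false
  merge true  true  false = one true
  merge true  false true  = one true
  merge true  true  true  = []
  merge false false false = one true
  merge false _     _     = []

  split : (p r : Bool) → Combination Bits
  split true  false = one (false , false)
  split true  true  = (1ℚ , (true , false)) ∷ (1ℚ , (false , true)) ∷ []
  split false false = []
  split false true  = one (false , false)

  -- The state before a down-pointing cell tells whether that cell is joined
  -- to its predecessor, and the state before an up-pointing cell whether the
  -- predecessor is already covered.  Absent cells let no lozenge pass.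
  scan : ∀ {n} K → Vec Bool n → Bool → Word K n → (Word (opposite K) n → ℚ) → ℚ
  scan dn []       c ts       f = if c then 0ℚ else f []
  scan up []       r ts       f = if r then f [] else 0ℚ
  scan dn (p ∷ ps) c (t ∷ ts) f = ⟦ merge p c t ⟧ (λ r → scan up ps r ts f)
  scan up (p ∷ ps) r ts       f = ⟦ split p r ⟧ (λ x → scan dn ps (proj₂ x) ts (f ∘ (proj₁ x ∷_)))

  scan-cong : ∀ {n} K (ps : Vec Bool n) c ts {f g} → (∀ bs → f bs ≡ g bs) → scan K ps c ts f ≡ scan K ps c ts g
  scan-cong dn [] true  [] e = refl
  scan-cong dn [] false [] e = e []
  scan-cong up [] true  [] e = e []
  scan-cong up [] false [] e = refl
  scan-cong dn (p ∷ ps) c (t ∷ ts) e = ⟦⟧-cong (merge p c t) λ r → scan-cong up ps r ts e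
  scan-cong up (p ∷ ps) r ts e = ⟦⟧-cong (split p r) λ x → scan-cong dn ps (proj₂ x) ts (e ∘ (proj₁ x ∷_))

  scan-* : ∀ {n} K (ps : Vec Bool n) c ts k f → scan K ps c ts (λ bs → k * f bs) ≡ k * scan K ps c ts f
  scan-* dn [] true  [] k f = sym (*-zeroʳ k)
  scan-* dn [] false [] k f = refl
  scan-* up [] true  [] k f = refl
  scan-* up [] false [] k f = sym (*-zeroʳ k)
  scan-* dn (p ∷ ps) c (t ∷ ts) k f =
    trans (⟦⟧-cong (merge p c t) λ r → scan-* up ps r ts k f) (⟦⟧-* (merge p c t) k _)
  scan-* up (p ∷ ps) r ts k f =
    trans (⟦⟧-cong (split p r) λ x → scan-* dn ps (proj₂ x) ts k _) (⟦⟧-* (split p r) k _)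

  scan-⟦⟧ : ∀ {n} K (ps : Vec Bool n) c ts (xs : Combination A) (f : A → _) →
    scan K ps c ts (λ bs → ⟦ xs ⟧ (λ a → f a bs)) ≡ ⟦ xs ⟧ (λ a → scan K ps c ts (f a))
  scan-⟦⟧ dn [] true  [] xs f = sym (⟦⟧-zero xs)
  scan-⟦⟧ dn [] false [] xs f = refl
  scan-⟦⟧ up [] true  [] xs f = refl
  scan-⟦⟧ up [] false [] xs f = sym (⟦⟧-zero xs)
  scan-⟦⟧ dn (p ∷ ps) c (t ∷ ts) xs f =
    trans (⟦⟧-cong (merge p c t) λ r → scan-⟦⟧ up ps r ts xs f) (⟦⟧-swap (merge p c t) xs _)
  scan-⟦⟧ up (p ∷ ps) r ts xs f =
    trans (⟦⟧-cong (split p r) λ x → scan-⟦⟧ dn ps (proj₂ x) ts xs _) (⟦⟧-swap (split p r) xs _)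

  scan² : ∀ {n} K → Vec Bool n → Bits → Word K n → Word K n →
    (Word (opposite K) n → Word (opposite K) n → ℚ) → ℚ
  scan² K ps (c , d) ts us f = scan K ps c ts (λ bs → scan K ps d us (f bs))

  scan²-⟦⟧ : ∀ {n} K (ps : Vec Bool n) c ts us (xs : Combination A) (f : A → _) →
    scan² K ps c ts us (λ v w → ⟦ xs ⟧ (λ a → f a v w)) ≡ ⟦ xs ⟧ (λ a → scan² K ps c ts us (f a))
  scan²-⟦⟧ K ps (c , d) ts us xs f =
    trans (scan-cong K ps c ts λ v → scan-⟦⟧ K ps d us xs (λ a → f a v)) (scan-⟦⟧ K ps c ts xs _)

  both : Combination A → Combination B → Combination (A × B)
  both xs ys = xs >>= λ a → ys >>= λ b → one (a , b)

  ⟦⟧-both : (xs : Combination A) (ys : Combination B) (f : A → B → ℚ) →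
    ⟦ both xs ys ⟧ (λ x → f (proj₁ x) (proj₂ x)) ≡ ⟦ xs ⟧ (λ a → ⟦ ys ⟧ (f a))
  ⟦⟧-both xs ys f = trans (⟦⟧->>= xs _ _) (⟦⟧-cong xs λ a →
    trans (⟦⟧->>= ys _ _) (⟦⟧-cong ys λ b → ⟦⟧-one (a , b) (λ x → f (proj₁ x) (proj₂ x))))

  merge² : (p : Bool) → Bits → Bits → Combination Bits
  merge² p (c , d) (t , u) = both (merge p c t) (merge p d u)

  transpose : Bits × Bits → Bits × Bits
  transpose ((b , c) , (d , e)) = (b , d) , (c , e)

  split² : (p : Bool) → Bits → Combination (Bits × Bits)
  split² p (r , s) = both (split p r) (split p s) >>= λ x → one (transpose x)

  scan²-dn : ∀ {n} p (ps : Vec Bool n) c t ts u us f →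
    scan² dn (p ∷ ps) c (t ∷ ts) (u ∷ us) f ≡ ⟦ merge² p c (t , u) ⟧ (λ r → scan² up ps r ts us f)
  scan²-dn p ps (c , d) t ts u us f = begin
    ⟦ merge p c t ⟧ (λ r → scan up ps r ts (λ bs → ⟦ merge p d u ⟧ (λ s → scan up ps s us (f bs))))
      ≡⟨ ⟦⟧-cong (merge p c t) (λ r → scan-⟦⟧ up ps r ts (merge p d u) _) ⟩
    ⟦ merge p c t ⟧ (λ r → ⟦ merge p d u ⟧ (λ s → scan² up ps (r , s) ts us f))
      ≡⟨ ⟦⟧-both (merge p c t) (merge p d u) _ ⟨
    _ ∎

  scan²-up : ∀ {n} p (ps : Vec Bool n) r ts us f →
    scan² up (p ∷ ps) r ts us f ≡
    ⟦ split² p r ⟧ (λ x → scan² dn ps (proj₂ x) ts us (λ v w → f (proj₁ (proj₁ x) ∷ v) (proj₂ (proj₁ x) ∷ w)))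
  scan²-up p ps (r , s) ts us f = begin
    ⟦ split p r ⟧ (λ x → scan dn ps (proj₂ x) ts (λ bs → ⟦ split p s ⟧ (λ y → scan dn ps (proj₂ y) us (f (proj₁ x ∷ bs) ∘ (proj₁ y ∷_)))))
      ≡⟨ ⟦⟧-cong (split p r) (λ x → scan-⟦⟧ dn ps (proj₂ x) ts (split p s) _) ⟩
    ⟦ split p r ⟧ (λ x → ⟦ split p s ⟧ (λ y → scan² dn ps (proj₂ x , proj₂ y) ts us (λ v w → f (proj₁ x ∷ v) (proj₁ y ∷ w))))
      ≡⟨ ⟦⟧-both (split p r) (split p s) (λ x y → g (transpose (x , y))) ⟨
    ⟦ both (split p r) (split p s) ⟧ (g ∘ transpose)
      ≡⟨ ⟦⟧-cong (both (split p r) (split p s)) (λ x → sym (⟦⟧-one (transpose x) g)) ⟩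
    ⟦ both (split p r) (split p s) ⟧ (λ x → ⟦ one (transpose x) ⟧ g)
      ≡⟨ ⟦⟧->>= (both (split p r) (split p s)) _ g ⟨
    _ ∎
    where
    g : Bits × Bits → ℚ
    g x = scan² dn ps (proj₂ x) ts us (λ v w → f (proj₁ (proj₁ x) ∷ v) (proj₂ (proj₁ x) ∷ w))

  parity : ∀ {n} → Vec Bool n → Bool
  parity []       = false
  parity (b ∷ bs) = b xor parity bs

  parity² : ∀ {n} → Vec Bool n → Vec Bool n → Bool
  parity² v w = parity v xor parity w

  -½ : ℚ
  -½ = - ½

  -- Up to scaling, (x , y) ↦ (x + y , x - y) on the letters of the two
  -- copies, with the sign of an exterior algebra: it depends on the parity of
  -- the letters that follow.
  mix : (odd : Bool) → Bits → Combination Bits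
  mix _     (true  , true)  = one (true , true)
  mix _     (false , false) = one (false , false)
  mix false (true  , false) = (1ℚ , (true , false)) ∷ (1ℚ , (false , true)) ∷ []
  mix false (false , true)  = (1ℚ , (true , false)) ∷ (- 1ℚ , (false , true)) ∷ []
  mix true  (true  , false) = (-½ , (true , false)) ∷ (½ , (false , true)) ∷ []
  mix true  (false , true)  = (½ , (true , false)) ∷ (½ , (false , true)) ∷ []

  rotate : ∀ {n} → (Vec Bool n → Vec Bool n → ℚ) → Vec Bool n → Vec Bool n → ℚ
  rotate f []      []      = f [] []
  rotate f (s ∷ v) (t ∷ w) =
    ⟦ mix (parity² v w) (s , t) ⟧ (λ x → rotate (λ v w → f (proj₁ x ∷ v) (proj₂ x ∷ w)) v w)

  rotate-cong : ∀ {n} {f g : Vec Bool n → Vec Bool n → ℚ} → (∀ v w → f v w ≡ g v w) → ∀ v w → rotate f v w ≡ rotate g v w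
  rotate-cong e []      []      = e [] []
  rotate-cong e (s ∷ v) (t ∷ w) =
    ⟦⟧-cong (mix (parity² v w) (s , t)) λ x → rotate-cong (λ v w → e (proj₁ x ∷ v) (proj₂ x ∷ w)) v w

  rotate-⟦⟧ : ∀ {n} (xs : Combination A) (f : A → Vec Bool n → Vec Bool n → ℚ) v w →
    rotate (λ v w → ⟦ xs ⟧ (λ a → f a v w)) v w ≡ ⟦ xs ⟧ (λ a → rotate (f a) v w)
  rotate-⟦⟧ xs f []      []      = refl
  rotate-⟦⟧ xs f (s ∷ v) (t ∷ w) =
    trans (⟦⟧-cong (mix (parity² v w) (s , t)) λ x → rotate-⟦⟧ xs _ v w)
          (⟦⟧-swap (mix (parity² v w) (s , t)) xs _)

  supported : (A → Bool) → Combination A → Bool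
  supported P []             = true
  supported P ((_ , a) ∷ xs) = P a ∧ supported P xs

  ⟦⟧-cong-on : (P : A → Bool) (xs : Combination A) → supported P xs ≡ true →
    ∀ {f g} → (∀ a → P a ≡ true → f a ≡ g a) → ⟦ xs ⟧ f ≡ ⟦ xs ⟧ g
  ⟦⟧-cong-on P []             s e = refl
  ⟦⟧-cong-on P ((q , a) ∷ xs) s e =
    cong₂ _+_ (cong (q *_) (e a (∧-left _ s))) (⟦⟧-cong-on P xs (∧-right (P a) s) e)

  flipIf : Bool → Bits → Bool
  flipIf π x = (proj₁ x xor proj₂ x) xor π

  code¹ : Bits → Vec Bool 2
  code¹ (a , b) = a ∷ b ∷ []

  decode¹ : Vec Bool 2 → Bits
  decode¹ (a ∷ b ∷ []) = a , b

  code² : Bits × Bits → Vec Bool 4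
  code² ((a , b) , (c , d)) = a ∷ b ∷ c ∷ d ∷ []

  decode² : Vec Bool 4 → Bits × Bits
  decode² (a ∷ b ∷ c ∷ d ∷ []) = (a , b) , (c , d)

  module Bits¹ = Coded code¹ decode¹ (λ _ → refl)
  module Bits² = Coded code² decode² (λ _ → refl)

  mergeThenMix mixThenMerge : Bool → Bool → Bits → Bits → Combination Bits
  mergeThenMix π p c t = merge² p c t >>= mix π
  mixThenMerge π p c t = mix (flipIf π t) c >>= λ x → mix π t >>= merge² p x

  merge-mix : ∀ π p c t f → ⟦ mergeThenMix π p c t ⟧ f ≡ ⟦ mixThenMerge π p c t ⟧ f
  merge-mix π p (c , d) (t , u) = Bits¹.agree-sound (mergeThenMix π p (c , d) (t , u)) (mixThenMerge π p (c , d) (t , u)) (everywhere-sound 6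
    (λ { (π ∷ p ∷ c ∷ d ∷ t ∷ u ∷ []) →
      Bits¹.agree (mergeThenMix π p (c , d) (t , u)) (mixThenMerge π p (c , d) (t , u)) })
    refl (π ∷ p ∷ c ∷ d ∷ t ∷ u ∷ []))

  splitThenMix mixThenSplit : Bool → Bool → Bits → Combination (Bits × Bits)
  splitThenMix π p r = split² p r >>= λ x → mix (flipIf π (proj₂ x)) (proj₁ x) >>= λ b → mix π (proj₂ x) >>= λ c → one (b , c)
  mixThenSplit π p r = mix π r >>= split² p

  split-mix : ∀ π p r f → ⟦ splitThenMix π p r ⟧ f ≡ ⟦ mixThenSplit π p r ⟧ f
  split-mix π p (r , s) = Bits².agree-sound (splitThenMix π p (r , s)) (mixThenSplit π p (r , s)) (everywhere-sound 4
    (λ { (π ∷ p ∷ r ∷ s ∷ []) → Bits².agree (splitThenMix π p (r , s)) (mixThenSplit π p (r , s)) })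
    refl (π ∷ p ∷ r ∷ s ∷ []))

  parityOf : Bits → Bool
  parityOf x = proj₁ x xor proj₂ x

  sameBit : Bool → Bool → Bool
  sameBit a b = not (a xor b)

  sameBit-sound : ∀ a b → sameBit a b ≡ true → a ≡ b
  sameBit-sound true  true  _ = refl
  sameBit-sound false false _ = refl

  merge-parity : ∀ p c t → supported (λ r → sameBit (parityOf r) (parityOf c xor parityOf t)) (merge² p c t) ≡ true
  merge-parity p (c , d) (t , u) = everywhere-sound 5
    (λ { (p ∷ c ∷ d ∷ t ∷ u ∷ []) →
      supported (λ r → sameBit (parityOf r) (parityOf (c , d) xor parityOf (t , u))) (merge² p (c , d) (t , u)) })
    refl (p ∷ c ∷ d ∷ t ∷ u ∷ [])

  split-parity : ∀ p r → supported (λ x → sameBit (parityOf r) (parityOf (proj₁ x) xor parityOf (proj₂ x))) (split² p r) ≡ true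
  split-parity p (r , s) = everywhere-sound 3
    (λ { (p ∷ r ∷ s ∷ []) →
      supported (λ x → sameBit (parityOf (r , s)) (parityOf (proj₁ x) xor parityOf (proj₂ x))) (split² p (r , s)) })
    refl (p ∷ r ∷ s ∷ [])

  xor-four : ∀ a b x y → (a xor x) xor (b xor y) ≡ (a xor b) xor (x xor y)
  xor-four a b x y = begin
    (a xor x) xor (b xor y) ≡⟨ xor-assoc a x _ ⟩
    a xor (x xor (b xor y)) ≡⟨ cong (a xor_) (xor-assoc x b y) ⟨
    a xor ((x xor b) xor y) ≡⟨ cong (λ t → a xor (t xor y)) (xor-comm x b) ⟩
    a xor ((b xor x) xor y) ≡⟨ cong (a xor_) (xor-assoc b x y) ⟩
    a xor (b xor (x xor y)) ≡⟨ xor-assoc a b _ ⟨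
    (a xor b) xor (x xor y) ∎

  -- Cells that are present conserve the number of occupied legs, and absent
  -- ones change it equally in both copies.
  scan²-cong : ∀ {n} K (ps : Vec Bool n) c ts us {f g} →
    (∀ v w → parity² v w ≡ parityOf c xor parity² ts us → f v w ≡ g v w) →
    scan² K ps c ts us f ≡ scan² K ps c ts us g
  scan²-cong dn [] (true  , d)     [] [] e = refl
  scan²-cong dn [] (false , true)  [] [] e = refl
  scan²-cong dn [] (false , false) [] [] e = e [] [] refl
  scan²-cong up [] (true  , true)  [] [] e = e [] [] refl
  scan²-cong up [] (true  , false) [] [] e = refl
  scan²-cong up [] (false , d)     [] [] e = refl
  scan²-cong dn (p ∷ ps) c (t ∷ ts) (u ∷ us) {f} {g} e = begin
    _ ≡⟨ scan²-dn p ps c t ts u us f ⟩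
    _ ≡⟨ ⟦⟧-cong-on _ (merge² p c (t , u)) (merge-parity p c (t , u)) (λ r s →
           scan²-cong up ps r ts us λ v w q → e v w (trans q (regroup r (sameBit-sound _ _ s)))) ⟩
    _ ≡⟨ scan²-dn p ps c t ts u us g ⟨
    _ ∎
    where
    regroup : ∀ r → parityOf r ≡ parityOf c xor (t xor u) →
      parityOf r xor parity² ts us ≡ parityOf c xor ((t xor parity ts) xor (u xor parity us))
    regroup r q = begin
      parityOf r xor parity² ts us                   ≡⟨ cong (_xor parity² ts us) q ⟩
      (parityOf c xor (t xor u)) xor parity² ts us   ≡⟨ xor-assoc (parityOf c) (t xor u) _ ⟩
      parityOf c xor ((t xor u) xor parity² ts us)   ≡⟨ cong (parityOf c xor_) (xor-four t u (parity ts) (parity us)) ⟨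
      _ ∎
  scan²-cong up (p ∷ ps) r ts us {f} {g} e = begin
    _ ≡⟨ scan²-up p ps r ts us f ⟩
    _ ≡⟨ ⟦⟧-cong-on _ (split² p r) (split-parity p r) (λ x s →
           scan²-cong dn ps (proj₂ x) ts us λ v w q → e _ _ (regroup x (sameBit-sound _ _ s) v w q)) ⟩
    _ ≡⟨ scan²-up p ps r ts us g ⟨
    _ ∎
    where
    regroup : ∀ x → parityOf r ≡ parityOf (proj₁ x) xor parityOf (proj₂ x) → ∀ v w →
      parity² v w ≡ parityOf (proj₂ x) xor parity² ts us →
      parity² (proj₁ (proj₁ x) ∷ v) (proj₂ (proj₁ x) ∷ w) ≡ parityOf r xor parity² ts us
    regroup x s v w q = begin
      _ ≡⟨ xor-four (proj₁ (proj₁ x)) (proj₂ (proj₁ x)) (parity v) (parity w) ⟩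
      parityOf (proj₁ x) xor parity² v w ≡⟨ cong (parityOf (proj₁ x) xor_) q ⟩
      parityOf (proj₁ x) xor (parityOf (proj₂ x) xor parity² ts us) ≡⟨ xor-assoc (parityOf (proj₁ x)) _ _ ⟨
      (parityOf (proj₁ x) xor parityOf (proj₂ x)) xor parity² ts us ≡⟨ cong (_xor parity² ts us) s ⟨
      _ ∎

  -- The rotation commutes with the traversal of a row: on the exterior
  -- algebra of a plane it acts by algebra and coalgebra morphisms.
  scan²-rotate : ∀ {n} K (ps : Vec Bool n) c ts us f →
    scan² K ps c ts us (rotate f) ≡
    ⟦ mix (parity² ts us) c ⟧ (λ c → rotate (λ v w → scan² K ps c v w f) ts us)
  scan²-rotate dn [] (true  , true)  [] [] f = sym (⟦⟧-one (true , true) (λ c → rotate (λ v w → scan² dn [] c v w f) [] []))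
  scan²-rotate dn [] (true  , false) [] [] f = refl
  scan²-rotate dn [] (false , true)  [] [] f = refl
  scan²-rotate dn [] (false , false) [] [] f = sym (⟦⟧-one (false , false) (λ c → rotate (λ v w → scan² dn [] c v w f) [] []))
  scan²-rotate up [] (true  , true)  [] [] f = sym (⟦⟧-one (true , true) (λ c → rotate (λ v w → scan² up [] c v w f) [] []))
  scan²-rotate up [] (true  , false) [] [] f = refl
  scan²-rotate up [] (false , true)  [] [] f = refl
  scan²-rotate up [] (false , false) [] [] f = sym (⟦⟧-one (false , false) (λ c → rotate (λ v w → scan² up [] c v w f) [] []))
  scan²-rotate dn (p ∷ ps) c (t ∷ ts) (u ∷ us) f = begin
    _ ≡⟨ scan²-dn p ps c t ts u us (rotate f) ⟩
    ⟦ merge² p c (t , u) ⟧ (λ r → scan² up ps r ts us (rotate f))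
      ≡⟨ ⟦⟧-cong (merge² p c (t , u)) (λ r → scan²-rotate up ps r ts us f) ⟩
    ⟦ merge² p c (t , u) ⟧ (λ r → ⟦ mix π r ⟧ g)
      ≡⟨ ⟦⟧->>= (merge² p c (t , u)) (mix π) g ⟨
    ⟦ mergeThenMix π p c (t , u) ⟧ g
      ≡⟨ merge-mix π p c (t , u) g ⟩
    ⟦ mixThenMerge π p c (t , u) ⟧ g
      ≡⟨ trans (⟦⟧->>= (mix _ c) _ g) (⟦⟧-cong (mix _ c) λ c → ⟦⟧->>= (mix π (t , u)) (merge² p c) g) ⟩
    ⟦ mix (flipIf π (t , u)) c ⟧ (λ c → ⟦ mix π (t , u) ⟧ (λ x → ⟦ merge² p c x ⟧ g))
      ≡⟨ ⟦⟧-cong (mix _ c) (λ c → ⟦⟧-cong (mix π (t , u)) λ x → sym (rotate-⟦⟧ (merge² p c x) (λ r v w → scan² up ps r v w f) ts us)) ⟩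
    ⟦ mix (flipIf π (t , u)) c ⟧ (λ c → ⟦ mix π (t , u) ⟧ (λ x → rotate (λ v w → ⟦ merge² p c x ⟧ (λ r → scan² up ps r v w f)) ts us))
      ≡⟨ ⟦⟧-cong (mix _ c) (λ c → ⟦⟧-cong (mix π (t , u)) λ x → rotate-cong (λ v w → sym (scan²-dn p ps c (proj₁ x) v (proj₂ x) w f)) ts us) ⟩
    ⟦ mix (flipIf π (t , u)) c ⟧ (λ c → rotate (λ v w → scan² dn (p ∷ ps) c v w f) (t ∷ ts) (u ∷ us))
      ≡⟨ cong (λ q → ⟦ mix q c ⟧ (λ c → rotate (λ v w → scan² dn (p ∷ ps) c v w f) (t ∷ ts) (u ∷ us))) (sym (xor-four t u (parity ts) (parity us))) ⟩
    _ ∎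
    where
    π = parity² ts us
    g : Bits → ℚ
    g r = rotate (λ v w → scan² up ps r v w f) ts us
  scan²-rotate up (p ∷ ps) r ts us f = begin
    _ ≡⟨ scan²-up p ps r ts us (rotate f) ⟩
    ⟦ split² p r ⟧ (λ x → scan² dn ps (proj₂ x) ts us (λ v w →
        ⟦ mix (parity² v w) (proj₁ x) ⟧ (λ b → rotate (ext b) v w)))
      ≡⟨ ⟦⟧-cong (split² p r) (λ x → scan²-cong dn ps (proj₂ x) ts us λ v w q →
           cong (λ q → ⟦ mix q (proj₁ x) ⟧ (λ b → rotate (ext b) v w)) q) ⟩
    ⟦ split² p r ⟧ (λ x → scan² dn ps (proj₂ x) ts us (λ v w → ⟦ mix (flipIf π (proj₂ x)) (proj₁ x) ⟧ (λ b → rotate (ext b) v w)))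
      ≡⟨ ⟦⟧-cong (split² p r) (λ x → scan²-⟦⟧ dn ps (proj₂ x) ts us (mix (flipIf π (proj₂ x)) (proj₁ x)) (λ b → rotate (ext b))) ⟩
    ⟦ split² p r ⟧ (λ x → ⟦ mix (flipIf π (proj₂ x)) (proj₁ x) ⟧ (λ b → scan² dn ps (proj₂ x) ts us (rotate (ext b))))
      ≡⟨ ⟦⟧-cong (split² p r) (λ x → ⟦⟧-cong (mix (flipIf π (proj₂ x)) (proj₁ x)) λ b → scan²-rotate dn ps (proj₂ x) ts us (ext b)) ⟩
    ⟦ split² p r ⟧ (λ x → ⟦ mix (flipIf π (proj₂ x)) (proj₁ x) ⟧ (λ b → ⟦ mix π (proj₂ x) ⟧ (λ c → g (b , c))))
      ≡⟨ ⟦⟧-cong (split² p r) (λ x → ⟦⟧-both′ (mix (flipIf π (proj₂ x)) (proj₁ x)) (mix π (proj₂ x))) ⟨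
    ⟦ split² p r ⟧ (λ x → ⟦ both (mix (flipIf π (proj₂ x)) (proj₁ x)) (mix π (proj₂ x)) ⟧ g)
      ≡⟨ ⟦⟧->>= (split² p r) _ g ⟨
    ⟦ splitThenMix π p r ⟧ g
      ≡⟨ split-mix π p r g ⟩
    ⟦ mixThenSplit π p r ⟧ g
      ≡⟨ ⟦⟧->>= (mix π r) (split² p) g ⟩
    ⟦ mix π r ⟧ (λ r → ⟦ split² p r ⟧ g)
      ≡⟨ ⟦⟧-cong (mix π r) (λ r → sym (rotate-⟦⟧ (split² p r) (λ x v w → scan² dn ps (proj₂ x) v w (ext (proj₁ x))) ts us)) ⟩
    _ ≡⟨ ⟦⟧-cong (mix π r) (λ r → rotate-cong (λ v w → sym (scan²-up p ps r v w f)) ts us) ⟩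
    _ ∎
    where
    π = parity² ts us
    ext : Bits → _ → _ → ℚ
    ext b v w = f (proj₁ b ∷ v) (proj₂ b ∷ w)
    g : Bits × Bits → ℚ
    g x = rotate (λ v w → scan² dn ps (proj₂ x) v w (ext (proj₁ x))) ts us
    ⟦⟧-both′ : ∀ (xs ys : Combination Bits) → ⟦ both xs ys ⟧ g ≡ ⟦ xs ⟧ (λ b → ⟦ ys ⟧ (λ c → g (b , c)))
    ⟦⟧-both′ xs ys = ⟦⟧-both xs ys (λ b c → g (b , c))

module Rows where

  open Transfer
  open import Data.Bool using (Bool; true; false; not; _xor_; _∧_; if_then_else_)
  open import Data.List using (List; []; _∷_; map)
  open import Data.Nat using (ℕ; zero; suc)
  open import Data.Product using (_×_; _,_; proj₁; proj₂)
  open import Data.Rational using (ℚ; 0ℚ; 1ℚ; ½; _+_; _*_; -_)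
  open import Data.Rational.Properties hiding (_≟_)
  import Data.Rational.Solver as ℚSolver
  open import Data.Vec using (Vec; []; _∷_)
  open import Relation.Binary.PropositionalEquality
  open ≡-Reasoning

  module _ {n : ℕ} where

    Row Row² : Set
    Row  = Bool × Vec Bool n
    Row² = Bool × Vec Bool n × Vec Bool n

    vacant : ∀ {m} → Vec Bool m → ℚ
    vacant []          = 1ℚ
    vacant (true ∷ v)  = 0ℚ
    vacant (false ∷ v) = vacant v

    axisUp² : ℚ → Bool → Combination (Bool × Bits)
    axisUp² w true  = (1ℚ , (false , (true , false))) ∷ (1ℚ , (false , (false , true))) ∷ (w , (true , (false , false))) ∷ []
    axisUp² w false = one (false , (false , false))

    axisDown² : (p τ : Bool) → Combination Bits
    axisDown² true  false = (1ℚ , (false , true)) ∷ (1ℚ , (true , false)) ∷ []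
    axisDown² true  true  = one (true , true)
    axisDown² false false = one (true , true)
    axisDown² false true  = []

    axisUp : Bool → Combination Bits
    axisUp true  = (1ℚ , (false , true)) ∷ (½ , (true , false)) ∷ []
    axisUp false = one (false , false)

    axisDown : (p τ : Bool) → Combination Bool
    axisDown true  false = one false
    axisDown true  true  = one true
    axisDown false false = one true
    axisDown false true  = []

    count² : ℚ → ∀ K → List Row² → Bool → Word K n → Word K n → ℚ
    count² w K  []                 τ ts us = if τ then 0ℚ else vacant ts * vacant us
    count² w dn ((p , r , l) ∷ rs) τ ts us = ⟦ axisUp² w p ⟧ λ x →
      scan dn r (proj₁ (proj₂ x)) ts λ bs → scan dn l (proj₂ (proj₂ x)) us λ ds → count² w up rs (proj₁ x) bs ds
    count² w up ((p , r , l) ∷ rs) τ ts us = ⟦ axisDown² p τ ⟧ λ x →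
      scan up r (proj₁ x) ts λ bs → scan up l (proj₂ x) us λ ds → count² w dn rs false bs ds

    count : ∀ K → List Row → Bool → Word K n → ℚ
    count K  []             τ ts = if τ then 0ℚ else vacant ts
    count dn ((p , r) ∷ rs) τ ts = ⟦ axisUp p ⟧ λ x → scan dn r (proj₂ x) ts (count up rs (proj₁ x))
    count up ((p , r) ∷ rs) τ ts = ⟦ axisDown p τ ⟧ λ x → scan up r x ts (count dn rs false)

    double : Row → Row²
    double (p , r) = p , r , r

    -- Halving K π rs rs₁ rs₂ e: the axis cells of rs are distributed among
    -- rs₁ and rs₂, and e of them leave the parity π of the number of axis
    -- cells met before even.
    data Halving : Kind → Bool → List Row → List Row → List Row → ℕ → Set where
      []   : ∀ {K π} → Halving K π [] [] [] 0
      gap  : ∀ {K π rs rs₁ rs₂ e} v → Halving (opposite K) π rs rs₁ rs₂ e →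
             Halving K π ((false , v) ∷ rs) ((false , v) ∷ rs₁) ((false , v) ∷ rs₂) e
      dn₁  : ∀ {rs rs₁ rs₂ e} v → Halving up true rs rs₁ rs₂ e →
             Halving dn false ((true , v) ∷ rs) ((true , v) ∷ rs₁) ((false , v) ∷ rs₂) (suc e)
      dn₂  : ∀ {rs rs₁ rs₂ e} v → Halving up false rs rs₁ rs₂ e →
             Halving dn true ((true , v) ∷ rs) ((false , v) ∷ rs₁) ((true , v) ∷ rs₂) e
      up₂  : ∀ {rs rs₁ rs₂ e} v → Halving dn true rs rs₁ rs₂ e →
             Halving up false ((true , v) ∷ rs) ((false , v) ∷ rs₁) ((true , v) ∷ rs₂) (suc e)
      up₁  : ∀ {rs rs₁ rs₂ e} v → Halving dn false rs rs₁ rs₂ e →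
             Halving up true ((true , v) ∷ rs) ((true , v) ∷ rs₁) ((false , v) ∷ rs₂) e

    2ℚ : ℚ
    2ℚ = 1ℚ + 1ℚ

    power : ℕ → ℚ
    power zero    = 1ℚ
    power (suc e) = 2ℚ * power e

    _⊗_ : ∀ {A B : Set} → (A → ℚ) → (B → ℚ) → A → B → ℚ
    (f ⊗ g) a b = f a * g b

    scan²-⊗ : ∀ K (ps : Vec Bool n) c ts us f g →
      scan² K ps c ts us (f ⊗ g) ≡ scan K ps (proj₁ c) ts f * scan K ps (proj₂ c) us g
    scan²-⊗ K ps (c , d) ts us f g = begin
      _ ≡⟨ scan-cong K ps c ts (λ v → scan-* K ps d us (f v) g) ⟩
      _ ≡⟨ scan-cong K ps c ts (λ v → *-comm (f v) _) ⟩
      _ ≡⟨ scan-* K ps c ts (scan K ps d us g) f ⟩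
      _ ≡⟨ *-comm (scan K ps d us g) _ ⟩
      _ ∎

    rotate-* : ∀ {m} k (f : Vec Bool m → Vec Bool m → ℚ) v w → rotate (λ v w → k * f v w) v w ≡ k * rotate f v w
    rotate-* k f []      []      = refl
    rotate-* k f (s ∷ v) (t ∷ w) =
      trans (⟦⟧-cong (mix (parity² v w) (s , t)) λ x → rotate-* k _ v w) (⟦⟧-* (mix (parity² v w) (s , t)) k _)

    scan²-step : ∀ K (ps : Vec Bool n) c ts us k {f g h} →
      (∀ v w → parity² v w ≡ parityOf c xor parity² ts us → f v w ≡ k * rotate (g ⊗ h) v w) →
      scan² K ps c ts us f ≡ k * ⟦ mix (parity² ts us) c ⟧ (λ c →
        rotate ((λ v → scan K ps (proj₁ c) v g) ⊗ (λ w → scan K ps (proj₂ c) w h)) ts us)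
    scan²-step K ps c ts us k {f} {g} {h} e = begin
      scan² K ps c ts us f                            ≡⟨ scan²-cong K ps c ts us e ⟩
      scan² K ps c ts us (λ v w → k * rotate (g ⊗ h) v w) ≡⟨ scan-cong K ps (proj₁ c) ts (λ v → scan-* K ps (proj₂ c) us k _) ⟩
      _                                               ≡⟨ scan-* K ps (proj₁ c) ts k _ ⟩
      k * scan² K ps c ts us (rotate (g ⊗ h))         ≡⟨ cong (k *_) (scan²-rotate K ps c ts us (g ⊗ h)) ⟩
      _ ≡⟨ cong (k *_) (⟦⟧-cong (mix (parity² ts us) c) λ c → rotate-cong (λ v w → scan²-⊗ K ps c v w g h) ts us) ⟩
      _ ∎

    rotate-zero : ∀ {m} {f : Vec Bool m → Vec Bool m → ℚ} → (∀ v w → f v w ≡ 0ℚ) → ∀ v w → rotate f v w ≡ 0ℚ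
    rotate-zero e v w = trans (rotate-cong (λ v w → trans (e v w) (sym (*-zeroˡ 0ℚ))) v w)
      (trans (rotate-* 0ℚ (λ _ _ → 0ℚ) v w) (*-zeroˡ (rotate (λ _ _ → 0ℚ) v w)))

    rotate-vacant : ∀ {m} (v w : Vec Bool m) → rotate (vacant ⊗ vacant) v w ≡ vacant v * vacant w
    rotate-vacant [] [] = refl
    rotate-vacant (s ∷ v) (t ∷ w) = head (parity² v w) s t
      where
      f : Bits → ℚ
      f x = rotate (λ v w → vacant (proj₁ x ∷ v) * vacant (proj₂ x ∷ w)) v w
      ftt : f (true , true) ≡ 0ℚ
      ftt = rotate-zero (λ v w → *-zeroˡ 0ℚ) v w
      ftf : f (true , false) ≡ 0ℚ
      ftf = rotate-zero (λ v w → *-zeroˡ (vacant w)) v w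
      fft : f (false , true) ≡ 0ℚ
      fft = rotate-zero (λ v w → *-zeroʳ (vacant v)) v w
      head : ∀ π s t → ⟦ mix π (s , t) ⟧ f ≡ vacant (s ∷ v) * vacant (t ∷ w)
      head true  true  true  = trans (cong (λ q → 1ℚ * q + 0ℚ) ftt) (sym (*-zeroˡ 0ℚ))
      head false true  true  = trans (cong (λ q → 1ℚ * q + 0ℚ) ftt) (sym (*-zeroˡ 0ℚ))
      head true  false false = trans (⟦⟧-one (false , false) f) (rotate-vacant v w)
      head false false false = trans (⟦⟧-one (false , false) f) (rotate-vacant v w)
      head true  true  false = trans (cong₂ (λ q r → -½ * q + (½ * r + 0ℚ)) ftf fft) (sym (*-zeroˡ (vacant w)))
      head false true  false = trans (cong₂ (λ q r → 1ℚ * q + (1ℚ * r + 0ℚ)) ftf fft) (sym (*-zeroˡ (vacant w)))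
      head true  false true  = trans (cong₂ (λ q r → ½ * q + (½ * r + 0ℚ)) ftf fft) (sym (*-zeroʳ (vacant v)))
      head false false true  = trans (cong₂ (λ q r → 1ℚ * q + (- 1ℚ * r + 0ℚ)) ftf fft) (sym (*-zeroʳ (vacant v)))

    halfWeight : (π τ : Bool) → ℚ
    halfWeight false true = ½
    halfWeight _     _    = 1ℚ

    open ℚSolver.+-*-Solver using (solve; _:+_; _:*_; _:=_; con)

    -- The base of an axis triangle is counted for the copy owning that triangle.
    Factors : Kind → Bool → List Row → List Row → List Row → ℕ → Set
    Factors dn π rs rs₁ rs₂ e = ∀ v w → parity² v w ≡ π →
      count² 1ℚ dn (map double rs) false v w ≡ power e * rotate (count dn rs₁ false ⊗ count dn rs₂ false) v w
    Factors up π rs rs₁ rs₂ e = ∀ τ v w → parity² v w ≡ τ xor π →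
      count² 1ℚ up (map double rs) τ v w ≡
      power e * (halfWeight π τ * rotate (count up rs₁ (τ ∧ π) ⊗ count up rs₂ (τ ∧ not π)) v w)

    rotate-⊗ : ∀ {A B : Set} {m} (xs : Combination A) (ys : Combination B)
      (f : A → Vec Bool m → ℚ) (g : B → Vec Bool m → ℚ) v w →
      rotate ((λ v → ⟦ xs ⟧ (λ a → f a v)) ⊗ (λ w → ⟦ ys ⟧ (λ b → g b w))) v w ≡
      ⟦ xs ⟧ (λ a → ⟦ ys ⟧ (λ b → rotate (f a ⊗ g b) v w))
    rotate-⊗ xs ys f g v w = begin
      _ ≡⟨ rotate-cong (λ v w → trans (*-comm _ (⟦ ys ⟧ (λ b → g b w)))
             (trans (sym (⟦⟧-* xs (⟦ ys ⟧ (λ b → g b w)) (λ a → f a v)))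
             (⟦⟧-cong xs λ a → trans (*-comm _ (f a v)) (sym (⟦⟧-* ys (f a v) (λ b → g b w)))))) v w ⟩
      _ ≡⟨ rotate-⟦⟧ xs (λ a v w → ⟦ ys ⟧ (λ b → f a v * g b w)) v w ⟩
      _ ≡⟨ ⟦⟧-cong xs (λ a → rotate-⟦⟧ ys (λ b → f a ⊗ g b) v w) ⟩
      _ ∎

    halving-factors : ∀ {K π rs rs₁ rs₂ e} → Halving K π rs rs₁ rs₂ e → Factors K π rs rs₁ rs₂ e
    halving-factors {dn} {π} [] v w q =
      sym (trans (*-identityˡ _) (rotate-vacant v w))
    halving-factors {up} {true} [] false v w q =
      sym (trans (*-identityˡ _) (trans (*-identityˡ _) (rotate-vacant v w)))
    halving-factors {up} {false} [] false v w q =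
      sym (trans (*-identityˡ _) (trans (*-identityˡ _) (rotate-vacant v w)))
    halving-factors {up} {true} [] true v w q =
      sym (trans (*-identityˡ _) (trans (*-identityˡ _) (rotate-zero (λ v w → *-zeroˡ (vacant w)) v w)))
    halving-factors {up} {false} [] true v w q =
      sym (trans (*-identityˡ _) (trans (cong (½ *_) (rotate-zero (λ v w → *-zeroʳ (vacant v)) v w)) (*-zeroʳ ½)))
    halving-factors {dn} {π} (gap {rs = rs} {rs₁} {rs₂} {e} ps H) v w q = begin
      _ ≡⟨ ⟦⟧-one (false , (false , false)) (λ x → scan² dn ps (proj₂ x) v w (count² 1ℚ up (map double rs) (proj₁ x))) ⟩
      _ ≡⟨ scan²-step dn ps (false , false) v w (power e)
             (λ v w q′ → trans (F false v w (trans q′ q)) (cong (power e *_) (unit π _))) ⟩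
      _ ≡⟨ cong (power e *_) (trans (⟦⟧-one (false , false) g) (sym (trans
             (rotate-⊗ (one (false , false)) (one (false , false)) (λ x v → scan dn ps (proj₂ x) v (count up rs₁ (proj₁ x)))
               (λ x v → scan dn ps (proj₂ x) v (count up rs₂ (proj₁ x))) v w)
             (trans (⟦⟧-one (false , false) h) (⟦⟧-one (false , false) h′))))) ⟩
      _ ∎
      where
      F = halving-factors H
      unit : ∀ π x → halfWeight π false * x ≡ x
      unit true  x = *-identityˡ x
      unit false x = *-identityˡ x
      g h h′ : Bits → ℚ
      g c = rotate ((λ v → scan dn ps (proj₁ c) v (count up rs₁ false)) ⊗ (λ w → scan dn ps (proj₂ c) w (count up rs₂ false))) v w
      h′ y = rotate ((λ v → scan dn ps false v (count up rs₁ false)) ⊗ (λ v → scan dn ps (proj₂ y) v (count up rs₂ (proj₁ y)))) v w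
      h x = ⟦ one (false , false) ⟧ (λ y → rotate ((λ v → scan dn ps (proj₂ x) v (count up rs₁ (proj₁ x))) ⊗ (λ v → scan dn ps (proj₂ y) v (count up rs₂ (proj₁ y)))) v w)
    halving-factors {up} {π} (gap {rs = rs} {rs₁} {rs₂} {e} ps H) false v w q = begin
      _ ≡⟨ ⟦⟧-one (true , true) (λ x → scan² up ps x v w (count² 1ℚ dn (map double rs) false)) ⟩
      _ ≡⟨ scan²-step up ps (true , true) v w (power e) (λ v w q′ → F v w (trans q′ q)) ⟩
      _ ≡⟨ cong (power e *_) (trans (⟦⟧-one (true , true) g) (sym (trans (unit π _) (trans
             (rotate-⊗ (one true) (one true) (λ x v → scan up ps x v (count dn rs₁ false))
               (λ x v → scan up ps x v (count dn rs₂ false)) v w)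
             (trans (⟦⟧-one true (λ x → ⟦ one true ⟧ (λ y → g (x , y)))) (⟦⟧-one true (λ y → g (true , y)))))))) ⟩
      _ ∎
      where
      F = halving-factors H
      unit : ∀ π x → halfWeight π false * x ≡ x
      unit true  x = *-identityˡ x
      unit false x = *-identityˡ x
      g : Bits → ℚ
      g c = rotate ((λ v → scan up ps (proj₁ c) v (count dn rs₁ false)) ⊗ (λ w → scan up ps (proj₂ c) w (count dn rs₂ false))) v w
    halving-factors {up} {true} (gap {rs₂ = rs₂} {e} ps H) true v w q = sym (trans (cong (power e *_)
      (trans (*-identityˡ _) (rotate-zero (λ v w → *-zeroˡ (count up ((false , ps) ∷ rs₂) false w)) v w))) (*-zeroʳ (power e)))
    halving-factors {up} {false} (gap {rs₁ = rs₁} {e = e} ps H) true v w q = sym (trans (cong (power e *_)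
      (trans (cong (½ *_) (rotate-zero (λ v w → *-zeroʳ (count up ((false , ps) ∷ rs₁) false v)) v w)) (*-zeroʳ ½))) (*-zeroʳ (power e)))
    halving-factors (dn₁ {rs} {rs₁} {rs₂} {e} ps H) v w q = begin
      _ ≡⟨ cong₂ (λ x y → 1ℚ * x + y) (step (true , false) false (λ v w q′ → trans (F false v w (trans q′ (cong not q))) (cong (power e *_) (*-identityˡ _))))
            (cong₂ (λ x y → 1ℚ * x + (1ℚ * y + 0ℚ)) (step (false , true) false (λ v w q′ → trans (F false v w (trans q′ (cong not q))) (cong (power e *_) (*-identityˡ _))))
              (step (false , false) true (λ v w q′ → trans (F true v w (trans q′ q)) (cong (power e *_) (*-identityˡ _))))) ⟩
      _ ≡⟨ cong (λ π → 1ℚ * (power e * ⟦ mix π (true , false) ⟧ (g false)) + (1ℚ * (power e * ⟦ mix π (false , true) ⟧ (g false)) +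
              (1ℚ * (power e * ⟦ mix π (false , false) ⟧ (g true)) + 0ℚ))) q ⟩
      _ ≡⟨ solve 4 (λ k x y z →
             con 1ℚ :* (k :* (con 1ℚ :* x :+ (con 1ℚ :* y :+ con 0ℚ))) :+ (con 1ℚ :* (k :* (con 1ℚ :* x :+ (con (- 1ℚ) :* y :+ con 0ℚ))) :+
               (con 1ℚ :* (k :* (con 1ℚ :* z :+ con 0ℚ)) :+ con 0ℚ)) :=
             con 2ℚ :* k :* (con 1ℚ :* (con 1ℚ :* x :+ con 0ℚ) :+ (con ½ :* (con 1ℚ :* z :+ con 0ℚ) :+ con 0ℚ)))
             refl (power e) (g false (true , false)) (g false (false , true)) (g true (false , false)) ⟩
      _ ≡⟨ cong (2ℚ * power e *_) (rotate-⊗ (axisUp true) (one (false , false)) (λ x v → scan dn ps (proj₂ x) v (count up rs₁ (proj₁ x)))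
               (λ x v → scan dn ps (proj₂ x) v (count up rs₂ (proj₁ x))) v w) ⟨
      _ ∎
      where
      F = halving-factors H
      g : Bool → Bits → ℚ
      g τ c = rotate ((λ v → scan dn ps (proj₁ c) v (count up rs₁ (τ ∧ true))) ⊗ (λ w → scan dn ps (proj₂ c) w (count up rs₂ (τ ∧ false)))) v w
      step : ∀ c τ → (∀ v′ w′ → parity² v′ w′ ≡ parityOf c xor parity² v w →
        count² 1ℚ up (map double rs) τ v′ w′ ≡ power e * rotate (count up rs₁ (τ ∧ true) ⊗ count up rs₂ (τ ∧ false)) v′ w′) →
        scan² dn ps c v w (count² 1ℚ up (map double rs) τ) ≡ power e * ⟦ mix (parity² v w) c ⟧ (g τ)
      step c τ h = scan²-step dn ps c v w (power e) h
    halving-factors (dn₂ {rs} {rs₁} {rs₂} {e} ps H) v w q = begin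
      _ ≡⟨ cong₂ (λ x y → 1ℚ * x + y) (step (true , false) false 1ℚ (λ v w q′ → F false v w (trans q′ (cong not q))))
            (cong₂ (λ x y → 1ℚ * x + (1ℚ * y + 0ℚ)) (step (false , true) false 1ℚ (λ v w q′ → F false v w (trans q′ (cong not q))))
              (step (false , false) true ½ (λ v w q′ → F true v w (trans q′ q)))) ⟩
      _ ≡⟨ cong (λ π → 1ℚ * ((power e * 1ℚ) * ⟦ mix π (true , false) ⟧ (g false)) + (1ℚ * ((power e * 1ℚ) * ⟦ mix π (false , true) ⟧ (g false)) +
              (1ℚ * ((power e * ½) * ⟦ mix π (false , false) ⟧ (g true)) + 0ℚ))) q ⟩
      _ ≡⟨ solve 4 (λ k x y z →
             con 1ℚ :* ((k :* con 1ℚ) :* (con -½ :* x :+ (con ½ :* y :+ con 0ℚ))) :+ (con 1ℚ :* ((k :* con 1ℚ) :* (con ½ :* x :+ (con ½ :* y :+ con 0ℚ))) :+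
               (con 1ℚ :* ((k :* con ½) :* (con 1ℚ :* z :+ con 0ℚ)) :+ con 0ℚ)) :=
             k :* (con 1ℚ :* (con 1ℚ :* y :+ (con ½ :* z :+ con 0ℚ)) :+ con 0ℚ))
             refl (power e) (g false (true , false)) (g false (false , true)) (g true (false , false)) ⟩
      _ ≡⟨ cong (power e *_) (rotate-⊗ (one (false , false)) (axisUp true) (λ x v → scan dn ps (proj₂ x) v (count up rs₁ (proj₁ x)))
               (λ x v → scan dn ps (proj₂ x) v (count up rs₂ (proj₁ x))) v w) ⟨
      _ ∎
      where
      F = halving-factors H
      g : Bool → Bits → ℚ
      g τ c = rotate ((λ v → scan dn ps (proj₁ c) v (count up rs₁ (τ ∧ false))) ⊗ (λ w → scan dn ps (proj₂ c) w (count up rs₂ (τ ∧ true)))) v w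
      step : ∀ c τ k → (∀ v′ w′ → parity² v′ w′ ≡ parityOf c xor parity² v w →
        count² 1ℚ up (map double rs) τ v′ w′ ≡ power e * (k * rotate (count up rs₁ (τ ∧ false) ⊗ count up rs₂ (τ ∧ true)) v′ w′)) →
        scan² dn ps c v w (count² 1ℚ up (map double rs) τ) ≡ (power e * k) * ⟦ mix (parity² v w) c ⟧ (g τ)
      step c τ k h = scan²-step dn ps c v w (power e * k) (λ v w q → trans (h v w q) (sym (*-assoc (power e) k _)))
    halving-factors (up₂ {rs} {rs₁} {rs₂} {e} ps H) false v w q = begin
      _ ≡⟨ cong₂ (λ x y → 1ℚ * x + (1ℚ * y + 0ℚ)) (step (false , true) (λ v w q′ → F v w (trans q′ (cong not q))))
             (step (true , false) (λ v w q′ → F v w (trans q′ (cong not q)))) ⟩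
      _ ≡⟨ cong (λ π → 1ℚ * (power e * ⟦ mix π (false , true) ⟧ g) + (1ℚ * (power e * ⟦ mix π (true , false) ⟧ g) + 0ℚ)) q ⟩
      _ ≡⟨ solve 3 (λ k x y →
             con 1ℚ :* (k :* (con 1ℚ :* x :+ (con (- 1ℚ) :* y :+ con 0ℚ))) :+ (con 1ℚ :* (k :* (con 1ℚ :* x :+ (con 1ℚ :* y :+ con 0ℚ))) :+ con 0ℚ) :=
             con 2ℚ :* k :* (con 1ℚ :* (con 1ℚ :* (con 1ℚ :* x :+ con 0ℚ) :+ con 0ℚ)))
             refl (power e) (g (true , false)) (g (false , true)) ⟩
      _ ≡⟨ cong (λ t → 2ℚ * power e * (1ℚ * t)) (rotate-⊗ (one true) (one false) (λ x v → scan up ps x v (count dn rs₁ false))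
               (λ x v → scan up ps x v (count dn rs₂ false)) v w) ⟨
      _ ∎
      where
      F = halving-factors H
      g : Bits → ℚ
      g c = rotate ((λ v → scan up ps (proj₁ c) v (count dn rs₁ false)) ⊗ (λ w → scan up ps (proj₂ c) w (count dn rs₂ false))) v w
      step : ∀ c → (∀ v′ w′ → parity² v′ w′ ≡ parityOf c xor parity² v w →
        count² 1ℚ dn (map double rs) false v′ w′ ≡ power e * rotate (count dn rs₁ false ⊗ count dn rs₂ false) v′ w′) →
        scan² up ps c v w (count² 1ℚ dn (map double rs) false) ≡ power e * ⟦ mix (parity² v w) c ⟧ g
      step c h = scan²-step up ps c v w (power e) h
    halving-factors (up₂ {rs} {rs₁} {rs₂} {e} ps H) true v w q = begin
      _ ≡⟨ cong (λ x → 1ℚ * x + 0ℚ) (step (true , true) (λ v w q′ → F v w (trans q′ q))) ⟩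
      _ ≡⟨ solve 2 (λ k x →
             con 1ℚ :* (k :* (con 1ℚ :* x :+ con 0ℚ)) :+ con 0ℚ :=
             con 2ℚ :* k :* (con ½ :* (con 1ℚ :* (con 1ℚ :* x :+ con 0ℚ) :+ con 0ℚ)))
             refl (power e) (g (true , true)) ⟩
      _ ≡⟨ cong (λ t → 2ℚ * power e * (½ * t)) (rotate-⊗ (one true) (one true) (λ x v → scan up ps x v (count dn rs₁ false))
               (λ x v → scan up ps x v (count dn rs₂ false)) v w) ⟨
      _ ∎
      where
      F = halving-factors H
      g : Bits → ℚ
      g c = rotate ((λ v → scan up ps (proj₁ c) v (count dn rs₁ false)) ⊗ (λ w → scan up ps (proj₂ c) w (count dn rs₂ false))) v w
      step : ∀ c → (∀ v′ w′ → parity² v′ w′ ≡ parityOf c xor parity² v w →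
        count² 1ℚ dn (map double rs) false v′ w′ ≡ power e * rotate (count dn rs₁ false ⊗ count dn rs₂ false) v′ w′) →
        scan² up ps c v w (count² 1ℚ dn (map double rs) false) ≡ power e * ⟦ mix (parity² v w) c ⟧ g
      step c h = scan²-step up ps c v w (power e) h
    halving-factors (up₁ {rs} {rs₁} {rs₂} {e} ps H) false v w q = begin
      _ ≡⟨ cong₂ (λ x y → 1ℚ * x + (1ℚ * y + 0ℚ)) (step (false , true) (λ v w q′ → F v w (trans q′ (cong not q))))
             (step (true , false) (λ v w q′ → F v w (trans q′ (cong not q)))) ⟩
      _ ≡⟨ cong (λ π → 1ℚ * (power e * ⟦ mix π (false , true) ⟧ g) + (1ℚ * (power e * ⟦ mix π (true , false) ⟧ g) + 0ℚ)) q ⟩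
      _ ≡⟨ solve 3 (λ k x y →
             con 1ℚ :* (k :* (con ½ :* x :+ (con ½ :* y :+ con 0ℚ))) :+ (con 1ℚ :* (k :* (con -½ :* x :+ (con ½ :* y :+ con 0ℚ))) :+ con 0ℚ) :=
             k :* (con 1ℚ :* (con 1ℚ :* (con 1ℚ :* y :+ con 0ℚ) :+ con 0ℚ)))
             refl (power e) (g (true , false)) (g (false , true)) ⟩
      _ ≡⟨ cong (λ t → power e * (1ℚ * t)) (rotate-⊗ (one false) (one true) (λ x v → scan up ps x v (count dn rs₁ false))
               (λ x v → scan up ps x v (count dn rs₂ false)) v w) ⟨
      _ ∎
      where
      F = halving-factors H
      g : Bits → ℚ
      g c = rotate ((λ v → scan up ps (proj₁ c) v (count dn rs₁ false)) ⊗ (λ w → scan up ps (proj₂ c) w (count dn rs₂ false))) v w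
      step : ∀ c → (∀ v′ w′ → parity² v′ w′ ≡ parityOf c xor parity² v w →
        count² 1ℚ dn (map double rs) false v′ w′ ≡ power e * rotate (count dn rs₁ false ⊗ count dn rs₂ false) v′ w′) →
        scan² up ps c v w (count² 1ℚ dn (map double rs) false) ≡ power e * ⟦ mix (parity² v w) c ⟧ g
      step c h = scan²-step up ps c v w (power e) h
    halving-factors (up₁ {rs} {rs₁} {rs₂} {e} ps H) true v w q = begin
      _ ≡⟨ cong (λ x → 1ℚ * x + 0ℚ) (step (true , true) (λ v w q′ → F v w (trans q′ q))) ⟩
      _ ≡⟨ solve 2 (λ k x →
             con 1ℚ :* (k :* (con 1ℚ :* x :+ con 0ℚ)) :+ con 0ℚ :=
             k :* (con 1ℚ :* (con 1ℚ :* (con 1ℚ :* x :+ con 0ℚ) :+ con 0ℚ)))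
             refl (power e) (g (true , true)) ⟩
      _ ≡⟨ cong (λ t → power e * (1ℚ * t)) (rotate-⊗ (one true) (one true) (λ x v → scan up ps x v (count dn rs₁ false))
               (λ x v → scan up ps x v (count dn rs₂ false)) v w) ⟨
      _ ∎
      where
      F = halving-factors H
      g : Bits → ℚ
      g c = rotate ((λ v → scan up ps (proj₁ c) v (count dn rs₁ false)) ⊗ (λ w → scan up ps (proj₂ c) w (count dn rs₂ false))) v w
      step : ∀ c → (∀ v′ w′ → parity² v′ w′ ≡ parityOf c xor parity² v w →
        count² 1ℚ dn (map double rs) false v′ w′ ≡ power e * rotate (count dn rs₁ false ⊗ count dn rs₂ false) v′ w′) →
        scan² up ps c v w (count² 1ℚ dn (map double rs) false) ≡ power e * ⟦ mix (parity² v w) c ⟧ g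
      step c h = scan²-step up ps c v w (power e) h

module Coverings where

  open Transfer using (+-interchange; *-leftComm)
  open import Data.Bool using (Bool; true; false; _∧_; if_then_else_)
  open import Data.List using (List; []; _∷_; map; filter)
  open import Data.List.Membership.Propositional using (_∈_)
  open import Data.List.Relation.Unary.All using (All; []; _∷_)
  open import Data.List.Relation.Unary.Any using (here; there)
  open import Data.List.Relation.Binary.Permutation.Propositional using (_↭_; refl; prep; swap; trans)
  open import Data.Nat using (ℕ; suc)
  open import Data.Product using (_×_; _,_)
  open import Data.Rational using (ℚ; 0ℚ; 1ℚ; _+_; _*_)
  open import Data.Rational.Properties hiding (_≟_; ≤-refl)
  open import Data.Sum using (_⊎_; inj₁; inj₂)
  open import Function using (_∘_)
  open import Relation.Binary.Definitions using (DecidableEquality)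
  open import Relation.Binary.PropositionalEquality as ≡ hiding (trans)
  open import Relation.Nullary using (yes; no; does; contradiction)
  open import Relation.Unary using (Decidable)
  open import Relation.Nullary.Decidable using (dec-true; dec-false)

  open ≡-Reasoning

  exactly : Bool → ℕ → Bool
  exactly true  1 = true
  exactly true  _ = false
  exactly false 0 = true
  exactly false _ = false

  ifℚ : Bool → ℚ → ℚ
  ifℚ true  x = x
  ifℚ false x = 0ℚ

  module Bump {V : Set} (_≟_ : DecidableEquality V) where

    bump : V → (V → ℕ) → V → ℕ
    bump a f x = if does (a ≟ x) then suc (f x) else f x

    bump-hit : ∀ a f → bump a f a ≡ suc (f a)
    bump-hit a f = cong (λ b → if b then suc (f a) else f a) (dec-true (a ≟ a) refl)

    bump-miss : ∀ {a x} f → a ≢ x → bump a f x ≡ f x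
    bump-miss {a} {x} f n = cong (λ b → if b then suc (f x) else f x) (dec-false (a ≟ x) n)

    bump-cong : ∀ a {f g : V → ℕ} → f ≗ g → bump a f ≗ bump a g
    bump-cong a e x with does (a ≟ x)
    ... | true  = cong suc (e x)
    ... | false = e x

    bump-comm : ∀ a b f → bump a (bump b f) ≗ bump b (bump a f)
    bump-comm a b f x with does (a ≟ x) | does (b ≟ x)
    ... | true  | true  = refl
    ... | true  | false = refl
    ... | false | true  = refl
    ... | false | false = refl

  -- Sums over all sublists of a list of edges, weighted by products, under
  -- the condition that the vertices of K for which t holds are covered
  -- exactly once and the other ones not at all.
  module Cover {V E : Set} (_≟_ : DecidableEquality V) (src tgt : E → V) (t : V → Bool) where

    open Bump _≟_ public

    cover : E → (V → ℕ) → V → ℕ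
    cover e f = bump (src e) (bump (tgt e) f)

    cover-cong : ∀ e {f g : V → ℕ} → f ≗ g → cover e f ≗ cover e g
    cover-cong e q = bump-cong (src e) (bump-cong (tgt e) q)

    cover-comm : ∀ d e f → cover d (cover e f) ≗ cover e (cover d f)
    cover-comm d e f x = begin
      bump (src d) (bump (tgt d) (bump (src e) (bump (tgt e) f))) x
        ≡⟨ bump-cong (src d) (bump-comm (tgt d) (src e) (bump (tgt e) f)) x ⟩
      bump (src d) (bump (src e) (bump (tgt d) (bump (tgt e) f))) x
        ≡⟨ bump-comm (src d) (src e) (bump (tgt d) (bump (tgt e) f)) x ⟩
      bump (src e) (bump (src d) (bump (tgt d) (bump (tgt e) f))) x
        ≡⟨ bump-cong (src e) (bump-cong (src d) (bump-comm (tgt d) (tgt e) f)) x ⟩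
      bump (src e) (bump (src d) (bump (tgt e) (bump (tgt d) f))) x
        ≡⟨ bump-cong (src e) (bump-comm (src d) (tgt e) (bump (tgt d) f)) x ⟩
      _ ∎

    cover-miss : ∀ {e x} f → src e ≢ x → tgt e ≢ x → cover e f x ≡ f x
    cover-miss {e} f n m = ≡.trans (bump-miss (bump (tgt e) f) n) (bump-miss f m)

    cover-src : ∀ {e x} f → src e ≡ x → tgt e ≢ x → cover e f x ≡ suc (f x)
    cover-src {e} f refl m = ≡.trans (bump-hit (src e) (bump (tgt e) f)) (cong suc (bump-miss f m))

    cover-tgt : ∀ {e x} f → src e ≢ x → tgt e ≡ x → cover e f x ≡ suc (f x)
    cover-tgt {e} f n refl = ≡.trans (bump-miss (bump (tgt e) f) n) (bump-hit (tgt e) f)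

    satisfied : List V → (V → ℕ) → Bool
    satisfied []      f = true
    satisfied (x ∷ K) f = exactly (t x) (f x) ∧ satisfied K f

    Q : (E → ℚ) → List E → List V → (V → ℕ) → ℚ
    Q w []       K f = ifℚ (satisfied K f) 1ℚ
    Q w (e ∷ es) K f = Q w es K f + w e * Q w es K (cover e f)

    satisfied-cong : ∀ K {f g : V → ℕ} → f ≗ g → satisfied K f ≡ satisfied K g
    satisfied-cong []      q = refl
    satisfied-cong (x ∷ K) q = cong₂ (λ a b → exactly (t x) a ∧ b) (q x) (satisfied-cong K q)

    Q-cong : ∀ w es K {f g : V → ℕ} → f ≗ g → Q w es K f ≡ Q w es K g
    Q-cong w []       K q = cong (λ b → ifℚ b 1ℚ) (satisfied-cong K q)
    Q-cong w (e ∷ es) K q = cong₂ (λ a b → a + w e * b) (Q-cong w es K q) (Q-cong w es K (cover-cong e q))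

    Q-↭ : ∀ w {es es′} K → es ↭ es′ → ∀ f → Q w es K f ≡ Q w es′ K f
    Q-↭ w K refl f = refl
    Q-↭ w K (prep e s) f = cong₂ (λ a b → a + w e * b) (Q-↭ w K s f) (Q-↭ w K s (cover e f))
    Q-↭ w K (trans s s′) f = ≡.trans (Q-↭ w K s f) (Q-↭ w K s′ f)
    Q-↭ w K (swap {es} {es′} d e s) f = begin
      (Q w es K f + w e * Q w es K (cover e f)) + w d * (Q w es K (cover d f) + w e * Q w es K (cover e (cover d f)))
        ≡⟨ cong ((Q w es K f + w e * Q w es K (cover e f)) +_) (*-distribˡ-+ (w d) _ _) ⟩
      (Q w es K f + w e * Q w es K (cover e f)) + (w d * Q w es K (cover d f) + w d * (w e * Q w es K (cover e (cover d f))))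
        ≡⟨ +-interchange (Q w es K f) _ (w d * Q w es K (cover d f)) _ ⟩
      (Q w es K f + w d * Q w es K (cover d f)) + (w e * Q w es K (cover e f) + w d * (w e * Q w es K (cover e (cover d f))))
        ≡⟨ cong (λ q → (Q w es K f + w d * Q w es K (cover d f)) + (w e * Q w es K (cover e f) + q)) (≡.trans (*-leftComm (w d) (w e) _)
             (cong (λ q → w e * (w d * q)) (Q-cong w es K (cover-comm e d f)))) ⟩
      (Q w es K f + w d * Q w es K (cover d f)) + (w e * Q w es K (cover e f) + w e * (w d * Q w es K (cover d (cover e f))))
        ≡⟨ cong ((Q w es K f + w d * Q w es K (cover d f)) +_) (*-distribˡ-+ (w e) _ _) ⟨
      (Q w es K f + w d * Q w es K (cover d f)) + w e * (Q w es K (cover e f) + w d * Q w es K (cover d (cover e f)))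
        ≡⟨ cong₂ (λ a b → a + w e * b) (cong₂ (λ a b → a + w d * b) (Q-↭ w K s f) (Q-↭ w K s _))
             (cong₂ (λ a b → a + w d * b) (Q-↭ w K s _) (Q-↭ w K s _)) ⟩
      _ ∎

    Avoids : V → E → Set
    Avoids x e = src e ≢ x × tgt e ≢ x

    Q-check : ∀ w {x} es K f → All (Avoids x) es → Q w es (x ∷ K) f ≡ ifℚ (exactly (t x) (f x)) (Q w es K f)
    Q-check w {x} [] K f [] with exactly (t x) (f x)
    ... | true  = refl
    ... | false = refl
    Q-check w {x} (e ∷ es) K f ((n , m) ∷ a)
      rewrite Q-check w es K f a | Q-check w es K (cover e f) a | cover-miss {e} f n m
      with exactly (t x) (f x)
    ... | true  = refl
    ... | false = ≡.trans (cong (0ℚ +_) (*-zeroʳ (w e))) (+-identityˡ 0ℚ)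

    unsatisfied : ∀ {x} K f {k} → x ∈ K → t x ≡ false → f x ≡ suc k → satisfied K f ≡ false
    unsatisfied (x ∷ K) f (here refl) q r rewrite q | r = refl
    unsatisfied (y ∷ K) f (there i) q r rewrite unsatisfied K f i q r with exactly (t y) (f y)
    ... | true  = refl
    ... | false = refl

    bump-suc : ∀ a f x {k} → f x ≡ suc k → bump a f x ≡ suc (if does (a ≟ x) then suc k else k)
    bump-suc a f x q with does (a ≟ x)
    ... | true  = cong suc q
    ... | false = q

    Q-overfull : ∀ w {x} es K f {k} → x ∈ K → t x ≡ false → f x ≡ suc k → Q w es K f ≡ 0ℚ
    Q-overfull w [] K f i q r = cong (λ b → ifℚ b 1ℚ) (unsatisfied K f i q r)
    Q-overfull w {x} (e ∷ es) K f i q r = ≡.trans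
      (cong₂ (λ a b → a + w e * b) (Q-overfull w es K f i q r)
        (Q-overfull w es K (cover e f) i q (bump-suc (src e) (bump (tgt e) f) x (bump-suc (tgt e) f x r))))
      (≡.trans (cong (0ℚ +_) (*-zeroʳ (w e))) (+-identityˡ 0ℚ))

    Useless : List V → E → Set
    Useless K e = (src e ∈ K × t (src e) ≡ false) ⊎ (tgt e ∈ K × t (tgt e) ≡ false)

    Q-useless : ∀ w es K f e → Useless K e → Q w es K (cover e f) ≡ 0ℚ
    Q-useless w es K f e (inj₁ (i , q)) = Q-overfull w es K (cover e f) i q (bump-hit (src e) (bump (tgt e) f))
    Q-useless w es K f e (inj₂ (i , q)) = Q-overfull w es K (cover e f) i q
      (bump-suc (src e) (bump (tgt e) f) (tgt e) (bump-hit (tgt e) f))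

    Q-filter : ∀ w {P : E → Set} (P? : Decidable P) es K f → All (λ e → P e ⊎ Useless K e) es →
      Q w (filter P? es) K f ≡ Q w es K f
    Q-filter w P? [] K f [] = refl
    Q-filter w P? (e ∷ es) K f (a ∷ as) with P? e
    ... | yes _ = cong₂ (λ a b → a + w e * b) (Q-filter w P? es K f as) (Q-filter w P? es K (cover e f) as)
    ... | no np with a
    ...   | inj₁ p = contradiction p np
    ...   | inj₂ u = begin
      _                                   ≡⟨ Q-filter w P? es K f as ⟩
      Q w es K f                          ≡⟨ +-identityʳ _ ⟨
      Q w es K f + 0ℚ                     ≡⟨ cong (Q w es K f +_) (≡.trans (cong (w e *_) (Q-useless w es K f e u)) (*-zeroʳ (w e))) ⟨
      _ ∎

    Q-weights : ∀ {w w′} es K f → All (λ e → w e ≡ w′ e) es → Q w es K f ≡ Q w′ es K f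
    Q-weights []       K f []       = refl
    Q-weights (e ∷ es) K f (q ∷ qs) =
      cong₂ _+_ (Q-weights es K f qs) (cong₂ _*_ q (Q-weights es K (cover e f) qs))

    Q-star : ∀ w {x} e₁ e₂ e₃ es K f → (src e₁ ≡ x × tgt e₁ ≢ x) → (src e₂ ≡ x × tgt e₂ ≢ x) → (src e₃ ≡ x × tgt e₃ ≢ x) →
      All (Avoids x) es → f x ≡ 0 →
      Q w (e₁ ∷ e₂ ∷ e₃ ∷ es) (x ∷ K) f ≡
      (if t x then w e₁ * Q w es K (cover e₁ f) + (w e₂ * Q w es K (cover e₂ f) + w e₃ * Q w es K (cover e₃ f)) else Q w es K f)
    Q-star w {x} e₁ e₂ e₃ es K f (s₁ , n₁) (s₂ , n₂) (s₃ , n₃) a z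
      rewrite Q-check w es K f a | Q-check w es K (cover e₁ f) a | Q-check w es K (cover e₂ f) a | Q-check w es K (cover e₃ f) a
            | Q-check w es K (cover e₂ (cover e₁ f)) a | Q-check w es K (cover e₃ (cover e₁ f)) a
            | Q-check w es K (cover e₃ (cover e₂ f)) a | Q-check w es K (cover e₃ (cover e₂ (cover e₁ f))) a
            | cover-src {e₃} (cover e₂ (cover e₁ f)) s₃ n₃ | cover-src {e₃} (cover e₂ f) s₃ n₃ | cover-src {e₃} (cover e₁ f) s₃ n₃
            | cover-src {e₂} (cover e₁ f) s₂ n₂ | cover-src {e₁} f s₁ n₁ | cover-src {e₂} f s₂ n₂ | cover-src {e₃} f s₃ n₃ | z
      with t x
    ... | true  = begin
      ((0ℚ + w e₃ * c) + w e₂ * (b + w e₃ * 0ℚ)) + w e₁ * ((a′ + w e₃ * 0ℚ) + w e₂ * (0ℚ + w e₃ * 0ℚ))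
        ≡⟨ cong₂ _+_ (cong₂ _+_ (+-identityˡ (w e₃ * c)) (cong (w e₂ *_) (drop b e₃)))
             (cong (w e₁ *_) (≡.trans (cong₂ _+_ (drop a′ e₃) (≡.trans (cong (w e₂ *_) (drop 0ℚ e₃)) (*-zeroʳ (w e₂)))) (+-identityʳ a′))) ⟩
      (w e₃ * c + w e₂ * b) + w e₁ * a′ ≡⟨ +-comm _ (w e₁ * a′) ⟩
      w e₁ * a′ + (w e₃ * c + w e₂ * b) ≡⟨ cong (w e₁ * a′ +_) (+-comm (w e₃ * c) _) ⟩
      _ ∎
      where
      a′ = Q w es K (cover e₁ f)
      b = Q w es K (cover e₂ f)
      c = Q w es K (cover e₃ f)
      drop : ∀ q e → q + w e * 0ℚ ≡ q
      drop q e = ≡.trans (cong (q +_) (*-zeroʳ (w e))) (+-identityʳ q)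
    ... | false = begin
      ((d + w e₃ * 0ℚ) + w e₂ * (0ℚ + w e₃ * 0ℚ)) + w e₁ * ((0ℚ + w e₃ * 0ℚ) + w e₂ * (0ℚ + w e₃ * 0ℚ))
        ≡⟨ cong₂ _+_ (cong₂ _+_ (drop d e₃) (none e₂))
             (≡.trans (cong (w e₁ *_) (≡.trans (cong₂ _+_ (drop 0ℚ e₃) (none e₂)) (+-identityʳ 0ℚ))) (*-zeroʳ (w e₁))) ⟩
      (d + 0ℚ) + 0ℚ ≡⟨ ≡.trans (+-identityʳ _) (+-identityʳ _) ⟩
      d ∎
      where
      d = Q w es K f
      drop : ∀ q e → q + w e * 0ℚ ≡ q
      drop q e = ≡.trans (cong (q +_) (*-zeroʳ (w e))) (+-identityʳ q)
      none : ∀ e → w e * (0ℚ + w e₃ * 0ℚ) ≡ 0ℚ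
      none e = ≡.trans (cong (w e *_) (drop 0ℚ e₃)) (*-zeroʳ (w e))

  module Transport {V V′ E E′ : Set} (_≟_ : DecidableEquality V) (_≟′_ : DecidableEquality V′)
    (src tgt : E → V) (src′ tgt′ : E′ → V′) (t : V′ → Bool) (φ : V → V′) (ψ : E → E′)
    (φ-injective : ∀ {x y} → φ x ≡ φ y → x ≡ y) where

    private
      module C  = Cover _≟_ src tgt (t ∘ φ)
      module C′ = Cover _≟′_ src′ tgt′ t

    bump-∘ : ∀ a f x → C′.bump (φ a) f (φ x) ≡ C.bump a (f ∘ φ) x
    bump-∘ a f x with a ≟ x | φ a ≟′ φ x
    ... | yes _    | yes _ = refl
    ... | no _     | no _  = refl
    ... | yes refl | no n  = contradiction refl n
    ... | no n     | yes q = contradiction (φ-injective q) n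

    satisfied-map : ∀ K f → C′.satisfied (map φ K) f ≡ C.satisfied K (f ∘ φ)
    satisfied-map []      f = refl
    satisfied-map (x ∷ K) f = cong (exactly (t (φ x)) (f (φ x)) ∧_) (satisfied-map K f)

    Q-map : ∀ w es K f → All (λ e → src′ (ψ e) ≡ φ (src e) × tgt′ (ψ e) ≡ φ (tgt e)) es →
      C′.Q w (map ψ es) (map φ K) f ≡ C.Q (w ∘ ψ) es K (f ∘ φ)
    Q-map w []       K f [] = cong (λ b → ifℚ b 1ℚ) (satisfied-map K f)
    Q-map w (e ∷ es) K f ((r , q) ∷ qs) = cong₂ (λ a b → a + w (ψ e) * b) (Q-map w es K f qs)
      (≡.trans (Q-map w es K (C′.cover (ψ e) f) qs) (C.Q-cong (w ∘ ψ) es K cover-∘))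
      where
      cover-∘ : ∀ x → C′.cover (ψ e) f (φ x) ≡ C.cover e (f ∘ φ) x
      cover-∘ x rewrite r | q = ≡.trans (bump-∘ (src e) (C′.bump (φ (tgt e)) f) x)
        (C.bump-cong (src e) (bump-∘ (tgt e) f) x)

module Grids where

  open Transfer
  open Rows
  open Coverings
  open import Defs using (Side; base; westSide; eastSide)
  open import Data.Bool using (Bool; true; false; if_then_else_)
  open import Data.List using (List; []; _∷_)
  open import Data.List.Relation.Unary.All as All using (All; []; _∷_)
  open import Data.Nat as ℕ using (ℕ; zero; suc; _≤_; _<_)
  open import Data.Nat.Properties as ℕP using (≤-refl; ≤-trans; n<1+n; m<n⇒m<1+n; <-irrefl; n≤1+n; <⇒≤; +-suc)
  open import Data.Product using (_×_; _,_; proj₁; proj₂)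
  open import Data.Rational using (ℚ; 0ℚ; 1ℚ; _+_; _*_)
  open import Data.Rational.Properties as ℚP using (*-identityˡ; *-zeroˡ; +-identityʳ; +-identityˡ; +-assoc)
  open import Data.Unit using (⊤; tt)
  open import Data.Vec using (Vec; []; _∷_)
  open import Function using (_∘_)
  open import Relation.Binary.Definitions using (DecidableEquality)
  open import Relation.Binary.PropositionalEquality
  open import Relation.Nullary using (yes; no; _×-dec_)
  open import Relation.Nullary.Decidable using (map′)

  open ≡-Reasoning

  -- The cells of a strip: the one bisected by the axis of symmetry and, on
  -- either side of it, those at distances 0, 1, 2, …  Strips are numbered
  -- from top to bottom.
  data Flank : Set where
    right left : Flank

  data Cellᴳ : Set where
    axis : ℕ → Cellᴳ
    cell : Flank → ℕ → ℕ → Cellᴳ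

  _≟ᶠ_ : DecidableEquality Flank
  right ≟ᶠ right = yes refl
  right ≟ᶠ left  = no λ ()
  left  ≟ᶠ right = no λ ()
  left  ≟ᶠ left  = yes refl

  _≟ᴳ_ : DecidableEquality Cellᴳ
  axis i ≟ᴳ axis j = map′ (cong axis) (λ { refl → refl }) (i ℕ.≟ j)
  axis _ ≟ᴳ cell _ _ _ = no λ ()
  cell _ _ _ ≟ᴳ axis _ = no λ ()
  cell s i u ≟ᴳ cell r j v = map′ (λ { (refl , refl , refl) → refl }) (λ { refl → refl , refl , refl })
    (s ≟ᶠ r ×-dec i ℕ.≟ j ×-dec u ℕ.≟ v)

  strip : Cellᴳ → ℕ
  strip (axis j)     = j
  strip (cell _ j _) = j

  -- Edges are given by an up-pointing cell and one of its sides.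
  Edge : Set
  Edge = Cellᴳ × Side

  inwards : Flank → ℕ → ℕ → Cellᴳ
  inwards s j zero    = axis j
  inwards s j (suc u) = cell s j u

  source target : Edge → Cellᴳ
  source = proj₁
  target (axis j , base)             = axis (suc j)
  target (axis j , westSide)         = cell left j 0
  target (axis j , eastSide)         = cell right j 0
  target (cell s j u , base)         = cell s (suc j) u
  target (cell right j u , westSide) = inwards right j u
  target (cell right j u , eastSide) = cell right j (suc u)
  target (cell left j u , westSide)  = cell left j (suc u)
  target (cell left j u , eastSide)  = inwards left j u

  inner outer : Flank → Side
  inner right = westSide
  inner left  = eastSide
  outer right = eastSide
  outer left  = westSide

  target-inner : ∀ s j u → target (cell s j u , inner s) ≡ inwards s j u
  target-inner right j u = refl
  target-inner left  j u = refl

  target-outer : ∀ s j u → target (cell s j u , outer s) ≡ cell s j (suc u)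
  target-outer right j u = refl
  target-outer left  j u = refl

  flankEdges : Kind → Flank → ℕ → ℕ → ℕ → List Edge → List Edge
  flankEdges K  s j u zero    es = es
  flankEdges dn s j u (suc r) es = flankEdges up s j (suc u) r es
  flankEdges up s j u (suc r) es =
    (cell s j u , base) ∷ (cell s j u , outer s) ∷ (cell s j u , inner s) ∷ flankEdges dn s j (suc u) r es

  -- A down-pointing cell comes after the up-pointing cell next to it, all
  -- of whose edges precede the check of either.
  flankCells : Kind → Flank → ℕ → ℕ → ℕ → List Cellᴳ → List Cellᴳ
  flankCells K  s j u zero    K′ = cell s j u ∷ K′
  flankCells dn s j u (suc r) K′ = flankCells up s j (suc u) r (cell s j u ∷ K′)
  flankCells up s j u (suc r) K′ = cell s j u ∷ flankCells dn s j (suc u) r K′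

  data Outside (s : Flank) (j u : ℕ) : Cellᴳ → Set where
    onAxis      : ∀ {i} → Outside s j u (axis i)
    otherFlank  : ∀ {r i v} → s ≢ r → Outside s j u (cell r i v)
    otherStrip  : ∀ {i v} → i ≢ j → i ≢ suc j → Outside s j u (cell s i v)
    nearer      : ∀ {i v} → v < u → Outside s j u (cell s i v)

  outside-suc : ∀ {s j u y} → Outside s j u y → Outside s j (suc u) y
  outside-suc onAxis           = onAxis
  outside-suc (otherFlank n)   = otherFlank n
  outside-suc (otherStrip n m) = otherStrip n m
  outside-suc (nearer l)       = nearer (m<n⇒m<1+n l)

  outside≢ : ∀ {s j u y v} → Outside s j u y → u ≤ v → cell s j v ≢ y
  outside≢ (otherFlank n)   l refl = n refl
  outside≢ (otherStrip n m) l refl = n refl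
  outside≢ (nearer k)       l refl = <-irrefl refl (≤-trans k l)

  outside≢′ : ∀ {s j u y v} → Outside s j u y → u ≤ v → cell s (suc j) v ≢ y
  outside≢′ (otherFlank n)   l refl = n refl
  outside≢′ (otherStrip n m) l refl = m refl
  outside≢′ (nearer k)       l refl = <-irrefl refl (≤-trans k l)

  flankEdges-All : ∀ {P : Edge → Set} K s j u r {es} → (∀ v side → u ≤ v → P (cell s j v , side)) → All P es →
    All P (flankEdges K s j u r es)
  flankEdges-All K  s j u zero    p a = a
  flankEdges-All dn s j u (suc r) p a = flankEdges-All up s j (suc u) r (λ v side l → p v side (<⇒≤ l)) a
  flankEdges-All up s j u (suc r) p a =
    p u _ ≤-refl ∷ p u _ ≤-refl ∷ p u _ ≤-refl ∷ flankEdges-All dn s j (suc u) r (λ v side l → p v side (<⇒≤ l)) a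

  module Grid (n : ℕ) (p : Cellᴳ → Bool) (ω : ℚ) where

    open Cover _≟ᴳ_ source target p public

    weightᴳ : Edge → ℚ
    weightᴳ (axis _ , base)     = ω
    weightᴳ (axis _ , westSide) = 1ℚ
    weightᴳ (axis _ , eastSide) = 1ℚ
    weightᴳ (cell _ _ _ , _)    = 1ℚ

    presence : Flank → ℕ → ℕ → ∀ r → Vec Bool r
    presence s j u zero    = []
    presence s j u (suc r) = p (cell s j u) ∷ presence s j (suc u) r

    bit : Bool → ℕ
    bit false = 0
    bit true  = 1

    Coverage : Set
    Coverage = Cellᴳ → ℕ

    -- The coverage of the cells of a strip from distance u on is that by
    -- the vertical lozenges of the word, plus c for the first cell.
    Matches : ∀ K (c : ℕ) s j u r → Word K r → Coverage → Set
    Matches K  c s j u zero    ts       f = f (cell s j u) ≡ c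
    Matches dn c s j u (suc r) (t ∷ ts) f = f (cell s j u) ≡ c ℕ.+ bit t × Matches up 0 s j (suc u) r ts f
    Matches up c s j u (suc r) ts       f = f (cell s j u) ≡ c × Matches dn 0 s j (suc u) r ts f

    Matches-cong : ∀ K {c} s j u r (ts : Word K r) {f g} → (∀ v → u ≤ v → g (cell s j v) ≡ f (cell s j v)) →
      Matches K c s j u r ts f → Matches K c s j u r ts g
    Matches-cong K  s j u zero    ts       e m = trans (e u ≤-refl) m
    Matches-cong dn s j u (suc r) (t ∷ ts) e (m , ms) = trans (e u ≤-refl) m , Matches-cong up s j (suc u) r ts (λ v l → e v (<⇒≤ l)) ms
    Matches-cong up s j u (suc r) ts       e (m , ms) = trans (e u ≤-refl) m , Matches-cong dn s j (suc u) r ts (λ v l → e v (<⇒≤ l)) ms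

    Untouched : Flank → ℕ → List Edge → Set
    Untouched s j es = ∀ v → All (Avoids (cell s j v)) es

    Fresh : Flank → ℕ → ℕ → Coverage → Set
    Fresh s j u f = ∀ v → u ≤ v → f (cell s j v) ≡ 0

    -- ρ = false if the first cell is joined to its inner neighbour.
    innerCover : Bool → Flank → ℕ → ℕ → Coverage → Coverage
    innerCover true  s j u f = f
    innerCover false s j u f = bump (inwards s j u) f

    inwards≢ : ∀ s j u v → u ≤ v → inwards s j u ≢ cell s j v
    inwards≢ s j (suc u) v l refl = <-irrefl refl l

    below≢ : ∀ s j u v → inwards s j u ≢ cell s (suc j) v
    below≢ s j zero    v ()
    below≢ s j (suc u) v ()

    avoids-later : ∀ s j u r {es} → Untouched s j es → All (Avoids (cell s j u)) (flankEdges dn s j (suc u) r es)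
    avoids-later s j u zero    a = a u
    avoids-later s j u (suc r) a = flankEdges-All up s j (suc (suc u)) r later (a u)
      where
      later : ∀ v side → suc (suc u) ≤ v → Avoids (cell s j u) (cell s j v , side)
      later (suc v) side l = (λ { refl → <-irrefl refl (<⇒≤ l) }) , other s side
        where
        other : ∀ s side → target (cell s j (suc v) , side) ≢ cell s j u
        other s     base     ()
        other right westSide refl = <-irrefl refl (ℕP.≤-pred l)
        other right eastSide refl = <-irrefl refl (<⇒≤ (<⇒≤ l))
        other left  eastSide refl = <-irrefl refl (ℕP.≤-pred l)
        other left  westSide refl = <-irrefl refl (<⇒≤ (<⇒≤ l))

    module _ (edge-absent : ∀ s j → p (cell s j n) ≡ false) where

      scan-up : ∀ r s j u → u ℕ.+ r ≡ n → ∀ (ts : Word up r) f es K (g : Bool → Word dn r → ℚ) → Untouched s j es →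
        Matches up 0 s j u r ts f → Fresh s (suc j) u f →
        (∀ ρ bs f′ → Matches dn 0 s (suc j) u r bs f′ → (∀ y → Outside s j u y → f′ y ≡ innerCover ρ s j u f y) →
          Q weightᴳ es K f′ ≡ g ρ bs) →
        Q weightᴳ (flankEdges up s j u r es) (flankCells up s j u r K) f ≡
        scan up (presence s j u r) true ts (g true) + scan up (presence s j u r) false ts (g false)

      scan-dn : ∀ r s j u → u ℕ.+ r ≡ n → ∀ c (ts : Word dn r) f es K (g : Word up r → ℚ) → Untouched s j es →
        Matches dn (bit c) s j u r ts f → Fresh s (suc j) u f →
        (∀ bs f′ → Matches up 0 s (suc j) u r bs f′ → (∀ y → Outside s j u y → f′ y ≡ f y) → Q weightᴳ es K f′ ≡ g bs) →
        Q weightᴳ (flankEdges dn s j u r es) (flankCells dn s j u r K) f ≡ scan dn (presence s j u r) c ts g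

      scan-dn zero s j u q c [] f es K g a m fr h
        rewrite Q-check weightᴳ es K f (a u) | m | trans (cong (λ v → p (cell s j v)) (trans (sym (ℕP.+-identityʳ u)) q)) (edge-absent s j)
        with c
      ... | true  = refl
      ... | false = h [] f (fr u ≤-refl) (λ _ _ → refl)
      scan-dn (suc r) s j u q c (t ∷ ts) f es K g a (m , ms) fr h = begin
        _ ≡⟨ scan-up r s j (suc u) (trans (sym (+-suc u r)) q) ts f es (y ∷ K) g′ a ms (λ v l → fr v (<⇒≤ l)) h′ ⟩
        scan up ps true ts (g′ true) + scan up ps false ts (g′ false)
          ≡⟨ cong₂ _+_ (pull (exactly (p y) (k true)) true) (pull (exactly (p y) (k false)) false) ⟩
        ifℚ (exactly (p y) (k true)) (X true) + ifℚ (exactly (p y) (k false)) (X false) ≡⟨ collect (p y) c t ⟩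
        ⟦ merge (p y) c t ⟧ X ∎
        where
        y = cell s j u
        ps = presence s j (suc u) r
        X : Bool → ℚ
        X ρ = scan up ps ρ ts g
        k : Bool → ℕ
        k true  = bit c ℕ.+ bit t
        k false = suc (bit c ℕ.+ bit t)
        g′ : Bool → _ → ℚ
        g′ ρ bs = ifℚ (exactly (p y) (k ρ)) (g bs)
        pull : ∀ b ρ → scan up ps ρ ts (λ bs → ifℚ b (g bs)) ≡ ifℚ b (X ρ)
        pull true  ρ = refl
        pull false ρ = trans (scan-cong up ps ρ ts (λ bs → sym (*-zeroˡ 0ℚ)))
          (trans (scan-* up ps ρ ts 0ℚ (λ _ → 0ℚ)) (*-zeroˡ (scan up ps ρ ts (λ _ → 0ℚ))))
        collect : ∀ b c t → let k₀ = bit c ℕ.+ bit t in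
          ifℚ (exactly b k₀) (X true) + ifℚ (exactly b (suc k₀)) (X false) ≡ ⟦ merge b c t ⟧ X
        collect true  true  true  = +-identityˡ 0ℚ
        collect true  true  false = trans (+-identityʳ (X true)) (sym (⟦⟧-one true X))
        collect true  false true  = trans (+-identityʳ (X true)) (sym (⟦⟧-one true X))
        collect true  false false = trans (+-identityˡ (X false)) (sym (⟦⟧-one false X))
        collect false true  true  = +-identityˡ 0ℚ
        collect false true  false = +-identityˡ 0ℚ
        collect false false true  = +-identityˡ 0ℚ
        collect false false false = trans (+-identityʳ (X true)) (sym (⟦⟧-one true X))
        inner-y : ∀ ρ → innerCover ρ s j (suc u) f y ≡ k ρ
        inner-y true  = m
        inner-y false = trans (bump-hit y f) (cong suc m)
        inner-other : ∀ ρ z → y ≢ z → innerCover ρ s j (suc u) f z ≡ f z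
        inner-other true  z d = refl
        inner-other false z d = bump-miss f d
        h′ : ∀ ρ bs f′ → Matches dn 0 s (suc j) (suc u) r bs f′ →
          (∀ z → Outside s j (suc u) z → f′ z ≡ innerCover ρ s j (suc u) f z) → Q weightᴳ es (y ∷ K) f′ ≡ g′ ρ bs
        h′ ρ bs f′ m′ o = begin
          _ ≡⟨ Q-check weightᴳ es K f′ (a u) ⟩
          ifℚ (exactly (p y) (f′ y)) (Q weightᴳ es K f′)
            ≡⟨ cong₂ (λ i q → ifℚ (exactly (p y) i) q) (trans (o y (nearer (n<1+n u))) (inner-y ρ))
                 (h bs f′ (trans (o _ (nearer (n<1+n u))) (trans (inner-other ρ _ λ ()) (fr u ≤-refl)) , m′)
                    λ z oz → trans (o z (outside-suc oz)) (inner-other ρ z (outside≢ oz ≤-refl))) ⟩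
          g′ ρ bs ∎

      scan-up zero s j u q [] f es K g a m fr h
        rewrite Q-check weightᴳ es K f (a u) | m | trans (cong (λ v → p (cell s j v)) (trans (sym (ℕP.+-identityʳ u)) q)) (edge-absent s j)
        = trans (h true [] f (fr u ≤-refl) (λ _ _ → refl)) (sym (+-identityʳ (g true [])))
      scan-up (suc r) s j u q ts f es K g a (m , ms) fr h = begin
        _ ≡⟨ Q-star weightᴳ (x , base) (x , outer s) (x , inner s) rest K₁ f (refl , λ ()) (refl , outer≢ s) (refl , inner≢ s)
               (avoids-later s j u r a) m ⟩
        _ ≡⟨ cases (p x) refl ⟩
        _ ∎
        where
        x = cell s j u
        rest = flankEdges dn s j (suc u) r es
        K₁ = flankCells dn s j (suc u) r K
        ps = presence s j (suc u) r
        outer≢ : ∀ s → target (cell s j u , outer s) ≢ cell s j u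
        outer≢ right ()
        outer≢ left  ()
        inner≢ : ∀ s → target (cell s j u , inner s) ≢ cell s j u
        inner≢ right e = inwards≢ right j u u ≤-refl e
        inner≢ left  e = inwards≢ left j u u ≤-refl e
        q′ = trans (sym (+-suc u r)) q
        beyond : ∀ {v} → suc u ≤ v → x ≢ cell s j v
        beyond l refl = <-irrefl refl l
        f₁ = cover (x , base) f
        viaBase : Q weightᴳ rest K₁ f₁ ≡ scan dn ps false ts (g true ∘ (true ∷_))
        viaBase = scan-dn r s j (suc u) q′ false ts f₁ es K (g true ∘ (true ∷_)) a
          (Matches-cong dn s j (suc u) r ts (λ v l → cover-miss {x , base} f (beyond l) (λ ())) ms)
          (λ v l → trans (cover-miss {x , base} f (λ ()) (λ { refl → <-irrefl refl l })) (fr v (<⇒≤ l)))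
          (λ bs f′ m′ o → h true (true ∷ bs) f′
            (trans (o _ (nearer (n<1+n u))) (trans (cover-tgt {x , base} f (λ ()) refl) (cong suc (fr u ≤-refl))) , m′)
            λ z oz → trans (o z (outside-suc oz)) (cover-miss {x , base} f (outside≢ oz ≤-refl) (outside≢′ oz ≤-refl)))
        f₂ = cover (x , outer s) f
        f₂≡ : ∀ z → x ≢ z → cell s j (suc u) ≢ z → f₂ z ≡ f z
        f₂≡ z d d′ = cover-miss {x , outer s} f d (λ e → d′ (trans (sym (target-outer s j u)) e))
        bumped : ∀ r (ts : Word dn r) → Matches dn 0 s j (suc u) r ts f → Matches dn 1 s j (suc u) r ts f₂
        bumped zero    ts       m = trans (cover-tgt {x , outer s} f (beyond ≤-refl) (target-outer s j u)) (cong suc m)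
        bumped (suc r) (t ∷ ts) (m , ms) = trans (cover-tgt {x , outer s} f (beyond ≤-refl) (target-outer s j u)) (cong suc m) ,
          Matches-cong up s j (suc (suc u)) r ts (λ v l → f₂≡ _ (beyond (<⇒≤ l)) (λ { refl → <-irrefl refl l })) ms
        viaOuter : Q weightᴳ rest K₁ f₂ ≡ scan dn ps true ts (g true ∘ (false ∷_))
        viaOuter = scan-dn r s j (suc u) q′ true ts f₂ es K (g true ∘ (false ∷_)) a (bumped r ts ms)
          (λ v l → trans (f₂≡ _ (λ ()) (λ ())) (fr v (<⇒≤ l)))
          (λ bs f′ m′ o → h true (false ∷ bs) f′
            (trans (o _ (nearer (n<1+n u))) (trans (f₂≡ _ (λ ()) (λ ())) (fr u ≤-refl)) , m′)
            λ z oz → trans (o z (outside-suc oz)) (f₂≡ z (outside≢ oz ≤-refl) (outside≢ oz (n≤1+n u))))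
        f₃ = cover (x , inner s) f
        f₃≡ : ∀ z → x ≢ z → f₃ z ≡ bump (inwards s j u) f z
        f₃≡ z d = trans (bump-miss (bump (target (x , inner s)) f) d) (cong (λ y → bump y f z) (target-inner s j u))
        viaInner : Q weightᴳ rest K₁ f₃ ≡ scan dn ps false ts (g false ∘ (false ∷_))
        viaInner = scan-dn r s j (suc u) q′ false ts f₃ es K (g false ∘ (false ∷_)) a
          (Matches-cong dn s j (suc u) r ts (λ v l → trans (f₃≡ _ (beyond l)) (bump-miss f (inwards≢ s j u v (<⇒≤ l)))) ms)
          (λ v l → trans (f₃≡ _ (λ ())) (trans (bump-miss f (below≢ s j u v)) (fr v (<⇒≤ l))))
          (λ bs f′ m′ o → h false (false ∷ bs) f′
            (trans (o _ (nearer (n<1+n u))) (trans (f₃≡ _ (λ ())) (trans (bump-miss f (below≢ s j u u)) (fr u ≤-refl))) , m′)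
            λ z oz → trans (o z (outside-suc oz)) (f₃≡ z (outside≢ oz ≤-refl)))
        skipped : Q weightᴳ rest K₁ f ≡ scan dn ps false ts (g true ∘ (false ∷_))
        skipped = scan-dn r s j (suc u) q′ false ts f es K (g true ∘ (false ∷_)) a ms (λ v l → fr v (<⇒≤ l))
          (λ bs f′ m′ o → h true (false ∷ bs) f′
            (trans (o _ (nearer (n<1+n u))) (fr u ≤-refl) , m′) λ z oz → o z (outside-suc oz))
        Y : Bool → Bits → ℚ
        Y ρ b = scan dn ps (proj₂ b) ts (g ρ ∘ (proj₁ b ∷_))
        cases : ∀ b → p x ≡ b →
          (if b then 1ℚ * Q weightᴳ rest K₁ f₁ + (1ℚ * Q weightᴳ rest K₁ f₂ + 1ℚ * Q weightᴳ rest K₁ f₃) else Q weightᴳ rest K₁ f) ≡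
          ⟦ split b true ⟧ (Y true) + ⟦ split b false ⟧ (Y false)
        cases true _ = begin
          _ ≡⟨ cong₂ _+_ (cong (1ℚ *_) viaBase) (cong₂ _+_ (cong (1ℚ *_) viaOuter) (cong (1ℚ *_) viaInner)) ⟩
          1ℚ * A + (1ℚ * B + 1ℚ * C) ≡⟨ +-assoc (1ℚ * A) (1ℚ * B) (1ℚ * C) ⟨
          (1ℚ * A + 1ℚ * B) + 1ℚ * C ≡⟨ cong₂ _+_ (cong (1ℚ * A +_) (sym (+-identityʳ (1ℚ * B)))) (sym (+-identityʳ (1ℚ * C))) ⟩
          _ ∎
          where
          A = Y true (true , false)
          B = Y true (false , true)
          C = Y false (false , false)
        cases false _ = trans skipped (trans (sym (⟦⟧-one (false , false) (Y true))) (sym (+-identityʳ (⟦ split false true ⟧ (Y true)))))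

    stripEdges : Kind → ℕ → List Edge → List Edge
    stripEdges dn j es = (axis j , eastSide) ∷ (axis j , westSide) ∷ (axis j , base) ∷ flankEdges dn right j 0 n (flankEdges dn left j 0 n es)
    stripEdges up j es = flankEdges up right j 0 n (flankEdges up left j 0 n es)

    stripCells : Kind → ℕ → List Cellᴳ → List Cellᴳ
    stripCells dn j K = axis j ∷ flankCells dn right j 0 n (flankCells dn left j 0 n K)
    stripCells up j K = flankCells up right j 0 n (flankCells up left j 0 n (axis j ∷ K))

    line : Flank → ℕ → ℕ → ℕ → List Cellᴳ → List Cellᴳ
    line s j u zero    K = cell s j u ∷ K
    line s j u (suc r) K = cell s j u ∷ line s j (suc u) r K

    allEdges : Kind → ℕ → ℕ → List Edge
    allEdges K j zero    = []
    allEdges K j (suc m) = stripEdges K j (allEdges (opposite K) (suc j) m)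

    allCells : Kind → ℕ → ℕ → List Cellᴳ
    allCells K j zero    = axis j ∷ line right j 0 n (line left j 0 n [])
    allCells K j (suc m) = stripCells K j (allCells (opposite K) (suc j) m)

    rows² : ℕ → ℕ → List (Row² {n})
    rows² j zero    = []
    rows² j (suc m) = (p (axis j) , presence right j 0 n , presence left j 0 n) ∷ rows² (suc j) m

    Low : ℕ → Edge → Set
    Low j e = j ≤ strip (source e) × j ≤ strip (target e)

    low-cell : ∀ s j v side → Low j (cell s j v , side)
    low-cell s j v base               = ≤-refl , n≤1+n j
    low-cell right j zero    westSide = ≤-refl , ≤-refl
    low-cell right j (suc v) westSide = ≤-refl , ≤-refl
    low-cell right j v       eastSide = ≤-refl , ≤-refl
    low-cell left  j zero    eastSide = ≤-refl , ≤-refl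
    low-cell left  j (suc v) eastSide = ≤-refl , ≤-refl
    low-cell left  j v       westSide = ≤-refl , ≤-refl

    low-strip : ∀ K j {es} → All (Low j) es → All (Low j) (stripEdges K j es)
    low-strip K j {es} a = top K
      where
      flanks : ∀ K → All (Low j) (flankEdges K right j 0 n (flankEdges K left j 0 n es))
      flanks K = flankEdges-All K right j 0 n (λ v side _ → low-cell right j v side)
                   (flankEdges-All K left j 0 n (λ v side _ → low-cell left j v side) a)
      top : ∀ K → All (Low j) (stripEdges K j es)
      top dn = (≤-refl , ≤-refl) ∷ (≤-refl , ≤-refl) ∷ (≤-refl , n≤1+n j) ∷ flanks dn
      top up = flanks up

    low-all : ∀ K j m → All (Low j) (allEdges K j m)
    low-all K j zero    = []
    low-all K j (suc m) = low-strip K j (All.map (λ l → <⇒≤ (proj₁ l) , <⇒≤ (proj₂ l)) (low-all (opposite K) (suc j) m))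

    low-avoids : ∀ {j y es} → strip y < j → All (Low j) es → All (Avoids y) es
    low-avoids l = All.map λ { (a , b) → (λ { refl → <-irrefl refl (≤-trans l a) }) , (λ { refl → <-irrefl refl (≤-trans l b) }) }

    right-untouched : ∀ K j {es} → All (Low (suc j)) es → Untouched right j (flankEdges K left j 0 n es)
    right-untouched K j a v = flankEdges-All K left j 0 n (λ u side _ → (λ ()) , other u side) (low-avoids ≤-refl a)
      where
      other : ∀ u side → target (cell left j u , side) ≢ cell right j v
      other u       base     ()
      other u       westSide ()
      other zero    eastSide ()
      other (suc u) eastSide ()

    axis-avoided : ∀ j {es} → All (Low (suc j)) es →
      All (Avoids (axis j)) (flankEdges dn right j 0 n (flankEdges dn left j 0 n es))
    axis-avoided j a = all right (all left (low-avoids ≤-refl a))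
      where
      other : ∀ s u side → target (cell s j (suc u) , side) ≢ axis j
      other right u base     ()
      other right u westSide ()
      other right u eastSide ()
      other left  u base     ()
      other left  u westSide ()
      other left  u eastSide ()
      from1 : ∀ r s {es} → All (Avoids (axis j)) es → All (Avoids (axis j)) (flankEdges up s j 1 r es)
      from1 r s a = flankEdges-All up s j 1 r (λ { (suc u) side _ → (λ ()) , other s u side }) a
      all′ : ∀ r s {es} → All (Avoids (axis j)) es → All (Avoids (axis j)) (flankEdges dn s j 0 r es)
      all′ zero    s a = a
      all′ (suc r) s a = from1 r s a
      all : ∀ s {es} → All (Avoids (axis j)) es → All (Avoids (axis j)) (flankEdges dn s j 0 n es)
      all = all′ n

    deeper : ∀ {j u} s y → suc j < strip y → Outside s j u y
    deeper s (axis i) l = onAxis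
    deeper s (cell r i v) l with s ≟ᶠ r
    ... | yes refl = otherStrip (λ { refl → <-irrefl refl (<⇒≤ l) }) (λ { refl → <-irrefl refl l })
    ... | no d     = otherFlank d

    guard : Bool → Combination Bool
    guard true  = one true
    guard false = []

    ifℚ-guard : ∀ b x → ifℚ b x ≡ ⟦ guard b ⟧ (λ _ → x)
    ifℚ-guard true  x = sym (⟦⟧-one true (λ _ → x))
    ifℚ-guard false x = refl

    bits : Combination Bool
    bits = (1ℚ , true) ∷ (1ℚ , false) ∷ []

    sum-bits : ∀ f → f true + f false ≡ ⟦ bits ⟧ f
    sum-bits f = cong₂ _+_ (sym (*-identityˡ (f true))) (sym (trans (+-identityʳ (1ℚ * f false)) (*-identityˡ (f false))))

    axisLoad : (τ : Bool) → Bits → ℕ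
    axisLoad τ (ρ , σ) = load σ (load ρ (bit τ))
      where
      load : Bool → ℕ → ℕ
      load true  k = k
      load false k = suc k

    axisDown²-choice : ∀ p τ f → ⟦ bits ⟧ (λ ρ → ⟦ bits ⟧ (λ σ → ⟦ guard (exactly p (axisLoad τ (ρ , σ))) ⟧ (λ _ → f (ρ , σ)))) ≡
      ⟦ axisDown² {n} p τ ⟧ f
    axisDown²-choice p τ f = begin
      _ ≡⟨ ⟦⟧-cong bits (λ ρ → ⟦⟧-cong bits λ σ → ⟦⟧-cong (G ρ σ) λ _ → sym (⟦⟧-one (ρ , σ) f)) ⟩
      _ ≡⟨ ⟦⟧-cong bits (λ ρ → ⟦⟧-cong bits λ σ → sym (⟦⟧->>= (G ρ σ) (λ _ → one (ρ , σ)) f)) ⟩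
      _ ≡⟨ ⟦⟧-cong bits (λ ρ → sym (⟦⟧->>= bits (λ σ → G ρ σ >>= λ _ → one (ρ , σ)) f)) ⟩
      _ ≡⟨ ⟦⟧->>= bits (λ ρ → bits >>= λ σ → G ρ σ >>= λ _ → one (ρ , σ)) f ⟨
      ⟦ choice p τ ⟧ f ≡⟨ same p τ ⟩
      _ ∎
      where
      G : Bool → Bool → Combination Bool
      G ρ σ = guard (exactly p (axisLoad τ (ρ , σ)))
      choice : Bool → Bool → Combination Bits
      choice p τ = bits >>= λ ρ → bits >>= λ σ → guard (exactly p (axisLoad τ (ρ , σ))) >>= λ _ → one (ρ , σ)
      same : ∀ p τ → ⟦ choice p τ ⟧ f ≡ ⟦ axisDown² {n} p τ ⟧ f
      same true  true  = Bits¹.agree-sound (choice true true) (axisDown² {n} true true) refl f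
      same true  false = Bits¹.agree-sound (choice true false) (axisDown² {n} true false) refl f
      same false true  = Bits¹.agree-sound (choice false true) (axisDown² {n} false true) refl f
      same false false = Bits¹.agree-sound (choice false false) (axisDown² {n} false false) refl f

    UpAxisFree : Kind → Bool → Set
    UpAxisFree dn τ = τ ≡ false
    UpAxisFree up τ = ⊤

    module _ (edge-absent : ∀ s j → p (cell s j n) ≡ false) where

      line-vacant : ∀ K s j u r (ts : Word K r) K′ f → (∀ v → p (cell s j v) ≡ false) → Matches K 0 s j u r ts f →
        ifℚ (satisfied (line s j u r K′) f) 1ℚ ≡ vacant {n} ts * ifℚ (satisfied K′ f) 1ℚ
      line-vacant dn s j u zero [] K′ f a m rewrite a u | m = sym (*-identityˡ _)
      line-vacant up s j u zero [] K′ f a m rewrite a u | m = sym (*-identityˡ _)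
      line-vacant dn s j u (suc r) (true ∷ ts) K′ f a (m , ms) rewrite a u | m = sym (*-zeroˡ (ifℚ (satisfied K′ f) 1ℚ))
      line-vacant dn s j u (suc r) (false ∷ ts) K′ f a (m , ms) rewrite a u | m = line-vacant up s j (suc u) r ts K′ f a ms
      line-vacant up s j u (suc r) ts K′ f a (m , ms) rewrite a u | m = line-vacant dn s j (suc u) r ts K′ f a ms

      Q-count² : ∀ m K j τ (ts us : Word K n) f → UpAxisFree K τ →
        p (axis (j ℕ.+ m)) ≡ false → (∀ s v → p (cell s (j ℕ.+ m) v) ≡ false) →
        Matches K 0 right j 0 n ts f → Matches K 0 left j 0 n us f → f (axis j) ≡ bit τ → (∀ y → j < strip y → f y ≡ 0) →
        Q weightᴳ (allEdges K j m) (allCells K j m) f ≡ count² {n} ω K (rows² j m) τ ts us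
      Q-count² zero K j τ ts us f up-free pa pc mr ml ma mz
        rewrite ℕP.+-identityʳ j | pa | ma with τ
      ... | true  = refl
      ... | false = begin
        ifℚ (satisfied (line right j 0 n (line left j 0 n [])) f) 1ℚ ≡⟨ line-vacant K right j 0 n ts (line left j 0 n []) f (pc right) mr ⟩
        vacant {n} ts * ifℚ (satisfied (line left j 0 n []) f) 1ℚ ≡⟨ cong (vacant {n} ts *_) (line-vacant K left j 0 n us [] f (pc left) ml) ⟩
        vacant {n} ts * (vacant {n} us * 1ℚ) ≡⟨ cong (vacant {n} ts *_) (ℚP.*-identityʳ _) ⟩
        _ ∎
      Q-count² (suc m) dn j τ ts us f up-free pa pc mr ml ma mz = begin
        _ ≡⟨ Q-star weightᴳ (axis j , eastSide) (axis j , westSide) (axis j , base) es K f (refl , λ ()) (refl , λ ()) (refl , (λ { () }))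
               (axis-avoided j low) (trans ma (cong bit up-free)) ⟩
        (if p (axis j) then 1ℚ * Q weightᴳ es K f₁ + (1ℚ * Q weightᴳ es K f₂ + ω * Q weightᴳ es K f₃) else Q weightᴳ es K f)
          ≡⟨ cases (p (axis j)) ⟩
        _ ∎
        where
        low = low-all up (suc j) m
        rest = allEdges up (suc j) m
        es = flankEdges dn right j 0 n (flankEdges dn left j 0 n rest)
        K′ = allCells up (suc j) m
        K = flankCells dn right j 0 n (flankCells dn left j 0 n K′)
        A : Bool × Bits → ℚ
        A x = scan dn (presence right j 0 n) (proj₁ (proj₂ x)) ts λ bs → scan dn (presence left j 0 n) (proj₂ (proj₂ x)) us λ ds →
          count² {n} ω up (rows² (suc j) m) (proj₁ x) bs ds
        flanks : ∀ f τ c d → Matches dn (bit c) right j 0 n ts f → Matches dn (bit d) left j 0 n us f → f (axis (suc j)) ≡ bit τ →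
          (∀ y → y ≢ axis (suc j) → j < strip y → f y ≡ 0) → Q weightᴳ es K f ≡ A (τ , (c , d))
        flanks f τ c d mr ml ma mz =
          scan-dn edge-absent n right j 0 refl c ts f _ _ _ (right-untouched dn j low) mr (λ v _ → mz _ (λ ()) ≤-refl) λ bs f′ mb o →
          scan-dn edge-absent n left j 0 refl d us f′ _ _ _ (λ v → low-avoids ≤-refl low)
            (Matches-cong dn left j 0 n us (λ v _ → o _ (otherFlank λ ())) ml)
            (λ v _ → trans (o _ (otherFlank λ ())) (mz _ (λ ()) ≤-refl)) λ ds f″ md o′ →
          Q-count² m up (suc j) τ bs ds f″ tt (subst (λ i → p (axis i) ≡ false) (+-suc j m) pa)
            (subst (λ i → ∀ s v → p (cell s i v) ≡ false) (+-suc j m) pc)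
            (Matches-cong up right (suc j) 0 n bs (λ v _ → o′ _ (otherFlank λ ())) mb) md
            (trans (o′ _ onAxis) (trans (o _ onAxis) ma))
            λ y l → trans (o′ y (deeper left y l)) (trans (o y (deeper right y l)) (mz y (λ { refl → <-irrefl refl l }) (<⇒≤ l)))
        f₁ = cover (axis j , eastSide) f
        f₂ = cover (axis j , westSide) f
        f₃ = cover (axis j , base) f
        carry : ∀ s side → target (axis j , side) ≡ cell s j 0 → ∀ r (ts : Word dn r) → Matches dn 0 s j 0 r ts f →
          Matches dn 1 s j 0 r ts (cover (axis j , side) f)
        carry s side e zero    ts       m = trans (cover-tgt {axis j , side} f (λ ()) e) (cong suc m)
        carry s side e (suc r) (t ∷ ts) (m , ms) = trans (cover-tgt {axis j , side} f (λ ()) e) (cong suc m) ,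
          Matches-cong up s j 1 r ts (λ { (suc v) l → cover-miss {axis j , side} f (λ ()) (λ e′ → zero≢ (trans (sym e) e′)) }) ms
          where
          zero≢ : ∀ {v} → cell s j 0 ≢ cell s j (suc v)
          zero≢ ()
        untouched : ∀ s side K c ts → (∀ v → target (axis j , side) ≢ cell s j v) → Matches K c s j 0 n ts f →
          Matches K c s j 0 n ts (cover (axis j , side) f)
        untouched s side K c ts d = Matches-cong K s j 0 n ts (λ v _ → cover-miss {axis j , side} f (λ ()) (d v))
        cases : ∀ b → (if b then 1ℚ * Q weightᴳ es K f₁ + (1ℚ * Q weightᴳ es K f₂ + ω * Q weightᴳ es K f₃) else Q weightᴳ es K f) ≡
          ⟦ axisUp² {n} ω b ⟧ A
        cases false = trans (flanks f false false false mr ml (mz _ ≤-refl) (λ y _ → mz y)) (sym (⟦⟧-one (false , (false , false)) A))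
        cases true = cong₂ _+_ (cong (1ℚ *_) east) (cong₂ _+_ (cong (1ℚ *_) west) (trans (cong (ω *_) down) (sym (+-identityʳ _))))
          where
          east : Q weightᴳ es K f₁ ≡ A (false , (true , false))
          east = flanks f₁ false true false (carry right eastSide refl n ts mr) (untouched left eastSide dn 0 us (λ v ()) ml)
            (trans (cover-miss {axis j , eastSide} {axis (suc j)} f (λ ()) (λ ())) (mz (axis (suc j)) ≤-refl))
            (λ y _ l → trans (cover-miss {axis j , eastSide} f (λ { refl → <-irrefl refl l }) (λ { refl → <-irrefl refl l })) (mz y l))
          west : Q weightᴳ es K f₂ ≡ A (false , (false , true))
          west = flanks f₂ false false true (untouched right westSide dn 0 ts (λ v ()) mr) (carry left westSide refl n us ml)
            (trans (cover-miss {axis j , westSide} {axis (suc j)} f (λ ()) (λ ())) (mz (axis (suc j)) ≤-refl))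
            (λ y _ l → trans (cover-miss {axis j , westSide} f (λ { refl → <-irrefl refl l }) (λ { refl → <-irrefl refl l })) (mz y l))
          down : Q weightᴳ es K f₃ ≡ A (true , (false , false))
          down = flanks f₃ true false false (untouched right base dn 0 ts (λ v ()) mr) (untouched left base dn 0 us (λ v ()) ml)
            (trans (cover-tgt {axis j , base} f (λ { () }) refl) (cong suc (mz _ ≤-refl)))
            (λ y d l → trans (cover-miss {axis j , base} f (λ { refl → <-irrefl refl l }) (λ e → d (sym e))) (mz y l))
      Q-count² (suc m) up j τ ts us f up-free pa pc mr ml ma mz = begin
        Q weightᴳ (flankEdges up right j 0 n es₁) (flankCells up right j 0 n K₁) f
          ≡⟨ scan-up edge-absent n right j 0 refl ts f es₁ K₁ (λ ρ bs → ⟦ bits ⟧ (λ σ → G ρ bs σ))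
               (right-untouched up j low) mr (λ v _ → mz _ ≤-refl) outerStep ⟩
        _ ≡⟨ sum-bits (λ ρ → scan up R ρ ts (λ bs → ⟦ bits ⟧ (λ σ → G ρ bs σ))) ⟩
        ⟦ bits ⟧ (λ ρ → scan up R ρ ts (λ bs → ⟦ bits ⟧ (λ σ → G ρ bs σ)))
          ≡⟨ ⟦⟧-cong bits (λ ρ → scan-⟦⟧ up R ρ ts bits (λ σ bs → G ρ bs σ)) ⟩
        ⟦ bits ⟧ (λ ρ → ⟦ bits ⟧ (λ σ → scan up R ρ ts (λ bs → G ρ bs σ)))
          ≡⟨ ⟦⟧-cong bits (λ ρ → ⟦⟧-cong bits λ σ → pull ρ σ) ⟩
        ⟦ bits ⟧ (λ ρ → ⟦ bits ⟧ (λ σ → ⟦ guard (exactly (p (axis j)) (axisLoad τ (ρ , σ))) ⟧ (λ _ → A (ρ , σ))))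
          ≡⟨ axisDown²-choice (p (axis j)) τ A ⟩
        _ ∎
        where
        low = low-all dn (suc j) m
        rest = allEdges dn (suc j) m
        es₁ = flankEdges up left j 0 n rest
        K′ = allCells dn (suc j) m
        K₁ = flankCells up left j 0 n (axis j ∷ K′)
        R = presence right j 0 n
        L = presence left j 0 n
        C : _ → _ → ℚ
        C bs ds = count² {n} ω dn (rows² (suc j) m) false bs ds
        A : Bits → ℚ
        A x = scan up R (proj₁ x) ts λ bs → scan up L (proj₂ x) us λ ds → C bs ds
        H : Bool → Bool → Combination Bool
        H ρ σ = guard (exactly (p (axis j)) (axisLoad τ (ρ , σ)))
        G : Bool → Word dn n → Bool → ℚ
        G ρ bs σ = scan up L σ us (λ ds → ⟦ H ρ σ ⟧ (λ _ → C bs ds))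
        pull : ∀ ρ σ → scan up R ρ ts (λ bs → G ρ bs σ) ≡ ⟦ H ρ σ ⟧ (λ _ → A (ρ , σ))
        pull ρ σ = trans (scan-cong up R ρ ts λ bs → scan-⟦⟧ up L σ us (H ρ σ) (λ _ → C bs)) (scan-⟦⟧ up R ρ ts (H ρ σ) _)
        inner-axis : ∀ ρ s f → innerCover ρ s j 0 f (axis j) ≡ (if ρ then f (axis j) else suc (f (axis j)))
        inner-axis true  s f = refl
        inner-axis false s f = bump-hit (axis j) f
        inner-other : ∀ ρ s f y → y ≢ axis j → innerCover ρ s j 0 f y ≡ f y
        inner-other true  s f y d = refl
        inner-other false s f y d = bump-miss f (λ e → d (sym e))
        load≡ : ∀ ρ σ → (if σ then (if ρ then bit τ else suc (bit τ)) else suc (if ρ then bit τ else suc (bit τ))) ≡ axisLoad τ (ρ , σ)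
        load≡ true  true  = refl
        load≡ true  false = refl
        load≡ false true  = refl
        load≡ false false = refl
        outerStep : ∀ ρ bs f′ → Matches dn 0 right (suc j) 0 n bs f′ → (∀ y → Outside right j 0 y → f′ y ≡ innerCover ρ right j 0 f y) →
          Q weightᴳ (flankEdges up left j 0 n rest) (flankCells up left j 0 n (axis j ∷ K′)) f′ ≡ ⟦ bits ⟧ (λ σ → G ρ bs σ)
        outerStep ρ bs f′ mb o = trans
          (scan-up edge-absent n left j 0 refl us f′ rest (axis j ∷ K′) (λ σ ds → ⟦ H ρ σ ⟧ (λ _ → C bs ds)) (λ v → low-avoids ≤-refl low)
            (Matches-cong up left j 0 n us (λ v _ → trans (o _ (otherFlank λ ())) (inner-other ρ right f _ λ ())) ml)
            (λ v _ → trans (o _ (otherFlank λ ())) (trans (inner-other ρ right f _ λ ()) (mz _ ≤-refl))) innerStep)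
          (sum-bits (λ σ → G ρ bs σ))
          where
          innerStep : ∀ σ ds f″ → Matches dn 0 left (suc j) 0 n ds f″ → (∀ y → Outside left j 0 y → f″ y ≡ innerCover σ left j 0 f′ y) →
            Q weightᴳ rest (axis j ∷ K′) f″ ≡ ⟦ H ρ σ ⟧ (λ _ → C bs ds)
          innerStep σ ds f″ md o′ = begin
            _ ≡⟨ Q-check weightᴳ rest K′ f″ (low-avoids ≤-refl low) ⟩
            ifℚ (exactly (p (axis j)) (f″ (axis j))) (Q weightᴳ rest K′ f″)
              ≡⟨ cong₂ (λ i q → ifℚ (exactly (p (axis j)) i) q) axis-load next ⟩
            ifℚ (exactly (p (axis j)) (axisLoad τ (ρ , σ))) (C bs ds) ≡⟨ ifℚ-guard (exactly (p (axis j)) (axisLoad τ (ρ , σ))) (C bs ds) ⟩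
            _ ∎
            where
            axis-load : f″ (axis j) ≡ axisLoad τ (ρ , σ)
            axis-load = begin
              f″ (axis j) ≡⟨ trans (o′ _ onAxis) (inner-axis σ left f′) ⟩
              (if σ then f′ (axis j) else suc (f′ (axis j)))
                ≡⟨ cong (λ k → if σ then k else suc k) (trans (o _ onAxis) (trans (inner-axis ρ right f)
                     (cong (λ k → if ρ then k else suc k) ma))) ⟩
              _ ≡⟨ load≡ ρ σ ⟩
              _ ∎
            frame : ∀ y → y ≢ axis j → Outside left j 0 y → Outside right j 0 y → f″ y ≡ f y
            frame y d l r = trans (o′ y l) (trans (inner-other σ left f′ y d) (trans (o y r) (inner-other ρ right f y d)))
            next : Q weightᴳ rest K′ f″ ≡ C bs ds
            next = Q-count² m dn (suc j) false bs ds f″ refl (subst (λ i → p (axis i) ≡ false) (+-suc j m) pa)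
              (subst (λ i → ∀ s v → p (cell s i v) ≡ false) (+-suc j m) pc)
              (Matches-cong dn right (suc j) 0 n bs (λ v _ → trans (o′ _ (otherFlank λ ())) (inner-other σ left f′ _ λ ())) mb) md
              (trans (frame (axis (suc j)) (λ ()) onAxis onAxis) (mz _ ≤-refl))
              λ y l → trans (frame y (λ { refl → <-irrefl refl (<⇒≤ l) }) (deeper left y l) (deeper right y l)) (mz y (<⇒≤ l))

module TilingSums where

  open Coverings
  open import Defs
  open import Data.Bool using (Bool; true; false; _∧_)
  open import Data.List using (List; []; _∷_; _++_; map; filter; foldr; concatMap; length)
  open import Data.List.Membership.Propositional using (_∈_; _∉_; find; lose)
  open import Data.List.Membership.Propositional.Properties using (∈-concatMap⁺; ∈-concatMap⁻; ∈-filter⁺; ∈-filter⁻)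
  open import Data.List.Properties using (concatMap-cong; filter-accept; filter-reject)
  open import Data.List.Relation.Binary.Disjoint.Propositional using (Disjoint)
  open import Data.List.Relation.Unary.All as All using (All; []; _∷_; all?)
  import Data.List.Relation.Unary.All.Properties as AllP
  open import Data.List.Relation.Unary.AllPairs using (AllPairs; []; _∷_)
  open import Data.List.Relation.Unary.Any using (here; there)
  open import Data.List.Relation.Unary.Unique.Propositional using (Unique)
  open import Data.List.Relation.Unary.Unique.Propositional.Properties as UniqueP using (concat⁺; filter⁺)
  import Data.List.Membership.DecPropositional as DecMembership
  open import Data.Nat as ℕ using (ℕ; suc)
  open import Data.Nat.Properties using (+-suc)
  open import Data.Product using (_×_; _,_; proj₁; proj₂)
  open import Data.Rational using (ℚ; 0ℚ; 1ℚ; _+_; _*_)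
  open import Data.Rational.Properties using (*-zeroʳ; +-identityʳ; +-identityˡ; +-assoc; *-distribˡ-+)
  open import Function using (_∘_; mk⇔)
  open import Relation.Binary.PropositionalEquality
  open import Relation.Nullary using (Dec; yes; no; does)
  open import Relation.Nullary.Decidable using (does-⇔; dec-true)

  open ≡-Reasoning
  open DecMembership _≟ᶜ_ using (_∈?_)

  up≢down : ∀ l → upCell l ≢ downCell l
  up≢down (lozenge P base)     ()
  up≢down (lozenge P westSide) ()
  up≢down (lozenge P eastSide) ()

  module Regional (cs : List Cell) (w : Lozenge → ℚ) where

    module C = Cover _≟ᶜ_ upCell downCell (λ _ → true)

    product : List Lozenge → ℚ
    product T = foldr _*_ 1ℚ (map w T)

    Completes : (Cell → ℕ) → List Lozenge → Set
    Completes f T = All (λ c → f c ℕ.+ length (filter (covers? c) T) ≡ 1) cs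

    completes? : ∀ f T → Dec (Completes f T)
    completes? f T = all? (λ c → f c ℕ.+ length (filter (covers? c) T) ℕ.≟ 1) cs

    total : (Cell → ℕ) → List (List Lozenge) → ℚ
    total f Ts = foldr _+_ 0ℚ (map product (filter (completes? f) Ts))

    total-++ : ∀ f Ts Us → total f (Ts ++ Us) ≡ total f Ts + total f Us
    total-++ f []       Us = sym (+-identityˡ _)
    total-++ f (T ∷ Ts) Us with does (completes? f T)
    ... | true  = trans (cong (product T +_) (total-++ f Ts Us)) (sym (+-assoc (product T) _ _))
    ... | false = total-++ f Ts Us

    cover-step : ∀ l f c T → f c ℕ.+ length (filter (covers? c) (l ∷ T)) ≡ C.cover l f c ℕ.+ length (filter (covers? c) T)
    cover-step l f c T with covers? c l
    ... | yes i = trans (cong (λ U → f c ℕ.+ length U) (filter-accept (covers? c) i))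
      (trans (+-suc (f c) _) (cong (ℕ._+ length (filter (covers? c) T)) (sym (covered i))))
      where
      covered : Covers c l → C.cover l f c ≡ suc (f c)
      covered (here refl)         = C.cover-src {l} f refl (up≢down l ∘ sym)
      covered (there (here refl)) = C.cover-tgt {l} f (up≢down l) refl
    ... | no n = cong₂ ℕ._+_ (sym (C.cover-miss {l} f (λ { refl → n (here refl) }) (λ { refl → n (there (here refl)) })))
      (cong length (filter-reject (covers? c) n))

    total-∷ : ∀ l f Ts → total f (map (l ∷_) Ts) ≡ w l * total (C.cover l f) Ts
    total-∷ l f []       = sym (*-zeroʳ (w l))
    total-∷ l f (T ∷ Ts)
      rewrite does-⇔ (mk⇔ (All.map (λ {c} → trans (sym (cover-step l f c T)))) (All.map (λ {c} → trans (cover-step l f c T))))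
        (completes? f (l ∷ T)) (completes? (C.cover l f) T)
      with does (completes? (C.cover l f) T)
    ... | true  = trans (cong (w l * product T +_) (total-∷ l f Ts)) (sym (*-distribˡ-+ (w l) _ _))
    ... | false = total-∷ l f Ts

    completes-[] : ∀ f ds → does (all? (λ c → f c ℕ.+ 0 ℕ.≟ 1) ds) ≡ C.satisfied ds f
    completes-[] f []       = refl
    completes-[] f (c ∷ ds) = cong₂ _∧_ (once (f c)) (completes-[] f ds)
      where
      once : ∀ k → does (k ℕ.+ 0 ℕ.≟ 1) ≡ exactly true k
      once 0             = refl
      once 1             = refl
      once (suc (suc k)) = refl

    total-sublists : ∀ ls f → total f (sublists ls) ≡ C.Q w ls cs f
    total-sublists [] f rewrite sym (completes-[] f cs) with does (completes? f [])
    ... | true  = +-identityʳ 1ℚ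
    ... | false = refl
    total-sublists (l ∷ ls) f = trans (total-++ f (sublists ls) _)
      (cong₂ _+_ (total-sublists ls f) (trans (total-∷ l f (sublists ls)) (cong (w l *_) (total-sublists ls (C.cover l f)))))

    -- The list of cells to be checked may then be enlarged by cells outside
    -- the region, which have to stay uncovered.
    inside : Cell → Bool
    inside c = does (c ∈? cs)

    module D = Cover _≟ᶜ_ upCell downCell inside

    ∧-intro : ∀ {a b} → a ≡ true → b ≡ true → a ∧ b ≡ true
    ∧-intro refl refl = refl

    ∧-split : ∀ a {b} → a ∧ b ≡ true → a ≡ true × b ≡ true
    ∧-split true q = refl , q

    satisfied-D : ∀ K f → cs ≡ cs → (∀ {c} → c ∈ cs → c ∈ K) → (∀ c → c ∉ cs → f c ≡ 0) → C.satisfied cs f ≡ D.satisfied K f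
    satisfied-D K f _ sub z = bool-ext (C.satisfied cs f) (D.satisfied K f)
        (λ q → D-intro K (λ {c} _ → local c (λ i → C-elim cs q i)))
        (λ q → C-intro cs (λ {c} i → trans (cong (λ b → exactly b (f c)) (sym (dec-true (c ∈? cs) i))) (D-elim K q (sub i))))
      where
      bool-ext : ∀ a b → (a ≡ true → b ≡ true) → (b ≡ true → a ≡ true) → a ≡ b
      bool-ext true  b     g h = sym (g refl)
      bool-ext false true  g h = h refl
      bool-ext false false g h = refl
      C-elim : ∀ K → C.satisfied K f ≡ true → ∀ {c} → c ∈ K → exactly true (f c) ≡ true
      C-elim (x ∷ K) q (here refl) = proj₁ (∧-split _ q)
      C-elim (x ∷ K) q (there i)   = C-elim K (proj₂ (∧-split (exactly true (f x)) q)) i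
      C-intro : ∀ K → (∀ {c} → c ∈ K → exactly true (f c) ≡ true) → C.satisfied K f ≡ true
      C-intro []      h = refl
      C-intro (x ∷ K) h = ∧-intro (h (here refl)) (C-intro K (h ∘ there))
      D-elim : ∀ K → D.satisfied K f ≡ true → ∀ {c} → c ∈ K → exactly (inside c) (f c) ≡ true
      D-elim (x ∷ K) q (here refl) = proj₁ (∧-split _ q)
      D-elim (x ∷ K) q (there i)   = D-elim K (proj₂ (∧-split (exactly (inside x) (f x)) q)) i
      D-intro : ∀ K → (∀ {c} → c ∈ K → exactly (inside c) (f c) ≡ true) → D.satisfied K f ≡ true
      D-intro []      h = refl
      D-intro (x ∷ K) h = ∧-intro (h (here refl)) (D-intro K (h ∘ there))
      local : ∀ c → (c ∈ cs → exactly true (f c) ≡ true) → exactly (inside c) (f c) ≡ true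
      local c h with c ∈? cs
      ... | yes i = h i
      ... | no n  = cong (exactly false) (z c n)

    Q-inside : ∀ ls K f → All (λ l → upCell l ∈ cs × downCell l ∈ cs) ls → (∀ {c} → c ∈ cs → c ∈ K) → (∀ c → c ∉ cs → f c ≡ 0) →
      C.Q w ls cs f ≡ D.Q w ls K f
    Q-inside []       K f a sub z = cong (λ b → ifℚ b 1ℚ) (satisfied-D K f refl sub z)
    Q-inside (l ∷ ls) K f ((i , j) ∷ a) sub z = cong₂ (λ a b → a + w l * b) (Q-inside ls K f a sub z)
      (trans (Q-inside ls K (C.cover l f) a sub (λ c n → trans (C.cover-miss {l} f (λ { refl → n i }) (λ { refl → n j })) (z c n)))
        refl)

  allLozenges : Cell → List Lozenge
  allLozenges (△ P) = map (lozenge P) (base ∷ westSide ∷ eastSide ∷ [])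
  allLozenges (▽ _) = []

  lozengesIn-≡ : ∀ cs → lozengesIn cs ≡ filter (λ l → downCell l ∈? cs) (concatMap allLozenges cs)
  lozengesIn-≡ cs = cong (filter (λ l → downCell l ∈? cs)) (concatMap-cong (λ { (△ P) → refl ; (▽ P) → refl }) cs)

  allLozenges-up : ∀ c {l} → l ∈ allLozenges c → upCell l ≡ c
  allLozenges-up (△ P) (here refl)                 = refl
  allLozenges-up (△ P) (there (here refl))         = refl
  allLozenges-up (△ P) (there (there (here refl))) = refl

  ∈-allLozenges : ∀ l → l ∈ allLozenges (upCell l)
  ∈-allLozenges (lozenge P base)     = here refl
  ∈-allLozenges (lozenge P westSide) = there (here refl)
  ∈-allLozenges (lozenge P eastSide) = there (there (here refl))

  ∈-lozengesIn⁻ : ∀ cs {l} → l ∈ lozengesIn cs → upCell l ∈ cs × downCell l ∈ cs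
  ∈-lozengesIn⁻ cs {l} i with ∈-filter⁻ (λ l → downCell l ∈? cs) {xs = concatMap allLozenges cs} (subst (l ∈_) (lozengesIn-≡ cs) i)
  ... | j , d with find (∈-concatMap⁻ allLozenges {xs = cs} j)
  ...   | c , k , m = subst (_∈ cs) (sym (allLozenges-up c m)) k , d

  ∈-lozengesIn⁺ : ∀ cs {l} → upCell l ∈ cs → downCell l ∈ cs → l ∈ lozengesIn cs
  ∈-lozengesIn⁺ cs {l} i d = subst (l ∈_) (sym (lozengesIn-≡ cs))
    (∈-filter⁺ (λ l → downCell l ∈? cs) (∈-concatMap⁺ allLozenges (lose i (∈-allLozenges l))) d)

  unique-lozengesIn : ∀ cs → Unique cs → Unique (lozengesIn cs)
  unique-lozengesIn cs u = subst Unique (sym (lozengesIn-≡ cs))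
    (UniqueP.filter⁺ (λ l → downCell l ∈? cs) (concat⁺ (AllP.map⁺ (All.universal unique-over cs)) (disjoint u)))
    where
    unique-over : ∀ c → Unique (allLozenges c)
    unique-over (△ P) = ((λ ()) ∷ (λ ()) ∷ []) ∷ ((λ ()) ∷ []) ∷ [] ∷ []
    unique-over (▽ P) = []
    apart : ∀ {ds} c → All (c ≢_) ds → All (Disjoint (allLozenges c)) (map allLozenges ds)
    apart c []       = []
    apart c (n ∷ ns) = (λ { (i , j) → n (trans (sym (allLozenges-up c i)) (allLozenges-up _ j)) }) ∷ apart c ns
    disjoint : ∀ {ds} → Unique ds → AllPairs Disjoint (map allLozenges ds)
    disjoint []       = []
    disjoint (n ∷ ns) = apart _ n ∷ disjoint ns

  M-Q : ∀ R K → (∀ {c} → c ∈ cells R → c ∈ K) →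
    M R ≡ Regional.D.Q (cells R) (weight R) (weight R) (lozengesIn (cells R)) K (λ _ → 0)
  M-Q R K sub = trans (R′.total-sublists (lozengesIn (cells R)) (λ _ → 0))
    (R′.Q-inside (lozengesIn (cells R)) K (λ _ → 0) (All.tabulate (∈-lozengesIn⁻ (cells R))) sub (λ _ _ → refl))
    where module R′ = Regional (cells R) (weight R)

module Embeddings where

  open Transfer
  open Rows
  open Coverings
  open Grids
  open TilingSums
  open import Defs
  open import Data.Bool using (Bool; false)
  open import Data.Empty using (⊥)
  open import Data.Integer as ℤ using (ℤ; +_; -[1+_])
  import Data.Integer.Properties as ℤP
  open import Data.List using (List; []; _∷_; map; filter)
  open import Data.List.Membership.Propositional using (_∈_)
  open import Data.List.Membership.Propositional.Properties using (∈-filter⁺; ∈-filter⁻; ∈-map⁺; ∈-map⁻)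
  open import Data.List.Membership.Propositional.Properties.WithK using (unique∧set⇒bag)
  open import Data.List.Relation.Binary.BagAndSetEquality using (∼bag⇒↭)
  open import Data.List.Relation.Unary.All as All using (All; []; _∷_)
  open import Data.List.Relation.Unary.AllPairs using ([]; _∷_)
  open import Data.List.Relation.Unary.Any using (here; there)
  open import Data.List.Relation.Unary.Unique.Propositional using (Unique)
  import Data.List.Relation.Unary.Unique.Propositional.Properties as UniqueP
  import Data.List.Membership.DecPropositional as DecMembership
  open import Data.Nat as ℕ using (ℕ; zero; suc; _≤_; _<_; z≤n; s≤s)
  import Data.Nat.Properties as ℕP
  open import Data.Product using (_×_; _,_; proj₁; proj₂; ∃)
  open import Data.Rational using (ℚ; _+_)
  open import Data.Sum using (_⊎_; inj₁; inj₂)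
  open import Data.Unit using (tt)
  open import Data.Vec using (Vec; []; _∷_; replicate)
  open import Function using (_∘_; mk⇔)
  open import Relation.Binary.PropositionalEquality
  open import Relation.Nullary using (Dec; yes; no; does; contradiction; _×-dec_)
  open import Relation.Nullary.Decidable using (dec-false)

  open ≡-Reasoning
  open import Algebra.Bundles using (module AbelianGroup)
  open import Algebra.Properties.Group (AbelianGroup.group ℤP.+-0-abelianGroup) using () renaming (∙-cancelˡ to +-cancelˡ)
  open DecMembership _≟ᶜ_ using (_∈?_)

  kindAt : Kind → ℕ → Kind
  kindAt K zero    = K
  kindAt K (suc m) = kindAt (opposite K) m

  opposite-involutive : ∀ K → opposite (opposite K) ≡ K
  opposite-involutive dn = refl
  opposite-involutive up = refl

  kindAt-opposite : ∀ K m → kindAt (opposite K) m ≡ opposite (kindAt K m)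
  kindAt-opposite K zero    = refl
  kindAt-opposite K (suc m) = kindAt-opposite (opposite K) m

  distance : Cellᴳ → ℕ
  distance (axis _)     = 0
  distance (cell _ _ u) = u

  offset : Cellᴳ → ℤ
  offset (axis _)         = -[1+ 0 ]
  offset (cell right _ u) = + u
  offset (cell left _ u)  = -[1+ suc u ]

  fromOffset : ℤ → ℕ → Cellᴳ
  fromOffset (+ u)        j = cell right j u
  fromOffset -[1+ zero ]  j = axis j
  fromOffset -[1+ suc u ] j = cell left j u

  fromOffset-offset : ∀ x → fromOffset (offset x) (strip x) ≡ x
  fromOffset-offset (axis _)         = refl
  fromOffset-offset (cell right _ _) = refl
  fromOffset-offset (cell left _ _)  = refl

  -- κ is the kind of the cells next to the axis in the top strip.
  kindOfCell : Kind → Cellᴳ → Kind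
  kindOfCell κ (axis j)     = opposite (kindAt κ j)
  kindOfCell κ (cell _ j u) = kindAt (kindAt κ j) u

  module Embedding (top shift : ℤ) (κ : Kind) where

    level : ℕ → ℤ
    level j = top ℤ.- + j

    kindOf : Cellᴳ → Kind
    kindOf = kindOfCell κ

    place : Kind → ℤ → ℕ → Cell
    place up U j = △ ⟦ U ⨾ level (suc j) ⟧
    place dn U j = ▽ ⟦ U ⨾ level j ⟧

    embed : Cellᴳ → Cell
    embed x = place (kindOf x) (shift ℤ.+ offset x) (strip x)

    point : Cellᴳ → Point
    point x = ⟦ shift ℤ.+ offset x ⨾ level (suc (strip x)) ⟧

    lozengeOf : Edge → Lozenge
    lozengeOf (x , side) = lozenge (point x) side

    level-injective : ∀ {i j} → level i ≡ level j → i ≡ j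
    level-injective {i} {j} e = ℤP.+-injective (ℤP.neg-injective (+-cancelˡ top _ _ e))

    place-injective : ∀ K L {U V i j} → place K U i ≡ place L V j → U ≡ V × i ≡ j
    place-injective up up e = cong U-of e , ℕP.suc-injective (level-injective (cong k-of e))
      where
      U-of k-of : Cell → ℤ
      U-of (△ P) = 2u P
      U-of (▽ P) = 2u P
      k-of (△ P) = k P
      k-of (▽ P) = k P
    place-injective dn dn e = cong U-of e , level-injective (cong k-of e)
      where
      U-of k-of : Cell → ℤ
      U-of (△ P) = 2u P
      U-of (▽ P) = 2u P
      k-of (△ P) = k P
      k-of (▽ P) = k P

    same-place : ∀ {x y} → shift ℤ.+ offset x ≡ shift ℤ.+ offset y × strip x ≡ strip y → x ≡ y
    same-place {x} {y} (e , q) = begin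
      x                                ≡⟨ fromOffset-offset x ⟨
      fromOffset (offset x) (strip x)  ≡⟨ cong₂ fromOffset (+-cancelˡ shift _ _ e) q ⟩
      fromOffset (offset y) (strip y)  ≡⟨ fromOffset-offset y ⟩
      y                                ∎

    embed-injective : ∀ {x y} → embed x ≡ embed y → x ≡ y
    embed-injective {x} {y} e = same-place (place-injective (kindOf x) (kindOf y) e)

    up-△ : ∀ x {P} → embed x ≡ △ P → kindOf x ≡ up
    up-△ x e with kindOf x
    ... | up = refl

    embed-up : ∀ x → kindOf x ≡ up → embed x ≡ △ (point x)
    embed-up x e = cong (λ K → place K (shift ℤ.+ offset x) (strip x)) e

    lozengeOf-injective : ∀ {d e} → lozengeOf d ≡ lozengeOf e → d ≡ e
    lozengeOf-injective {x , a} {y , b} e = cong₂ _,_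
      (same-place (cong (2u ∘ Lozenge.corner) e , ℕP.suc-injective (level-injective (cong (k ∘ Lozenge.corner) e))))
      (cong Lozenge.glued e)

    next-kind : ∀ j u → kindAt (kindAt κ (suc j)) u ≡ opposite (kindAt (kindAt κ j) u)
    next-kind j u = trans (cong (λ K → kindAt K u) (kindAt-opposite κ j)) (kindAt-opposite (kindAt κ j) u)

    kind-suc : ∀ K u → kindAt K (suc u) ≡ opposite (kindAt K u)
    kind-suc = kindAt-opposite

    opposite-up : ∀ {K} → K ≡ up → opposite K ≡ dn
    opposite-up refl = refl

    opposite-up′ : ∀ {K} → opposite K ≡ up → K ≡ dn
    opposite-up′ {dn} _ = refl

    target-kind : ∀ e → kindOf (source e) ≡ up → kindOf (target e) ≡ dn
    target-kind (axis j , base) q = cong opposite (trans (kindAt-opposite κ j) q)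
    target-kind (axis j , westSide) q = opposite-up′ q
    target-kind (axis j , eastSide) q = opposite-up′ q
    target-kind (cell s j u , base) q = trans (next-kind j u) (opposite-up q)
    target-kind (cell right j u , eastSide) q = trans (kind-suc (kindAt κ j) u) (opposite-up q)
    target-kind (cell left j u , westSide) q = trans (kind-suc (kindAt κ j) u) (opposite-up q)
    target-kind (cell right j zero , westSide) q = opposite-up q
    target-kind (cell left j zero , eastSide) q = opposite-up q
    target-kind (cell right j (suc u) , westSide) q = opposite-up′ (trans (sym (kind-suc (kindAt κ j) u)) q)
    target-kind (cell left j (suc u) , eastSide) q = opposite-up′ (trans (sym (kind-suc (kindAt κ j) u)) q)

    level-suc : ∀ j → level (suc j) ℤ.+ + 1 ≡ level j
    level-suc j = trans (ℤP.+-assoc top (ℤ.- + suc j) (+ 1)) (cong (ℤ._+_ top) (step j))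
      where
      step : ∀ j → ℤ.- + suc j ℤ.+ + 1 ≡ ℤ.- + j
      step zero    = refl
      step (suc j) = refl

    embed-target : ∀ e → kindOf (source e) ≡ up → downCell (lozengeOf e) ≡ embed (target e)
    embed-target e q = trans (downPlace e) (sym (cong (λ K → place K (shift ℤ.+ offset (target e)) (strip (target e))) (target-kind e q)))
      where
      flat : ∀ {U V k l} → U ≡ V → k ≡ l → ▽ ⟦ U ⨾ k ⟧ ≡ ▽ ⟦ V ⨾ l ⟧
      flat refl refl = refl
      toWest : ∀ x {V} → offset x ℤ.- + 1 ≡ V → ▽ ⟦ shift ℤ.+ offset x ℤ.- + 1 ⨾ level (suc (strip x)) ℤ.+ + 1 ⟧ ≡ ▽ ⟦ shift ℤ.+ V ⨾ level (strip x) ⟧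
      toWest x refl = flat (ℤP.+-assoc shift (offset x) _) (level-suc (strip x))
      toEast : ∀ x {V} → offset x ℤ.+ + 1 ≡ V → ▽ ⟦ shift ℤ.+ offset x ℤ.+ + 1 ⨾ level (suc (strip x)) ℤ.+ + 1 ⟧ ≡ ▽ ⟦ shift ℤ.+ V ⨾ level (strip x) ⟧
      toEast x refl = flat (ℤP.+-assoc shift (offset x) _) (level-suc (strip x))
      downPlace : ∀ e → downCell (lozengeOf e) ≡ place dn (shift ℤ.+ offset (target e)) (strip (target e))
      downPlace (axis j , base)         = refl
      downPlace (axis j , westSide)     = toWest (axis j) refl
      downPlace (axis j , eastSide)     = toEast (axis j) refl
      downPlace (cell right j u , base) = refl
      downPlace (cell left j u , base)  = refl
      downPlace (cell right j zero , westSide)    = toWest (cell right j zero) refl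
      downPlace (cell right j (suc u) , westSide) = toWest (cell right j (suc u)) refl
      downPlace (cell right j u , eastSide)       = toEast (cell right j u) (cong +_ (ℕP.+-comm u 1))
      downPlace (cell left j u , westSide)        = toWest (cell left j u) (cong (λ v → -[1+ suc (suc v) ]) (ℕP.+-identityʳ u))
      downPlace (cell left j zero , eastSide)     = toEast (cell left j zero) refl
      downPlace (cell left j (suc u) , eastSide)  = toEast (cell left j (suc u)) refl

    kindAt-suc : ∀ K u {L} → kindAt K u ≡ L → kindAt K (suc u) ≡ opposite L
    kindAt-suc K u refl = kind-suc K u

    flank-All : ∀ {P : Edge → Set} K s j u r {es} → kindAt (kindAt κ j) u ≡ K →
      (∀ v side → u ≤ v → v < u ℕ.+ r → kindAt (kindAt κ j) v ≡ up → P (cell s j v , side)) → All P es →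
      All P (flankEdges K s j u r es)
    flank-All K  s j u zero    q h a = a
    flank-All dn s j u (suc r) q h a rewrite ℕP.+-suc u r =
      flank-All up s j (suc u) r (kindAt-suc (kindAt κ j) u q) (λ v side l → h v side (ℕP.<⇒≤ l)) a
    flank-All up s j u (suc r) q h a rewrite ℕP.+-suc u r =
      here′ _ ∷ here′ _ ∷ here′ _ ∷ flank-All dn s j (suc u) r (kindAt-suc (kindAt κ j) u q) (λ v side l → h v side (ℕP.<⇒≤ l)) a
      where
      here′ : ∀ side → _
      here′ side = h u side ℕP.≤-refl (s≤s (ℕP.m≤m+n u r)) q

    flank-⊆ : ∀ {e} K s j u r {es} → e ∈ es → e ∈ flankEdges K s j u r es
    flank-⊆ K  s j u zero    i = i
    flank-⊆ dn s j u (suc r) i = flank-⊆ up s j (suc u) r i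
    flank-⊆ up s j u (suc r) i = there (there (there (flank-⊆ dn s j (suc u) r i)))

    three-sides : ∀ s {x : Cellᴳ} {es} side → (x , side) ∈ (x , base) ∷ (x , outer s) ∷ (x , inner s) ∷ es
    three-sides s     base     = here refl
    three-sides right eastSide = there (here refl)
    three-sides right westSide = there (there (here refl))
    three-sides left  eastSide = there (there (here refl))
    three-sides left  westSide = there (here refl)

    flank-∈ : ∀ K s j u r {es} v side → kindAt (kindAt κ j) u ≡ K → u ≤ v → v < u ℕ.+ r → kindAt (kindAt κ j) v ≡ up →
      (cell s j v , side) ∈ flankEdges K s j u r es
    flank-∈ K s j u zero v side q l l′ e rewrite ℕP.+-identityʳ u = contradiction l′ (ℕP.≤⇒≯ l)
    flank-∈ K s j u (suc r) v side q l l′ e rewrite ℕP.+-suc u r with u ℕ.≟ v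
    flank-∈ dn s j u (suc r) v side q l l′ e | yes refl with trans (sym q) e
    ... | ()
    flank-∈ up s j u (suc r) v side q l l′ e | yes refl = three-sides s side
    flank-∈ dn s j u (suc r) v side q l l′ e | no d =
      flank-∈ up s j (suc u) r v side (kindAt-suc (kindAt κ j) u q) (ℕP.≤∧≢⇒< l d) l′ e
    flank-∈ up s j u (suc r) v side q l l′ e | no d =
      there (there (there (flank-∈ dn s j (suc u) r v side (kindAt-suc (kindAt κ j) u q) (ℕP.≤∧≢⇒< l d) l′ e)))

    flank-unique : ∀ K s j u r {es} → (∀ v side → u ≤ v → All ((cell s j v , side) ≢_) es) → Unique es →
      Unique (flankEdges K s j u r es)
    flank-unique K  s j u zero    h a = a
    flank-unique dn s j u (suc r) h a = flank-unique up s j (suc u) r (λ v side l → h v side (ℕP.<⇒≤ l)) a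
    flank-unique up s j u (suc r) h a =
      (base≢outer s ∷ base≢inner s ∷ tail base) ∷ (outer≢inner s ∷ tail (outer s)) ∷ tail (inner s) ∷
      flank-unique dn s j (suc u) r (λ v side l → h v side (ℕP.<⇒≤ l)) a
      where
      tail : ∀ side → All ((cell s j u , side) ≢_) (flankEdges dn s j (suc u) r _)
      tail side = flankEdges-All dn s j (suc u) r (λ { v _ l refl → ℕP.<-irrefl refl l }) (h u side ℕP.≤-refl)
      base≢outer : ∀ s → (cell s j u , base) ≢ (cell s j u , outer s)
      base≢outer right ()
      base≢outer left  ()
      base≢inner : ∀ s → (cell s j u , base) ≢ (cell s j u , inner s)
      base≢inner right ()
      base≢inner left  ()
      outer≢inner : ∀ s → (cell s j u , outer s) ≢ (cell s j u , inner s)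
      outer≢inner right ()
      outer≢inner left  ()

    module Covering (n : ℕ) (0<n : 0 < n) (p : Cellᴳ → Bool) (ω : ℚ) where

      open Grid n p ω

      Inner : ℕ → ℕ → Edge → Set
      Inner j m e = kindOf (source e) ≡ up × j ≤ strip (source e) × strip (source e) < j ℕ.+ m × distance (source e) < n

      strip-All : ∀ {P : Edge → Set} K j {es} → kindAt κ j ≡ K →
        (∀ e → kindOf (source e) ≡ up → strip (source e) ≡ j → distance (source e) < n → P e) →
        All P es → All P (stripEdges K j es)
      strip-All {P} K j q h a = whole K q
        where
        flanks : ∀ K → kindAt κ j ≡ K → All P (flankEdges K right j 0 n (flankEdges K left j 0 n _))
        flanks K q = flank-All K right j 0 n q (λ v side _ l e → h _ e refl l)
                     (flank-All K left j 0 n q (λ v side _ l e → h _ e refl l) a)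
        whole : ∀ K → kindAt κ j ≡ K → All P (stripEdges K j _)
        whole dn q = h _ (cong opposite q) refl 0<n ∷ h _ (cong opposite q) refl 0<n ∷ h _ (cong opposite q) refl 0<n ∷ flanks dn q
        whole up q = flanks up q

      inner-all : ∀ K j m → kindAt κ j ≡ K → All (Inner j m) (allEdges K j m)
      inner-all K j zero    q = []
      inner-all K j (suc m) q = strip-All K j q
        (λ { e u refl d → u , ℕP.≤-refl , ℕP.m<m+n j (s≤s z≤n) , d })
        (All.map (λ { {e} (u , l , l′ , d) → u , ℕP.<⇒≤ l , subst (strip (source e) <_) (sym (ℕP.+-suc j m)) l′ , d })
          (inner-all (opposite K) (suc j) m (kindAt-suc κ j q)))

      strip-⊆ : ∀ {e} K j {es} → e ∈ es → e ∈ stripEdges K j es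
      strip-⊆ dn j i = there (there (there (flank-⊆ dn right j 0 n (flank-⊆ dn left j 0 n i))))
      strip-⊆ up j i = flank-⊆ up right j 0 n (flank-⊆ up left j 0 n i)

      strip-∈ : ∀ K j {es} x side → kindAt κ j ≡ K → kindOf x ≡ up → strip x ≡ j → distance x < n → (x , side) ∈ stripEdges K j es
      strip-∈ dn j (axis .j) base     q e refl d = there (there (here refl))
      strip-∈ dn j (axis .j) westSide q e refl d = there (here refl)
      strip-∈ dn j (axis .j) eastSide q e refl d = here refl
      strip-∈ up j (axis .j) side q e refl d with trans (sym e) (cong opposite q)
      ... | ()
      strip-∈ dn j (cell right .j u) side q e refl d = there (there (there (flank-∈ dn right j 0 n u side q z≤n d e)))
      strip-∈ dn j (cell left .j u) side q e refl d =
        there (there (there (flank-⊆ dn right j 0 n (flank-∈ dn left j 0 n u side q z≤n d e))))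
      strip-∈ up j (cell right .j u) side q e refl d = flank-∈ up right j 0 n u side q z≤n d e
      strip-∈ up j (cell left .j u) side q e refl d = flank-⊆ up right j 0 n (flank-∈ up left j 0 n u side q z≤n d e)

      all-∈ : ∀ K j m x side → kindAt κ j ≡ K → kindOf x ≡ up → j ≤ strip x → strip x < j ℕ.+ m → distance x < n →
        (x , side) ∈ allEdges K j m
      all-∈ K j zero x side q e l l′ d rewrite ℕP.+-identityʳ j = contradiction l′ (ℕP.≤⇒≯ l)
      all-∈ K j (suc m) x side q e l l′ d with j ℕ.≟ strip x
      ... | yes eq = strip-∈ K j x side q e (sym eq) d
      ... | no ne  = strip-⊆ K j (all-∈ (opposite K) (suc j) m x side (kindAt-suc κ j q) e (ℕP.≤∧≢⇒< l ne)
                       (subst (strip x <_) (ℕP.+-suc j m) l′) d)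

      strip-unique : ∀ K j {es} → All (Low (suc j)) es → Unique es → Unique (stripEdges K j es)
      strip-unique K j {es} a u = whole K
        where
        below : ∀ {e} → strip (source e) ≡ j → All (e ≢_) es
        below refl = All.map (λ { (l , _) refl → ℕP.<-irrefl refl l }) a
        flanks : ∀ K → Unique (flankEdges K right j 0 n (flankEdges K left j 0 n es))
        flanks K = flank-unique K right j 0 n (λ v side _ → flankEdges-All K left j 0 n (λ _ _ _ ()) (below refl))
          (flank-unique K left j 0 n (λ v side _ → below refl) u)
        axis≢ : ∀ side → All ((axis j , side) ≢_) (flankEdges dn right j 0 n (flankEdges dn left j 0 n es))
        axis≢ side = flankEdges-All dn right j 0 n (λ _ _ _ ()) (flankEdges-All dn left j 0 n (λ _ _ _ ()) (below refl))
        whole : ∀ K → Unique (stripEdges K j es)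
        whole dn = ((λ ()) ∷ (λ ()) ∷ axis≢ _) ∷ ((λ ()) ∷ axis≢ _) ∷ axis≢ _ ∷ flanks dn
        whole up = flanks up

      all-unique : ∀ K j m → Unique (allEdges K j m)
      all-unique K j zero    = []
      all-unique K j (suc m) = strip-unique K j (low-all (opposite K) (suc j) m) (all-unique (opposite K) (suc j) m)

      flankCells-⊆ : ∀ {x} K s j u r {K′} → x ∈ K′ → x ∈ flankCells K s j u r K′
      flankCells-⊆ K  s j u zero    i = there i
      flankCells-⊆ dn s j u (suc r) i = flankCells-⊆ up s j (suc u) r (there i)
      flankCells-⊆ up s j u (suc r) i = there (flankCells-⊆ dn s j (suc u) r i)

      flankCells-∈ : ∀ K s j u r {K′} v → u ≤ v → v ≤ u ℕ.+ r → cell s j v ∈ flankCells K s j u r K′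
      flankCells-∈ K s j u zero v l l′ rewrite ℕP.+-identityʳ u | ℕP.≤-antisym l l′ = here refl
      flankCells-∈ K s j u (suc r) v l l′ with u ℕ.≟ v
      flankCells-∈ dn s j u (suc r) v l l′ | yes refl = flankCells-⊆ up s j (suc u) r (here refl)
      flankCells-∈ up s j u (suc r) v l l′ | yes refl = here refl
      flankCells-∈ dn s j u (suc r) v l l′ | no d = flankCells-∈ up s j (suc u) r v (ℕP.≤∧≢⇒< l d) (subst (v ≤_) (ℕP.+-suc u r) l′)
      flankCells-∈ up s j u (suc r) v l l′ | no d = there (flankCells-∈ dn s j (suc u) r v (ℕP.≤∧≢⇒< l d) (subst (v ≤_) (ℕP.+-suc u r) l′))

      line-⊆ : ∀ {x} s j u r {K′} → x ∈ K′ → x ∈ line s j u r K′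
      line-⊆ s j u zero    i = there i
      line-⊆ s j u (suc r) i = there (line-⊆ s j (suc u) r i)

      line-∈ : ∀ s j u r {K′} v → u ≤ v → v ≤ u ℕ.+ r → cell s j v ∈ line s j u r K′
      line-∈ s j u zero v l l′ rewrite ℕP.+-identityʳ u | ℕP.≤-antisym l l′ = here refl
      line-∈ s j u (suc r) v l l′ with u ℕ.≟ v
      ... | yes refl = here refl
      ... | no d = there (line-∈ s j (suc u) r v (ℕP.≤∧≢⇒< l d) (subst (v ≤_) (ℕP.+-suc u r) l′))

      stripCells-⊆ : ∀ {x} K j {K′} → x ∈ K′ → x ∈ stripCells K j K′
      stripCells-⊆ dn j i = there (flankCells-⊆ dn right j 0 n (flankCells-⊆ dn left j 0 n i))
      stripCells-⊆ up j i = flankCells-⊆ up right j 0 n (flankCells-⊆ up left j 0 n (there i))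

      stripCells-∈ : ∀ K x {K′} → distance x ≤ n → x ∈ stripCells K (strip x) K′
      stripCells-∈ dn (axis j) d         = here refl
      stripCells-∈ up (axis j) d         = flankCells-⊆ up right j 0 n (flankCells-⊆ up left j 0 n (here refl))
      stripCells-∈ dn (cell right j u) d = there (flankCells-∈ dn right j 0 n u z≤n d)
      stripCells-∈ dn (cell left j u) d  = there (flankCells-⊆ dn right j 0 n (flankCells-∈ dn left j 0 n u z≤n d))
      stripCells-∈ up (cell right j u) d = flankCells-∈ up right j 0 n u z≤n d
      stripCells-∈ up (cell left j u) d  = flankCells-⊆ up right j 0 n (flankCells-∈ up left j 0 n u z≤n d)

      allCells-∈ : ∀ K j m x → j ≤ strip x → strip x ≤ j ℕ.+ m → distance x ≤ n → x ∈ allCells K j m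
      allCells-∈ K j zero x l l′ d = last x (trans (ℕP.≤-antisym l′ (subst (_≤ strip x) (sym (ℕP.+-identityʳ j)) l)) (ℕP.+-identityʳ j)) d
        where
        last : ∀ x → strip x ≡ j → distance x ≤ n → x ∈ axis j ∷ line right j 0 n (line left j 0 n [])
        last (axis _)         refl d = here refl
        last (cell right _ u) refl d = there (line-∈ right j 0 n u z≤n d)
        last (cell left _ u)  refl d = there (line-⊆ right j 0 n (line-∈ left j 0 n u z≤n d))
      allCells-∈ K j (suc m) x l l′ d with j ℕ.≟ strip x
      ... | yes refl = stripCells-∈ K x d
      ... | no ne    = stripCells-⊆ K j (allCells-∈ (opposite K) (suc j) m x (ℕP.≤∧≢⇒< l ne) (subst (strip x ≤_) (ℕP.+-suc j m) l′) d)

      target-strip : ∀ e → strip (source e) ≤ strip (target e) × strip (target e) ≤ suc (strip (source e))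
      target-strip (axis j , base)             = ℕP.n≤1+n _ , ℕP.≤-refl
      target-strip (axis j , westSide)         = ℕP.≤-refl , ℕP.n≤1+n _
      target-strip (axis j , eastSide)         = ℕP.≤-refl , ℕP.n≤1+n _
      target-strip (cell s j u , base)         = ℕP.n≤1+n _ , ℕP.≤-refl
      target-strip (cell right j u , eastSide) = ℕP.≤-refl , ℕP.n≤1+n _
      target-strip (cell left j u , westSide)  = ℕP.≤-refl , ℕP.n≤1+n _
      target-strip (cell right j zero , westSide)    = ℕP.≤-refl , ℕP.n≤1+n _
      target-strip (cell left j zero , eastSide)     = ℕP.≤-refl , ℕP.n≤1+n _
      target-strip (cell right j (suc u) , westSide) = ℕP.≤-refl , ℕP.n≤1+n _
      target-strip (cell left j (suc u) , eastSide)  = ℕP.≤-refl , ℕP.n≤1+n _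

      target-distance : ∀ e → distance (source e) < n → distance (target e) ≤ n
      target-distance (axis j , base)             d = z≤n
      target-distance (axis j , westSide)         d = z≤n
      target-distance (axis j , eastSide)         d = z≤n
      target-distance (cell s j u , base)         l = ℕP.<⇒≤ l
      target-distance (cell right j u , eastSide) l = l
      target-distance (cell left j u , westSide)  l = l
      target-distance (cell right j zero , westSide)    d = z≤n
      target-distance (cell left j zero , eastSide)     d = z≤n
      target-distance (cell right j (suc u) , westSide) l = ℕP.<⇒≤ (ℕP.<⇒≤ l)
      target-distance (cell left j (suc u) , eastSide)  l = ℕP.<⇒≤ (ℕP.<⇒≤ l)

      zeros : ∀ {m} → Vec Bool m
      zeros = replicate _ false

      zeros-match : ∀ K s j u r → Matches K 0 s j u r zeros (λ _ → 0)
      zeros-match K  s j u zero    = refl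
      zeros-match dn s j u (suc r) = refl , zeros-match up s j (suc u) r
      zeros-match up s j u (suc r) = refl , zeros-match dn s j (suc u) r

    module _ (n : ℕ) (0<n : 0 < n) (m : ℕ) (R : Region) (ω : ℚ)
      (unique : Unique (cells R))
      (located : ∀ {c} → c ∈ cells R → ∃ λ x → embed x ≡ c × strip x < m × distance x < n)
      where

      present : Cellᴳ → Bool
      present x = does (embed x ∈? cells R)

      open Grid n present ω
      open Covering n 0<n present ω

      M-count² : (∀ e → kindOf (source e) ≡ up → embed (source e) ∈ cells R → embed (target e) ∈ cells R →
                   weight R (lozengeOf e) ≡ weightᴳ e) →
        M R ≡ count² {n} ω κ (rows² 0 m) false zeros zeros
      M-count² weights = begin
        M R ≡⟨ M-Q R (map embed K) (λ i → subst (_∈ map embed K) (proj₁ (proj₂ (located i))) (∈-map⁺ embed (in-K i))) ⟩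
        D.Q (weight R) (lozengesIn (cells R)) (map embed K) (λ _ → 0)
          ≡⟨ D.Q-↭ (weight R) (map embed K) (∼bag⇒↭ (unique∧set⇒bag (unique-lozengesIn (cells R) unique)
               (UniqueP.map⁺ lozengeOf-injective (UniqueP.filter⁺ good? (all-unique κ 0 m))) (mk⇔ to from))) (λ _ → 0) ⟩
        D.Q (weight R) (map lozengeOf (filter good? E)) (map embed K) (λ _ → 0)
          ≡⟨ T.Q-map (weight R) (filter good? E) K (λ _ → 0) (All.tabulate λ {e} i → let q = kind (proj₁ (∈-filter⁻ good? i)) in
               sym (embed-up (source e) q) , embed-target e q) ⟩
        Q (weight R ∘ lozengeOf) (filter good? E) K (λ _ → 0)
          ≡⟨ Q-weights (filter good? E) K (λ _ → 0) (All.tabulate λ {e} i → let (j , (g , h)) = ∈-filter⁻ good? {xs = E} i in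
               weights e (kind j) g h) ⟩
        Q weightᴳ (filter good? E) K (λ _ → 0) ≡⟨ Q-filter weightᴳ good? E K (λ _ → 0) (All.tabulate useful) ⟩
        Q weightᴳ E K (λ _ → 0)
          ≡⟨ Q-count² (λ s j → dec-false (_ ∈? cells R) (λ i → far {s} {j} (located i)))
               m κ 0 false zeros zeros (λ _ → 0) (axis-free κ) (dec-false (_ ∈? cells R) (λ i → ℕP.<-irrefl refl (low {axis m} (located i))))
               (λ s v → dec-false (_ ∈? cells R) (λ i → ℕP.<-irrefl refl (low {cell s m v} (located i))))
               (zeros-match κ right 0 0 n) (zeros-match κ left 0 0 n) refl (λ _ _ → refl) ⟩
        _ ∎
        where
        module D = Regional.D (cells R) (weight R)
        K = allCells κ 0 m
        E = allEdges κ 0 m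
        module T = Transport _≟ᴳ_ _≟ᶜ_ source target upCell downCell (λ c → does (c ∈? cells R)) embed lozengeOf embed-injective
        Good : Edge → Set
        Good e = embed (source e) ∈ cells R × embed (target e) ∈ cells R
        good? : ∀ e → Dec (Good e)
        good? e = (embed (source e) ∈? cells R) ×-dec (embed (target e) ∈? cells R)
        inside : ∀ {e} → e ∈ E → Inner 0 m e
        inside = All.lookup (inner-all κ 0 m refl)
        kind : ∀ {e} → e ∈ E → kindOf (source e) ≡ up
        kind i = proj₁ (inside i)
        in-K : ∀ {c} (i : c ∈ cells R) → proj₁ (located i) ∈ K
        in-K i = let (x , _ , l , d) = located i in allCells-∈ κ 0 m x z≤n (ℕP.<⇒≤ l) (ℕP.<⇒≤ d)
        far : ∀ {s j} → ∃ (λ x → embed x ≡ embed (cell s j n) × strip x < m × distance x < n) → ⊥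
        far (x , e , l , d) with embed-injective {x} e
        ... | refl = ℕP.<-irrefl refl d
        low : ∀ {y} → ∃ (λ x → embed x ≡ embed y × strip x < m × distance x < n) → strip y < m
        low (x , e , l , d) = subst (λ y → strip y < m) (embed-injective {x} e) l
        axis-free : ∀ κ → UpAxisFree κ false
        axis-free dn = refl
        axis-free up = tt
        to : ∀ {l} → l ∈ lozengesIn (cells R) → l ∈ map lozengeOf (filter good? E)
        to {l} i with ∈-lozengesIn⁻ (cells R) {l} i
        to {lozenge P side} i | u , d with located u
        ... | x , e , b , c = subst (_∈ _) l≡ (∈-map⁺ lozengeOf (∈-filter⁺ good? (all-∈ κ 0 m x side refl q z≤n b c)
                (subst (_∈ cells R) (sym e) u , subst (_∈ cells R) (trans (cong (λ P → downCell (lozenge P side)) (sym P≡)) (embed-target (x , side) q)) d)))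
          where
          q = up-△ x e
          P≡ : point x ≡ P
          P≡ with trans (sym (embed-up x q)) e
          ... | refl = refl
          l≡ : lozenge (point x) side ≡ lozenge P side
          l≡ = cong (λ P → lozenge P side) P≡
        from : ∀ {l} → l ∈ map lozengeOf (filter good? E) → l ∈ lozengesIn (cells R)
        from i with ∈-map⁻ lozengeOf i
        ... | e , j , refl with ∈-filter⁻ good? {xs = E} j
        ...   | k , (g , h) = ∈-lozengesIn⁺ (cells R) (subst (_∈ cells R) (embed-up (source e) (kind k)) g)
                                (subst (_∈ cells R) (sym (embed-target e (kind k))) h)
        useful : ∀ {e} → e ∈ E → Good e ⊎ Useless K e
        useful {e} i = decide (embed (source e) ∈? cells R) (embed (target e) ∈? cells R)
          where
          decide : Dec (embed (source e) ∈ cells R) → Dec (embed (target e) ∈ cells R) → Good e ⊎ Useless K e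
          decide (yes g) (yes h) = inj₁ (g , h)
          decide (no g)  _ = let (u , l , l′ , d) = inside i in
            inj₂ (inj₁ (allCells-∈ κ 0 m (source e) z≤n (ℕP.<⇒≤ l′) (ℕP.<⇒≤ d) , dec-false (embed (source e) ∈? cells R) g))
          decide (yes _) (no h)  = let (u , l , l′ , d) = inside i in
            inj₂ (inj₂ (allCells-∈ κ 0 m (target e) z≤n (ℕP.≤-trans (proj₂ (target-strip e)) l′) (target-distance e d) ,
              dec-false (embed (target e) ∈? cells R) h))

module OneSided where

  open Transfer
  open Rows
  open import Data.Bool using (Bool; true; false; not; _∧_; _xor_; if_then_else_)
  open import Data.Bool.Properties using (not-involutive)
  open import Data.List using (List; []; _∷_; map)
  open import Data.Nat as ℕ using (ℕ; zero; suc)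
  import Data.Nat.Properties as ℕP
  open import Data.Product using (_×_; _,_; proj₁; proj₂; ∃)
  open import Data.Rational using (ℚ; 0ℚ; 1ℚ; ½; _+_; _*_)
  open import Data.Rational.Properties using (*-zeroˡ; +-identityʳ; +-identityˡ; *-identityˡ)
  open import Data.Vec using (Vec; []; _∷_; replicate)
  open import Function using (_∘_)
  open import Relation.Binary.PropositionalEquality
  open ≡-Reasoning

  falses : ∀ {m} → Vec Bool m
  falses = replicate _ false

  scan-0 : ∀ {n} K (ps : Vec Bool n) c ts → scan K ps c ts (λ _ → 0ℚ) ≡ 0ℚ
  scan-0 K ps c ts = trans (scan-cong K ps c ts (λ _ → sym (*-zeroˡ 0ℚ)))
    (trans (scan-* K ps c ts 0ℚ (λ _ → 0ℚ)) (*-zeroˡ (scan K ps c ts (λ _ → 0ℚ))))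

  absent-up : ∀ n f → scan up (falses {n}) true falses f ≡ f falses
  absent-dn : ∀ n f → scan dn (falses {n}) false falses f ≡ f falses
  absent-up zero    f = refl
  absent-up (suc n) f = trans (⟦⟧-one (false , false) (λ x → scan dn (falses {n}) (proj₂ x) falses (f ∘ (proj₁ x ∷_)))) (absent-dn n (f ∘ (false ∷_)))
  absent-dn zero    f = refl
  absent-dn (suc n) f = trans (⟦⟧-one true (λ r → scan up (falses {n}) r falses f)) (absent-up n f)

  blocked-up : ∀ n ts f → scan up (falses {n}) false ts f ≡ 0ℚ
  blocked-up zero    [] f = refl
  blocked-up (suc n) ts f = refl

  blocked-dn : ∀ n ts f → scan dn (falses {n}) true ts f ≡ 0ℚ
  blocked-dn zero    []       f = refl
  blocked-dn (suc n) (t ∷ ts) f = refl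

  module _ {n : ℕ} where

    oneSided : Row {n} → Row² {n}
    oneSided (p , r) = p , r , falses

    count²-oneSided : ∀ K rs τ ts → count² {n} ½ K (map oneSided rs) τ ts falses ≡ count {n} K rs τ ts
    count²-oneSided K  [] true  ts = refl
    count²-oneSided K  [] false ts = trans (cong (vacant {n} ts *_) (vacant-falses (downs K n))) (Data.Rational.Properties.*-identityʳ _)
      where
      vacant-falses : ∀ m → vacant {n} (falses {m}) ≡ 1ℚ
      vacant-falses zero    = refl
      vacant-falses (suc m) = vacant-falses m
    count²-oneSided dn ((p , r) ∷ rs) τ ts = axisCase p
      where
      A : Bool × Bits → ℚ
      A x = scan dn r (proj₁ (proj₂ x)) ts λ bs → scan dn (falses {n}) (proj₂ (proj₂ x)) falses λ ds → count² {n} ½ up (map oneSided rs) (proj₁ x) bs ds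
      B : Bits → ℚ
      B x = scan dn r (proj₂ x) ts (count {n} up rs (proj₁ x))
      same : ∀ τ c → A (τ , (c , false)) ≡ B (τ , c)
      same τ c = scan-cong dn r c ts λ bs → trans (absent-dn n (count² {n} ½ up (map oneSided rs) τ bs)) (count²-oneSided up rs τ bs)
      none : ∀ τ c → A (τ , (c , true)) ≡ 0ℚ
      none τ c = trans (scan-cong dn r c ts λ bs → blocked-dn n falses (count² {n} ½ up (map oneSided rs) τ bs)) (scan-0 dn r c ts)
      axisCase : ∀ p → ⟦ axisUp² {n} ½ p ⟧ A ≡ ⟦ axisUp {n} p ⟧ B
      axisCase true  = cong₂ (λ a b → 1ℚ * a + b) (same false true)
        (trans (cong₂ (λ a b → 1ℚ * a + (½ * b + 0ℚ)) (none false false) (same true false)) (+-identityˡ _))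
      axisCase false = cong (λ a → 1ℚ * a + 0ℚ) (same false false)
    count²-oneSided up ((p , r) ∷ rs) τ ts = axisCase p τ
      where
      A : Bits → ℚ
      A x = scan up r (proj₁ x) ts λ bs → scan up (falses {n}) (proj₂ x) falses λ ds → count² {n} ½ dn (map oneSided rs) false bs ds
      B : Bool → ℚ
      B c = scan up r c ts (count {n} dn rs false)
      same : ∀ c → A (c , true) ≡ B c
      same c = scan-cong up r c ts λ bs → trans (absent-up n (count² {n} ½ dn (map oneSided rs) false bs)) (count²-oneSided dn rs false bs)
      none : ∀ c → A (c , false) ≡ 0ℚ
      none c = trans (scan-cong up r c ts λ bs → blocked-up n falses (count² {n} ½ dn (map oneSided rs) false bs)) (scan-0 up r c ts)
      axisCase : ∀ p τ → ⟦ axisDown² {n} p τ ⟧ A ≡ ⟦ axisDown {n} p τ ⟧ B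
      axisCase true  true  = cong (λ a → 1ℚ * a + 0ℚ) (same true)
      axisCase true  false = cong₂ (λ a b → 1ℚ * a + b) (same false) (cong (λ a → 1ℚ * a + 0ℚ) (none true))
      axisCase false true  = refl
      axisCase false false = cong (λ a → 1ℚ * a + 0ℚ) (same true)

  data Paired : ∀ {n} → Vec Bool n → Set where
    []     : Paired []
    single : Paired (false ∷ [])
    pair   : ∀ {n} p {ps : Vec Bool n} → Paired ps → Paired (p ∷ p ∷ ps)

  falses-paired : ∀ n → Paired (falses {n})
  falses-paired 0             = []
  falses-paired 1             = single
  falses-paired (suc (suc n)) = pair false (falses-paired n)

  -- With no lozenge crossing the north side, every pair of the first strip
  -- is a lozenge; likewise for the south side.
  top-dn : ∀ {n} {ps : Vec Bool n} → Paired ps → ∀ f → scan dn ps false falses f ≡ f falses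
  top-up : ∀ {n} {p} {ps : Vec Bool n} → Paired (p ∷ ps) → ∀ f → scan up ps (not p) falses f ≡ f falses
  top-dn []              f = refl
  top-dn single          f = ⟦⟧-one true (λ r → scan up [] r falses f)
  top-dn (pair true {ps} q)  f = trans (⟦⟧-one false (λ r → scan up (true ∷ ps) r falses f)) (top-up (pair true q) f)
  top-dn (pair false {ps} q) f = trans (⟦⟧-one true (λ r → scan up (false ∷ ps) r falses f)) (top-up (pair false q) f)
  top-up single          f = refl
  top-up (pair true {ps} q)  f = trans (⟦⟧-one (false , false) (λ x → scan dn ps (proj₂ x) falses (f ∘ (proj₁ x ∷_)))) (top-dn q (f ∘ (false ∷_)))
  top-up (pair false {ps} q) f = trans (⟦⟧-one (false , false) (λ x → scan dn ps (proj₂ x) falses (f ∘ (proj₁ x ∷_)))) (top-dn q (f ∘ (false ∷_)))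

  module _ {n : ℕ} where

    vac : ∀ {m} → Vec Bool m → ℚ
    vac = vacant {n}

    bottom-up : ∀ {m} {ps : Vec Bool m} → Paired ps → ∀ ts → scan up ps true ts vac ≡ vac ts
    bottom-dn : ∀ {m} {p} {ps : Vec Bool m} → Paired (p ∷ ps) → ∀ ts → scan dn ps p ts vac ≡ vac ts
    bottom-up []     [] = refl
    bottom-up single [] = trans (⟦⟧-one (false , false) (λ x → scan dn [] (proj₂ x) [] (λ bs → vac (proj₁ x ∷ bs)))) refl
    bottom-up (pair {m} true {ps} q) ts = begin
      1ℚ * scan dn (true ∷ ps) false ts (λ _ → 0ℚ) + (1ℚ * scan dn (true ∷ ps) true ts vac + 0ℚ)
        ≡⟨ cong₂ (λ a b → 1ℚ * a + (1ℚ * b + 0ℚ)) (scan-0 dn (true ∷ ps) false ts) (bottom-dn (pair true q) ts) ⟩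
      1ℚ * 0ℚ + (1ℚ * vac ts + 0ℚ) ≡⟨ trans (+-identityˡ _) (trans (+-identityʳ _) (*-identityˡ _)) ⟩
      vac ts ∎
    bottom-up (pair {m} false {ps} q) ts = begin
      1ℚ * scan dn (false ∷ ps) false ts vac + 0ℚ ≡⟨ trans (+-identityʳ _) (*-identityˡ _) ⟩
      scan dn (false ∷ ps) false ts vac ≡⟨ bottom-dn (pair false q) ts ⟩
      vac ts ∎
    bottom-dn single [] = refl
    bottom-dn (pair {m} true {ps} q) (true ∷ ts) = refl
    bottom-dn (pair {m} true {ps} q) (false ∷ ts) = trans (⟦⟧-one true (λ r → scan up ps r ts vac)) (bottom-up q ts)
    bottom-dn (pair {m} false {ps} q) (true ∷ ts) = refl
    bottom-dn (pair {m} false {ps} q) (false ∷ ts) = trans (⟦⟧-one true (λ r → scan up ps r ts vac)) (bottom-up q ts)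

    TopPaired BottomPaired : Kind → Row {n} → Set
    TopPaired dn (p , r) = p ≡ false × Paired r
    TopPaired up (p , r) = Paired (p ∷ r)
    BottomPaired dn (p , r) = Paired (p ∷ r)
    BottomPaired up (p , r) = p ≡ false × Paired r

    count-top : ∀ K {row} rs → TopPaired K row → count {n} K (row ∷ rs) false falses ≡ count {n} (opposite K) rs false falses
    count-top dn {p , r} rs (refl , q) = trans (⟦⟧-one (false , false) (λ x → scan dn r (proj₂ x) falses (count {n} up rs (proj₁ x))))
      (top-dn q (count {n} up rs false))
    count-top up {true , r}  rs q = trans (⟦⟧-one false (λ x → scan up r x falses (count {n} dn rs false))) (top-up q (count {n} dn rs false))
    count-top up {false , r} rs q = trans (⟦⟧-one true (λ x → scan up r x falses (count {n} dn rs false))) (top-up q (count {n} dn rs false))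

    UpAxis : Kind → Bool → Set
    UpAxis dn τ = τ ≡ false
    UpAxis up τ = τ ≡ τ

    count-bottom : ∀ K {row} τ ts → UpAxis K τ → BottomPaired K row → count {n} K (row ∷ []) τ ts ≡ (if τ then 0ℚ else vac ts)
    count-bottom dn {true , r}  .false ts refl q = begin
      1ℚ * scan dn r true ts vac + (½ * scan dn r false ts (λ _ → 0ℚ) + 0ℚ)
        ≡⟨ cong₂ (λ a b → 1ℚ * a + (½ * b + 0ℚ)) (bottom-dn q ts) (scan-0 dn r false ts) ⟩
      1ℚ * vac ts + 0ℚ ≡⟨ trans (+-identityʳ _) (*-identityˡ _) ⟩
      vac ts ∎
    count-bottom dn {false , r} .false ts refl q = trans (+-identityʳ _) (trans (*-identityˡ _) (bottom-dn q ts))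
    count-bottom up {.false , r} true  ts _ (refl , q) = refl
    count-bottom up {.false , r} false ts _ (refl , q) = trans (+-identityʳ _) (trans (*-identityˡ _) (bottom-up q ts))

    rows : (ℕ → Row {n}) → ℕ → ℕ → List (Row {n})
    rows R j zero    = []
    rows R j (suc m) = R j ∷ rows R (suc j) m

    data Comparable (R R′ : ℕ → Row {n}) : Kind → ℕ → ℕ → Set where
      []   : ∀ {K j} → Comparable R R′ K j 0
      last : ∀ {K j} → BottomPaired K (R j) → BottomPaired K (R′ j) → Comparable R R′ K j 1
      _∷_  : ∀ {K j m} → R j ≡ R′ j → Comparable R R′ (opposite K) (suc j) m → Comparable R R′ K j (suc m)

    count-comparable : ∀ {R R′} K j m τ ts → UpAxis K τ → Comparable R R′ K j m →
      count {n} K (rows R j m) τ ts ≡ count {n} K (rows R′ j m) τ ts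
    count-comparable K j .0 τ ts u [] = refl
    count-comparable K j .1 τ ts u (last q q′) = trans (count-bottom K τ ts u q) (sym (count-bottom K τ ts u q′))
    count-comparable {R} {R′} dn j (suc m) τ ts u (e ∷ c) rewrite e = ⟦⟧-cong (axisUp {n} (proj₁ (R′ j))) λ x →
      scan-cong dn (proj₂ (R′ j)) (proj₂ x) ts λ bs → count-comparable up (suc j) m (proj₁ x) bs refl c
    count-comparable {R} {R′} up j (suc m) τ ts u (e ∷ c) rewrite e = ⟦⟧-cong (axisDown {n} (proj₁ (R′ j)) τ) λ x →
      scan-cong up (proj₂ (R′ j)) x ts λ bs → count-comparable dn (suc j) m false bs refl c

    -- Whether the next axis cell goes to the first half, in terms of the
    -- parity π of the number of axis cells met before.
    phase : Kind → Bool → Bool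
    phase dn π = not π
    phase up π = π

    trues : (ℕ → Bool) → ℕ → ℕ → ℕ
    trues a j zero    = 0
    trues a j (suc m) = (if a j then 1 else 0) ℕ.+ trues a (suc j) m

    bitℕ : Bool → ℕ
    bitℕ false = 0
    bitℕ true  = 1

    oddℕ : ℕ → Bool
    oddℕ zero    = false
    oddℕ (suc k) = not (oddℕ k)

    distribute : ∀ (a own : ℕ → Bool) (v : ℕ → Vec Bool n) →
      (∀ j → own (suc j) ≡ (if a j then own j else not (own j))) →
      ∀ K π j m → phase K π ≡ own j →
      ∃ λ e → Halving {n} K π (rows (λ j → a j , v j) j m) (rows (λ j → a j ∧ own j , v j) j m) (rows (λ j → a j ∧ not (own j) , v j) j m) e
            × e ℕ.+ e ℕ.+ bitℕ π ≡ trues a j m ℕ.+ bitℕ (π xor oddℕ (trues a j m))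
    distribute a own v h K π j zero q = 0 , [] , cong bitℕ (sym (xor-false π))
      where
      xor-false : ∀ π → π xor false ≡ π
      xor-false true  = refl
      xor-false false = refl
    distribute a own v h K π j (suc m) q with a j | own j | h j
    distribute a own v h K π j (suc m) q | false | o | h′
      with distribute a own v h (opposite K) π (suc j) m (trans (flip K π q) (sym h′))
      where
      flip : ∀ K π → phase K π ≡ o → phase (opposite K) π ≡ not o
      flip dn π refl = sym (not-involutive π)
      flip up π refl = refl
    ... | e , H , t = e , gap (v j) H , t
    distribute a own v h dn false j (suc m) refl | true | .true | h′
      with distribute a own v h up true (suc j) m (sym h′)
    ... | e , H , t = suc e , dn₁ (v j) H , trans (arith e) (trans (cong suc t) (cong (λ b → suc (trues a (suc j) m ℕ.+ bitℕ b)) refl))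
      where
      arith : ∀ e → suc e ℕ.+ suc e ℕ.+ 0 ≡ suc (e ℕ.+ e ℕ.+ 1)
      arith e rewrite ℕP.+-suc e e | ℕP.+-identityʳ (e ℕ.+ e) | ℕP.+-comm (e ℕ.+ e) 1 = refl
    distribute a own v h dn true j (suc m) refl | true | .false | h′
      with distribute a own v h up false (suc j) m (sym h′)
    ... | e , H , t = e , dn₂ (v j) H , trans (ℕP.+-suc (e ℕ.+ e) 0) (cong suc (trans t (cong (λ b → trues a (suc j) m ℕ.+ bitℕ b) (sym (not-involutive _)))))
    distribute a own v h up false j (suc m) refl | true | .false | h′
      with distribute a own v h dn true (suc j) m (sym h′)
    ... | e , H , t = suc e , up₂ (v j) H , trans (arith e) (cong suc t)
      where
      arith : ∀ e → suc e ℕ.+ suc e ℕ.+ 0 ≡ suc (e ℕ.+ e ℕ.+ 1)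
      arith e rewrite ℕP.+-suc e e | ℕP.+-identityʳ (e ℕ.+ e) | ℕP.+-comm (e ℕ.+ e) 1 = refl
    distribute a own v h up true j (suc m) refl | true | .true | h′
      with distribute a own v h dn false (suc j) m (sym h′)
    ... | e , H , t = e , up₁ (v j) H , trans (ℕP.+-suc (e ℕ.+ e) 0) (cong suc (trans t (cong (λ b → trues a (suc j) m ℕ.+ bitℕ b) (sym (not-involutive _)))))

module Factorizing where

  open Transfer
  open Rows
  open Coverings
  open Grids
  open TilingSums
  open Embeddings
  open OneSided
  open import Relation.Nullary using (does)
  open import Defs
  open import Data.List.Membership.DecPropositional _≟ᶜ_ using (_∈?_)
  open import Data.Bool using (Bool; true; false; not; _∧_; _xor_; if_then_else_)
  open import Data.Integer as ℤ using (ℤ; +_)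
  import Data.Integer.Properties as ℤP
  open import Data.List using (List; []; _∷_; map)
  open import Data.List.Membership.Propositional using (_∈_)
  open import Data.List.Relation.Unary.Unique.Propositional using (Unique)
  open import Data.Nat as ℕ using (ℕ; zero; suc; _<_; _≤_; z≤n; s≤s; _^_)
  import Data.Nat.Properties as ℕP
  open import Data.Product using (_×_; _,_; proj₁; proj₂; ∃)
  open import Data.Rational using (ℚ; 1ℚ; ½; _+_; _*_; _/_)
  open import Data.Rational.Properties as ℚP using (+-identityʳ; *-identityˡ; *-distribʳ-+)
  open import Data.Sum using (_⊎_; inj₁; inj₂)
  open import Data.Vec using (Vec; []; _∷_)
  open import Relation.Binary.PropositionalEquality
  import Data.Rational.Unnormalised as ℚᵘ
  import Data.Rational.Unnormalised.Properties as ℚᵘP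
  open ≡-Reasoning

  /1-+ : ∀ a b → + (a ℕ.+ b) / 1 ≡ (+ a / 1) + (+ b / 1)
  /1-+ a b = sym (ℚP.toℚᵘ-injective (ℚᵘP.≃-trans (ℚP.toℚᵘ-homo-+ (+ a / 1) (+ b / 1))
    (ℚᵘP.≃-trans (ℚᵘP.+-cong (ℚP.toℚᵘ-fromℚᵘ (ℚᵘ.mkℚᵘ (+ a) 0)) (ℚP.toℚᵘ-fromℚᵘ (ℚᵘ.mkℚᵘ (+ b) 0)))
    (ℚᵘP.≃-trans (ℚᵘ.*≡* (cong (ℤ._* + 1) (trans (cong₂ ℤ._+_ (ℤP.*-identityʳ (+ a)) (ℤP.*-identityʳ (+ b))) refl)))
      (ℚᵘP.≃-sym (ℚP.toℚᵘ-fromℚᵘ (ℚᵘ.mkℚᵘ (+ (a ℕ.+ b)) 0)))))))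

  power-2^ : ∀ {n} e → + (2 ^ e) / 1 ≡ power {n} e
  power-2^ zero    = refl
  power-2^ {n} (suc e) = begin
    + (2 ^ e ℕ.+ (2 ^ e ℕ.+ 0)) / 1     ≡⟨ cong (λ k → + (2 ^ e ℕ.+ k) / 1) (ℕP.+-identityʳ (2 ^ e)) ⟩
    + (2 ^ e ℕ.+ 2 ^ e) / 1             ≡⟨ /1-+ (2 ^ e) (2 ^ e) ⟩
    (+ (2 ^ e) / 1) + (+ (2 ^ e) / 1)   ≡⟨ cong₂ _+_ (sym (*-identityˡ (+ (2 ^ e) / 1))) (sym (*-identityˡ (+ (2 ^ e) / 1))) ⟩
    1ℚ * (+ (2 ^ e) / 1) + 1ℚ * (+ (2 ^ e) / 1) ≡⟨ *-distribʳ-+ (+ (2 ^ e) / 1) 1ℚ 1ℚ ⟨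
    2ℚ {n} * (+ (2 ^ e) / 1)            ≡⟨ cong (2ℚ {n} *_) (power-2^ {n} e) ⟩
    power {n} (suc e)                   ∎

  odd-double : ∀ {n} N → oddℕ {n} (N ℕ.+ N) ≡ false
  odd-double zero    = refl
  odd-double {n} (suc N) rewrite ℕP.+-suc N N = trans (not-not (oddℕ {n} (N ℕ.+ N))) (odd-double {n} N)
    where
    not-not : ∀ b → not (not b) ≡ b
    not-not true  = refl
    not-not false = refl

  halve-injective : ∀ {a b} → a ℕ.+ a ≡ b ℕ.+ b → a ≡ b
  halve-injective {zero}  {zero}  e = refl
  halve-injective {suc a} {suc b} e = cong suc (halve-injective
    (ℕP.suc-injective (ℕP.suc-injective (trans (sym (cong suc (ℕP.+-suc a a))) (trans e (cong suc (ℕP.+-suc b b)))))))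

  comparable : ∀ {n} {R R′ : ℕ → Row {n}} κ j m →
    (∀ i → j ≤ i → i < j ℕ.+ m → R i ≡ R′ i ⊎ (suc i ≡ j ℕ.+ m × BottomPaired (kindAt κ i) (R i) × BottomPaired (kindAt κ i) (R′ i))) →
    Comparable R R′ (kindAt κ j) j m
  comparable κ j zero    h = []
  comparable {R = R} {R′} κ j (suc m) h with h j ℕP.≤-refl (ℕP.m<m+n j (s≤s z≤n))
  ... | inj₁ e = e ∷ subst (λ K → Comparable R R′ K (suc j) m) (kindAt-opposite κ j)
        (comparable κ (suc j) m λ i l l′ → subst (λ k → R i ≡ R′ i ⊎ (suc i ≡ k × BottomPaired (kindAt κ i) (R i) × BottomPaired (kindAt κ i) (R′ i))) (ℕP.+-suc j m) (h i (ℕP.<⇒≤ l) (subst (i <_) (sym (ℕP.+-suc j m)) l′)))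
  ... | inj₂ (e , b , b′) with ℕP.+-cancelˡ-≡ j 1 (suc m) (trans (ℕP.+-comm j 1) e)
  ...   | refl = last b b′

  module _ (n : ℕ) where

    parity-falses : ∀ m → parity (falses {m}) ≡ false
    parity-falses zero    = refl
    parity-falses (suc m) = parity-falses m

    rotate-falses : ∀ {m} (f : Vec Bool m → Vec Bool m → ℚ) → rotate f falses falses ≡ f falses falses
    rotate-falses {zero}  f = refl
    rotate-falses {suc m} f = trans (cong (λ π → ⟦ mix π (false , false) ⟧ (λ x → rotate (λ v w → f (proj₁ x ∷ v) (proj₂ x ∷ w)) (falses {m}) falses)) (cong₂ _xor_ (parity-falses m) (parity-falses m)))
      (trans (⟦⟧-one (false , false) (λ x → rotate (λ v w → f (proj₁ x ∷ v) (proj₂ x ∷ w)) (falses {m}) falses)) (rotate-falses (λ v w → f (false ∷ v) (false ∷ w))))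

    factor : ∀ κ {rs rs₁ rs₂ e} → Halving {n} κ false rs rs₁ rs₂ e →
      count² {n} 1ℚ κ (map double rs) false falses falses ≡ power {n} e * (count {n} κ rs₁ false falses * count {n} κ rs₂ false falses)
    factor dn {rs₁ = rs₁} {rs₂} {e} H = trans (halving-factors H falses falses (cong₂ _xor_ (parity-falses (downs dn n)) (parity-falses (downs dn n))))
      (cong (power {n} e *_) (rotate-falses (_⊗_ {n} (count {n} dn rs₁ false) (count {n} dn rs₂ false))))
    factor up {rs₁ = rs₁} {rs₂} {e} H = trans (halving-factors H false falses falses (cong₂ _xor_ (parity-falses (downs up n)) (parity-falses (downs up n))))
      (cong (power {n} e *_) (trans (*-identityˡ _) (rotate-falses (_⊗_ {n} (count {n} up rs₁ false) (count {n} up rs₂ false)))))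

  module Factorization (κ : Kind) (top : ℤ) (n : ℕ) (0<n : 0 < n) (m : ℕ) where

    module In (shift : ℤ) (R : Region) where

      open Embedding top shift κ public

      Located : Set
      Located = ∀ {c} → c ∈ cells R → ∃ λ x → embed x ≡ c × strip x < m × distance x < n

      at : Cellᴳ → Bool
      at x = does (embed x ∈? cells R)

      Weights : ℚ → Set
      Weights ω = ∀ e → kindOf (source e) ≡ up → embed (source e) ∈ cells R → embed (target e) ∈ cells R →
        weight R (lozengeOf e) ≡ Grid.weightᴳ n at ω e

      row : ℕ → Row {n}
      row j = at (axis j) , Grid.presence n at 1ℚ right j 0 n

    presence-ω : ∀ p ω ω′ s j u r → Grid.presence n p ω s j u r ≡ Grid.presence n p ω′ s j u r
    presence-ω p ω ω′ s j u zero    = refl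
    presence-ω p ω ω′ s j u (suc r) = cong (p (cell s j u) ∷_) (presence-ω p ω ω′ s j (suc u) r)

    presence-cong : ∀ {p p′} ω s s′ j u r → (∀ u → p (cell s j u) ≡ p′ (cell s′ j u)) → Grid.presence n p ω s j u r ≡ Grid.presence n p′ ω s′ j u r
    presence-cong ω s s′ j u zero    h = refl
    presence-cong ω s s′ j u (suc r) h = cong₂ _∷_ (h u) (presence-cong ω s s′ j (suc u) r h)

    presence-absent : ∀ {p} ω s j u r → (∀ u → p (cell s j u) ≡ false) → Grid.presence n p ω s j u r ≡ falses
    presence-absent ω s j u zero    h = refl
    presence-absent ω s j u (suc r) h = cong₂ _∷_ (h u) (presence-absent ω s j (suc u) r h)

    rows²-map : ∀ p ω (f : Row {n} → Row² {n}) (R : ℕ → Row {n}) j m →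
      (∀ j → (p (axis j) , Grid.presence n p ω right j 0 n , Grid.presence n p ω left j 0 n) ≡ f (R j)) →
      Grid.rows² n p ω j m ≡ map f (rows R j m)
    rows²-map p ω f R j zero    h = refl
    rows²-map p ω f R j (suc m) h = cong₂ _∷_ (h j) (rows²-map p ω f R (suc j) m h)

    module Half (shift : ℤ) (R : Region) (unique : Unique (cells R)) (located : In.Located shift R) (weights : In.Weights shift R ½)
      (flat : ∀ j u → In.at shift R (cell left j u) ≡ false) where

      open In shift R

      M-count : M R ≡ count {n} κ (rows row 0 m) false falses
      M-count = begin
        M R ≡⟨ M-count² n 0<n m R ½ unique located weights ⟩
        count² {n} ½ κ (Grid.rows² n at ½ 0 m) false falses falses
          ≡⟨ cong (λ rs → count² {n} ½ κ rs false falses falses) (rows²-map at ½ oneSided row 0 m λ j →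
               cong₂ (λ r l → at (axis j) , r , l) (presence-ω at ½ 1ℚ right j 0 n) (presence-absent ½ left j 0 n (flat j))) ⟩
        count² {n} ½ κ (map oneSided (rows row 0 m)) false falses falses ≡⟨ count²-oneSided κ (rows row 0 m) false falses ⟩
        _ ∎

    UpAxis-false : ∀ K → UpAxis {n} K false
    UpAxis-false dn = refl
    UpAxis-false up = refl

    count-same : ∀ (R R′ : ℕ → Row {n}) →
      (∀ j → j < m → R j ≡ R′ j ⊎ (j ≡ 0 × TopPaired κ (R j) × TopPaired κ (R′ j))
                                ⊎ (suc j ≡ m × BottomPaired (kindAt κ j) (R j) × BottomPaired (kindAt κ j) (R′ j))) →
      count {n} κ (rows R 0 m) false falses ≡ count {n} κ (rows R′ 0 m) false falses
    count-same R R′ = go m refl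
      where
      Row≈ : ℕ → ℕ → Set
      Row≈ m j = R j ≡ R′ j ⊎ (j ≡ 0 × TopPaired κ (R j) × TopPaired κ (R′ j))
                            ⊎ (suc j ≡ m × BottomPaired (kindAt κ j) (R j) × BottomPaired (kindAt κ j) (R′ j))
      go : ∀ m′ → m′ ≡ m → (∀ j → j < m′ → Row≈ m′ j) → count {n} κ (rows R 0 m′) false falses ≡ count {n} κ (rows R′ 0 m′) false falses
      go zero     _ h = refl
      go (suc m′) _ h with h 0 (s≤s z≤n)
      ... | inj₂ (inj₁ (_ , t , t′)) = begin
        _ ≡⟨ count-top κ (rows R 1 m′) t ⟩
        count {n} (opposite κ) (rows R 1 m′) false falses
          ≡⟨ count-comparable (opposite κ) 1 m′ false falses (UpAxis-false (opposite κ)) (comparable κ 1 m′ below1) ⟩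
        count {n} (opposite κ) (rows R′ 1 m′) false falses ≡⟨ count-top κ (rows R′ 1 m′) t′ ⟨
        _ ∎
        where
        below1 : ∀ i → 1 ≤ i → i < suc m′ → R i ≡ R′ i ⊎ (suc i ≡ suc m′ × BottomPaired (kindAt κ i) (R i) × BottomPaired (kindAt κ i) (R′ i))
        below1 (suc i) _ l with h (suc i) l
        ... | inj₁ e = inj₁ e
        ... | inj₂ (inj₂ b) = inj₂ b
      ... | inj₁ e = count-comparable κ 0 (suc m′) false falses (UpAxis-false κ) (comparable κ 0 (suc m′) all)
        where
        all : ∀ i → 0 ≤ i → i < suc m′ → R i ≡ R′ i ⊎ (suc i ≡ suc m′ × BottomPaired (kindAt κ i) (R i) × BottomPaired (kindAt κ i) (R′ i))
        all zero _ l = inj₁ e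
        all (suc i) _ l with h (suc i) l
        ... | inj₁ e = inj₁ e
        ... | inj₂ (inj₂ b) = inj₂ b
      ... | inj₂ (inj₂ b) = count-comparable κ 0 (suc m′) false falses (UpAxis-false κ) (comparable κ 0 (suc m′) all)
        where
        all : ∀ i → 0 ≤ i → i < suc m′ → R i ≡ R′ i ⊎ (suc i ≡ suc m′ × BottomPaired (kindAt κ i) (R i) × BottomPaired (kindAt κ i) (R′ i))
        all zero _ l = inj₂ b
        all (suc i) _ l with h (suc i) l
        ... | inj₁ e = inj₁ e
        ... | inj₂ (inj₂ b) = inj₂ b

    module Whole (S : Region) (unique : Unique (cells S)) (located : In.Located (+ 0) S) (weights : In.Weights (+ 0) S 1ℚ)
      (mirrored : ∀ j u → In.at (+ 0) S (cell left j u) ≡ In.at (+ 0) S (cell right j u)) where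

      open In (+ 0) S

      own : ℕ → Bool
      own zero    = phase {n} κ false
      own (suc j) = if at (axis j) then own j else not (own j)

      share : (Bool → Bool) → ℕ → Row {n}
      share f j = at (axis j) ∧ f (own j) , proj₂ (row j)

      M-factors : ∀ N → trues {n} (λ j → at (axis j)) 0 m ≡ N ℕ.+ N →
        M S ≡ (+ (2 ^ N) / 1) * (count {n} κ (rows (share (λ o → o)) 0 m) false falses * count {n} κ (rows (share not) 0 m) false falses)
      M-factors N t = begin
        M S ≡⟨ M-count² n 0<n m S 1ℚ unique located weights ⟩
        count² {n} 1ℚ κ (Grid.rows² n at 1ℚ 0 m) false falses falses
          ≡⟨ cong (λ rs → count² {n} 1ℚ κ rs false falses falses) (rows²-map at 1ℚ double row 0 m λ j →
               cong (λ l → at (axis j) , proj₂ (row j) , l) (presence-cong 1ℚ left right j 0 n (mirrored j))) ⟩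
        count² {n} 1ℚ κ (map double (rows row 0 m)) false falses falses ≡⟨ factor n κ H ⟩
        power {n} e * _ ≡⟨ cong (_* _) (trans (cong (power {n}) e≡N) (sym (power-2^ {n} N))) ⟩
        _ ∎
        where
        H∃ = distribute (λ j → at (axis j)) own (λ j → proj₂ (row j)) (λ _ → refl) κ false 0 m refl
        e = proj₁ H∃
        H = proj₁ (proj₂ H∃)
        e≡N : e ≡ N
        e≡N = halve-injective (begin
          e ℕ.+ e ≡⟨ ℕP.+-identityʳ (e ℕ.+ e) ⟨
          e ℕ.+ e ℕ.+ 0 ≡⟨ proj₂ (proj₂ H∃) ⟩
          T ℕ.+ bitℕ {n} (oddℕ {n} T) ≡⟨ cong (λ k → k ℕ.+ bitℕ {n} (oddℕ {n} k)) t ⟩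
          N ℕ.+ N ℕ.+ bitℕ {n} (oddℕ {n} (N ℕ.+ N)) ≡⟨ cong (λ b → N ℕ.+ N ℕ.+ bitℕ {n} b) (odd-double {n} N) ⟩
          N ℕ.+ N ℕ.+ 0 ≡⟨ ℕP.+-identityʳ (N ℕ.+ N) ⟩
          N ℕ.+ N ∎)
          where T = trues {n} (λ j → at (axis j)) 0 m

module Boxes where

  open Transfer
  open Grids
  open Embeddings
  open import Algebra.Bundles using (module AbelianGroup)
  open import Defs
  open import Data.Bool using (Bool)
  open import Data.Integer using (ℤ; +_; -[1+_]; ∣_∣; _+_; _-_; -_; _*_; _≤_; +≤+; -≤-)
  import Data.Integer.Properties as ℤP
  open import Data.Integer.Tactic.RingSolver using (solve-∀)
  open import Data.List using (List; []; _∷_; map; filter; cartesianProductWith)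
  open import Data.List.Membership.Propositional using (_∈_; find; lose)
  open import Data.List.Membership.Propositional.Properties using (∈-filter⁺; ∈-filter⁻; ∈-concatMap⁺; ∈-concatMap⁻; ∈-cartesianProductWith⁺; ∈-applyUpTo⁺)
  open import Data.List.Relation.Binary.Disjoint.Propositional using (Disjoint)
  open import Data.List.Relation.Unary.All as All using (All; []; _∷_)
  import Data.List.Relation.Unary.All.Properties as AllP
  open import Data.List.Relation.Unary.AllPairs using (AllPairs; []; _∷_)
  open import Data.List.Relation.Unary.Any using (Any; here; there)
  open import Data.List.Relation.Unary.Unique.Propositional using (Unique)
  import Data.List.Relation.Unary.Unique.Propositional.Properties as UniqueP
  open import Data.Nat as ℕ using (ℕ; zero; suc; z≤n; s≤s)
  open import Data.Nat.Divisibility using (_∣_; divides; ∣-refl)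
  import Data.Nat.Divisibility as Div
  import Data.Nat.Properties as ℕP
  open import Data.Product using (_×_; _,_; proj₂; ∃)
  open import Function using (_∘_)
  open import Relation.Binary.PropositionalEquality
  open ≡-Reasoning
  open import Algebra.Properties.Group (AbelianGroup.group ℤP.+-0-abelianGroup) using () renaming (∙-cancelˡ to +-cancelˡ)

  -- Linear arithmetic: a ≤ b is read as 0 ≤ b - a.
  Pos : ℤ → Set
  Pos e = + 0 ≤ e

  pos : ∀ {a b} → a ≤ b → Pos (b - a)
  pos = ℤP.i≤j⇒0≤j-i

  infixl 6 _⊕_
  _⊕_ : ∀ {a b} → Pos a → Pos b → Pos (a + b)
  _⊕_ = ℤP.+-mono-≤

  num : ∀ n → Pos (+ n)
  num n = +≤+ z≤n

  by : ∀ {a b e} → Pos e → e ≡ b - a → a ≤ b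
  by p refl = ℤP.0≤i-j⇒j≤i p

  ≤-difference : ∀ {a b} → a ≤ b → ∃ λ n → b - a ≡ + n
  ≤-difference l = nonNegative (pos l)
    where
    nonNegative : ∀ {e} → Pos e → ∃ λ n → e ≡ + n
    nonNegative (+≤+ {n = n} _) = n , refl

  kindℤ : ℤ → Kind
  kindℤ i = kindAt dn ∣ i ∣

  kindℤ-suc : ∀ i → kindℤ (i + + 1) ≡ opposite (kindℤ i)
  kindℤ-suc (+ n) rewrite ℕP.+-comm n 1 = kindAt-opposite dn n
  kindℤ-suc -[1+ zero ]  = refl
  kindℤ-suc -[1+ suc n ] = sym (trans (cong opposite (kindAt-opposite dn (suc n))) (opposite-involutive _))

  kindℤ-+ : ∀ i n → kindℤ (i + + n) ≡ kindAt (kindℤ i) n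
  kindℤ-+ i zero    = cong kindℤ (ℤP.+-identityʳ i)
  kindℤ-+ i (suc n) = begin
    kindℤ (i + + suc n)           ≡⟨ cong kindℤ (sym (ℤP.+-assoc i (+ 1) (+ n))) ⟩
    kindℤ ((i + + 1) + + n)       ≡⟨ kindℤ-+ (i + + 1) n ⟩
    kindAt (kindℤ (i + + 1)) n    ≡⟨ cong (λ K → kindAt K n) (kindℤ-suc i) ⟩
    kindAt (opposite (kindℤ i)) n ∎

  kindℤ-even : ∀ i n → kindℤ (i + + (n ℕ.+ n)) ≡ kindℤ i
  kindℤ-even i n = trans (kindℤ-+ i (n ℕ.+ n)) (twice n (kindℤ i))
    where
    twice : ∀ n K → kindAt K (n ℕ.+ n) ≡ K
    twice zero    K = refl
    twice (suc n) K rewrite ℕP.+-suc n n | opposite-involutive K = twice n K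

  kindℤ-cong : ∀ {i j} c → i ≡ j + + 2 * c → kindℤ i ≡ kindℤ j
  kindℤ-cong {j = j} (+ c) refl = trans (cong (λ d → kindℤ (j + d)) (double (+ c))) (kindℤ-even j c)
    where
    double : ∀ c → + 2 * c ≡ c + c
    double = solve-∀
  kindℤ-cong {i} {j} -[1+ c ] e = sym (trans (cong kindℤ (trans (back i j -[1+ c ] e) refl)) (kindℤ-even i (suc c)))
    where
    cancel : ∀ j c → j ≡ j + + 2 * c + (- c + - c)
    cancel = solve-∀
    back : ∀ i j c → i ≡ j + + 2 * c → j ≡ i + (- c + - c)
    back i j c refl = cancel j c

  kindAt-even : ∀ n → kindAt dn n ≡ dn → 2 ∣ n
  kindAt-even zero          e = Div._∣0 2
  kindAt-even (suc (suc n)) e = Div.∣m∣n⇒∣m+n (∣-refl {2}) (kindAt-even n e)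

  even-kindAt : ∀ n → 2 ∣ n → kindAt dn n ≡ dn
  even-kindAt n (divides q refl) = go q
    where
    go : ∀ q → kindAt dn (q ℕ.* 2) ≡ dn
    go zero    = refl
    go (suc q) = go q

  vertex : Cell → Point
  vertex (△ P) = P
  vertex (▽ P) = P

  interval-∈⁺ : ∀ {lo hi v} → lo ≤ v → v ≤ hi → v ∈ interval lo hi
  interval-∈⁺ {lo} {hi} {v} l h with ≤-difference l | ≤-difference (ℤP.≤-trans l h)
  ... | n , e | m , e′ = subst (_∈ interval lo hi) (back lo v (+ n) e)
      (∈-applyUpTo⁺ (λ i → lo + + i) (s≤s (subst (n ℕ.≤_) (sym (cong ∣_∣ e′)) (ℤP.drop‿+≤+ (subst₂ _≤_ e e′ (ℤP.+-monoˡ-≤ (- lo) h))))))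
    where
    cancel : ∀ lo v → lo + (v - lo) ≡ v
    cancel = solve-∀
    back : ∀ lo v n → v - lo ≡ n → lo + n ≡ v
    back lo v n refl = cancel lo v

  interval-unique : ∀ lo hi → Unique (interval lo hi)
  interval-unique lo hi = UniqueP.applyUpTo⁺₁ (λ i → lo + + i) _ λ l _ e → ℕP.<⇒≢ l (ℤP.+-injective (+-cancelˡ lo _ _ e))

  pairOfCells : Point → List Cell
  pairOfCells P = △ P ∷ ▽ P ∷ []

  boxPoints : (σ : ℤ) → (ℤ × ℤ) → (ℤ × ℤ) → List Point
  boxPoints σ (a , b) (c , d) = filter (latticeVertex? σ) (cartesianProductWith (λ k U → ⟦ U ⨾ k ⟧) (interval c d) (interval a b))

  pairOfCells-∈ : ∀ c → c ∈ pairOfCells (vertex c)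
  pairOfCells-∈ (△ P) = here refl
  pairOfCells-∈ (▽ P) = there (here refl)

  pairOfCells-vertex : ∀ {c P} → c ∈ pairOfCells P → vertex c ≡ P
  pairOfCells-vertex (here refl)         = refl
  pairOfCells-vertex (there (here refl)) = refl

  cellsInBox-∈⁺ : ∀ {σ a b c d x} → LatticeVertex σ (vertex x) → a ≤ 2u (vertex x) → 2u (vertex x) ≤ b → c ≤ k (vertex x) → k (vertex x) ≤ d →
    x ∈ cellsInBox σ (a , b) (c , d)
  cellsInBox-∈⁺ {σ} {x = x} v p q r s = ∈-concatMap⁺ pairOfCells (lose
    (∈-filter⁺ (latticeVertex? σ) (∈-cartesianProductWith⁺ (λ k U → ⟦ U ⨾ k ⟧) (interval-∈⁺ r s) (interval-∈⁺ p q)) v) (pairOfCells-∈ x))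

  cellsInBox-∈⁻ : ∀ {σ a b c d x} → x ∈ cellsInBox σ (a , b) (c , d) → LatticeVertex σ (vertex x)
  cellsInBox-∈⁻ {σ} {a} {b} {c} {d} {x} i with find (∈-concatMap⁻ pairOfCells {xs = boxPoints σ (a , b) (c , d)} i)
  ... | P , j , m = subst (LatticeVertex σ) (sym (pairOfCells-vertex m))
    (proj₂ (∈-filter⁻ (latticeVertex? σ) {xs = cartesianProductWith (λ k U → ⟦ U ⨾ k ⟧) (interval c d) (interval a b)} j))

  cellsInBox-unique : ∀ σ U k → Unique (cellsInBox σ U k)
  cellsInBox-unique σ (a , b) (c , d) = UniqueP.concat⁺ (AllP.map⁺ (All.universal (λ P → ((λ ()) ∷ []) ∷ [] ∷ []) (boxPoints σ (a , b) (c , d))))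
    (disjoint (UniqueP.filter⁺ (latticeVertex? σ) (UniqueP.cartesianProductWith⁺ (λ k U → ⟦ U ⨾ k ⟧) (λ { refl → refl , refl })
      (interval-unique c d) (interval-unique a b))))
    where
    apart : ∀ {Ps} P → All (P ≢_) Ps → All (Disjoint (pairOfCells P)) (map pairOfCells Ps)
    apart P []       = []
    apart P (n ∷ ns) = (λ { (i , j) → n (trans (sym (pairOfCells-vertex i)) (pairOfCells-vertex j)) }) ∷ apart P ns
    disjoint : ∀ {Ps} → Unique Ps → AllPairs Disjoint (map pairOfCells Ps)
    disjoint []       = []
    disjoint (n ∷ ns) = apart _ n ∷ disjoint ns

  movePoint : ℤ → Point → Point
  movePoint s ⟦ U ⨾ k ⟧ = ⟦ s + U ⨾ k ⟧

  moveCell : ℤ → Cell → Cell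
  moveCell s (△ P) = △ (movePoint s P)
  moveCell s (▽ P) = ▽ (movePoint s P)

  corners-move : ∀ s c → corners (moveCell s c) ≡ map (movePoint s) (corners c)
  corners-move s (△ ⟦ U ⨾ k ⟧) = cong₂ (λ a b → ⟦ s + U ⨾ k ⟧ ∷ ⟦ a ⨾ k ⟧ ∷ ⟦ b ⨾ k + + 1 ⟧ ∷ []) (ℤP.+-assoc s U (+ 2)) (ℤP.+-assoc s U (+ 1))
  corners-move s (▽ ⟦ U ⨾ k ⟧) = cong₂ (λ a b → ⟦ s + U ⨾ k ⟧ ∷ ⟦ a ⨾ k ⟧ ∷ ⟦ b ⨾ k - + 1 ⟧ ∷ []) (ℤP.+-assoc s U (+ 2)) (ℤP.+-assoc s U (+ 1))

  ⊑-move⁻ : ∀ {X : Point → Set} s c → moveCell s c ⊑ X → c ⊑ (X ∘ movePoint s)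
  ⊑-move⁻ {X} s c p = AllP.map⁻ (subst (All X) (corners-move s c) p)

  ⊑-move⁺ : ∀ {X : Point → Set} s c → c ⊑ (X ∘ movePoint s) → moveCell s c ⊑ X
  ⊑-move⁺ {X} s c p = subst (All X) (sym (corners-move s c)) (AllP.map⁺ p)

  -- x, a natural number with the parity of the width of the north side,
  -- determines the kind of the cells next to the axis.
  module Located (top : ℤ) (x m : ℕ) (bottom : ℤ) (height : + m ≡ top - bottom) where

    κ : Kind
    κ = kindAt dn x

    embedAt : ℤ → Cellᴳ → Cell
    embedAt s = Embedding.embed top s κ

    level′ : ℕ → ℤ
    level′ j = top - + j

    place₀ : Kind → ℤ → ℕ → Cell
    place₀ up U j = △ ⟦ U ⨾ level′ (suc j) ⟧
    place₀ dn U j = ▽ ⟦ U ⨾ level′ j ⟧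

    base₀ : Cellᴳ → Cell
    base₀ y = place₀ (kindOfCell κ y) (offset y) (strip y)

    embed-base : ∀ s y → embedAt s y ≡ moveCell s (base₀ y)
    embed-base s y with kindOfCell κ y
    ... | up = refl
    ... | dn = refl

    kindOf-kindℤ : ∀ y → kindOfCell κ y ≡ kindℤ (+ x + + strip y + offset y)
    kindOf-kindℤ (cell right j u) = sym (begin
      kindℤ (+ x + + j + + u)       ≡⟨ kindℤ-+ (+ x + + j) u ⟩
      kindAt (kindℤ (+ x + + j)) u  ≡⟨ cong (λ K → kindAt K u) (kindℤ-+ (+ x) j) ⟩
      _ ∎)
    kindOf-kindℤ (axis j) = sym (begin
      kindℤ (+ x + + j + -[1+ 0 ]) ≡⟨ kindℤ-cong {j = + x + + j + + 1} (- + 1) (solve′ (+ x + + j)) ⟩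
      kindℤ (+ x + + j + + 1)     ≡⟨ kindℤ-suc (+ x + + j) ⟩
      opposite (kindℤ (+ x + + j)) ≡⟨ cong opposite (kindℤ-+ (+ x) j) ⟩
      _ ∎)
      where
      solve′ : ∀ a → a + - + 1 ≡ a + + 1 + + 2 * - + 1
      solve′ = solve-∀
    kindOf-kindℤ (cell left j u) = sym (begin
      kindℤ (+ x + + j + -[1+ suc u ]) ≡⟨ kindℤ-cong {j = + x + + j + + u} (- (+ 1 + + u)) (solve′ (+ x + + j) (+ u)) ⟩
      kindℤ (+ x + + j + + u)          ≡⟨ kindℤ-+ (+ x + + j) u ⟩
      kindAt (kindℤ (+ x + + j)) u     ≡⟨ cong (λ K → kindAt K u) (kindℤ-+ (+ x) j) ⟩
      _ ∎)
      where
      solve′ : ∀ a u → a + - (+ 1 + (+ 1 + u)) ≡ a + u + + 2 * - (+ 1 + u)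
      solve′ = solve-∀

    offset-fromOffset : ∀ o j → offset (fromOffset o j) ≡ o
    offset-fromOffset (+ u)        j = refl
    offset-fromOffset -[1+ zero ]  j = refl
    offset-fromOffset -[1+ suc u ] j = refl

    strip-fromOffset : ∀ o j → strip (fromOffset o j) ≡ j
    strip-fromOffset (+ u)        j = refl
    strip-fromOffset -[1+ zero ]  j = refl
    strip-fromOffset -[1+ suc u ] j = refl

    distance-fromOffset : ∀ {o w} j → - + w - + 1 ≤ o → o ≤ + w → distance (fromOffset o j) ℕ.< suc w
    distance-fromOffset {+ u}        j l (+≤+ h) = s≤s h
    distance-fromOffset { -[1+ zero ]} j l h = s≤s z≤n
    distance-fromOffset { -[1+ suc u ]} {w} j l h = s≤s (ℕP.≤-pred (ℕP.≤-pred (ℕP.m≤n⇒m≤1+n (drop w l))))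
      where
      drop : ∀ w → - + w - + 1 ≤ -[1+ suc u ] → suc (suc u) ℕ.≤ suc w
      drop zero    (-≤- ())
      drop (suc w) (-≤- q) = s≤s (subst (suc u ℕ.≤_) (cong suc (ℕP.+-identityʳ w)) q)

    module _ (σ s c : ℤ) (parity : s - top - σ ≡ + x + + 2 * c) where

      vertex-kind : ∀ o i → kindℤ (s + o - (top - + i) - σ) ≡ kindℤ (+ x + + i + o)
      vertex-kind o i = kindℤ-cong {j = + x + + i + o} c (shuffle s o top (+ i) σ (+ x) c parity)
        where
        left-side : ∀ s o t i σ → s + o - (t - i) - σ ≡ (s - t - σ) + i + o
        left-side = solve-∀
        right-side : ∀ x c i o → (x + + 2 * c) + i + o ≡ x + i + o + + 2 * c
        right-side = solve-∀
        shuffle : ∀ s o t i σ x c → s - t - σ ≡ x + + 2 * c → s + o - (t - i) - σ ≡ x + i + o + + 2 * c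
        shuffle s o t i σ x c e = trans (left-side s o t i σ) (trans (cong (λ q → q + i + o) e) (right-side x c i o))

      kind-fromOffset : ∀ o j → kindOfCell κ (fromOffset o j) ≡ kindℤ (+ x + + j + o)
      kind-fromOffset o j = trans (kindOf-kindℤ (fromOffset o j))
        (cong₂ (λ i o → kindℤ (+ x + + i + o)) (strip-fromOffset o j) (offset-fromOffset o j))

      kind-next : ∀ o j → kindℤ (+ x + + suc j + o) ≡ opposite (kindℤ (+ x + + j + o))
      kind-next o j = trans (cong kindℤ (rearrange (+ x) (+ j) o)) (kindℤ-suc (+ x + + j + o))
        where
        rearrange : ∀ x j o → x + (+ 1 + j) + o ≡ x + j + o + + 1
        rearrange = solve-∀

      lattice⁺ : ∀ K o j → kindOfCell κ (fromOffset o j) ≡ K → LatticeVertex σ (vertex (moveCell s (place₀ K o j)))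
      lattice⁺ dn o j e = kindAt-even _ (trans (vertex-kind o j) (trans (sym (kind-fromOffset o j)) e))
      lattice⁺ up o j e = kindAt-even _ (trans (vertex-kind o (suc j)) (trans (kind-next o j)
        (cong opposite (trans (sym (kind-fromOffset o j)) e))))

      lattice⁻ : ∀ K o j → LatticeVertex σ (vertex (moveCell s (place₀ K o j))) → kindOfCell κ (fromOffset o j) ≡ K
      lattice⁻ dn o j v = trans (kind-fromOffset o j) (trans (sym (vertex-kind o j)) (even-kindAt _ v))
      lattice⁻ up o j v = trans (kind-fromOffset o j) (trans (sym (opposite-involutive _))
        (cong opposite (trans (sym (kind-next o j)) (trans (sym (vertex-kind o (suc j))) (even-kindAt _ v)))))

      lattice-base : ∀ y → LatticeVertex σ (vertex (moveCell s (base₀ y)))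
      lattice-base y = lattice⁺ (kindOfCell κ y) (offset y) (strip y) (cong (kindOfCell κ) (fromOffset-offset y))

      Within : ℕ → Point → Set
      Within w ⟦ U ⨾ k ⟧ = bottom ≤ k × k ≤ top × - + w - + 1 ≤ U - s × U - s ≤ + w

      embed-fromOffset : ∀ K o j → kindOfCell κ (fromOffset o j) ≡ K → embedAt s (fromOffset o j) ≡ moveCell s (place₀ K o j)
      embed-fromOffset K o j refl = trans (embed-base s (fromOffset o j))
        (cong₂ (λ o′ j′ → moveCell s (place₀ (kindOfCell κ (fromOffset o j)) o′ j′)) (offset-fromOffset o j) (strip-fromOffset o j))

      locate : ∀ {w} c → LatticeVertex σ (vertex c) → c ⊑ Within w →
        ∃ λ y → embedAt s y ≡ c × strip y ℕ.< m × distance y ℕ.< suc w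
      locate {w} (△ ⟦ V ⨾ l ⟧) v ((b , _ , lo , hi) ∷ _ ∷ (_ , t , _) ∷ []) with ≤-difference t
      ... | j , e = y , trans (embed-fromOffset up o j K≡) eq , subst (ℕ._< m) (sym (strip-fromOffset o j)) j<m , distance-fromOffset j lo hi
        where
        o = V - s
        y = fromOffset o j
        level-eq : ∀ t l j → t - (l + + 1) ≡ j → t - (+ 1 + j) ≡ l
        level-eq t l j refl = h t l
          where
          h : ∀ t l → t - (+ 1 + (t - (l + + 1))) ≡ l
          h = solve-∀
        shift-eq : ∀ s V → s + (V - s) ≡ V
        shift-eq = solve-∀
        eq : moveCell s (place₀ up o j) ≡ △ ⟦ V ⨾ l ⟧
        eq = cong₂ (λ U k → △ ⟦ U ⨾ k ⟧) (shift-eq s V) (level-eq top l (+ j) e)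
        K≡ : kindOfCell κ y ≡ up
        K≡ = lattice⁻ up o j (subst (LatticeVertex σ ∘ vertex) (sym eq) v)
        h₁ : ∀ t b l j m → m ≡ t - b → t - (l + + 1) ≡ j → l - b ≡ m - (+ 1 + j)
        h₁ t b l j m refl refl = h t b l
          where
          h : ∀ t b l → l - b ≡ t - b - (+ 1 + (t - (l + + 1)))
          h = solve-∀
        j<m : j ℕ.< m
        j<m = ℤP.drop‿+≤+ (by (pos b) (h₁ top bottom l (+ j) (+ m) height e))
      locate {w} (▽ ⟦ V ⨾ l ⟧) v ((_ , t , lo , hi) ∷ _ ∷ (b , _ , _) ∷ []) with ≤-difference t
      ... | j , e = y , trans (embed-fromOffset dn o j K≡) eq , subst (ℕ._< m) (sym (strip-fromOffset o j)) j<m , distance-fromOffset j lo hi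
        where
        o = V - s
        y = fromOffset o j
        level-eq : ∀ t l j → t - l ≡ j → t - j ≡ l
        level-eq t l j refl = h t l
          where
          h : ∀ t l → t - (t - l) ≡ l
          h = solve-∀
        shift-eq : ∀ s V → s + (V - s) ≡ V
        shift-eq = solve-∀
        eq : moveCell s (place₀ dn o j) ≡ ▽ ⟦ V ⨾ l ⟧
        eq = cong₂ (λ U k → ▽ ⟦ U ⨾ k ⟧) (shift-eq s V) (level-eq top l (+ j) e)
        K≡ : kindOfCell κ y ≡ dn
        K≡ = lattice⁻ dn o j (subst (LatticeVertex σ ∘ vertex) (sym eq) v)
        h₁ : ∀ t b l j m → m ≡ t - b → t - l ≡ j → l - + 1 - b ≡ m - (+ 1 + j)
        h₁ t b l j m refl refl = h t b l
          where
          h : ∀ t b l → l - + 1 - b ≡ t - b - (+ 1 + (t - l))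
          h = solve-∀
        j<m : j ℕ.< m
        j<m = ℤP.drop‿+≤+ (by (pos b) (h₁ top bottom l (+ j) (+ m) height e))

  module _ (top : ℤ) where

    private
      lev : ℕ → ℤ
      lev j = top - + j

    lev-up : ∀ j → lev (suc j) + + 1 ≡ lev j
    lev-up j = h top (+ j)
      where
      h : ∀ t j → t - (+ 1 + j) + + 1 ≡ t - j
      h = solve-∀

    lev-down : ∀ j → lev j - + 1 ≡ lev (suc j)
    lev-down j = h top (+ j)
      where
      h : ∀ t j → t - j - + 1 ≡ t - (+ 1 + j)
      h = solve-∀

module Ferns where

  open Transfer
  open Grids
  open Embeddings
  open Boxes
  open import Defs
  open import Data.Integer using (ℤ; +_; _+_; _-_; -_; _*_; _≤_; +≤+)
  import Data.Integer.Properties as ℤP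
  open import Data.Integer.Tactic.RingSolver using (solve-∀)
  open import Data.List using (List; []; _∷_; map)
  open import Data.List.Relation.Unary.All as All using (All; []; _∷_)
  import Data.List.Relation.Unary.All.Properties as AllP
  open import Data.Nat as ℕ using (ℕ; zero; suc; z≤n; s≤s)
  open import Data.Nat.ListAction using (sum)
  import Data.Nat.Properties as ℕP
  open import Data.Product using (_×_; _,_; proj₁; proj₂)
  open import Relation.Binary.PropositionalEquality
  open ≡-Reasoning
  open FernTriangle renaming (left to leftEnd)

  sum-oddEven : ∀ ss → sum ss ≡ oddSum ss ℕ.+ evenSum ss
  sum-oddEven []       = refl
  sum-oddEven (s ∷ ss) = begin
    s ℕ.+ sum ss                      ≡⟨ cong (s ℕ.+_) (trans (sum-oddEven ss) (ℕP.+-comm (oddSum ss) _)) ⟩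
    s ℕ.+ (evenSum ss ℕ.+ oddSum ss)  ≡⟨ ℕP.+-assoc s _ _ ⟨
    s ℕ.+ evenSum ss ℕ.+ oddSum ss    ∎

  double-∸ : ∀ f k → 2 ℕ.* (f ℕ.+ k) ℕ.∸ f ≡ f ℕ.+ 2 ℕ.* k
  double-∸ f k = trans (cong (ℕ._∸ f) (trans (ℕP.*-distribˡ-+ 2 f k) (trans (cong (ℕ._+ 2 ℕ.* k) (cong (f ℕ.+_) (ℕP.+-identityʳ f)))
    (ℕP.+-assoc f f _)))) (ℕP.m+n∸m≡n f (f ℕ.+ 2 ℕ.* k))

  +2* : ∀ a → + (2 ℕ.* a) ≡ + 2 * + a
  +2* a = ℤP.pos-* 2 a

  LeftNonNegative : FernTriangle → Set
  LeftNonNegative T = + 0 ≤ leftEnd T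

  fernEast-left : ∀ o U ss → + 0 ≤ U → All LeftNonNegative (fernEast o U ss)
  fernEast-left o U []       p = []
  fernEast-left o U (s ∷ ss) p = p ∷ fernEast-left (flip o) (U + + 2 * + s) ss
    (subst (λ e → + 0 ≤ U + e) (+2* s) (ℤP.+-mono-≤ p (+≤+ z≤n)))

  fernWest-left : ∀ o U ss → + 2 * + sum ss ≤ U → All LeftNonNegative (fernWest o U ss)
  fernWest-left o U []       p = []
  fernWest-left o U (s ∷ ss) p = by (pos p ⊕ pos (+≤+ (z≤n {2 ℕ.* sum ss}))) (trans (cong (λ e → U - + 2 * + sum (s ∷ ss) + (e - + 0)) (+2* (sum ss))) (eq U (+ s) (+ sum ss)))
    ∷ fernWest-left (flip o) (U - + 2 * + s) ss (by (pos p) (eq′ U (+ s) (+ sum ss)))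
    where
    eq : ∀ U s t → U - + 2 * (s + t) + (+ 2 * t - + 0) ≡ U - + 2 * s - + 0
    eq = solve-∀
    eq′ : ∀ U s t → U - + 2 * (s + t) ≡ U - + 2 * s - + 2 * t
    eq′ = solve-∀

  SidesAtMost : Orientation → ℕ → ℕ → FernTriangle → Set
  SidesAtMost o p q T = (orientation T ≡ o → side T ℕ.≤ p) × (orientation T ≡ flip o → side T ℕ.≤ q)

  flip-flip : ∀ o → flip (flip o) ≡ o
  flip-flip up   = refl
  flip-flip down = refl

  flip≢ : ∀ o → o ≢ flip o
  flip≢ up   ()
  flip≢ down ()

  sides-step : ∀ {o s p q Ts} → All (SidesAtMost (flip o) p q) Ts → All (SidesAtMost o (s ℕ.+ q) p) Ts
  sides-step {o} {s} = All.map λ (h , h′) → (λ e → ℕP.≤-trans (h′ (trans e (sym (flip-flip o)))) (ℕP.m≤n+m _ s)) , h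

  fernEast-sides : ∀ o U ss → All (SidesAtMost o (oddSum ss) (evenSum ss)) (fernEast o U ss)
  fernEast-sides o U []       = []
  fernEast-sides o U (s ∷ ss) = ((λ _ → ℕP.m≤m+n s _) , λ e → contradict e) ∷ sides-step {o} {s} (fernEast-sides (flip o) (U + + 2 * + s) ss)
    where
    contradict : o ≡ flip o → s ℕ.≤ oddSum ss
    contradict e with () ← flip≢ o e

  fernWest-sides : ∀ o U ss → All (SidesAtMost o (oddSum ss) (evenSum ss)) (fernWest o U ss)
  fernWest-sides o U []       = []
  fernWest-sides o U (s ∷ ss) = ((λ _ → ℕP.m≤m+n s _) , λ e → contradict e) ∷ sides-step {o} {s} (fernWest-sides (flip o) (U - + 2 * + s) ss)
    where
    contradict : o ≡ flip o → s ℕ.≤ oddSum ss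
    contradict e with () ← flip≢ o e

  translate : ℤ → FernTriangle → FernTriangle
  translate t (tri o l s) = tri o (t + l) s

  fernEast-translate : ∀ t o U ss → fernEast o (t + U) ss ≡ map (translate t) (fernEast o U ss)
  fernEast-translate t o U []       = refl
  fernEast-translate t o U (s ∷ ss) = cong (tri o (t + U) s ∷_) (trans
    (cong (λ V → fernEast (flip o) V ss) (ℤP.+-assoc t U _)) (fernEast-translate t (flip o) (U + + 2 * + s) ss))

  fernWest-translate : ∀ t o U ss → fernWest o (t + U) ss ≡ map (translate t) (fernWest o U ss)
  fernWest-translate t o U []       = refl
  fernWest-translate t o U (s ∷ ss) = cong₂ _∷_ (cong (λ V → tri o V s) (ℤP.+-assoc t U _)) (trans
    (cong (λ V → fernWest (flip o) V ss) (ℤP.+-assoc t U _)) (fernWest-translate t (flip o) (U - + 2 * + s) ss))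

  module Dimensions (x y z f : ℕ) (d b : List ℕ) where

    open SymmetricHexagon x y z (f ∷ d) b public

    X Y Z F Oᵈ Eᵈ Oᵇ Eᵇ : ℤ
    X = + x
    Y = + y
    Z = + z
    F = + f
    Oᵈ = + oddSum d
    Eᵈ = + evenSum d
    Oᵇ = + oddSum b
    Eᵇ = + evenSum b

    W≡ : + W ≡ X + Y + (F + + 2 * (Oᵈ + Eᵈ)) + + 2 * (Oᵇ + Eᵇ)
    W≡ = cong₂ (λ p q → X + Y + p + q)
      (trans (cong +_ (double-∸ f (sum d))) (cong (λ t → F + t) (trans (+2* (sum d)) (cong (λ t → + 2 * + t) (sum-oddEven d)))))
      (trans (+2* (sum b)) (cong (λ t → + 2 * + t) (sum-oddEven b)))

    NE≡ : + NE ≡ Y + Z + (F + + 2 * Eᵈ) + + 2 * Oᵇ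
    NE≡ = cong₂ (λ p q → Y + Z + p + q) (trans (cong +_ (double-∸ f (evenSum d))) (cong (λ t → F + t) (+2* (evenSum d)))) (+2* (oddSum b))

    SE≡ : + SE ≡ Y + Z + + 2 * Oᵈ + + 2 * Eᵇ
    SE≡ = cong₂ (λ p q → Y + Z + p + q) (+2* (oddSum d)) (+2* (evenSum b))

    top≡ : top ≡ Y + F + + 2 * Eᵈ + + 2 * Oᵇ
    top≡ = trans (cong (λ t → - Z + t) NE≡) (eq Y Z F Eᵈ Oᵇ)
      where
      eq : ∀ Y Z F E O → - Z + (Y + Z + (F + + 2 * E) + + 2 * O) ≡ Y + F + + 2 * E + + 2 * O
      eq = solve-∀

    bottom≡ : bottom ≡ - (Y + + 2 * Z + + 2 * Oᵈ + + 2 * Eᵇ)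
    bottom≡ = trans (cong (λ t → - Z - t) SE≡) (eq Y Z Oᵈ Eᵇ)
      where
      eq : ∀ Y Z O E → - Z - (Y + Z + + 2 * O + + 2 * E) ≡ - (Y + + 2 * Z + + 2 * O + + 2 * E)
      eq = solve-∀

    north≡ : + W - top ≡ X + + 2 * (Oᵈ + Eᵇ)
    north≡ = trans (cong₂ _-_ W≡ top≡) (eq X Y F Oᵈ Eᵈ Oᵇ Eᵇ)
      where
      eq : ∀ X Y F O E P Q → X + Y + (F + + 2 * (O + E)) + + 2 * (P + Q) - (Y + F + + 2 * E + + 2 * P) ≡ X + + 2 * (O + Q)
      eq = solve-∀

    south≡ : + W + + 2 * Z + bottom ≡ X + F + + 2 * Eᵈ + + 2 * Oᵇ
    south≡ = trans (cong₂ (λ p q → p + + 2 * Z + q) W≡ bottom≡) (eq X Y Z F Oᵈ Eᵈ Oᵇ Eᵇ)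
      where
      eq : ∀ X Y Z F O E P Q → X + Y + (F + + 2 * (O + E)) + + 2 * (P + Q) + + 2 * Z + - (Y + + 2 * Z + + 2 * O + + 2 * Q) ≡ X + F + + 2 * E + + 2 * P
      eq = solve-∀

    two : ∀ a → Pos (+ 2 * + a)
    two a = subst Pos (+2* a) (num _)

    north : top ≤ + W
    north = by {e = X + (+ 2 * Oᵈ + + 2 * Eᵇ)} (num x ⊕ (two (oddSum d) ⊕ two (evenSum b))) (trans (eq X Oᵈ Eᵇ) (sym north≡))
      where
      eq : ∀ X O E → X + (+ 2 * O + + 2 * E) ≡ X + + 2 * (O + E)
      eq = solve-∀

    south : Pos (+ W + + 2 * Z + bottom)
    south = subst Pos (sym south≡) (num x ⊕ num f ⊕ two (evenSum d) ⊕ two (oddSum b))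

    f≤top : F ≤ top
    f≤top = by (num y ⊕ two (evenSum d) ⊕ two (oddSum b)) (trans (eq Y F Eᵈ Oᵇ) (cong (_- F) (sym top≡)))
      where
      eq : ∀ Y F E O → Y + + 2 * E + + 2 * O ≡ Y + F + + 2 * E + + 2 * O - F
      eq = solve-∀

    0≤top : + 0 ≤ top
    0≤top = ℤP.≤-trans (num f) f≤top

    depth : Pos (Y + + 2 * Z + + 2 * Oᵈ + + 2 * Eᵇ)
    depth = num y ⊕ two z ⊕ two (oddSum d) ⊕ two (evenSum b)

    bottom≤0 : bottom ≤ + 0
    bottom≤0 = subst (_≤ + 0) (sym bottom≡) (ℤP.neg-mono-≤ depth)

    m : ℕ
    m = NE ℕ.+ SE

    height : + m ≡ top - bottom
    height = eq Z (+ NE) (+ SE)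
      where
      eq : ∀ Z N S → N + S ≡ - Z + N - (- Z - S)
      eq = solve-∀

    deep : bottom ≤ - + 1 → bottom ≤ - Z - + 1
    deep h = by {e = + SE - + 1} (pos {+ 1} (+≤+ (positive (SE) refl))) (eq Z (+ SE))
      where
      eq : ∀ Z S → S - + 1 ≡ - Z - + 1 - (- Z - S)
      eq = solve-∀
      positive : ∀ S → S ≡ SE → 1 ℕ.≤ S
      positive (suc S) e = s≤s z≤n
      positive zero    e with ℕP.m+n≡0⇒m≡0 y (ℕP.m+n≡0⇒m≡0 (y ℕ.+ z) (ℕP.m+n≡0⇒m≡0 (y ℕ.+ z ℕ.+ 2 ℕ.* oddSum d) (sym e)))
         | ℕP.m+n≡0⇒n≡0 y (ℕP.m+n≡0⇒m≡0 (y ℕ.+ z) (ℕP.m+n≡0⇒m≡0 (y ℕ.+ z ℕ.+ 2 ℕ.* oddSum d) (sym e)))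
      ... | _ | refl with () ← subst (λ S → - + 0 - + S ≤ - + 1) (sym e) h

    east-left : All LeftNonNegative eastFerns
    east-left = AllP.++⁺ (fernEast-left down F d (num f)) (fernWest-left up (+ W) b W-large)
      where
      W-large : + 2 * + sum b ≤ + W
      W-large = by (num (x ℕ.+ y ℕ.+ (2 ℕ.* (f ℕ.+ sum d) ℕ.∸ f))) (trans (sym (eq (+ (x ℕ.+ y ℕ.+ (2 ℕ.* (f ℕ.+ sum d) ℕ.∸ f))) (+ (2 ℕ.* sum b))))
        (cong (λ t → + W - t) (+2* (sum b))))
        where
        eq : ∀ A B → A + B - B ≡ A
        eq = solve-∀

    UpSmall DownSmall : FernTriangle → Set
    UpSmall T   = orientation T ≡ up → + 2 * + side T ≤ top
    DownSmall T = orientation T ≡ down → + 2 * + side T ≤ - bottom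

    private
      twice-≤ : ∀ {s t} → s ℕ.≤ t → + 2 * + s ≤ + 2 * + t
      twice-≤ {s} {t} l = subst₂ _≤_ (+2* s) (+2* t) (+≤+ (ℕP.*-monoʳ-≤ 2 l))
      up-E : + 2 * Eᵈ ≤ top
      up-E = by (num y ⊕ num f ⊕ two (oddSum b)) (trans (eq Y F Eᵈ Oᵇ) (cong (_- + 2 * Eᵈ) (sym top≡)))
        where
        eq : ∀ Y F E O → Y + F + + 2 * O ≡ Y + F + + 2 * E + + 2 * O - + 2 * E
        eq = solve-∀
      up-O : + 2 * Oᵇ ≤ top
      up-O = by (num y ⊕ num f ⊕ two (evenSum d)) (trans (eq Y F Eᵈ Oᵇ) (cong (_- + 2 * Oᵇ) (sym top≡)))
        where
        eq : ∀ Y F E O → Y + F + + 2 * E ≡ Y + F + + 2 * E + + 2 * O - + 2 * O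
        eq = solve-∀
      down-O : + 2 * Oᵈ ≤ - bottom
      down-O = by (num y ⊕ two z ⊕ two (evenSum b)) (trans (eq Y Z Oᵈ Eᵇ) (cong (λ t → - t - + 2 * Oᵈ) (sym bottom≡)))
        where
        eq : ∀ Y Z O E → Y + + 2 * Z + + 2 * E ≡ - (- (Y + + 2 * Z + + 2 * O + + 2 * E)) - + 2 * O
        eq = solve-∀
      down-E : + 2 * Eᵇ ≤ - bottom
      down-E = by (num y ⊕ two z ⊕ two (oddSum d)) (trans (eq Y Z Oᵈ Eᵇ) (cong (λ t → - t - + 2 * Eᵇ) (sym bottom≡)))
        where
        eq : ∀ Y Z O E → Y + + 2 * Z + + 2 * O ≡ - (- (Y + + 2 * Z + + 2 * O + + 2 * E)) - + 2 * E
        eq = solve-∀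

    east-up : All UpSmall eastFerns
    east-up = AllP.++⁺ (All.map (λ h e → ℤP.≤-trans (twice-≤ (proj₂ h e)) up-E) (fernEast-sides down F d))
                       (All.map (λ h e → ℤP.≤-trans (twice-≤ (proj₁ h e)) up-O) (fernWest-sides up (+ W) b))

    east-down : All DownSmall eastFerns
    east-down = AllP.++⁺ (All.map (λ h e → ℤP.≤-trans (twice-≤ (proj₁ h e)) down-O) (fernEast-sides down F d))
                         (All.map (λ h e → ℤP.≤-trans (twice-≤ (proj₂ h e)) down-E) (fernWest-sides up (+ W) b))

module Geometry where

  open Transfer
  open Grids
  open Embeddings
  open Boxes
  open Ferns
  open import Defs
  open import Data.Bool using (Bool; true; false)
  open import Data.Integer as ℤ using (ℤ; +_; ∣_∣; _+_; _-_; -_; _*_; _≤_; +≤+; -≤+; -≤-)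
  import Data.Integer.Properties as ℤP
  open import Data.Integer.Tactic.RingSolver using (solve-∀)
  open import Data.List using (List; []; _∷_; _++_; map; drop)
  open import Data.List.Properties using (map-++)
  open import Data.List.Relation.Unary.All as All using (All; []; _∷_)
  open import Data.List.Relation.Unary.Any as Any using (Any)
  import Data.List.Relation.Unary.Any.Properties as AnyP
  open import Data.Nat as ℕ using (ℕ; zero; suc; z≤n; s≤s)
  import Data.Nat.Properties as ℕP
  open import Data.Product using (_×_; _,_; ∃)
  open import Data.Sum using (_⊎_; inj₁; inj₂)
  open import Data.Unit using (⊤; tt)
  open import Function using (_∘_)
  open import Relation.Binary.PropositionalEquality
  open import Relation.Nullary using (yes; no; ¬_; contradiction)
  open ≡-Reasoning
  open FernTriangle using (orientation; side)

  -- The horizontal (doubled) coordinate, relative to the axis, of a west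
  -- zigzag that includes or excludes the axis cells.
  zig : (included : Bool) → Kind → ℤ
  zig _     dn = + 0
  zig true  up = - + 1
  zig false up = + 1

  zig≤suc : ∀ i K v → zig i K ≤ + suc v
  zig≤suc i     dn v = +≤+ z≤n
  zig≤suc true  up v = -≤+
  zig≤suc false up v = +≤+ (s≤s z≤n)

  zig≥-1 : ∀ i K → - + 1 ≤ zig i K
  zig≥-1 i     dn = -≤+
  zig≥-1 true  up = -≤- z≤n
  zig≥-1 false up = -≤+

  ≤-refl′ : ∀ {a b} → a ≡ b → a ≤ b
  ≤-refl′ = ℤP.≤-reflexive

  0≤2* : ∀ a → Pos (+ 2 * + a)
  0≤2* a = subst Pos (+2* a) (num _)

  absurd : ∀ {n} {A : Set} → + suc n ≤ + 0 → A
  absurd (+≤+ ())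

  -- S¹ with its dimensions as parameters: f and d are the central fern's
  -- triangles, m is the number of strips, and the gap of the central fern on
  -- the axis begins T strips below the north side.
  record Hexagon : Set where
    field
      x z f m W : ℕ
      d b : List ℕ
      top bottom : ℤ
      height : + m ≡ top - bottom
      0≤top : + 0 ≤ top
      bottom≤0 : bottom ≤ + 0

    eastFerns : List FernTriangle
    eastFerns = fernEast down (+ f) d ++ fernWest up (+ W) b

    κ₀ : Kind
    κ₀ = kindAt dn x

    field
      north : top ≤ + W
      south : Pos (+ W + + 2 * + z + bottom)
      f≤top : + f ≤ top
      deep : bottom ≤ - + 1 → bottom ≤ - + z - + 1
      east-left : All LeftNonNegative eastFerns
      east-up : All (λ T → orientation T ≡ up → + 2 * + side T ≤ top) eastFerns
      east-down : All (λ T → orientation T ≡ down → + 2 * + side T ≤ - bottom) eastFerns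
      T : ℕ
      top≡ : top ≡ + (T ℕ.+ f)
      kindT : kindAt κ₀ T ≡ dn
      north′ : kindAt κ₀ 0 ≡ up → + 1 ≤ + W - top
      south′ : kindAt κ₀ m ≡ up → + 1 ≤ + W + + 2 * + z + bottom
      E : ℤ
      north≡ : + x + + 2 * E ≡ + W - top

  module Cells (hexagon : Hexagon) where

    open Hexagon hexagon public

    open Located top x m bottom height public

    Z F : ℤ
    Z = + z
    F = + f

    central : FernTriangle
    central = tri up (- F) f

    Box : Point → Set
    Box ⟦ U ⨾ k ⟧ = bottom ≤ k × k ≤ top × U ≤ + W - k × U ≤ + W + + 2 * Z + k

    Present : Cell → Set
    Present c = c ⊑ Box × ¬ c ⊑ (_∈△ central) × ¬ Removed eastFerns c

    corners₀ : Kind → ℤ → ℕ → List Point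
    corners₀ up o j = ⟦ o ⨾ level′ (suc j) ⟧ ∷ ⟦ o + + 2 ⨾ level′ (suc j) ⟧ ∷ ⟦ o + + 1 ⨾ level′ j ⟧ ∷ []
    corners₀ dn o j = ⟦ o ⨾ level′ j ⟧ ∷ ⟦ o + + 2 ⨾ level′ j ⟧ ∷ ⟦ o + + 1 ⨾ level′ (suc j) ⟧ ∷ []

    corners-place : ∀ K o j → corners (place₀ K o j) ≡ corners₀ K o j
    corners-place up o j = cong (λ k → ⟦ o ⨾ level′ (suc j) ⟧ ∷ ⟦ o + + 2 ⨾ level′ (suc j) ⟧ ∷ ⟦ o + + 1 ⨾ k ⟧ ∷ []) (lev-up top j)
    corners-place dn o j = cong (λ k → ⟦ o ⨾ level′ j ⟧ ∷ ⟦ o + + 2 ⨾ level′ j ⟧ ∷ ⟦ o + + 1 ⨾ k ⟧ ∷ []) (lev-down top j)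

    ⊑₀⁺ : ∀ {X : Point → Set} K o j → All X (corners₀ K o j) → place₀ K o j ⊑ X
    ⊑₀⁺ {X} K o j = subst (All X) (sym (corners-place K o j))

    ⊑₀⁻ : ∀ {X : Point → Set} K o j → place₀ K o j ⊑ X → All X (corners₀ K o j)
    ⊑₀⁻ {X} K o j = subst (All X) (corners-place K o j)

    upperCorner : ∀ {X : Point → Set} K o j → place₀ K o j ⊑ X → ∃ λ U → X ⟦ U ⨾ level′ j ⟧
    upperCorner {X} up o j (_ ∷ _ ∷ q ∷ []) = o + + 1 , subst (λ k → X ⟦ o + + 1 ⨾ k ⟧) (lev-up top j) q
    upperCorner dn o j (q ∷ _) = o , q

    lowerCorner : ∀ {X : Point → Set} K o j → place₀ K o j ⊑ X → ∃ λ U → X ⟦ U ⨾ level′ (suc j) ⟧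
    lowerCorner {X} dn o j (_ ∷ _ ∷ q ∷ []) = o + + 1 , subst (λ k → X ⟦ o + + 1 ⨾ k ⟧) (lev-down top j) q
    lowerCorner up o j (q ∷ _) = o , q

    Upper Lower : ℕ → Set
    Upper j = + 0 ≤ level′ (suc j)
    Lower j = level′ j ≤ + 0

    level-step : ∀ j → level′ j ≡ + 1 + level′ (suc j)
    level-step j = eq top (+ j)
      where
      eq : ∀ t j → t - j ≡ + 1 + (t - (+ 1 + j))
      eq = solve-∀

    upper-positive : ∀ j → Upper j → + 1 ≤ level′ j
    upper-positive j u = by (pos u) (trans (eq (level′ (suc j))) (cong (_- + 1) (sym (level-step j))))
      where
      eq : ∀ l → l - + 0 ≡ + 1 + l - + 1
      eq = solve-∀

    lower-negative : ∀ j → Lower j → level′ (suc j) ≤ - + 1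
    lower-negative j l = by (pos l) (trans (cong (λ t → + 0 - t) (level-step j)) (eq (level′ (suc j))))
      where
      eq : ∀ l → + 0 - (+ 1 + l) ≡ - + 1 - l
      eq = solve-∀

    position : ∀ j → Upper j ⊎ Lower j
    position j with ℤP.≤-total (level′ j) (+ 0)
    ... | inj₁ l = inj₂ l
    ... | inj₂ g with level′ j ℤ.≟ + 0
    ...   | yes e = inj₂ (≤-refl′ e)
    ...   | no n  = inj₁ (by (pos (positive (level′ j) g n)) (trans (cong (_- + 1) (level-step j)) (eq (level′ (suc j)))))
      where
      eq : ∀ l → + 1 + l - + 1 ≡ l - + 0
      eq = solve-∀
      positive : ∀ i → + 0 ≤ i → i ≢ + 0 → + 1 ≤ i
      positive (+ zero)  p n = contradiction refl n
      positive (+ suc i) p n = +≤+ (s≤s z≤n)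

    Good : (Bool → Set) → ℕ → Point → Set
    Good allowed j ⟦ U ⨾ k ⟧ = ∃ λ i → k ≡ level′ i × j ℕ.≤ i × i ℕ.≤ suc j × (∀ inc → allowed inc → zig inc (kindAt κ i) ≤ U)

    Any-kind : Bool → Set
    Any-kind _ = ⊤

    Included : Bool → Set
    Included inc = inc ≡ true

    kind-suc′ : ∀ j {K} → kindAt κ j ≡ K → kindAt κ (suc j) ≡ opposite K
    kind-suc′ j refl = kindAt-opposite κ j

    right-good : ∀ j u → base₀ (cell right j u) ⊑ Good Any-kind j
    right-good j u = ⊑₀⁺ (kindAt (kindAt κ j) u) (+ u) j (corners-good u _ refl)
      where
      zigs : ∀ i v → ∀ inc → ⊤ → zig inc (kindAt κ i) ≤ + suc v
      zigs i v inc _ = zig≤suc inc (kindAt κ i) v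
      zig0 : ∀ i → kindAt κ i ≡ dn → ∀ inc → ⊤ → zig inc (kindAt κ i) ≤ + 0
      zig0 i e inc _ = subst (λ K → zig inc K ≤ + 0) (sym e) (+≤+ z≤n)
      corners-good : ∀ u K → kindAt (kindAt κ j) u ≡ K → All (Good Any-kind j) (corners₀ K (+ u) j)
      corners-good u dn e = (j , refl , ℕP.≤-refl , ℕP.n≤1+n j , west u e) ∷
        (j , refl , ℕP.≤-refl , ℕP.n≤1+n j , subst (λ v → ∀ inc → ⊤ → zig inc (kindAt κ j) ≤ + v) (ℕP.+-comm 2 u) (zigs j (suc u))) ∷
        (suc j , refl , ℕP.n≤1+n j , ℕP.≤-refl , subst (λ v → ∀ inc → ⊤ → zig inc (kindAt κ (suc j)) ≤ + v) (ℕP.+-comm 1 u) (zigs (suc j) u)) ∷ []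
        where
        west : ∀ u → kindAt (kindAt κ j) u ≡ dn → ∀ inc → ⊤ → zig inc (kindAt κ j) ≤ + u
        west zero    e = zig0 j e
        west (suc u) e = zigs j u
      corners-good u up e = (suc j , refl , ℕP.n≤1+n j , ℕP.≤-refl , west u e) ∷
        (suc j , refl , ℕP.n≤1+n j , ℕP.≤-refl , subst (λ v → ∀ inc → ⊤ → zig inc (kindAt κ (suc j)) ≤ + v) (ℕP.+-comm 2 u) (zigs (suc j) (suc u))) ∷
        (j , refl , ℕP.≤-refl , ℕP.n≤1+n j , subst (λ v → ∀ inc → ⊤ → zig inc (kindAt κ j) ≤ + v) (ℕP.+-comm 1 u) (zigs j u)) ∷ []
        where
        west : ∀ u → kindAt (kindAt κ j) u ≡ up → ∀ inc → ⊤ → zig inc (kindAt κ (suc j)) ≤ + u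
        west zero    e = zig0 (suc j) (kind-suc′ j e)
        west (suc u) e = zigs (suc j) u

    right-nonNegative : ∀ j u → base₀ (cell right j u) ⊑ (λ p → + 0 ≤ 2u p)
    right-nonNegative j u = ⊑₀⁺ (kindAt (kindAt κ j) u) (+ u) j (all (kindAt (kindAt κ j) u))
      where
      all : ∀ K → All (λ p → + 0 ≤ 2u p) (corners₀ K (+ u) j)
      all up = +≤+ z≤n ∷ +≤+ z≤n ∷ +≤+ z≤n ∷ []
      all dn = +≤+ z≤n ∷ +≤+ z≤n ∷ +≤+ z≤n ∷ []

    axis-good : ∀ j → base₀ (axis j) ⊑ Good Included j
    axis-good j = ⊑₀⁺ (opposite (kindAt κ j)) (- + 1) j (all (kindAt κ j) refl)
      where
      incl : ∀ i {U} → (∀ K → kindAt κ i ≡ K → zig true K ≤ U) → ∀ inc → inc ≡ true → zig inc (kindAt κ i) ≤ U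
      incl i h .true refl = h _ refl
      all : ∀ K → kindAt κ j ≡ K → All (Good Included j) (corners₀ (opposite K) (- + 1) j)
      all dn e = (suc j , refl , ℕP.n≤1+n j , ℕP.≤-refl , incl (suc j) (λ K e′ → subst (λ K → zig true K ≤ - + 1) (trans (sym (kind-suc′ j e)) e′) (-≤- z≤n))) ∷
        (suc j , refl , ℕP.n≤1+n j , ℕP.≤-refl , incl (suc j) (λ K _ → zig≤suc true K 0)) ∷
        (j , refl , ℕP.≤-refl , ℕP.n≤1+n j , incl j (λ K e′ → subst (λ K → zig true K ≤ + 0) (trans (sym e) e′) (+≤+ z≤n))) ∷ []
      all up e = (j , refl , ℕP.≤-refl , ℕP.n≤1+n j , incl j (λ K e′ → subst (λ K → zig true K ≤ - + 1) (trans (sym e) e′) (-≤- z≤n))) ∷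
        (j , refl , ℕP.≤-refl , ℕP.n≤1+n j , incl j (λ K _ → zig≤suc true K 0)) ∷
        (suc j , refl , ℕP.n≤1+n j , ℕP.≤-refl , incl (suc j) (λ K e′ → subst (λ K → zig true K ≤ + 0) (trans (sym (kind-suc′ j e)) e′) (+≤+ z≤n))) ∷ []

    place-∈ : ∀ {X : Point → Set} K o j → place₀ K o j ⊑ X → ∃ λ i → (i ≡ j ⊎ i ≡ suc j) × X ⟦ o ⨾ level′ i ⟧
    place-∈ up o j (q ∷ _) = suc j , inj₂ refl , q
    place-∈ dn o j (q ∷ _) = j , inj₁ refl , q

    axis-west : ∀ {X : Point → Set} j → base₀ (axis j) ⊑ X → ∃ λ i → kindAt κ i ≡ up × (i ≡ j ⊎ i ≡ suc j) × X ⟦ - + 1 ⨾ level′ i ⟧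
    axis-west {X} j = west (kindAt κ j) refl
      where
      west : ∀ K → kindAt κ j ≡ K → place₀ (opposite K) (- + 1) j ⊑ X →
        ∃ λ i → kindAt κ i ≡ up × (i ≡ j ⊎ i ≡ suc j) × X ⟦ - + 1 ⨾ level′ i ⟧
      west up e (q ∷ _) = j , e , inj₁ refl , q
      west dn e (q ∷ _) = suc j , kind-suc′ j e , inj₂ refl , q

    -- Being west of the central fern means being in the central triangle,
    -- for the cells under consideration.
    Shadowed : Cell → Set
    Shadowed c = c ⊑ (λ { ⟦ U ⨾ k ⟧ → + 0 ≤ k × U ≤ F - k }) → c ⊑ (_∈△ central)

    private
      width : ∀ k → F - k ≡ - F + + 2 * F - k
      width k = eq F k
        where
        eq : ∀ F k → F - k ≡ - F + + 2 * F - k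
        eq = solve-∀

    right-shadowed : ∀ j u → Shadowed (base₀ (cell right j u))
    right-shadowed j u s = All.zipWith (λ { {⟦ U ⨾ k ⟧} (g , (p , q)) →
        p , by (pos g ⊕ pos g ⊕ pos q) (eq U k F) , ℤP.≤-trans q (≤-refl′ (width k)) }) (right-nonNegative j u , s)
      where
      eq : ∀ U k F → (U - + 0) + (U - + 0) + (F - k - U) ≡ U - (- F + k)
      eq = solve-∀

    axis-shadowed : ∀ j → Shadowed (base₀ (axis j))
    axis-shadowed j s = ⊑₀⁺ K (- + 1) j (all K (⊑₀⁻ K (- + 1) j s))
      where
      K = opposite (kindAt κ j)
      inside : ∀ {U k} → + 0 ≤ k → U ≤ F - k → - U ≤ F - k → ⟦ U ⨾ k ⟧ ∈△ central
      inside {U} {k} p q r = p , by (pos r) (eq U k F) , ℤP.≤-trans q (≤-refl′ (width k))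
        where
        eq : ∀ U k F → F - k - - U ≡ U - (- F + k)
        eq = solve-∀
      all : ∀ K → All _ (corners₀ K (- + 1) j) → All (_∈△ central) (corners₀ K (- + 1) j)
      all up ((p , q) ∷ (_ , q′) ∷ (r , t) ∷ []) = inside p q q′ ∷ inside p q′ q ∷ inside r t t ∷ []
      all dn ((p , q) ∷ (_ , q′) ∷ (r , t) ∷ []) = inside p q q′ ∷ inside p q′ q ∷ inside r t t ∷ []

    -- A halved hexagon in which the axis has the doubled coordinate s, and
    -- which lacks ε strips at its top and at its bottom.
    record Placement : Set where
      field
        x′ y′ : ℕ
        a′ : List ℕ
        s : ℤ
        D : Profile
        ε : ℕ
        uo lo : Bool
        L≡ : + 2 * + HalvedHexagon.L x′ y′ z a′ b ≡ s + + W
        first≡ : + 2 * + first a′ ≡ s + F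
        tail≡ : drop 1 a′ ≡ d
        A≡ : Profile.A D ≡ top - + ε
        B≡ : Profile.B D ≡ - bottom - + ε
        α≡ : ∀ i → + 0 ≤ level′ i → Profile.α D ∣ level′ i ∣ ≡ s + zig uo (kindAt κ i)
        β≡ : ∀ i → level′ i ≤ + 0 → Profile.β D ∣ level′ i ∣ ≡ s + zig lo (kindAt κ i)
        ε≤1 : ε ℕ.≤ 1
        s≥ : - + 1 ≤ s

    module Halved (placement : Placement) where

      open Placement placement public

      module H = HalvedHexagon x′ y′ z a′ b
      open Profile D

      ferns≡ : H.ferns D ≡ map (translate s) eastFerns
      ferns≡ = begin
        fernEast down (+ 2 * + first a′) (drop 1 a′) ++ fernWest up (+ 2 * + H.L) b
          ≡⟨ cong₂ _++_ (cong₂ (fernEast down) first≡ tail≡) (cong (λ U → fernWest up U b) L≡) ⟩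
        fernEast down (s + F) d ++ fernWest up (s + + W) b
          ≡⟨ cong₂ _++_ (fernEast-translate s down F d) (fernWest-translate s up (+ W) b) ⟩
        map (translate s) (fernEast down F d) ++ map (translate s) (fernWest up (+ W) b) ≡⟨ sym (map-++ (translate s) (fernEast down F d) _) ⟩
        _ ∎

      ∈△-translate⁺ : ∀ T p → p ∈△ T → movePoint s p ∈△ translate s T
      ∈△-translate⁺ (tri up l t)   ⟦ U ⨾ k ⟧ (p , q , r) = p , by (pos q) (eq s l k U) , by (pos r) (eq′ s l (+ t) k U)
        where
        eq : ∀ s l k U → U - (l + k) ≡ s + U - (s + l + k)
        eq = solve-∀
        eq′ : ∀ s l t k U → l + + 2 * t - k - U ≡ s + l + + 2 * t - k - (s + U)
        eq′ = solve-∀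
      ∈△-translate⁺ (tri down l t) ⟦ U ⨾ k ⟧ (p , q , r) = p , by (pos q) (eq s l k U) , by (pos r) (eq′ s l (+ t) k U)
        where
        eq : ∀ s l k U → U - (l - k) ≡ s + U - (s + l - k)
        eq = solve-∀
        eq′ : ∀ s l t k U → l + + 2 * t + k - U ≡ s + l + + 2 * t + k - (s + U)
        eq′ = solve-∀

      ∈△-translate⁻ : ∀ T p → movePoint s p ∈△ translate s T → p ∈△ T
      ∈△-translate⁻ (tri up l t)   ⟦ U ⨾ k ⟧ (p , q , r) = p , by (pos q) (eq s l k U) , by (pos r) (eq′ s l (+ t) k U)
        where
        eq : ∀ s l k U → s + U - (s + l + k) ≡ U - (l + k)
        eq = solve-∀
        eq′ : ∀ s l t k U → s + l + + 2 * t - k - (s + U) ≡ l + + 2 * t - k - U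
        eq′ = solve-∀
      ∈△-translate⁻ (tri down l t) ⟦ U ⨾ k ⟧ (p , q , r) = p , by (pos q) (eq s l k U) , by (pos r) (eq′ s l (+ t) k U)
        where
        eq : ∀ s l k U → s + U - (s + l - k) ≡ U - (l - k)
        eq = solve-∀
        eq′ : ∀ s l t k U → s + l + + 2 * t + k - (s + U) ≡ l + + 2 * t + k - U
        eq′ = solve-∀

      removed⁺ : ∀ c → Removed eastFerns c → Removed (H.ferns D) (moveCell s c)
      removed⁺ c r = subst (λ Ts → Removed Ts (moveCell s c)) (sym ferns≡)
        (AnyP.map⁺ (Any.map (λ {T} p → ⊑-move⁺ s c (All.map (λ {p} → ∈△-translate⁺ T p) p)) r))

      removed⁻ : ∀ c → Removed (H.ferns D) (moveCell s c) → Removed eastFerns c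
      removed⁻ c r = Any.map (λ {T} p → All.map (λ {p} → ∈△-translate⁻ T p) (⊑-move⁻ s c p))
        (AnyP.map⁻ (subst (λ Ts → Removed Ts (moveCell s c)) ferns≡ r))

      L-move : ∀ U k → + 2 * + H.L - k - (s + U) ≡ + W - k - U
      L-move U k = trans (cong (λ l → l - k - (s + U)) L≡) (eq s (+ W) k U)
        where
        eq : ∀ s W k U → s + W - k - (s + U) ≡ W - k - U
        eq = solve-∀

      upper→ : ∀ p → H.InPart D upper (movePoint s p) → Box p
      upper→ ⟦ U ⨾ k ⟧ (k≥0 , k≤A , _ , U≤) =
        ℤP.≤-trans bottom≤0 k≥0 , ℤP.≤-trans k≤A (by (num ε) (trans (eq top (+ ε)) (cong (λ a → top - a) (sym A≡)))) ,
        U≤′ , by (pos U≤′ ⊕ pos k≥0 ⊕ pos k≥0 ⊕ 0≤2* z) (eq′ (+ W) k U Z)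
        where
        eq : ∀ t e → e ≡ t - (t - e)
        eq = solve-∀
        U≤′ : U ≤ + W - k
        U≤′ = by (pos U≤) (L-move U k)
        eq′ : ∀ W k U Z → W - k - U + (k - + 0) + (k - + 0) + + 2 * Z ≡ W + + 2 * Z + k - U
        eq′ = solve-∀

      lower→ : ∀ p → H.InPart D lower (movePoint s p) → Box p
      lower→ ⟦ U ⨾ k ⟧ (k≤0 , B≤k , _ , U≤ , U≤′) =
        ℤP.≤-trans (by (num ε) (trans (eq bottom (+ ε)) (cong (λ b → - b - bottom) (sym B≡)))) B≤k , ℤP.≤-trans k≤0 0≤top ,
        by (pos U≤) (L-move U k) , by (pos U≤′) (trans (cong (λ l → l + + 2 * Z + k - (s + U)) L≡) (eq′ s (+ W) Z k U))
        where
        eq : ∀ t e → e ≡ - (- t - e) - t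
        eq = solve-∀
        eq′ : ∀ s W Z k U → s + W + + 2 * Z + k - (s + U) ≡ W + + 2 * Z + k - U
        eq′ = solve-∀

      upper← : ∀ {U} i → Box ⟦ U ⨾ level′ i ⟧ → + 0 ≤ level′ i → ε ℕ.≤ i → zig uo (kindAt κ i) ≤ U → H.InPart D upper ⟦ s + U ⨾ level′ i ⟧
      upper← {U} i (_ , _ , U≤ , _) k≥0 ε≤i zig≤ = k≥0 ,
        subst (level′ i ≤_) (sym A≡) (by (pos (+≤+ ε≤i)) (eq top (+ i) (+ ε))) ,
        subst (_≤ s + U) (sym (α≡ i k≥0)) (ℤP.+-monoʳ-≤ s zig≤) , by (pos U≤) (sym (L-move U (level′ i)))
        where
        eq : ∀ t i e → i - e ≡ t - e - (t - i)
        eq = solve-∀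

      lower← : ∀ {U} i → Box ⟦ U ⨾ level′ i ⟧ → level′ i ≤ + 0 → i ℕ.+ ε ℕ.≤ m → zig lo (kindAt κ i) ≤ U → H.InPart D lower ⟦ s + U ⨾ level′ i ⟧
      lower← {U} i (_ , _ , U≤ , U≤′) k≤0 i+ε≤m zig≤ = k≤0 ,
        by (pos (+≤+ i+ε≤m)) (trans (cong (_- + (i ℕ.+ ε)) height) (trans (eq top bottom (+ i) (+ ε)) (cong (λ b → level′ i - - b) (sym B≡)))) ,
        subst (_≤ s + U) (sym (β≡ i k≤0)) (ℤP.+-monoʳ-≤ s zig≤) , by (pos U≤) (sym (L-move U (level′ i))) ,
        by (pos U≤′) (sym (trans (cong (λ l → l + + 2 * Z + level′ i - (s + U)) L≡) (eq′ s (+ W) Z (level′ i) U)))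
        where
        eq : ∀ t b i e → t - b - (i + e) ≡ t - i - - (- b - e)
        eq = solve-∀
        eq′ : ∀ s W Z k U → s + W + + 2 * Z + k - (s + U) ≡ W + + 2 * Z + k - U
        eq′ = solve-∀

      Inside : Cellᴳ → Set
      Inside y = H.InRegion D (moveCell s (base₀ y))

      upper-not-lower : ∀ y → Upper (strip y) → ¬ moveCell s (base₀ y) ⊑ H.InPart D lower
      upper-not-lower y u p with upperCorner {λ q → H.InPart D lower (movePoint s q)} (kindOfCell κ y) (offset y) (strip y) (⊑-move⁻ s (base₀ y) p)
      ... | U , (k≤0 , _) = absurd (ℤP.≤-trans (upper-positive (strip y) u) k≤0)

      lower-not-upper : ∀ y → Lower (strip y) → ¬ moveCell s (base₀ y) ⊑ H.InPart D upper
      lower-not-upper y l p with lowerCorner {λ q → H.InPart D upper (movePoint s q)} (kindOfCell κ y) (offset y) (strip y) (⊑-move⁻ s (base₀ y) p)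
      ... | U , (k≥0 , _) with () ← ℤP.≤-trans k≥0 (lower-negative (strip y) l)

      west-move⁺ : ∀ {U k} → U ≤ F - k → H.WestOfFern D ⟦ s + U ⨾ k ⟧
      west-move⁺ {U} {k} p = by (pos p) (sym (trans (cong (λ t → t - k - (s + U)) first≡) (eq s F k U)))
        where
        eq : ∀ s F k U → s + F - k - (s + U) ≡ F - k - U
        eq = solve-∀

      west-move⁻ : ∀ {U k} → H.WestOfFern D ⟦ s + U ⨾ k ⟧ → U ≤ F - k
      west-move⁻ {U} {k} p = by (pos p) (trans (cong (λ t → t - k - (s + U)) first≡) (eq s F k U))
        where
        eq : ∀ s F k U → s + F - k - (s + U) ≡ F - k - U
        eq = solve-∀

      central-west : ∀ {U k} → ⟦ U ⨾ k ⟧ ∈△ central → U ≤ F - k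
      central-west {U} {k} (_ , _ , r) = ℤP.≤-trans r (≤-refl′ (eq F k))
        where
        eq : ∀ F k → - F + + 2 * F - k ≡ F - k
        eq = solve-∀

      Reach : Cellᴳ → Set
      Reach y = (Upper (strip y) × base₀ y ⊑ (λ p → H.InPart D upper (movePoint s p)))
              ⊎ (Lower (strip y) × base₀ y ⊑ (λ p → H.InPart D lower (movePoint s p)))

      reach : ∀ y → Inside y → Reach y
      reach y (q , _) with position (strip y) | q
      ... | inj₁ u | inj₁ (p , _) = inj₁ (u , ⊑-move⁻ s (base₀ y) p)
      ... | inj₁ u | inj₂ p       = contradiction p (upper-not-lower y u)
      ... | inj₂ l | inj₂ p       = inj₂ (l , ⊑-move⁻ s (base₀ y) p)
      ... | inj₂ l | inj₁ (p , _) = contradiction p (lower-not-upper y l)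

      inside→present : ∀ y → Inside y → Present (base₀ y)
      inside→present y (q , nr) = box (reach y (q , nr)) , not-central q , nr ∘ removed⁺ (base₀ y)
        where
        box : Reach y → base₀ y ⊑ Box
        box (inj₁ (_ , p)) = All.map (λ {p} → upper→ p) p
        box (inj₂ (_ , p)) = All.map (λ {p} → lower→ p) p
        not-central : ((moveCell s (base₀ y) ⊑ H.InPart D upper × ¬ moveCell s (base₀ y) ⊑ H.WestOfFern D) ⊎ moveCell s (base₀ y) ⊑ H.InPart D lower) →
          ¬ base₀ y ⊑ (_∈△ central)
        not-central (inj₁ (_ , w)) p = w (⊑-move⁺ s (base₀ y) (All.map (λ {p} i → west-move⁺ (central-west i)) p))
        not-central (inj₂ l) p with position (strip y)
        ... | inj₁ u  = upper-not-lower y u l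
        ... | inj₂ l′ with lowerCorner {_∈△ central} (kindOfCell κ y) (offset y) (strip y) p
        ...   | U , (k≥0 , _) with () ← ℤP.≤-trans k≥0 (lower-negative (strip y) l′)

      Complete : (Bool → Set) → ℕ → Set
      Complete allowed j = (Upper j × allowed uo × ε ℕ.≤ j) ⊎ (Lower j × allowed lo × suc j ℕ.+ ε ℕ.≤ m)

      present→inside : ∀ {allowed} y → base₀ y ⊑ Good allowed (strip y) → Shadowed (base₀ y) → Complete allowed (strip y) →
        Present (base₀ y) → Inside y
      present→inside y g sh (inj₁ (u , al , ε≤)) (bx , nc , nr) =
        inj₁ (⊑-move⁺ s (base₀ y) (All.zipWith (λ { {⟦ U ⨾ k ⟧} ((i , refl , j≤i , i≤j , zg) , bx) →
          upper← i bx (level-mono i≤j) (ℕP.≤-trans ε≤ j≤i) (zg uo al) }) (g , bx)) ,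
          (λ w → nc (sh (All.zipWith (λ { {⟦ U ⨾ k ⟧} ((i , refl , j≤i , i≤j , _) , w) → level-mono i≤j , west-move⁻ w })
            (g , ⊑-move⁻ s (base₀ y) w))))) , nr ∘ removed⁻ (base₀ y)
        where
        level-mono : ∀ {i} → i ℕ.≤ suc (strip y) → + 0 ≤ level′ i
        level-mono {i} l = by (pos u ⊕ pos (+≤+ l)) (eq top (+ i) (+ suc (strip y)))
          where
          eq : ∀ t i j → t - j - + 0 + (j - i) ≡ t - i - + 0
          eq = solve-∀
      present→inside y g sh (inj₂ (l , al , ≤m)) (bx , nc , nr) =
        inj₂ (⊑-move⁺ s (base₀ y) (All.zipWith (λ { {⟦ U ⨾ k ⟧} ((i , refl , j≤i , i≤j , zg) , bx) →
          lower← i bx (level-mono j≤i) (ℕP.≤-trans (ℕP.+-monoˡ-≤ ε i≤j) ≤m) (zg lo al) }) (g , bx))) , nr ∘ removed⁻ (base₀ y)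
        where
        level-mono : ∀ {i} → strip y ℕ.≤ i → level′ i ≤ + 0
        level-mono {i} h = by (pos l ⊕ pos (+≤+ h)) (eq top (+ i) (+ strip y))
          where
          eq : ∀ t i j → + 0 - (t - j) + (i - j) ≡ + 0 - (t - i)
          eq = solve-∀

      inside→uncut : ∀ y → Inside y → (Upper (strip y) × ε ℕ.≤ strip y) ⊎ (Lower (strip y) × suc (strip y) ℕ.+ ε ℕ.≤ m)
      inside→uncut y i with reach y i
      ... | inj₁ (u , p) with upperCorner {λ q → H.InPart D upper (movePoint s q)} (kindOfCell κ y) (offset y) (strip y) p
      ...   | U , (_ , k≤A , _) = inj₁ (u , ℤP.drop‿+≤+ (by (pos k≤A) (trans (cong (_- level′ (strip y)) A≡) (eq top (+ strip y) (+ ε)))))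
        where
        eq : ∀ t i e → t - e - (t - i) ≡ i - e
        eq = solve-∀
      inside→uncut y i | inj₂ (l , p) with lowerCorner {λ q → H.InPart D lower (movePoint s q)} (kindOfCell κ y) (offset y) (strip y) p
      ...   | U , (_ , B≤k , _) = inj₂ (l , ℤP.drop‿+≤+ (by (pos B≤k) (trans (cong (λ b → level′ (suc (strip y)) - - b) B≡)
                (trans (eq top bottom (+ suc (strip y)) (+ ε)) (cong (_- + (suc (strip y) ℕ.+ ε)) (sym height))))))
        where
        eq : ∀ t b i e → t - i - - (- b - e) ≡ t - b - (i + e)
        eq = solve-∀

      inside→zig : ∀ {P : ℕ → Set} y → (∀ {X : Point → Set} → base₀ y ⊑ X → ∃ λ i → P i × (i ≡ strip y ⊎ i ≡ suc (strip y)) × X ⟦ offset y ⨾ level′ i ⟧) →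
        Inside y → ∃ λ i → P i × ((Upper (strip y) × zig uo (kindAt κ i) ≤ offset y) ⊎ (Lower (strip y) × zig lo (kindAt κ i) ≤ offset y))
      inside→zig y w ins with reach y ins
      ... | inj₁ (u , p) = let (i , q , _ , (k≥0 , _ , α≤ , _)) = w p in i , q , inj₁ (u , cancel (subst (_≤ s + offset y) (α≡ i k≥0) α≤))
        where
        cancel : ∀ {a b} → s + a ≤ s + b → a ≤ b
        cancel {a} {b} h = by (pos h) (eq s a b)
          where
          eq : ∀ s a b → s + b - (s + a) ≡ b - a
          eq = solve-∀
      ... | inj₂ (l , p) = let (i , q , _ , (k≤0 , _ , β≤ , _)) = w p in i , q , inj₂ (l , cancel (subst (_≤ s + offset y) (β≡ i k≤0) β≤))
        where
        cancel : ∀ {a b} → s + a ≤ s + b → a ≤ b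
        cancel {a} {b} h = by (pos h) (eq s a b)
          where
          eq : ∀ s a b → s + b - (s + a) ≡ b - a
          eq = solve-∀

      left-outside : ∀ j u → ¬ Inside (cell left j u)
      left-outside j u ins with inside→zig {λ _ → ⊤} (cell left j u) (λ p → let (i , e , q) = place-∈ _ _ _ p in i , tt , e , q) ins
      ... | i , _ , inj₁ (_ , h) with (-≤- ()) ← ℤP.≤-trans (zig≥-1 uo (kindAt κ i)) h
      ... | i , _ , inj₂ (_ , h) with (-≤- ()) ← ℤP.≤-trans (zig≥-1 lo (kindAt κ i)) h

      axis-owned : ∀ j → Inside (axis j) → (Upper j × uo ≡ true) ⊎ (Lower j × lo ≡ true)
      axis-owned j ins with inside→zig {λ i → kindAt κ i ≡ up} (axis j) (axis-west j) ins
      ... | i , e , inj₁ (u , h) = inj₁ (u , owned uo (subst (λ K → zig uo K ≤ - + 1) e h))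
        where
        owned : ∀ o → zig o up ≤ - + 1 → o ≡ true
        owned true _ = refl
      ... | i , e , inj₂ (l , h) = inj₂ (l , owned lo (subst (λ K → zig lo K ≤ - + 1) e h))
        where
        owned : ∀ o → zig o up ≤ - + 1 → o ≡ true
        owned true _ = refl

module HexagonCells where

  open Transfer
  open Grids
  open Embeddings
  open Boxes
  open Ferns
  open Geometry
  open import Defs
  open import Data.Bool using (Bool)
  open import Data.Empty using (⊥)
  open import Data.Integer using (ℤ; +_; -[1+_]; _+_; _-_; -_; _*_; _≤_; -≤+; -≤-)
  import Data.Integer.Properties as ℤP
  open import Data.Integer.Tactic.RingSolver using (solve-∀)
  open import Data.List using (List; []; _∷_; _++_; map)
  open import Data.List.Relation.Unary.All as All using (All; []; _∷_)
  open import Data.List.Relation.Unary.Any as Any using (Any; here; there)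
  import Data.List.Relation.Unary.Any.Properties as AnyP
  open import Data.Nat using (ℕ; suc; z≤n)
  open import Data.Product using (_×_; _,_; proj₁; ∃)
  open import Data.Sum using (inj₁; inj₂)
  open import Function using (_∘_)
  open import Relation.Binary.PropositionalEquality
  open import Relation.Nullary using (¬_)
  open ≡-Reasoning
  open FernTriangle using (orientation; side)

  reflect : Point → Point
  reflect ⟦ U ⨾ k ⟧ = ⟦ - U ⨾ k ⟧

  Reflects : Cell → Cell → Set₁
  Reflects c c′ = ∀ {X : Point → Set} → c ⊑ (X ∘ reflect) → c′ ⊑ X

  ∈△-mirror⁺ : ∀ T p → p ∈△ T → reflect p ∈△ mirror T
  ∈△-mirror⁺ (tri up l s)   ⟦ U ⨾ k ⟧ (p , q , r) = p , by (pos r) (eq l k U (+ s)) , by (pos q) (eq′ l k U (+ s))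
    where
    eq : ∀ l k U s → l + + 2 * s - k - U ≡ - U - (- (l + + 2 * s) + k)
    eq = solve-∀
    eq′ : ∀ l k U s → U - (l + k) ≡ - (l + + 2 * s) + + 2 * s - k - - U
    eq′ = solve-∀
  ∈△-mirror⁺ (tri down l s) ⟦ U ⨾ k ⟧ (p , q , r) = p , by (pos r) (eq l k U (+ s)) , by (pos q) (eq′ l k U (+ s))
    where
    eq : ∀ l k U s → l + + 2 * s + k - U ≡ - U - (- (l + + 2 * s) - k)
    eq = solve-∀
    eq′ : ∀ l k U s → U - (l - k) ≡ - (l + + 2 * s) + + 2 * s + k - - U
    eq′ = solve-∀

  ∈△-mirror⁻ : ∀ T p → p ∈△ mirror T → reflect p ∈△ T
  ∈△-mirror⁻ (tri up l s)   ⟦ U ⨾ k ⟧ (p , q , r) = p , by (pos r) (eq l k U (+ s)) , by (pos q) (eq′ l k U (+ s))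
    where
    eq : ∀ l k U s → - (l + + 2 * s) + + 2 * s - k - U ≡ - U - (l + k)
    eq = solve-∀
    eq′ : ∀ l k U s → U - (- (l + + 2 * s) + k) ≡ l + + 2 * s - k - - U
    eq′ = solve-∀
  ∈△-mirror⁻ (tri down l s) ⟦ U ⨾ k ⟧ (p , q , r) = p , by (pos r) (eq l k U (+ s)) , by (pos q) (eq′ l k U (+ s))
    where
    eq : ∀ l k U s → - (l + + 2 * s) + + 2 * s + k - U ≡ - U - (l - k)
    eq = solve-∀
    eq′ : ∀ l k U s → U - (- (l + + 2 * s) - k) ≡ l + + 2 * s + k - - U
    eq′ = solve-∀

  ∈△-right : ∀ T {U k} → LeftNonNegative T → ⟦ U ⨾ k ⟧ ∈△ T → + 0 ≤ U
  ∈△-right (tri up l s)   {U} {k} h (p , q , _) = by (pos h ⊕ pos p ⊕ pos q) (eq l k U)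
    where
    eq : ∀ l k U → l - + 0 + (k - + 0) + (U - (l + k)) ≡ U - + 0
    eq = solve-∀
  ∈△-right (tri down l s) {U} {k} h (p , q , _) = by (pos h ⊕ pos p ⊕ pos q) (eq l k U)
    where
    eq : ∀ l k U → l - + 0 + (+ 0 - k) + (U - (l - k)) ≡ U - + 0
    eq = solve-∀

  module Facts (hexagon : Hexagon) where

    open Cells hexagon

    InHex : Point → Set
    InHex ⟦ U ⨾ k ⟧ = bottom ≤ k × k ≤ top × U ≤ + W - k × U ≤ + W + + 2 * Z + k × - U ≤ + W - k × - U ≤ + W + + 2 * Z + k

    allFerns : List FernTriangle
    allFerns = central ∷ eastFerns ++ map mirror eastFerns

    InS : Cell → Set
    InS c = c ⊑ InHex × ¬ Removed allFerns c

    inS→present : ∀ c → InS c → Present c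
    inS→present c (h , nr) = All.map (λ { {⟦ _ ⨾ _ ⟧} (p , q , r , s , _) → p , q , r , s }) h , nr ∘ here , nr ∘ there ∘ AnyP.++⁺ˡ

    not-mirrored : ∀ c {U k} → + 1 ≤ U → (∀ {X : Point → Set} → c ⊑ X → X ⟦ U ⨾ k ⟧) → ¬ Removed (map mirror eastFerns) c
    not-mirrored c {U} {k} 1≤U corner r = go (AnyP.map⁻ r) east-left
      where
      go : ∀ {Ts} → Any (λ T → c ⊑ (_∈△ mirror T)) Ts → All LeftNonNegative Ts → ⊥
      go (here {T} p) (h ∷ _) = absurd (ℤP.≤-trans 1≤U (by (pos (∈△-right T h (∈△-mirror⁻ T ⟦ U ⨾ k ⟧ (corner p)))) (eq U)))
        where
        eq : ∀ U → - U - + 0 ≡ + 0 - U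
        eq = solve-∀
      go (there i) (_ ∷ hs) = go i hs

    east-corner : ∀ {X : Point → Set} K o j → place₀ K o j ⊑ X → ∃ λ k → X ⟦ o + + 2 ⨾ k ⟧
    east-corner up o j (_ ∷ q ∷ _) = _ , q
    east-corner dn o j (_ ∷ q ∷ _) = _ , q

    not-all-removed : ∀ K o j → - + 1 ≤ o → Present (place₀ K o j) → ¬ Removed allFerns (place₀ K o j)
    not-all-removed K o j o≥ (_ , nc , nr) (here p) = nc p
    not-all-removed K o j o≥ (_ , nc , nr) (there r) with AnyP.++⁻ eastFerns r
    ... | inj₁ i = nr i
    ... | inj₂ i = not-mirrored (place₀ K o j) {o + + 2} {k′ K} (by (pos o≥) (eq o)) (corner K) i
      where
      eq : ∀ o → o - - + 1 ≡ o + + 2 - + 1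
      eq = solve-∀
      k′ : Kind → ℤ
      k′ up = level′ (suc j)
      k′ dn = level′ j
      corner : ∀ K {X : Point → Set} → place₀ K o j ⊑ X → X ⟦ o + + 2 ⨾ k′ K ⟧
      corner up (_ ∷ q ∷ _) = q
      corner dn (_ ∷ q ∷ _) = q

    present→inS-right : ∀ j u → Present (base₀ (cell right j u)) → InS (base₀ (cell right j u))
    present→inS-right j u p@(bx , _) = All.zipWith (λ { {⟦ U ⨾ k ⟧} (g , (p , q , r , s)) → p , q , r , s ,
        by (pos g ⊕ (pos q ⊕ pos north)) (eq U k top (+ W)) , by (pos g ⊕ (pos p ⊕ south)) (eq′ U k bottom (+ W) Z) }) (right-nonNegative j u , bx) ,
      not-all-removed (kindAt (kindAt κ j) u) (+ u) j -≤+ p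
      where
      eq : ∀ U k t W → U - + 0 + (t - k + (W - t)) ≡ W - k - - U
      eq = solve-∀
      eq′ : ∀ U k b W Z → U - + 0 + (k - b + (W + + 2 * Z + b)) ≡ W + + 2 * Z + k - - U
      eq′ = solve-∀

    present→inS-axis : ∀ j → Present (base₀ (axis j)) → InS (base₀ (axis j))
    present→inS-axis j p@(bx , _) = ⊑₀⁺ K (- + 1) j (all K (⊑₀⁻ K (- + 1) j bx)) , not-all-removed K (- + 1) j (-≤- z≤n) p
      where
      K = opposite (kindAt κ j)
      all : ∀ K → All Box (corners₀ K (- + 1) j) → All InHex (corners₀ K (- + 1) j)
      all up ((p , q , r , s) ∷ (_ , _ , r′ , s′) ∷ (p₃ , q₃ , r₃ , s₃) ∷ []) =
        (p , q , r , s , r′ , s′) ∷ (p , q , r′ , s′ , r , s) ∷ (p₃ , q₃ , r₃ , s₃ , r₃ , s₃) ∷ []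
      all dn ((p , q , r , s) ∷ (_ , _ , r′ , s′) ∷ (p₃ , q₃ , r₃ , s₃) ∷ []) =
        (p , q , r , s , r′ , s′) ∷ (p , q , r′ , s′ , r , s) ∷ (p₃ , q₃ , r₃ , s₃ , r₃ , s₃) ∷ []

    private
      neg₀ : ∀ u → - (- (+ 2 + u) + + 2) ≡ u
      neg₀ = solve-∀
      neg₁ : ∀ u → - (- (+ 2 + u) + + 1) ≡ u + + 1
      neg₁ = solve-∀
      neg₂ : ∀ u → - - (+ 2 + u) ≡ u + + 2
      neg₂ = solve-∀
      pos₀ : ∀ u → - (u + + 2) ≡ - (+ 2 + u)
      pos₀ = solve-∀
      pos₁ : ∀ u → - (u + + 1) ≡ - (+ 2 + u) + + 1
      pos₁ = solve-∀
      pos₂ : ∀ u → - u ≡ - (+ 2 + u) + + 2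
      pos₂ = solve-∀

    right-reflects-left : ∀ j u → Reflects (base₀ (cell right j u)) (base₀ (cell left j u))
    right-reflects-left j u {X} = go (kindAt (kindAt κ j) u)
      where
      at : ∀ {V V′ k} → V ≡ V′ → X ⟦ V ⨾ k ⟧ → X ⟦ V′ ⨾ k ⟧
      at refl p = p
      three : ∀ K → All (X ∘ reflect) (corners₀ K (+ u) j) → All X (corners₀ K -[1+ suc u ] j)
      three up (p ∷ q ∷ r ∷ []) = at (pos₀ (+ u)) q ∷ at (pos₂ (+ u)) p ∷ at (pos₁ (+ u)) r ∷ []
      three dn (p ∷ q ∷ r ∷ []) = at (pos₀ (+ u)) q ∷ at (pos₂ (+ u)) p ∷ at (pos₁ (+ u)) r ∷ []
      go : ∀ K → place₀ K (+ u) j ⊑ (X ∘ reflect) → place₀ K -[1+ suc u ] j ⊑ X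
      go K p = ⊑₀⁺ K -[1+ suc u ] j (three K (⊑₀⁻ {X ∘ reflect} K (+ u) j p))

    left-reflects-right : ∀ j u → Reflects (base₀ (cell left j u)) (base₀ (cell right j u))
    left-reflects-right j u {X} = go (kindAt (kindAt κ j) u)
      where
      at : ∀ {V V′ k} → V ≡ V′ → X ⟦ V ⨾ k ⟧ → X ⟦ V′ ⨾ k ⟧
      at refl p = p
      three : ∀ K → All (X ∘ reflect) (corners₀ K -[1+ suc u ] j) → All X (corners₀ K (+ u) j)
      three up (p ∷ q ∷ r ∷ []) = at (neg₀ (+ u)) q ∷ at (neg₂ (+ u)) p ∷ at (neg₁ (+ u)) r ∷ []
      three dn (p ∷ q ∷ r ∷ []) = at (neg₀ (+ u)) q ∷ at (neg₂ (+ u)) p ∷ at (neg₁ (+ u)) r ∷ []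
      go : ∀ K → place₀ K -[1+ suc u ] j ⊑ (X ∘ reflect) → place₀ K (+ u) j ⊑ X
      go K p = ⊑₀⁺ K (+ u) j (three K (⊑₀⁻ {X ∘ reflect} K -[1+ suc u ] j p))

    inS-reflect : ∀ c c′ → Reflects c c′ → Reflects c′ c → InS c → InS c′
    inS-reflect c c′ r r′ (h , nr) = r (All.map (λ { {⟦ U ⨾ k ⟧} (p , q , s , t , s′ , t′) → p , q , s′ , t′ , neg s , neg t }) h) , nr ∘ removed
      where
      neg : ∀ {U e} → U ≤ e → - - U ≤ e
      neg {U} {e} = subst (_≤ e) (sym (ℤP.neg-involutive U))
      central-reflect : ∀ {p} → p ∈△ central → reflect p ∈△ central
      central-reflect {⟦ U ⨾ k ⟧} (p , q , s) = p , by (pos s) (eq F U k) , by (pos q) (eq′ F U k)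
        where
        eq : ∀ F U k → - F + + 2 * F - k - U ≡ - U - (- F + k)
        eq = solve-∀
        eq′ : ∀ F U k → U - (- F + k) ≡ - F + + 2 * F - k - - U
        eq′ = solve-∀
      removed : Removed allFerns c′ → Removed allFerns c
      removed (here p) = here (r′ (All.map central-reflect p))
      removed (there i) with AnyP.++⁻ eastFerns i
      ... | inj₁ e = there (AnyP.++⁺ʳ eastFerns (AnyP.map⁺ (Any.map (λ {T} p → r′ (All.map (λ {p} → ∈△-mirror⁺ T p) p)) e)))
      ... | inj₂ e = there (AnyP.++⁺ˡ (Any.map (λ {T} p → r′ (All.map (λ {p} → ∈△-mirror⁻ T p) p)) (AnyP.map⁻ e)))

    tall : ∀ c {V} → + 1 ≤ top → + 1 ≤ V → (∀ {X : Point → Set} → c ⊑ X → X ⟦ V ⨾ top ⟧) → ¬ c ⊑ (_∈△ central) × ¬ Removed eastFerns c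
    tall c {V} 1≤top 1≤V corner = (λ p → not-central (corner p)) , λ r → not-east r east-up
      where
      not-central : ¬ ⟦ V ⨾ top ⟧ ∈△ central
      not-central (_ , _ , q) = absurd (ℤP.≤-trans 1≤V (by (pos q ⊕ pos f≤top) (eq F top V)))
        where
        eq : ∀ F t V → - F + + 2 * F - t - V + (t - F) ≡ + 0 - V
        eq = solve-∀
      not-east : ∀ {Ts} → Any (λ T → c ⊑ (_∈△ T)) Ts → All (λ T → orientation T ≡ up → + 2 * + side T ≤ top) Ts → ⊥
      not-east (here {tri up l s} p) (h ∷ _) with corner p
      ... | _ , q , r = absurd (ℤP.≤-trans 1≤top (by (pos q ⊕ pos r ⊕ pos (h refl)) (eq l top V (+ s))))
        where
        eq : ∀ l t V s → V - (l + t) + (l + + 2 * s - t - V) + (t - + 2 * s) ≡ + 0 - t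
        eq = solve-∀
      not-east (here {tri down l s} p) (h ∷ _) with corner p
      ... | q , _ , _ = absurd (ℤP.≤-trans 1≤top q)
      not-east (there i) (_ ∷ hs) = not-east i hs

    level-0 : level′ 0 ≡ top
    level-0 = ℤP.+-identityʳ top

    top-corner-dn : ∀ o {X : Point → Set} → place₀ dn o 0 ⊑ X → X ⟦ o + + 2 ⨾ top ⟧
    top-corner-dn o {X} (_ ∷ q ∷ _) = subst (λ k → X ⟦ o + + 2 ⨾ k ⟧) level-0 q

    top-corner-up : ∀ o {X : Point → Set} → place₀ up (o + + 1) 0 ⊑ X → X ⟦ o + + 2 ⨾ top ⟧
    top-corner-up o {X} (_ ∷ _ ∷ q ∷ []) = subst X (cong₂ ⟦_⨾_⟧ (ℤP.+-assoc o (+ 1) (+ 1)) (trans (lev-up top 0) level-0)) q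

    top-pair : ∀ o → + 1 ≤ top → - + 1 ≤ o →
      (Present (place₀ dn o 0) → Present (place₀ up (o + + 1) 0)) × (Present (place₀ up (o + + 1) 0) → Present (place₀ dn o 0))
    top-pair o 1≤top o≥ = (λ p → upP (fits (top-corner-dn o (proj₁ p)))) , (λ p → dnP (fits (top-corner-up o (proj₁ p))))
      where
      V≥1 : + 1 ≤ o + + 2
      V≥1 = by (pos o≥) (eq o)
        where
        eq : ∀ o → o - - + 1 ≡ o + + 2 - + 1
        eq = solve-∀
      fits : Box ⟦ o + + 2 ⨾ top ⟧ → o + + 2 ≤ + W - top
      fits (_ , _ , q , _) = q
      box : ∀ {U k} → k ≤ top → top - + 1 ≤ k → U ≤ + W - k → Box ⟦ U ⨾ k ⟧
      box {U} {k} k≤ k≥ U≤ = ℤP.≤-trans bottom≤0 0≤k , k≤ , U≤ , by (pos U≤ ⊕ pos 0≤k ⊕ pos 0≤k ⊕ 0≤2* z) (eq U k (+ W) Z)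
        where
        0≤k : + 0 ≤ k
        0≤k = by (pos 1≤top ⊕ pos k≥) (eq′ top k)
          where
          eq′ : ∀ t k → t - + 1 + (k - (t - + 1)) ≡ k - + 0
          eq′ = solve-∀
        eq : ∀ U k W Z → W - k - U + (k - + 0) + (k - + 0) + + 2 * Z ≡ W + + 2 * Z + k - U
        eq = solve-∀
      dnP : o + + 2 ≤ + W - top → Present (place₀ dn o 0)
      dnP h = ⊑₀⁺ dn o 0 (
          subst (λ k → Box ⟦ o ⨾ k ⟧) (sym level-0) (box ℤP.≤-refl (by (num 1) (e₁ top)) (by (pos h ⊕ num 2) (e₂ o (+ W) top))) ∷
          subst (λ k → Box ⟦ o + + 2 ⨾ k ⟧) (sym level-0) (box ℤP.≤-refl (by (num 1) (e₁ top)) h) ∷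
          box (by (num 1) (e₁ top)) ℤP.≤-refl (by (pos h ⊕ num 2) (e₃ o (+ W) top)) ∷ []) , tall (place₀ dn o 0) 1≤top V≥1 (top-corner-dn o)
        where
        e₁ : ∀ t → + 1 ≡ t - (t - + 1)
        e₁ = solve-∀
        e₂ : ∀ o W t → W - t - (o + + 2) + + 2 ≡ W - t - o
        e₂ = solve-∀
        e₃ : ∀ o W t → W - t - (o + + 2) + + 2 ≡ W - (t - + 1) - (o + + 1)
        e₃ = solve-∀
      upP : o + + 2 ≤ + W - top → Present (place₀ up (o + + 1) 0)
      upP h = ⊑₀⁺ up (o + + 1) 0 (
          box (by (num 1) (e₁ top)) ℤP.≤-refl (by (pos h ⊕ num 2) (e₂ o (+ W) top)) ∷
          box (by (num 1) (e₁ top)) ℤP.≤-refl (by (pos h) (e₃ o (+ W) top)) ∷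
          subst (λ k → Box ⟦ o + + 1 + + 1 ⨾ k ⟧) (sym level-0) (box ℤP.≤-refl (by (num 1) (e₁ top)) (by (pos h) (e₄ o (+ W) top))) ∷ []) ,
        tall (place₀ up (o + + 1) 0) 1≤top V≥1 (top-corner-up o)
        where
        e₁ : ∀ t → + 1 ≡ t - (t - + 1)
        e₁ = solve-∀
        e₂ : ∀ o W t → W - t - (o + + 2) + + 2 ≡ W - (t - + 1) - (o + + 1)
        e₂ = solve-∀
        e₃ : ∀ o W t → W - t - (o + + 2) ≡ W - (t - + 1) - (o + + 1 + + 2)
        e₃ = solve-∀
        e₄ : ∀ o W t → W - t - (o + + 2) ≡ W - t - (o + + 1 + + 1)
        e₄ = solve-∀

    sunk : ∀ c {V} → bottom ≤ - + 1 → (∀ {X : Point → Set} → c ⊑ X → X ⟦ V ⨾ bottom ⟧) → ¬ c ⊑ (_∈△ central) × ¬ Removed eastFerns c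
    sunk c {V} low corner = (λ p → not-central (corner p)) , λ r → not-east r east-down
      where
      negative : ¬ + 0 ≤ bottom
      negative q with () ← ℤP.≤-trans q low
      not-central : ¬ ⟦ V ⨾ bottom ⟧ ∈△ central
      not-central (q , _) = negative q
      not-east : ∀ {Ts} → Any (λ T → c ⊑ (_∈△ T)) Ts → All (λ T → orientation T ≡ down → + 2 * + side T ≤ - bottom) Ts → ⊥
      not-east (here {tri down l s} p) (h ∷ _) with corner p
      ... | _ , q , r = negative (by (pos q ⊕ pos r ⊕ pos (h refl)) (eq l bottom V (+ s)))
        where
        eq : ∀ l k V s → V - (l - k) + (l + + 2 * s + k - V) + (- k - + 2 * s) ≡ k - + 0
        eq = solve-∀
      not-east (here {tri up l s} p) (h ∷ _) with corner p
      ... | q , _ , _ = negative q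
      not-east (there i) (_ ∷ hs) = not-east i hs

    module _ (j : ℕ) (last : suc j ≡ m) where

      level-m : level′ (suc j) ≡ bottom
      level-m = trans (cong (λ t → top - + t) last) (trans (cong (λ t → top - t) height) (eq top bottom))
        where
        eq : ∀ t b → t - (t - b) ≡ b
        eq = solve-∀

      level-m-1 : level′ j ≡ bottom + + 1
      level-m-1 = trans (sym (lev-up top j)) (cong (_+ + 1) level-m)

      bottom-corner-up : ∀ o {X : Point → Set} → place₀ up o j ⊑ X → X ⟦ o + + 2 ⨾ bottom ⟧
      bottom-corner-up o {X} (_ ∷ q ∷ _) = subst (λ k → X ⟦ o + + 2 ⨾ k ⟧) level-m q

      bottom-corner-dn : ∀ o {X : Point → Set} → place₀ dn (o + + 1) j ⊑ X → X ⟦ o + + 2 ⨾ bottom ⟧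
      bottom-corner-dn o {X} (_ ∷ _ ∷ q ∷ []) = subst X (cong₂ ⟦_⨾_⟧ (ℤP.+-assoc o (+ 1) (+ 1)) (trans (lev-down top j) level-m)) q

      bottom-pair : ∀ o → bottom ≤ - + 1 →
        (Present (place₀ up o j) → Present (place₀ dn (o + + 1) j)) × (Present (place₀ dn (o + + 1) j) → Present (place₀ up o j))
      bottom-pair o low = (λ p → dnP (fits (bottom-corner-up o (proj₁ p)))) , (λ p → upP (fits (bottom-corner-dn o (proj₁ p))))
        where
        fits : Box ⟦ o + + 2 ⨾ bottom ⟧ → o + + 2 ≤ + W + + 2 * Z + bottom
        fits (_ , _ , _ , q) = q
        box : ∀ {U k} → bottom ≤ k → k ≤ bottom + + 1 → U ≤ + W + + 2 * Z + k → k ≤ - Z → Box ⟦ U ⨾ k ⟧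
        box {U} {k} k≥ k≤ U≤ k≤-Z = k≥ , ℤP.≤-trans k≤0 0≤top , by (pos U≤ ⊕ pos k≤-Z ⊕ pos k≤-Z) (eq U k (+ W) Z) , U≤
          where
          k≤0 : k ≤ + 0
          k≤0 = ℤP.≤-trans k≤-Z (ℤP.neg-mono-≤ (num z))
          eq : ∀ U k W Z → W + + 2 * Z + k - U + (- Z - k) + (- Z - k) ≡ W - k - U
          eq = solve-∀
        b≤ : bottom ≤ - Z
        b≤ = by (pos (deep low) ⊕ num 1) (eq bottom Z)
          where
          eq : ∀ b Z → - Z - + 1 - b + + 1 ≡ - Z - b
          eq = solve-∀
        b+1≤ : bottom + + 1 ≤ - Z
        b+1≤ = by (pos (deep low)) (eq bottom Z)
          where
          eq : ∀ b Z → - Z - + 1 - b ≡ - Z - (b + + 1)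
          eq = solve-∀
        e₁ : ∀ t → + 1 ≡ t + + 1 - t
        e₁ = solve-∀
        upP : o + + 2 ≤ + W + + 2 * Z + bottom → Present (place₀ up o j)
        upP h = ⊑₀⁺ up o j (
            subst (λ k → Box ⟦ o ⨾ k ⟧) (sym level-m) (box ℤP.≤-refl (by (num 1) (e₁ bottom)) (by (pos h ⊕ num 2) (e₂ o (+ W) Z bottom)) b≤) ∷
            subst (λ k → Box ⟦ o + + 2 ⨾ k ⟧) (sym level-m) (box ℤP.≤-refl (by (num 1) (e₁ bottom)) h b≤) ∷
            subst (λ k → Box ⟦ o + + 1 ⨾ k ⟧) (sym level-m-1) (box (by (num 1) (e₁ bottom)) ℤP.≤-refl (by (pos h ⊕ num 2) (e₃ o (+ W) Z bottom)) b+1≤) ∷ []) ,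
          sunk (place₀ up o j) low (bottom-corner-up o)
          where
          e₂ : ∀ o W Z t → W + + 2 * Z + t - (o + + 2) + + 2 ≡ W + + 2 * Z + t - o
          e₂ = solve-∀
          e₃ : ∀ o W Z t → W + + 2 * Z + t - (o + + 2) + + 2 ≡ W + + 2 * Z + (t + + 1) - (o + + 1)
          e₃ = solve-∀
        dnP : o + + 2 ≤ + W + + 2 * Z + bottom → Present (place₀ dn (o + + 1) j)
        dnP h = ⊑₀⁺ dn (o + + 1) j (
            subst (λ k → Box ⟦ o + + 1 ⨾ k ⟧) (sym level-m-1) (box (by (num 1) (e₁ bottom)) ℤP.≤-refl (by (pos h ⊕ num 2) (e₂ o (+ W) Z bottom)) b+1≤) ∷
            subst (λ k → Box ⟦ o + + 1 + + 2 ⨾ k ⟧) (sym level-m-1) (box (by (num 1) (e₁ bottom)) ℤP.≤-refl (by (pos h) (e₃ o (+ W) Z bottom)) b+1≤) ∷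
            subst (λ k → Box ⟦ o + + 1 + + 1 ⨾ k ⟧) (sym level-m) (box ℤP.≤-refl (by (num 1) (e₁ bottom)) (by (pos h) (e₄ o (+ W) Z bottom)) b≤) ∷ []) ,
          sunk (place₀ dn (o + + 1) j) low (bottom-corner-dn o)
          where
          e₂ : ∀ o W Z t → W + + 2 * Z + t - (o + + 2) + + 2 ≡ W + + 2 * Z + (t + + 1) - (o + + 1)
          e₂ = solve-∀
          e₃ : ∀ o W Z t → W + + 2 * Z + t - (o + + 2) ≡ W + + 2 * Z + (t + + 1) - (o + + 1 + + 2)
          e₃ = solve-∀
          e₄ : ∀ o W Z t → W + + 2 * Z + t - (o + + 2) ≡ W + + 2 * Z + t - (o + + 1 + + 1)
          e₄ = solve-∀

    present-bound : ∀ K o j → Present (place₀ K o j) → o + + 2 ≤ + W + Z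
    present-bound K o j (bx , _) with east-corner {Box} K o j bx
    ... | k , (_ , _ , q , r) = halve (by (pos q ⊕ pos r) (eq (+ W) Z k (o + + 2)))
      where
      eq : ∀ W Z k V → W - k - V + (W + + 2 * Z + k - V) ≡ + 2 * (W + Z) - + 2 * V
      eq = solve-∀
      halve : ∀ {a b} → + 2 * a ≤ + 2 * b → a ≤ b
      halve {a} {b} = ℤP.*-cancelˡ-≤-pos a b (+ 2)

module Axis where

  open Transfer
  open Rows
  open Grids
  open Embeddings
  open OneSided
  open Boxes
  open Ferns
  open Geometry
  open HexagonCells
  open import Defs
  open import Data.Bool using (Bool; true; false; not; if_then_else_)
  open import Data.Integer using (ℤ; +_; _+_; _-_; -_; _*_; _≤_; +≤+; -≤+)
  import Data.Integer.Properties as ℤP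
  open import Data.Integer.Tactic.RingSolver using (solve-∀)
  open import Data.List using (List; []; _∷_)
  open import Data.List.Relation.Unary.All using (All; []; _∷_)
  open import Data.List.Relation.Unary.Any using (Any; here; there)
  open import Data.Nat as ℕ using (ℕ; zero; suc; z≤n; s≤s)
  import Data.Nat.Properties as ℕP
  open import Data.Product using (_×_; _,_; proj₁; proj₂)
  open import Data.Sum using (inj₁; inj₂)
  open import Relation.Binary.PropositionalEquality
  open import Relation.Nullary using (¬_)
  open ≡-Reasoning

  module AxisCells (hexagon : Hexagon) where

    open Cells hexagon

    Hole : ℕ → Set
    Hole j = T ℕ.≤ j × j ℕ.< T ℕ.+ f

    level-T : ∀ j → level′ j ≡ + T + F - + j
    level-T j = cong (_- + j) top≡

    axis-hole : ∀ j → Hole j → ¬ Present (base₀ (axis j))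
    axis-hole j (T≤j , j<) (_ , nc , _) = nc (go (kindAt κ j) refl)
      where
      0≤next : + 0 ≤ level′ (suc j)
      0≤next = by (pos (+≤+ j<)) (trans (eq (+ T) F (+ suc j)) (cong (_- + 0) (sym (level-T (suc j)))))
        where
        eq : ∀ T F j → T + F - j ≡ T + F - j - + 0
        eq = solve-∀
      0≤level : + 0 ≤ level′ j
      0≤level = ℤP.≤-trans (+≤+ z≤n) (upper-positive j 0≤next)
      inside : ∀ {U k} → + 0 ≤ k → U ≤ F - k → - U ≤ F - k → ⟦ U ⨾ k ⟧ ∈△ central
      inside {U} {k} p q r = p , by (pos r) (eq U k F) , by (pos q) (eq′ U k F)
        where
        eq : ∀ U k F → F - k - - U ≡ U - (- F + k)
        eq = solve-∀
        eq′ : ∀ U k F → F - k - U ≡ - F + + 2 * F - k - U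
        eq′ = solve-∀
      near : ∀ {i} v → T ℕ.+ v ℕ.≤ i → + v ≤ F - level′ i
      near {i} v l = by (pos (+≤+ l)) (trans (eq (+ T) F (+ i) (+ v)) (cong (λ t → F - t - + v) (sym (level-T i))))
        where
        eq : ∀ T F i v → i - (T + v) ≡ F - (T + F - i) - v
        eq = solve-∀
      near0 : ∀ {i} → T ℕ.≤ i → + 0 ≤ F - level′ i
      near0 {i} l = near 0 (subst (ℕ._≤ i) (sym (ℕP.+-identityʳ T)) l)
      near1 : ∀ {i} → T ℕ.< i → + 1 ≤ F - level′ i
      near1 {i} l = near 1 (subst (ℕ._≤ i) (ℕP.+-comm 1 T) l)
      -1≤ : ∀ {e} → + 1 ≤ e → - + 1 ≤ e
      -1≤ = ℤP.≤-trans -≤+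
      go : ∀ K → kindAt κ j ≡ K → place₀ (opposite K) (- + 1) j ⊑ (_∈△ central)
      go dn e = ⊑₀⁺ up (- + 1) j (inside 0≤next (-1≤ (near1 (s≤s T≤j))) (near1 (s≤s T≤j)) ∷
        inside 0≤next (near1 (s≤s T≤j)) (-1≤ (near1 (s≤s T≤j))) ∷ inside 0≤level (near0 T≤j) (near0 T≤j) ∷ [])
      go up e = ⊑₀⁺ dn (- + 1) j (inside 0≤level (-1≤ (near1 T<j)) (near1 T<j) ∷
        inside 0≤level (near1 T<j) (-1≤ (near1 T<j)) ∷ inside 0≤next (near0 (ℕP.m≤n⇒m≤1+n T≤j)) (near0 (ℕP.m≤n⇒m≤1+n T≤j)) ∷ [])
        where
        T<j : T ℕ.< j
        T<j = ℕP.≤∧≢⇒< T≤j λ { refl → dn≢up (trans (sym kindT) e) }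
          where
          dn≢up : dn ≢ up
          dn≢up ()

    levels : ∀ {i} → i ℕ.≤ m → bottom ≤ level′ i × level′ i ≤ top
    levels {i} l = by (pos (+≤+ l)) (trans (cong (_- + i) height) (eq top bottom (+ i))) , by (num i) (eq′ top (+ i))
      where
      eq : ∀ t b i → t - b - i ≡ t - i - b
      eq = solve-∀
      eq′ : ∀ t i → i ≡ t - (t - i)
      eq′ = solve-∀

    axis-present : ∀ j → j ℕ.< m → ¬ Hole j → Present (base₀ (axis j))
    axis-present j j<m nh = ⊑₀⁺ (opposite (kindAt κ j)) (- + 1) j (go (kindAt κ j) refl) , not-central , not-east east-left
      where
      box0 : ∀ {i} → i ℕ.≤ m → Box ⟦ + 0 ⨾ level′ i ⟧
      box0 {i} l = proj₁ (levels l) , proj₂ (levels l) ,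
        by (pos north ⊕ pos (proj₂ (levels l))) (eq (+ W) top (level′ i)) , by (south ⊕ pos (proj₁ (levels l))) (eq′ (+ W) Z bottom (level′ i))
        where
        eq : ∀ W t k → W - t + (t - k) ≡ W - k - + 0
        eq = solve-∀
        eq′ : ∀ W Z b k → W + + 2 * Z + b + (k - b) ≡ W + + 2 * Z + k - + 0
        eq′ = solve-∀
      wide : ∀ {i} → i ℕ.≤ m → kindAt κ i ≡ up → + 1 ≤ + W - level′ i × + 1 ≤ + W + + 2 * Z + level′ i
      wide {i} l e = northern i l e , southern
        where
        northern : ∀ i → i ℕ.≤ m → kindAt κ i ≡ up → + 1 ≤ + W - level′ i
        northern zero    l e = by (pos (north′ e)) (eq (+ W) top)
          where
          eq : ∀ W t → W - t - + 1 ≡ W - (t - + 0) - + 1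
          eq = solve-∀
        northern (suc i) l e = by (pos north ⊕ num i) (eq (+ W) top (+ i))
          where
          eq : ∀ W t i → W - t + i ≡ W - (t - (+ 1 + i)) - + 1
          eq = solve-∀
        southern : + 1 ≤ + W + + 2 * Z + level′ i
        southern with ℕP.m≤n⇒m<n∨m≡n l
        ... | inj₂ refl = by (pos (south′ e)) (trans (eq (+ W) Z bottom top) (cong (λ h → + W + + 2 * Z + (top - h) - + 1) (sym height)))
          where
          eq : ∀ W Z b t → W + + 2 * Z + b - + 1 ≡ W + + 2 * Z + (t - (t - b)) - + 1
          eq = solve-∀
        ... | inj₁ l′ = by (south ⊕ pos (+≤+ l′)) (trans (cong (λ h → + W + + 2 * Z + bottom + (h - + suc i)) height) (eq (+ W) Z bottom top (+ i)))
          where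
          eq : ∀ W Z b t i → W + + 2 * Z + b + (t - b - (+ 1 + i)) ≡ W + + 2 * Z + (t - i) - + 1
          eq = solve-∀
      box± : ∀ {i U} → i ℕ.≤ m → kindAt κ i ≡ up → U ≤ + 1 → Box ⟦ U ⨾ level′ i ⟧
      box± {i} l e h = proj₁ (levels l) , proj₂ (levels l) , ℤP.≤-trans h (proj₁ (wide l e)) , ℤP.≤-trans h (proj₂ (wide l e))
      go : ∀ K → kindAt κ j ≡ K → All Box (corners₀ (opposite K) (- + 1) j)
      go dn e = box± j<m (kind-suc′ j e) -≤+ ∷ box± j<m (kind-suc′ j e) ℤP.≤-refl ∷ box0 (ℕP.<⇒≤ j<m) ∷ []
      go up e = box± (ℕP.<⇒≤ j<m) e -≤+ ∷ box± (ℕP.<⇒≤ j<m) e ℤP.≤-refl ∷ box0 j<m ∷ []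
      not-central : ¬ base₀ (axis j) ⊑ (_∈△ central)
      not-central p with upperCorner {_∈△ central} (kindOfCell κ (axis j)) (- + 1) j p | lowerCorner {_∈△ central} (kindOfCell κ (axis j)) (- + 1) j p
      ... | U , (_ , q , r) | _ , (k≥0 , _) = nh (T≤j , j<)
        where
        j< : j ℕ.< T ℕ.+ f
        j< = ℤP.drop‿+≤+ (by (pos k≥0) (trans (cong (_- + 0) (level-T (suc j))) (eq (+ T) F (+ suc j))))
          where
          eq : ∀ T F j → T + F - j - + 0 ≡ T + F - j
          eq = solve-∀
        T≤j : T ℕ.≤ j
        T≤j = ℤP.drop‿+≤+ (halve (by (pos q ⊕ pos r) (trans (eq U F (level′ j)) (trans (cong (λ t → + 2 * (F - t)) (level-T j)) (eq′ (+ T) F (+ j))))))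
          where
          halve : ∀ {a b} → + 2 * a ≤ + 2 * b → a ≤ b
          halve {a} {b} = ℤP.*-cancelˡ-≤-pos a b (+ 2)
          eq : ∀ U F k → U - (- F + k) + (- F + + 2 * F - k - U) ≡ + 2 * (F - k)
          eq = solve-∀
          eq′ : ∀ T F j → + 2 * (F - (T + F - j)) ≡ + 2 * j - + 2 * T
          eq′ = solve-∀
      not-east : ∀ {Ts} → All LeftNonNegative Ts → ¬ Any (λ T → base₀ (axis j) ⊑ (_∈△ T)) Ts
      not-east (h ∷ _) (here {T} p) with place-∈ {_∈△ T} (opposite (kindAt κ j)) (- + 1) j p
      ... | i , _ , q with () ← ∈△-right T h q
      not-east (_ ∷ hs) (there r) = not-east hs r

  flips : ℕ → Bool → Bool
  flips zero    o = o
  flips (suc k) o = not (flips k o)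

  module _ {n : ℕ} (a : ℕ → Bool) where

    trues-run : ∀ j m → (∀ i → j ℕ.≤ i → i ℕ.< j ℕ.+ m → a i ≡ true) → trues {n} a j m ≡ m
    trues-run j zero    h = refl
    trues-run j (suc m) h rewrite h j ℕP.≤-refl (ℕP.m<m+n j (s≤s z≤n)) =
      cong suc (trues-run (suc j) m λ i l l′ → h i (ℕP.<⇒≤ l) (subst (i ℕ.<_) (sym (ℕP.+-suc j m)) l′))

    trues-gap : ∀ j m → (∀ i → j ℕ.≤ i → i ℕ.< j ℕ.+ m → a i ≡ false) → trues {n} a j m ≡ 0
    trues-gap j zero    h = refl
    trues-gap j (suc m) h rewrite h j ℕP.≤-refl (ℕP.m<m+n j (s≤s z≤n)) =
      trues-gap (suc j) m λ i l l′ → h i (ℕP.<⇒≤ l) (subst (i ℕ.<_) (sym (ℕP.+-suc j m)) l′)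

    trues-+ : ∀ j k m → trues {n} a j (k ℕ.+ m) ≡ trues {n} a j k ℕ.+ trues {n} a (j ℕ.+ k) m
    trues-+ j zero    m = cong (λ i → trues {n} a i m) (sym (ℕP.+-identityʳ j))
    trues-+ j (suc k) m = trans (cong ((if a j then 1 else 0) ℕ.+_) (trans (trues-+ (suc j) k m)
        (cong (λ i → trues {n} a (suc j) k ℕ.+ trues {n} a i m) (sym (ℕP.+-suc j k)))))
      (sym (ℕP.+-assoc (if a j then 1 else 0) _ _))

    module _ (own : ℕ → Bool) (step : ∀ j → own (suc j) ≡ (if a j then own j else not (own j))) where

      own-run : ∀ j k → (∀ i → j ℕ.≤ i → i ℕ.< j ℕ.+ k → a i ≡ true) → own (j ℕ.+ k) ≡ own j
      own-run j zero    h = cong own (ℕP.+-identityʳ j)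
      own-run j (suc k) h = begin
        own (j ℕ.+ suc k)  ≡⟨ cong own (ℕP.+-suc j k) ⟩
        own (suc (j ℕ.+ k)) ≡⟨ step (j ℕ.+ k) ⟩
        (if a (j ℕ.+ k) then own (j ℕ.+ k) else not (own (j ℕ.+ k)))
          ≡⟨ cong (λ q → if q then own (j ℕ.+ k) else not (own (j ℕ.+ k))) (h (j ℕ.+ k) (ℕP.m≤m+n j k) (ℕP.+-monoʳ-< j (ℕP.n<1+n k))) ⟩
        own (j ℕ.+ k) ≡⟨ own-run j k (λ i l l′ → h i l (ℕP.≤-trans l′ (ℕP.+-monoʳ-≤ j (ℕP.n≤1+n k)))) ⟩
        own j ∎

      own-gap : ∀ j k → (∀ i → j ℕ.≤ i → i ℕ.< j ℕ.+ k → a i ≡ false) → own (j ℕ.+ k) ≡ flips k (own j)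
      own-gap j zero    h = cong own (ℕP.+-identityʳ j)
      own-gap j (suc k) h = begin
        own (j ℕ.+ suc k)  ≡⟨ cong own (ℕP.+-suc j k) ⟩
        own (suc (j ℕ.+ k)) ≡⟨ step (j ℕ.+ k) ⟩
        (if a (j ℕ.+ k) then own (j ℕ.+ k) else not (own (j ℕ.+ k)))
          ≡⟨ cong (λ q → if q then own (j ℕ.+ k) else not (own (j ℕ.+ k))) (h (j ℕ.+ k) (ℕP.m≤m+n j k) (ℕP.+-monoʳ-< j (ℕP.n<1+n k))) ⟩
        not (own (j ℕ.+ k)) ≡⟨ cong not (own-gap j k (λ i l l′ → h i l (ℕP.≤-trans l′ (ℕP.+-monoʳ-≤ j (ℕP.n≤1+n k))))) ⟩
        not (flips k (own j)) ∎

module Assembling where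

  open Transfer
  open Rows
  open Grids
  open Embeddings
  open OneSided
  open Factorizing
  open Boxes
  open Ferns
  open Geometry
  open HexagonCells
  open Axis
  open import Defs
  open import Data.Bool using (Bool; true; false; not; _∧_)
  open import Data.Bool.Properties using (not-involutive)
  open import Data.Empty using (⊥; ⊥-elim)
  open import Data.Integer using (ℤ; +_; ∣_∣; _+_; _-_; -_; _*_; _≤_; +≤+; -≤+; -≤-)
  import Data.Integer.Properties as ℤP
  open import Data.Integer.Tactic.RingSolver using (solve-∀)
  open import Data.List using (List; []; _∷_; map)
  open import Data.List.Membership.Propositional using (_∈_)
  open import Data.List.Membership.Propositional.Properties using (∈-filter⁺; ∈-filter⁻)
  open import Data.List.Membership.DecPropositional _≟ᶜ_ using (_∈?_)
  open import Data.List.Relation.Unary.All as All using (All; []; _∷_)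
  open import Data.List.Relation.Unary.Any as Any using (Any; here; there)
  open import Data.List.Relation.Unary.Unique.Propositional using (Unique)
  import Data.List.Relation.Unary.Unique.Propositional.Properties as UniqueP
  open import Data.Nat as ℕ using (ℕ; zero; suc; z≤n; s≤s)
  import Data.Nat.Properties as ℕP
  open import Data.Product using (_×_; _,_; proj₁; proj₂; ∃)
  open import Data.Rational using (ℚ; 1ℚ; ½)
  open import Data.Sum using (_⊎_; inj₁; inj₂)
  open import Data.Unit using (tt)
  open import Data.Vec using ([]; _∷_)
  open import Function using (_∘_; mk⇔)
  open import Relation.Binary.PropositionalEquality
  open import Relation.Nullary using (Dec; yes; no; ¬_; contradiction; _×-dec_)
  open import Relation.Nullary.Decidable using (does-⇔; dec-true; dec-false)
  open ≡-Reasoning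
  open import Algebra.Bundles using (module AbelianGroup)
  open import Algebra.Properties.Group (AbelianGroup.group ℤP.+-0-abelianGroup) using () renaming (∙-cancelˡ to +-cancelˡ)

  module Assembly (hexagon : Hexagon) where

    open Cells hexagon

    open Facts hexagon
    open AxisCells hexagon

    n : ℕ
    n = suc (W ℕ.+ z)

    module F = Factorization κ top n (s≤s z≤n) m

    move-0 : ∀ c → moveCell (+ 0) c ≡ c
    move-0 (△ ⟦ U ⨾ k ⟧) = cong (λ V → △ ⟦ V ⨾ k ⟧) (ℤP.+-identityˡ U)
    move-0 (▽ ⟦ U ⨾ k ⟧) = cong (λ V → ▽ ⟦ V ⨾ k ⟧) (ℤP.+-identityˡ U)

    record Realization : Set where
      field
        S : Region
        unique : Unique (cells S)
        in⁻ : ∀ {c} → c ∈ cells S → InS c × LatticeVertex (+ W) (vertex c)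
        in⁺ : ∀ {c} → InS c → LatticeVertex (+ W) (vertex c) → c ∈ cells S
        weightless : ∀ l → weight S l ≡ 1ℚ

    module Symmetric (realization : Realization) where

      open Realization realization public

      open F.In (+ 0) S

      parityS : + 0 - top - + W ≡ + x + + 2 * (E - + W)
      parityS = trans (eq top (+ W)) (trans (cong (_- + 2 * + W) (sym north≡)) (eq′ (+ x) E (+ W)))
        where
        eq : ∀ t W → + 0 - t - W ≡ W - t - + 2 * W
        eq = solve-∀
        eq′ : ∀ x E W → x + + 2 * E - + 2 * W ≡ x + + 2 * (E - W)
        eq′ = solve-∀

      embed≡ : ∀ y → embed y ≡ base₀ y
      embed≡ y = trans (embed-base (+ 0) y) (move-0 (base₀ y))

      embed-in⁺ : ∀ y → InS (base₀ y) → embed y ∈ cells S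
      embed-in⁺ y i = subst (_∈ cells S) (sym (embed≡ y)) (in⁺ i
        (subst (LatticeVertex (+ W) ∘ vertex) (move-0 (base₀ y)) (lattice-base (+ W) (+ 0) (E - + W) parityS y)))

      embed-in⁻ : ∀ y → embed y ∈ cells S → InS (base₀ y)
      embed-in⁻ y i = proj₁ (in⁻ (subst (_∈ cells S) (embed≡ y) i))

      located : Located
      located {c} i = let (h , _) , v = in⁻ i in
        locate (+ W) (+ 0) (E - + W) parityS c v (All.map (λ { {⟦ U ⨾ k ⟧} → within }) h)
        where
        halve : ∀ {a b} → + 2 * a ≤ + 2 * b → a ≤ b
        halve {a} {b} = ℤP.*-cancelˡ-≤-pos a b (+ 2)
        within : ∀ {U k} → InHex ⟦ U ⨾ k ⟧ → Within (+ W) (+ 0) (E - + W) parityS (W ℕ.+ z) ⟦ U ⨾ k ⟧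
        within {U} {k} (p , q , r , s , r′ , s′) = p , q ,
          halve (by (pos r′ ⊕ pos s′ ⊕ num 2) (eq (+ W) Z U k)) , halve (by (pos r ⊕ pos s) (eq′ (+ W) Z U k))
          where
          eq : ∀ W Z U k → W - k - - U + (W + + 2 * Z + k - - U) + + 2 ≡ + 2 * (U - + 0) - + 2 * (- (W + Z) - + 1)
          eq = solve-∀
          eq′ : ∀ W Z U k → W - k - U + (W + + 2 * Z + k - U) ≡ + 2 * (W + Z) - + 2 * (U - + 0)
          eq′ = solve-∀

      weights : Weights 1ℚ
      weights (axis _ , base)     _ _ _ = weightless _
      weights (axis _ , westSide) _ _ _ = weightless _
      weights (axis _ , eastSide) _ _ _ = weightless _
      weights (cell _ _ _ , _)    _ _ _ = weightless _

      mirrored : ∀ j u → at (cell left j u) ≡ at (cell right j u)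
      mirrored j u = does-⇔ (mk⇔
          (λ i → embed-in⁺ (cell right j u) (inS-reflect _ _ (left-reflects-right j u) (right-reflects-left j u) (embed-in⁻ (cell left j u) i)))
          (λ i → embed-in⁺ (cell left j u) (inS-reflect _ _ (right-reflects-left j u) (left-reflects-right j u) (embed-in⁻ (cell right j u) i))))
        (embed (cell left j u) ∈? cells S) (embed (cell right j u) ∈? cells S)

      open F.Whole S unique located weights mirrored public

      right⁺ : ∀ j u → Present (base₀ (cell right j u)) → embed (cell right j u) ∈ cells S
      right⁺ j u p = embed-in⁺ (cell right j u) (present→inS-right j u p)

      axis⁺ : ∀ j → Present (base₀ (axis j)) → embed (axis j) ∈ cells S
      axis⁺ j p = embed-in⁺ (axis j) (present→inS-axis j p)

      near⁻ : ∀ y → embed y ∈ cells S → Present (base₀ y)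
      near⁻ y i = inS→present (base₀ y) (embed-in⁻ y i)

      at-axis-true : ∀ j → j ℕ.< m → ¬ Hole j → at (axis j) ≡ true
      at-axis-true j l nh = dec-true (embed (axis j) ∈? cells S) (axis⁺ j (axis-present j l nh))

      at-axis-false : ∀ j → Hole j → at (axis j) ≡ false
      at-axis-false j h = dec-false (embed (axis j) ∈? cells S) (λ i → axis-hole j h (near⁻ (axis j) i))

      module _ (B : ℕ) (m≡ : m ≡ T ℕ.+ f ℕ.+ B) where

        T≤m : T ℕ.≤ m
        T≤m = subst (T ℕ.≤_) (sym m≡) (ℕP.≤-trans (ℕP.m≤m+n T f) (ℕP.m≤m+n (T ℕ.+ f) B))

        before : ∀ j → j ℕ.< T → at (axis j) ≡ true
        before j l = at-axis-true j (ℕP.≤-trans l T≤m) (λ h → ℕP.<⇒≱ l (proj₁ h))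

        after : ∀ j → T ℕ.+ f ℕ.≤ j → j ℕ.< m → at (axis j) ≡ true
        after j l l′ = at-axis-true j l′ (λ h → ℕP.<⇒≱ (proj₂ h) l)

        trues≡ : trues {n} (λ j → at (axis j)) 0 m ≡ T ℕ.+ B
        trues≡ = begin
          trues {n} a 0 m ≡⟨ cong (trues {n} a 0) (trans m≡ (ℕP.+-assoc T f B)) ⟩
          trues {n} a 0 (T ℕ.+ (f ℕ.+ B)) ≡⟨ trues-+ {n} a 0 T (f ℕ.+ B) ⟩
          trues {n} a 0 T ℕ.+ trues {n} a T (f ℕ.+ B) ≡⟨ cong₂ ℕ._+_ (trues-run {n} a 0 T (λ i _ → before i)) (trues-+ {n} a T f B) ⟩
          T ℕ.+ (trues {n} a T f ℕ.+ trues {n} a (T ℕ.+ f) B)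
            ≡⟨ cong (T ℕ.+_) (cong₂ ℕ._+_ (trues-gap {n} a T f (λ i l l′ → at-axis-false i (l , l′)))
                 (trues-run {n} a (T ℕ.+ f) B (λ i l l′ → after i l (subst (i ℕ.<_) (sym m≡) l′)))) ⟩
          T ℕ.+ B ∎
          where
          a : ℕ → Bool
          a j = at (axis j)

        own-before : ∀ j → j ℕ.≤ T → own j ≡ phase {n} κ false
        own-before j l = own-run {n} (λ j → at (axis j)) own (λ _ → refl) 0 j (λ i _ l′ → before i (ℕP.≤-trans l′ l))

        own-after : ∀ j → T ℕ.+ f ℕ.≤ j → j ℕ.≤ m → own j ≡ flips f (phase {n} κ false)
        own-after j l l′ = begin
          own j ≡⟨ cong own (ℕP.m+[n∸m]≡n l) ⟨
          own (T ℕ.+ f ℕ.+ (j ℕ.∸ (T ℕ.+ f)))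
            ≡⟨ own-run {n} (λ j → at (axis j)) own (λ _ → refl) (T ℕ.+ f) (j ℕ.∸ (T ℕ.+ f))
                 (λ i k k′ → after i k (ℕP.≤-trans (subst (i ℕ.<_) (ℕP.m+[n∸m]≡n l) k′) l′)) ⟩
          own (T ℕ.+ f) ≡⟨ own-gap {n} (λ j → at (axis j)) own (λ _ → refl) T f (λ i k k′ → at-axis-false i (k , k′)) ⟩
          flips f (own T) ≡⟨ cong (flips f) (own-before T ℕP.≤-refl) ⟩
          _ ∎

    level-suc-upper : ∀ j → Upper j → suc j ℕ.≤ T ℕ.+ f
    level-suc-upper j u = ℤP.drop‿+≤+ (by (pos u) (trans (cong (_- + 0) (level-T (suc j))) (eq (+ T) F (+ suc j))))
      where
      eq : ∀ T F j → T + F - j - + 0 ≡ T + F - j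
      eq = solve-∀

    level-lower : ∀ j → Lower j → T ℕ.+ f ℕ.≤ j
    level-lower j l = ℤP.drop‿+≤+ (by (pos l) (trans (cong (λ t → + 0 - t) (level-T j)) (eq (+ T) F (+ j))))
      where
      eq : ∀ T F j → + 0 - (T + F - j) ≡ j - (T + F)
      eq = solve-∀

    not-both : ∀ j → Upper j → ¬ Lower j
    not-both j u l = absurd (ℤP.≤-trans (upper-positive j u) l)

    as-level : ∀ {k} → k ≤ top → ∃ λ i → k ≡ level′ i
    as-level {k} h with ≤-difference h
    ... | i , e = i , trans (eq top k) (cong (λ t → top - t) e)
      where
      eq : ∀ t k → k ≡ t - (t - k)
      eq = solve-∀

    vertex-∈ : ∀ {X : Point → Set} c → c ⊑ X → X (vertex c)
    vertex-∈ (△ P) (p ∷ _) = p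
    vertex-∈ (▽ P) (p ∷ _) = p

    ownOf : (uo lo : Bool) → Part → Bool
    ownOf uo lo upper = uo
    ownOf uo lo lower = lo

    module Halfway (placement : Placement)
      (weighted⁺ : ∀ p → ownOf (Placement.uo placement) (Placement.lo placement) p ≡ true → p ∈ Profile.halving (Placement.D placement))
      (weighted⁻ : ∀ p → p ∈ Profile.halving (Placement.D placement) → ownOf (Placement.uo placement) (Placement.lo placement) p ≡ true)
      where

      open Halved placement
      open Profile D

      R : Region
      R = H.region D

      open F.In s R

      shift-parity : s - top - + 0 ≡ + x + + 2 * (E + + H.L - + W)
      shift-parity = trans (eq s (+ W) top) (trans (cong (λ l → l - + W - + W + (+ W - top)) (sym L≡))
        (trans (cong (λ q → + 2 * + H.L - + W - + W + q) (sym north≡)) (eq′ (+ x) E (+ H.L) (+ W))))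
        where
        eq : ∀ s W t → s - t - + 0 ≡ s + W - W - W + (W - t)
        eq = solve-∀
        eq′ : ∀ x E L W → + 2 * L - W - W + (x + + 2 * E) ≡ x + + 2 * (E + L - W)
        eq′ = solve-∀

      box : List Cell
      box = cellsInBox (+ 0) (- + 2 , + 2 * + H.L + Z) (- B - + 1 , A + + 1)

      in⁻ : ∀ {c} → c ∈ cells R → H.InRegion D c × LatticeVertex (+ 0) (vertex c)
      in⁻ {c} i = let (j , q) = ∈-filter⁻ (H.inRegion? D) {xs = box} i in
        q , cellsInBox-∈⁻ {+ 0} { - + 2} {+ 2 * + H.L + Z} { - B - + 1} {A + + 1} {c} j

      inside⁻ : ∀ y → embed y ∈ cells R → Inside y
      inside⁻ y i = subst (H.InRegion D) (embed-base s y) (proj₁ (in⁻ i))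

      zig-α : ∀ {k} → + 0 ≤ k → k ≤ A → s - + 1 ≤ α ∣ k ∣
      zig-α {k} p q with as-level {k} (ℤP.≤-trans q (by (num ε) (trans (eq top (+ ε)) (cong (λ a → top - a) (sym A≡)))))
        where
        eq : ∀ t e → e ≡ t - (t - e)
        eq = solve-∀
      ... | i , refl = subst (s - + 1 ≤_) (sym (α≡ i p)) (ℤP.+-monoʳ-≤ s (zig≥-1 uo (kindAt κ i)))

      zig-β : ∀ {k} → k ≤ + 0 → s - + 1 ≤ β ∣ k ∣
      zig-β {k} p with as-level {k} (ℤP.≤-trans p 0≤top)
      ... | i , refl = subst (s - + 1 ≤_) (sym (β≡ i p)) (ℤP.+-monoʳ-≤ s (zig≥-1 lo (kindAt κ i)))

      private
        halve : ∀ {a b} → + 2 * a ≤ + 2 * b → a ≤ b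
        halve {a} {b} = ℤP.*-cancelˡ-≤-pos a b (+ 2)

        back : ∀ s U → s + (U - s) ≡ U
        back = solve-∀

      inside⁺ : ∀ y → Inside y → embed y ∈ cells R
      inside⁺ y ins@(q , _) = subst (_∈ cells R) (sym (embed-base s y))
        (∈-filter⁺ (H.inRegion? D) (in-box q) ins)
        where
        c = moveCell s (base₀ y)
        lattice : LatticeVertex (+ 0) (vertex c)
        lattice = lattice-base (+ 0) s (E + + H.L - + W) shift-parity y
        A≥ : - + 1 ≤ A
        A≥ = by (pos 0≤top ⊕ pos (+≤+ ε≤1)) (trans (eq top (+ ε)) (cong (λ a → a - - + 1) (sym A≡)))
          where
          eq : ∀ t e → t - + 0 + (+ 1 - e) ≡ t - e - - + 1
          eq = solve-∀
        B≥ : - + 1 ≤ B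
        B≥ = by (pos bottom≤0 ⊕ pos (+≤+ ε≤1)) (trans (eq bottom (+ ε)) (cong (λ a → a - - + 1) (sym B≡)))
          where
          eq : ∀ t e → + 0 - t + (+ 1 - e) ≡ - t - e - - + 1
          eq = solve-∀
        west : ∀ {t U} → s - + 1 ≤ t → t ≤ U → - + 2 ≤ U
        west {t} {U} p q = by (pos p ⊕ pos q ⊕ pos s≥) (eq s t U)
          where
          eq : ∀ s t U → t - (s - + 1) + (U - t) + (s - - + 1) ≡ U - - + 2
          eq = solve-∀
        in-box : (c ⊑ H.InPart D upper × ¬ c ⊑ H.WestOfFern D) ⊎ c ⊑ H.InPart D lower → c ∈ box
        in-box (inj₁ (p , _)) with vertex c | vertex-∈ c p | cellsInBox-∈⁺ {+ 0} { - + 2} {+ 2 * + H.L + Z} { - B - + 1} {A + + 1} {c} lattice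
        ... | ⟦ U ⨾ k ⟧ | k≥0 , k≤A , α≤ , U≤ | done = done (west (zig-α k≥0 k≤A) α≤)
            (by (pos U≤ ⊕ pos k≥0 ⊕ num z) (eq (+ H.L) U k Z)) (by (pos B≥ ⊕ pos k≥0) (eq′ B k)) (by (pos k≤A ⊕ num 1) (eq″ A k))
          where
          eq : ∀ L U k Z → + 2 * L - k - U + (k - + 0) + Z ≡ + 2 * L + Z - U
          eq = solve-∀
          eq′ : ∀ B k → B - - + 1 + (k - + 0) ≡ k - (- B - + 1)
          eq′ = solve-∀
          eq″ : ∀ A k → A - k + + 1 ≡ A + + 1 - k
          eq″ = solve-∀
        in-box (inj₂ p) with vertex c | vertex-∈ c p | cellsInBox-∈⁺ {+ 0} { - + 2} {+ 2 * + H.L + Z} { - B - + 1} {A + + 1} {c} lattice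
        ... | ⟦ U ⨾ k ⟧ | k≤0 , k≥B , β≤ , U≤ , U≤′ | done = done (west (zig-β k≤0) β≤)
            (halve (by (pos U≤ ⊕ pos U≤′) (eq (+ H.L) U k Z))) (by (pos k≥B ⊕ num 1) (eq′ B k)) (by (pos A≥ ⊕ pos k≤0) (eq″ A k))
          where
          eq : ∀ L U k Z → + 2 * L - k - U + (+ 2 * L + + 2 * Z + k - U) ≡ + 2 * (+ 2 * L + Z) - + 2 * U
          eq = solve-∀
          eq′ : ∀ B k → k - - B + + 1 ≡ k - (- B - + 1)
          eq′ = solve-∀
          eq″ : ∀ A k → A - - + 1 + (+ 0 - k) ≡ A + + 1 - k
          eq″ = solve-∀

      located : Located
      located {c} i = let ((q , _) , v) = in⁻ i in locate (+ 0) s (E + + H.L - + W) shift-parity c v (within q)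
        where
        far : ∀ {U k} → Box ⟦ U - s ⨾ k ⟧ → - + 1 ≤ U - s → Within (+ 0) s (E + + H.L - + W) shift-parity (W ℕ.+ z) ⟦ U ⨾ k ⟧
        far {U} {k} (p , q , r , t) h = p , q , ℤP.≤-trans (ℤP.≤-trans (by (num (W ℕ.+ z)) (eq (+ (W ℕ.+ z)))) (ℤP.≤-refl { - + 1})) h , halve (by (pos r ⊕ pos t) (eq′ (+ W) Z (U - s) k))
          where
          eq : ∀ w → w ≡ - + 1 - (- w - + 1)
          eq = solve-∀
          eq′ : ∀ W Z V k → W - k - V + (W + + 2 * Z + k - V) ≡ + 2 * (W + Z) - + 2 * V
          eq′ = solve-∀
        left≥ : ∀ {t U} → s - + 1 ≤ t → t ≤ U → - + 1 ≤ U - s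
        left≥ {t} {U} p q = by (pos p ⊕ pos q) (eq s t U)
          where
          eq : ∀ s t U → t - (s - + 1) + (U - t) ≡ U - s - - + 1
          eq = solve-∀
        within : (c ⊑ H.InPart D upper × ¬ c ⊑ H.WestOfFern D) ⊎ c ⊑ H.InPart D lower → c ⊑ Within (+ 0) s (E + + H.L - + W) shift-parity (W ℕ.+ z)
        within (inj₁ (p , _)) = All.map (λ { {⟦ U ⨾ k ⟧} h@(k≥0 , k≤A , α≤ , _) →
          far {U} {k} (upper→ ⟦ U - s ⨾ k ⟧ (subst (λ V → H.InPart D upper ⟦ V ⨾ k ⟧) (sym (back s U)) h)) (left≥ (zig-α k≥0 k≤A) α≤) }) p
        within (inj₂ p) = All.map (λ { {⟦ U ⨾ k ⟧} h@(k≤0 , _ , β≤ , _) →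
          far {U} {k} (lower→ ⟦ U - s ⨾ k ⟧ (subst (λ V → H.InPart D lower ⟦ V ⨾ k ⟧) (sym (back s U)) h)) (left≥ (zig-β k≤0) β≤) }) p

      unique : Unique (cells R)
      unique = UniqueP.filter⁺ (H.inRegion? D) (cellsInBox-unique (+ 0) (- + 2 , + 2 * + H.L + Z) (- B - + 1 , A + + 1))

      flat : ∀ j u → at (cell left j u) ≡ false
      flat j u = dec-false (embed (cell left j u) ∈? cells R) (λ i → left-outside j u (inside⁻ (cell left j u) i))

      weight-½ : ∀ P → H.OnHalving D P (northEast P) → H.OnHalving D P (southEast P) → H.lozengeWeight D (lozenge P base) ≡ ½
      weight-½ P p q with H.onHalving? D P (northEast P) ×-dec H.onHalving? D P (southEast P)
      ... | yes _ = refl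
      ... | no n  = contradiction (p , q) n

      weight-1 : ∀ P → ¬ H.OnHalving D P (northEast P) → H.lozengeWeight D (lozenge P base) ≡ 1ℚ
      weight-1 P np with H.onHalving? D P (northEast P) ×-dec H.onHalving? D P (southEast P)
      ... | yes (p , _) = contradiction p np
      ... | no _        = refl

      on-upper : ∀ i → uo ≡ true → + 0 ≤ level′ i → level′ i ≤ A → H.OnZigzag D upper ⟦ s + zig true (kindAt κ i) ⨾ level′ i ⟧
      on-upper i e p q = p , q , sym (trans (α≡ i p) (cong (λ o → s + zig o (kindAt κ i)) e))

      on-lower : ∀ i → lo ≡ true → level′ i ≤ + 0 → - B ≤ level′ i → H.OnZigzag D lower ⟦ s + zig true (kindAt κ i) ⨾ level′ i ⟧
      on-lower i e p q = p , q , sym (trans (β≡ i p) (cong (λ o → s + zig o (kindAt κ i)) e))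

      off-zigzag : ∀ p v i → p ∈ halving → ¬ H.OnZigzag D p ⟦ s + + suc v ⨾ level′ i ⟧
      off-zigzag upper v i w (p , _ , e) = contradiction (+-cancelˡ s _ _ (trans e (trans (α≡ i p) (cong (λ o → s + zig o (kindAt κ i)) (weighted⁻ upper w)))))
        (positive (kindAt κ i))
        where
        positive : ∀ K → + suc v ≢ zig true K
        positive dn ()
        positive up ()
      off-zigzag lower v i w (p , _ , e) = contradiction (+-cancelˡ s _ _ (trans e (trans (β≡ i p) (cong (λ o → s + zig o (kindAt κ i)) (weighted⁻ lower w)))))
        (positive (kindAt κ i))
        where
        positive : ∀ K → + suc v ≢ zig true K
        positive dn ()
        positive up ()

      right-weight : ∀ j u → weight R (lozengeOf (cell right j u , base)) ≡ 1ℚ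
      right-weight j u = weight-1 (point (cell right j u)) λ o → on o
        where
        P = point (cell right j u)
        P≡ : northEast P ≡ ⟦ s + + suc u ⨾ level′ j ⟧
        P≡ = cong₂ ⟦_⨾_⟧ (trans (ℤP.+-assoc s (+ u) (+ 1)) (cong (λ v → s + + v) (ℕP.+-comm u 1))) (lev-up top j)
        on : ¬ Any (λ p → H.OnZigzag D p P × H.OnZigzag D p (northEast P)) halving
        on o = go halving (λ i → i) o
          where
          go : ∀ ps → (∀ {p} → p ∈ ps → p ∈ halving) → ¬ Any (λ p → H.OnZigzag D p P × H.OnZigzag D p (northEast P)) ps
          go (p ∷ ps) sub (here (_ , h)) = off-zigzag p u j (sub (here refl)) (subst (H.OnZigzag D p) P≡ h)
          go (p ∷ ps) sub (there i)      = go ps (sub ∘ there) i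

      lose′ : ∀ {Q : Part → Set} p → p ∈ halving → Q p → Any Q halving
      lose′ p i q = Any.map (λ { refl → q }) i

      axis-weight : ∀ j → kindOf (axis j) ≡ up → Inside (axis j) → Inside (axis (suc j)) → weight R (lozengeOf (axis j , base)) ≡ ½
      axis-weight j K i i′ = weight-½ P (proj₁ onBoth) (proj₂ onBoth)
        where
        P = point (axis j)
        kj : kindAt κ j ≡ dn
        kj = opposite-up′ K
        ksj : kindAt κ (suc j) ≡ up
        ksj = kind-suc′ j kj
        kssj : kindAt κ (suc (suc j)) ≡ dn
        kssj = kind-suc′ (suc j) ksj
        at-P : ⟦ s + zig true (kindAt κ (suc j)) ⨾ level′ (suc j) ⟧ ≡ P
        at-P = cong (λ K → ⟦ s + zig true K ⨾ level′ (suc j) ⟧) ksj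
        at-NE : ⟦ s + zig true (kindAt κ j) ⨾ level′ j ⟧ ≡ northEast P
        at-NE = cong₂ ⟦_⨾_⟧ (trans (cong (λ K → s + zig true K) kj) (eq s)) (sym (lev-up top j))
          where
          eq : ∀ s → s + + 0 ≡ s + - + 1 + + 1
          eq = solve-∀
        at-SE : ⟦ s + zig true (kindAt κ (suc (suc j))) ⨾ level′ (suc (suc j)) ⟧ ≡ southEast P
        at-SE = cong₂ ⟦_⨾_⟧ (trans (cong (λ K → s + zig true K) kssj) (eq s)) (sym (lev-down top (suc j)))
          where
          eq : ∀ s → s + + 0 ≡ s + - + 1 + + 1
          eq = solve-∀
        pack : ∀ p → p ∈ halving → H.OnZigzag D p P → H.OnZigzag D p (northEast P) → H.OnZigzag D p (southEast P) →
          H.OnHalving D P (northEast P) × H.OnHalving D P (southEast P)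
        pack p i a b c = lose′ p i (a , b) , lose′ p i (a , c)
        less : ∀ {i} k → i ≡ k → level′ (suc k) ≤ level′ i
        less k refl = by (num 1) (trans (eq (level′ (suc k))) (cong (_- level′ (suc k)) (sym (level-step k))))
          where
          eq : ∀ l → + 1 ≡ + 1 + l - l
          eq = solve-∀
        onBoth : H.OnHalving D P (northEast P) × H.OnHalving D P (southEast P)
        onBoth with axis-owned (suc j) i′ | axis-owned j i
        ... | inj₁ (u , e) | _ = pack upper (weighted⁺ upper e)
            (subst (H.OnZigzag D upper) at-P (on-upper (suc j) e (ℤP.≤-trans u (less (suc j) refl)) (ℤP.≤-trans (less j refl) A-bound)))
            (subst (H.OnZigzag D upper) at-NE (on-upper j e (ℤP.≤-trans (ℤP.≤-trans u (less (suc j) refl)) (less j refl)) A-bound))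
            (subst (H.OnZigzag D upper) at-SE (on-upper (suc (suc j)) e u (ℤP.≤-trans (less (suc j) refl) (ℤP.≤-trans (less j refl) A-bound))))
          where
          A-bound : level′ j ≤ A
          A-bound with inside→uncut (axis j) i
          ... | inj₁ (_ , ε≤j) = by (pos (+≤+ ε≤j)) (trans (eq top (+ j) (+ ε)) (cong (_- level′ j) (sym A≡)))
            where
            eq : ∀ t i e → i - e ≡ t - e - (t - i)
            eq = solve-∀
          ... | inj₂ (l , _) = contradiction l (not-both j (ℤP.≤-trans u (less (suc j) refl)))
        ... | inj₂ (l′ , _) | inj₂ (l , e) = pack lower (weighted⁺ lower e)
            (subst (H.OnZigzag D lower) at-P (on-lower (suc j) e l′ (ℤP.≤-trans B-bound (less (suc j) refl))))
            (subst (H.OnZigzag D lower) at-NE (on-lower j e l (ℤP.≤-trans (ℤP.≤-trans B-bound (less (suc j) refl)) (less j refl))))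
            (subst (H.OnZigzag D lower) at-SE (on-lower (suc (suc j)) e (ℤP.≤-trans (less (suc j) refl) l′) B-bound))
          where
          B-bound : - B ≤ level′ (suc (suc j))
          B-bound with inside→uncut (axis (suc j)) i′
          ... | inj₂ (_ , h) = by (pos (+≤+ h)) (trans (cong (_- + (suc (suc j) ℕ.+ ε)) height) (trans (eq top bottom (+ suc (suc j)) (+ ε))
                (cong (λ b → level′ (suc (suc j)) - - b) (sym B≡))))
            where
            eq : ∀ t b i e → t - b - (i + e) ≡ t - i - - (- b - e)
            eq = solve-∀
          ... | inj₁ (u , _) = contradiction l′ (not-both (suc j) u)
        -- the lozenge would lie across the line k = 0, between axis cells
        ... | inj₂ (l′ , _) | inj₁ (u , _) = ⊥-elim (crossing f refl)
          where
          j+1≡ : suc j ≡ T ℕ.+ f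
          j+1≡ = ℕP.≤-antisym (level-suc-upper j u) (level-lower (suc j) l′)
          crossing : ∀ f′ → f ≡ f′ → ⊥
          crossing zero    e with () ← trans (sym kindT) (subst (λ i → kindAt κ i ≡ up) (trans j+1≡ (trans (cong (T ℕ.+_) e) (ℕP.+-identityʳ T))) ksj)
          crossing (suc g) e = axis-hole j (T≤j , subst (j ℕ.<_) j+1≡ ℕP.≤-refl) (inside→present (axis j) i)
            where
            T≤j : T ℕ.≤ j
            T≤j = subst (T ℕ.≤_) (sym (ℕP.suc-injective (trans j+1≡ (trans (cong (T ℕ.+_) e) (ℕP.+-suc T g))))) (ℕP.m≤m+n T g)

      weights : Weights ½
      weights (axis j , base)     q i i′ = axis-weight j q (inside⁻ (axis j) i) (inside⁻ (axis (suc j)) i′)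
      weights (axis _ , westSide) _ _ _ = refl
      weights (axis _ , eastSide) _ _ _ = refl
      weights (cell right j u , base) _ _ _ = right-weight j u
      weights (cell left j u , base)  _ i _ = contradiction (inside⁻ (cell left j u) i) (left-outside j u)
      weights (cell right _ _ , westSide) _ _ _ = refl
      weights (cell right _ _ , eastSide) _ _ _ = refl
      weights (cell left _ _ , westSide)  _ _ _ = refl
      weights (cell left _ _ , eastSide)  _ _ _ = refl

      open F.Half s R unique located weights flat public

    isDn : Kind → Bool
    isDn dn = true
    isDn up = false

    isDn-opposite : ∀ K → isDn (opposite K) ≡ not (isDn K)
    isDn-opposite dn = refl
    isDn-opposite up = refl

    isDn-kindAt : ∀ K i → isDn (kindAt K i) ≡ flips i (isDn K)
    isDn-kindAt K zero    = refl
    isDn-kindAt K (suc i) = trans (cong isDn (kindAt-opposite K i)) (trans (isDn-opposite (kindAt K i)) (cong not (isDn-kindAt K i)))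

    flips-+ : ∀ i j o → flips (i ℕ.+ j) o ≡ flips i (flips j o)
    flips-+ zero    j o = refl
    flips-+ (suc i) j o = cong not (flips-+ i j o)

    flips-double : ∀ i o → flips (i ℕ.+ i) o ≡ o
    flips-double zero    o = refl
    flips-double (suc i) o = trans (cong (λ k → not (flips k o)) (ℕP.+-suc i i)) (trans (not-involutive _) (flips-double i o))

    phase-isDn : ∀ K → phase {n} K false ≡ isDn K
    phase-isDn dn = refl
    phase-isDn up = refl

    base-right : ∀ j u {K} → kindAt (kindAt κ j) u ≡ K → base₀ (cell right j u) ≡ place₀ K (+ u) j
    base-right j u refl = refl

    base-axis : ∀ j {K} → kindAt κ j ≡ K → base₀ (axis j) ≡ place₀ (opposite K) (- + 1) j
    base-axis j refl = refl

    pairedRow : ∀ (q : Cellᴳ → Bool) j K₀ K → (∀ u → suc u ≡ n → q (cell right j u) ≡ false) →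
      (∀ u → kindAt K₀ u ≡ K → q (cell right j u) ≡ q (cell right j (suc u))) →
      ∀ r u → u ℕ.+ r ≡ n → kindAt K₀ u ≡ K → Paired (Grid.presence n q 1ℚ right j u r)
    pairedRow q j K₀ K far h zero u e k = []
    pairedRow q j K₀ K far h (suc zero) u e k = subst (λ b → Paired (b ∷ [])) (sym (far u (trans (ℕP.+-comm 1 u) e))) single
    pairedRow q j K₀ K far h (suc (suc r)) u e k = subst (λ b → Paired (q (cell right j u) ∷ b ∷ Grid.presence n q 1ℚ right j (suc (suc u)) r)) (h u k)
      (pair (q (cell right j u)) (pairedRow q j K₀ K far h r (suc (suc u)) (trans (trans (cong suc (sym (ℕP.+-suc u r))) (sym (ℕP.+-suc u (suc r)))) e)
        (trans (kindAt-opposite K₀ (suc u)) (trans (cong opposite (kindAt-opposite K₀ u)) (trans (opposite-involutive _) k)))))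

    module Comparison (realization : Realization)
      (B N : ℕ) (m≡ : m ≡ T ℕ.+ f ℕ.+ B) (even : T ℕ.+ B ≡ N ℕ.+ N)
      where

      open Symmetric realization
      private module Sᴱ = F.In (+ 0) S

      halfCount : (Bool → Bool) → ℚ
      halfCount g = count {n} κ (rows (share g) 0 m) false falses

      own-last : ∀ j → suc j ≡ m → Lower j → own j ≡ isDn (kindAt κ m)
      own-last j e l = begin
        own j ≡⟨ own-after B m≡ j (level-lower j l) (ℕP.≤-trans (ℕP.n≤1+n j) (ℕP.≤-reflexive e)) ⟩
        flips f (phase {n} κ false) ≡⟨ cong (flips f) (phase-isDn κ) ⟩
        flips f (isDn κ) ≡⟨ cong (flips f) (sym (flips-double N (isDn κ))) ⟩
        flips f (flips (N ℕ.+ N) (isDn κ)) ≡⟨ flips-+ f (N ℕ.+ N) (isDn κ) ⟨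
        flips (f ℕ.+ (N ℕ.+ N)) (isDn κ) ≡⟨ cong (λ i → flips i (isDn κ)) m≡′ ⟨
        flips m (isDn κ) ≡⟨ isDn-kindAt κ m ⟨
        isDn (kindAt κ m) ∎
        where
        m≡′ : m ≡ f ℕ.+ (N ℕ.+ N)
        m≡′ = begin
          m ≡⟨ m≡ ⟩
          T ℕ.+ f ℕ.+ B ≡⟨ cong (ℕ._+ B) (ℕP.+-comm T f) ⟩
          f ℕ.+ T ℕ.+ B ≡⟨ ℕP.+-assoc f T B ⟩
          f ℕ.+ (T ℕ.+ B) ≡⟨ cong (f ℕ.+_) even ⟩
          _ ∎

      at-cong : ∀ y y′ → (Present (base₀ y) → Present (base₀ y′)) → (Present (base₀ y′) → Present (base₀ y)) →
        (Present (base₀ y) → Sᴱ.embed y ∈ cells S) → (Present (base₀ y′) → Sᴱ.embed y′ ∈ cells S) → Sᴱ.at y ≡ Sᴱ.at y′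
      at-cong y y′ g h i i′ = does-⇔ (mk⇔ (λ e → i′ (g (near⁻ y e))) (λ e → i (h (near⁻ y′ e)))) (Sᴱ.embed y ∈? cells S) (Sᴱ.embed y′ ∈? cells S)

      far-absent : ∀ j u → suc u ≡ n → Sᴱ.at (cell right j u) ≡ false
      far-absent j u e = dec-false (Sᴱ.embed (cell right j u) ∈? cells S) λ i →
        too-far (ℤP.drop‿+≤+ (present-bound (kindAt (kindAt κ j) u) (+ u) j (near⁻ (cell right j u) i)))
        where
        too-far : ¬ (u ℕ.+ 2 ℕ.≤ W ℕ.+ z)
        too-far h rewrite ℕP.suc-injective e = ℕP.<-irrefl refl (ℕP.≤-trans (ℕP.≤-trans (ℕP.m≤m+n (suc (W ℕ.+ z)) 1) (ℕP.≤-reflexive (sym (ℕP.+-suc (W ℕ.+ z) 1)))) h)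

      paired-presence : ∀ j K → (∀ u → kindAt (kindAt κ j) u ≡ K → Sᴱ.at (cell right j u) ≡ Sᴱ.at (cell right j (suc u))) →
        ∀ r u → u ℕ.+ r ≡ n → kindAt (kindAt κ j) u ≡ K → Paired (Grid.presence n Sᴱ.at 1ℚ right j u r)
      paired-presence j K h r u e k = pairedRow Sᴱ.at j (kindAt κ j) K (λ u e → far-absent j u e) h r u e k

      paired-axis : ∀ j K → Sᴱ.at (axis j) ≡ Sᴱ.at (cell right j 0) → kindAt (kindAt κ j) 1 ≡ K →
        (∀ u → kindAt (kindAt κ j) u ≡ K → Sᴱ.at (cell right j u) ≡ Sᴱ.at (cell right j (suc u))) →
        Paired (Sᴱ.at (axis j) ∷ proj₂ (Sᴱ.row j))
      paired-axis j K e k h rewrite e = pair _ (paired-presence j K h (W ℕ.+ z) 1 refl k)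

      transfer : ∀ {c c′ d d′} → c ≡ c′ → d ≡ d′ → (Present c′ → Present d′) → Present c → Present d
      transfer refl refl h = h

      top-pairs : Upper 0 → ∀ u → kindAt (kindAt κ 0) u ≡ dn → Sᴱ.at (cell right 0 u) ≡ Sᴱ.at (cell right 0 (suc u))
      top-pairs up₀ u k = at-cong (cell right 0 u) (cell right 0 (suc u))
        (transfer e e′ (proj₁ P)) (transfer e′ e (proj₂ P)) (right⁺ 0 u) (right⁺ 0 (suc u))
        where
        1≤top : + 1 ≤ top
        1≤top = subst (+ 1 ≤_) level-0 (upper-positive 0 up₀)
        P = top-pair (+ u) 1≤top -≤+
        e = base-right 0 u k
        e′ : base₀ (cell right 0 (suc u)) ≡ place₀ up (+ u + + 1) 0
        e′ = trans (base-right 0 (suc u) (trans (kindAt-opposite (kindAt κ 0) u) (cong opposite k))) (cong (λ v → place₀ up (+ v) 0) (ℕP.+-comm 1 u))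

      top-axis : Upper 0 → kindAt κ 0 ≡ up → Sᴱ.at (axis 0) ≡ Sᴱ.at (cell right 0 0)
      top-axis up₀ k = at-cong (axis 0) (cell right 0 0) (transfer e e′ (proj₁ P)) (transfer e′ e (proj₂ P)) (axis⁺ 0) (right⁺ 0 0)
        where
        1≤top : + 1 ≤ top
        1≤top = subst (+ 1 ≤_) level-0 (upper-positive 0 up₀)
        P = top-pair (- + 1) 1≤top (-≤- z≤n)
        e = base-axis 0 k
        e′ = base-right 0 0 k

      module _ (j : ℕ) (last : suc j ≡ m) (low : Lower j) where

        deep-enough : bottom ≤ - + 1
        deep-enough = subst (_≤ - + 1) (level-m j last) (lower-negative j low)

        bottom-pairs : ∀ u → kindAt (kindAt κ j) u ≡ up → Sᴱ.at (cell right j u) ≡ Sᴱ.at (cell right j (suc u))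
        bottom-pairs u k = at-cong (cell right j u) (cell right j (suc u))
          (transfer e e′ (proj₁ P)) (transfer e′ e (proj₂ P)) (right⁺ j u) (right⁺ j (suc u))
          where
          P = bottom-pair j last (+ u) deep-enough
          e = base-right j u k
          e′ : base₀ (cell right j (suc u)) ≡ place₀ dn (+ u + + 1) j
          e′ = trans (base-right j (suc u) (trans (kindAt-opposite (kindAt κ j) u) (cong opposite k))) (cong (λ v → place₀ dn (+ v) j) (ℕP.+-comm 1 u))

        bottom-axis : kindAt κ j ≡ dn → Sᴱ.at (axis j) ≡ Sᴱ.at (cell right j 0)
        bottom-axis k = at-cong (axis j) (cell right j 0) (transfer e e′ (proj₁ P)) (transfer e′ e (proj₂ P)) (axis⁺ j) (right⁺ j 0)
          where
          P = bottom-pair j last (- + 1) deep-enough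
          e = base-axis j k
          e′ = base-right j 0 k

      -- The halves that are cut off at the top and at the bottom own the
      -- axis cells of the second kind.
      top-row : Upper 0 → TopPaired κ (share not 0)
      top-row up₀ = by-kind κ refl
        where
        by-kind : ∀ K → κ ≡ K → TopPaired K (Sᴱ.at (axis 0) ∧ not (phase {n} K false) , proj₂ (Sᴱ.row 0))
        by-kind dn e = ∧-false (Sᴱ.at (axis 0)) , paired-presence 0 dn (top-pairs up₀) n 0 refl e
          where
          ∧-false : ∀ q → q ∧ false ≡ false
          ∧-false true  = refl
          ∧-false false = refl
        by-kind up e = subst (λ q → Paired (q ∷ proj₂ (Sᴱ.row 0))) (sym (∧-true (Sᴱ.at (axis 0))))
          (paired-axis 0 dn (top-axis up₀ e) (trans (kindAt-opposite κ 0) (cong opposite e)) (top-pairs up₀))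
          where
          ∧-true : ∀ q → q ∧ true ≡ q
          ∧-true true  = refl
          ∧-true false = refl

      bottom-row : ∀ j → suc j ≡ m → Lower j → BottomPaired (kindAt κ j) (share not j)
      bottom-row j lastRow low = subst (λ o → BottomPaired (kindAt κ j) (Sᴱ.at (axis j) ∧ not o , proj₂ (Sᴱ.row j)))
          (sym (trans (own-last j lastRow low) (trans (cong (λ i → isDn (kindAt κ i)) (sym lastRow)) (trans (cong isDn (kindAt-opposite κ j)) (isDn-opposite (kindAt κ j))))))
          (by-kind (kindAt κ j) refl)
        where
        by-kind : ∀ K → kindAt κ j ≡ K → BottomPaired K (Sᴱ.at (axis j) ∧ not (not (isDn K)) , proj₂ (Sᴱ.row j))
        by-kind up e = ∧-false (Sᴱ.at (axis j)) , paired-presence j up (bottom-pairs j lastRow low) n 0 refl e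
          where
          ∧-false : ∀ q → q ∧ false ≡ false
          ∧-false true  = refl
          ∧-false false = refl
        by-kind dn e = subst (λ q → Paired (q ∷ proj₂ (Sᴱ.row j))) (sym (∧-true (Sᴱ.at (axis j))))
          (paired-axis j up (bottom-axis j lastRow low e) (trans (kindAt-opposite (kindAt κ j) 0) (cong opposite e)) (bottom-pairs j lastRow low))
          where
          ∧-true : ∀ q → q ∧ true ≡ q
          ∧-true true  = refl
          ∧-true false = refl

      module WithHalf (placement : Placement) (g : Bool → Bool)
        (uo≡ : g (phase {n} κ false) ≡ Placement.uo placement) (lo≡ : g (flips f (phase {n} κ false)) ≡ Placement.lo placement)
        (weighted⁺ : ∀ p → ownOf (Placement.uo placement) (Placement.lo placement) p ≡ true → p ∈ Profile.halving (Placement.D placement))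
        (weighted⁻ : ∀ p → p ∈ Profile.halving (Placement.D placement) → ownOf (Placement.uo placement) (Placement.lo placement) p ≡ true)
        (cut : Placement.ε placement ≡ 0 ⊎ (∀ o → g o ≡ not o))
        where

        open Halved placement using (s; D; ε; uo; lo; ε≤1; Inside; Complete; inside→present; present→inside; inside→uncut; axis-owned)
        module Hf = Halfway placement weighted⁺ weighted⁻
        private module Rᴱ = F.In s Hf.R

        Uncut : ℕ → Set
        Uncut j = (Upper j × ε ℕ.≤ j) ⊎ (Lower j × suc j ℕ.+ ε ℕ.≤ m)

        own-upper : ∀ j → Upper j → ¬ Hole j → g (own j) ≡ uo
        own-upper j u nh = trans (cong g (own-before B m≡ j T≥)) uo≡
          where
          T≥ : j ℕ.≤ T
          T≥ = ℕP.≮⇒≥ (λ T<j → nh (ℕP.<⇒≤ T<j , level-suc-upper j u))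

        own-lower : ∀ j → j ℕ.< m → Lower j → g (own j) ≡ lo
        own-lower j j<m l = trans (cong g (own-after B m≡ j (level-lower j l) (ℕP.<⇒≤ j<m))) lo≡

        not-hole : ∀ j → Present (base₀ (axis j)) → ¬ Hole j
        not-hole j p h = axis-hole j h p

        row-uncut : ∀ j → j ℕ.< m → Uncut j → Rᴱ.row j ≡ share g j
        row-uncut j j<m un = cong₂ _,_ axis≡ (F.presence-cong 1ℚ right right j 0 n right≡)
          where
          right≡ : ∀ u → Rᴱ.at (cell right j u) ≡ Sᴱ.at (cell right j u)
          right≡ u = does-⇔ (mk⇔ (λ i → right⁺ j u (inside→present (cell right j u) (Hf.inside⁻ (cell right j u) i)))
              (λ i → Hf.inside⁺ (cell right j u) (present→inside (cell right j u) (right-good j u) (right-shadowed j u) (complete un) (near⁻ (cell right j u) i))))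
            (Rᴱ.embed (cell right j u) ∈? cells Hf.R) (Sᴱ.embed (cell right j u) ∈? cells S)
            where
            complete : Uncut j → Complete Any-kind j
            complete (inj₁ (u , e)) = inj₁ (u , tt , e)
            complete (inj₂ (l , e)) = inj₂ (l , tt , e)
          owned : Inside (axis j) → g (own j) ≡ true
          owned i with axis-owned j i
          ... | inj₁ (u , e) = trans (own-upper j u (not-hole j (inside→present (axis j) i))) e
          ... | inj₂ (l , e) = trans (own-lower j j<m l) e
          complete : g (own j) ≡ true → ¬ Hole j → Uncut j → Complete Included j
          complete q nh (inj₁ (u , e)) = inj₁ (u , trans (sym (own-upper j u nh)) q , e)
          complete q nh (inj₂ (l , e)) = inj₂ (l , trans (sym (own-lower j j<m l)) q , e)
          axis≡ : Rᴱ.at (axis j) ≡ Sᴱ.at (axis j) ∧ g (own j)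
          axis≡ = by-owner (g (own j)) refl
            where
            by-owner : ∀ o → g (own j) ≡ o → Rᴱ.at (axis j) ≡ Sᴱ.at (axis j) ∧ o
            by-owner true  q = trans (does-⇔ (mk⇔ (λ i → axis⁺ j (inside→present (axis j) (Hf.inside⁻ (axis j) i)))
                (λ i → let pr = near⁻ (axis j) i in Hf.inside⁺ (axis j)
                  (present→inside (axis j) (axis-good j) (axis-shadowed j) (complete q (not-hole j pr) un) pr)))
              (Rᴱ.embed (axis j) ∈? cells Hf.R) (Sᴱ.embed (axis j) ∈? cells S)) (∧-true (Sᴱ.at (axis j)))
              where
              ∧-true : ∀ q → q ≡ q ∧ true
              ∧-true true  = refl
              ∧-true false = refl
            by-owner false q = trans (dec-false (Rᴱ.embed (axis j) ∈? cells Hf.R) (λ i → true≢false (trans (sym (owned (Hf.inside⁻ (axis j) i))) q)))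
              (∧-false (Sᴱ.at (axis j)))
              where
              true≢false : true ≢ false
              true≢false ()
              ∧-false : ∀ q → false ≡ q ∧ false
              ∧-false true  = refl
              ∧-false false = refl

        row-cut : ∀ j → ¬ Uncut j → Rᴱ.row j ≡ (false , falses)
        row-cut j nu = cong₂ _,_ (dec-false (Rᴱ.embed (axis j) ∈? cells Hf.R) (λ i → nu (inside→uncut (axis j) (Hf.inside⁻ (axis j) i))))
          (F.presence-absent 1ℚ right j 0 n λ u →
            dec-false (Rᴱ.embed (cell right j u) ∈? cells Hf.R) (λ i → nu (inside→uncut (cell right j u) (Hf.inside⁻ (cell right j u) i))))

        falses-top : ∀ K → TopPaired {n} K (false , falses)
        falses-top dn = refl , falses-paired n
        falses-top up = falses-paired (suc n)

        falses-bottom : ∀ K → BottomPaired {n} K (false , falses)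
        falses-bottom dn = falses-paired (suc n)
        falses-bottom up = refl , falses-paired n

        share-not : ∀ j → (∀ o → g o ≡ not o) → share g j ≡ share not j
        share-not j h = cong (λ o → Sᴱ.at (axis j) ∧ o , proj₂ (Sᴱ.row j)) (h (own j))

        compare : ∀ j → j ℕ.< m → Rᴱ.row j ≡ share g j ⊎ (j ≡ 0 × TopPaired κ (Rᴱ.row j) × TopPaired κ (share g j))
                                ⊎ (suc j ≡ m × BottomPaired (kindAt κ j) (Rᴱ.row j) × BottomPaired (kindAt κ j) (share g j))
        compare j j<m = by-position (position j) (ε ℕ.≤? j) (suc j ℕ.+ ε ℕ.≤? m)
          where
          Row≈ : Set
          Row≈ = Rᴱ.row j ≡ share g j ⊎ (j ≡ 0 × TopPaired κ (Rᴱ.row j) × TopPaired κ (share g j))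
                                ⊎ (suc j ≡ m × BottomPaired (kindAt κ j) (Rᴱ.row j) × BottomPaired (kindAt κ j) (share g j))
          cut-top : Upper j → ¬ ε ℕ.≤ j → ε ≡ 0 ⊎ (∀ o → g o ≡ not o) → Row≈
          cut-top u ne (inj₁ e) = contradiction (subst (ℕ._≤ j) (sym e) z≤n) ne
          cut-top u ne (inj₂ h) = inj₂ (inj₁ (j≡0 , subst (TopPaired κ) (sym (row-cut j λ { (inj₁ (_ , e)) → ne e ; (inj₂ (l , _)) → not-both j u l })) (falses-top κ) ,
            subst (TopPaired κ) (sym (share-not j h)) (subst (λ i → TopPaired κ (share not i)) (sym j≡0) (top-row (subst Upper j≡0 u)))))
            where
            j≡0 : j ≡ 0
            j≡0 = ℕP.n≤0⇒n≡0 (ℕP.≤-pred (ℕP.≤-trans (ℕP.≰⇒> ne) ε≤1))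
          cut-bottom : Lower j → ¬ suc j ℕ.+ ε ℕ.≤ m → ε ≡ 0 ⊎ (∀ o → g o ≡ not o) → Row≈
          cut-bottom l ne (inj₁ e) = contradiction (subst (λ k → suc j ℕ.+ k ℕ.≤ m) (sym e) (subst (ℕ._≤ m) (sym (ℕP.+-identityʳ (suc j))) j<m)) ne
          cut-bottom l ne (inj₂ h) = inj₂ (inj₂ (lastRow , subst (BottomPaired (kindAt κ j)) (sym (row-cut j λ { (inj₁ (u , _)) → not-both j u l ; (inj₂ (_ , e)) → ne e })) (falses-bottom (kindAt κ j)) ,
            subst (BottomPaired (kindAt κ j)) (sym (share-not j h)) (bottom-row j lastRow l)))
            where
            lastRow : suc j ≡ m
            lastRow = ℕP.≤-antisym j<m (ℕP.≤-pred (ℕP.≤-trans (ℕP.≰⇒> ne) (ℕP.≤-trans (ℕP.+-monoʳ-≤ (suc j) ε≤1) (ℕP.≤-reflexive (ℕP.+-comm (suc j) 1)))))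
          by-position : Upper j ⊎ Lower j → Dec (ε ℕ.≤ j) → Dec (suc j ℕ.+ ε ℕ.≤ m) → Row≈
          by-position (inj₁ u) (yes e) _       = inj₁ (row-uncut j j<m (inj₁ (u , e)))
          by-position (inj₁ u) (no ne) _       = cut-top u ne cut
          by-position (inj₂ l) _       (yes e) = inj₁ (row-uncut j j<m (inj₂ (l , e)))
          by-position (inj₂ l) _       (no ne) = cut-bottom l ne cut

        M-half : M Hf.R ≡ halfCount g
        M-half = trans Hf.M-count (F.count-same Rᴱ.row (share g) compare)

      whole : M S ≡ (+ (2 ℕ.^ N) Data.Rational./ 1) Data.Rational.* (halfCount (λ o → o) Data.Rational.* halfCount not)
      whole = M-factors N (trans (trues≡ B m≡) even)

module HalfHexagons where

  open Transfer
  open Rows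
  open Grids
  open Embeddings
  open OneSided
  open Factorizing
  open Boxes
  open Ferns
  open Geometry
  open HexagonCells
  open Axis
  open Assembling
  open import Defs
  open import Data.Bool using (Bool; true; false; not)
  open import Data.Bool.Properties using (not-involutive)
  open import Data.Integer using (ℤ; +_; ∣_∣; _+_; _-_; -_; _*_; _≤_; -≤+)
  import Data.Integer.Properties as ℤP
  open import Data.Integer.Tactic.RingSolver using (solve-∀)
  open import Data.List using (List; []; _∷_)
  open import Data.List.Membership.Propositional using (_∈_)
  open import Data.List.Membership.Propositional.Properties using (∈-filter⁺; ∈-filter⁻)
  open import Data.List.Relation.Unary.All using (All; []; _∷_)
  open import Data.List.Relation.Unary.Any using (Any; here; there)
  open import Data.List.Relation.Unary.Unique.Propositional using (Unique)
  import Data.List.Relation.Unary.Unique.Propositional.Properties as UniqueP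
  open import Data.Nat as ℕ using (ℕ; zero; suc)
  open import Data.Nat.ListAction using (sum)
  import Data.Nat.Properties as ℕP
  open import Data.Product using (_×_; _,_)
  open import Data.Rational as ℚ using (ℚ)
  import Data.Rational.Properties as ℚP
  open import Data.Sum using (_⊎_)
  open import Relation.Binary.PropositionalEquality
  open import Relation.Nullary using (contradiction)
  open ≡-Reasoning

  choose : Kind → ℤ → ℤ → ℤ
  choose dn e o = e
  choose up e o = o

  byParity-choose : ∀ e o i → byParity e o i ≡ choose (kindAt dn i) e o
  byParity-choose e o zero    = refl
  byParity-choose e o (suc i) = trans (byParity-choose o e i) (trans (swap (kindAt dn i)) (cong (λ K → choose K e o) (sym (kindAt-opposite dn i))))
    where
    swap : ∀ K → choose K o e ≡ choose (opposite K) e o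
    swap dn = refl
    swap up = refl

  kindAt-double : ∀ K t → kindAt K (t ℕ.+ t) ≡ K
  kindAt-double K zero    = refl
  kindAt-double K (suc t) = trans (cong (kindAt (opposite K)) (ℕP.+-suc t t)) (trans (cong (λ L → kindAt L (t ℕ.+ t)) (opposite-involutive K)) (kindAt-double K t))

  flipsEven : ∀ t o → flips (t ℕ.+ t) o ≡ o
  flipsEven zero    o = refl
  flipsEven (suc t) o = trans (cong (λ k → not (flips k o)) (ℕP.+-suc t t)) (trans (not-involutive _) (flipsEven t o))

  module Concrete (x y z f : ℕ) (d b : List ℕ) (h : ℕ) (x+y : x ℕ.+ y ≡ h ℕ.+ h) where

    module Dm = Dimensions x y z f d b
    open Dm using (Oᵈ; Eᵈ; Oᵇ; Eᵇ)

    T B N : ℕ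
    T = y ℕ.+ 2 ℕ.* evenSum d ℕ.+ 2 ℕ.* oddSum b
    B = y ℕ.+ 2 ℕ.* z ℕ.+ 2 ℕ.* oddSum d ℕ.+ 2 ℕ.* evenSum b
    N = y ℕ.+ z ℕ.+ sum d ℕ.+ sum b

    top≡T : Dm.top ≡ + (T ℕ.+ f)
    top≡T = trans Dm.top≡ (trans (eq (+ y) (+ f) Eᵈ Oᵇ) (cong₂ (λ p q → + y + p + q + + f) (sym (+2* (evenSum d))) (sym (+2* (oddSum b)))))
      where
      eq : ∀ Y F E O → Y + F + + 2 * E + + 2 * O ≡ Y + + 2 * E + + 2 * O + F
      eq = solve-∀

    bottom≡B : Dm.bottom ≡ - + B
    bottom≡B = trans Dm.bottom≡ (cong -_ (trans (cong (λ p → + y + p + + 2 * Oᵈ + + 2 * Eᵇ) (sym (+2* z)))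
      (cong₂ (λ p q → + y + + (2 ℕ.* z) + p + q) (sym (+2* (oddSum d))) (sym (+2* (evenSum b))))))

    m≡ : Dm.m ≡ T ℕ.+ f ℕ.+ B
    m≡ = ℤP.+-injective (trans Dm.height (trans (cong₂ _-_ top≡T bottom≡B) (cong (λ t → + (T ℕ.+ f) + t) (ℤP.neg-involutive (+ B)))))

    even : T ℕ.+ B ≡ N ℕ.+ N
    even = ℤP.+-injective (begin
      + y + + (2 ℕ.* evenSum d) + + (2 ℕ.* oddSum b) + (+ y + + (2 ℕ.* z) + + (2 ℕ.* oddSum d) + + (2 ℕ.* evenSum b))
        ≡⟨ cong₂ (λ p q → + y + p + q + (+ y + + (2 ℕ.* z) + + (2 ℕ.* oddSum d) + + (2 ℕ.* evenSum b))) (+2* (evenSum d)) (+2* (oddSum b)) ⟩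
      + y + + 2 * Eᵈ + + 2 * Oᵇ + (+ y + + (2 ℕ.* z) + + (2 ℕ.* oddSum d) + + (2 ℕ.* evenSum b))
        ≡⟨ cong₂ (λ p q → + y + + 2 * Eᵈ + + 2 * Oᵇ + (+ y + + (2 ℕ.* z) + p + q)) (+2* (oddSum d)) (+2* (evenSum b)) ⟩
      + y + + 2 * Eᵈ + + 2 * Oᵇ + (+ y + + (2 ℕ.* z) + + 2 * Oᵈ + + 2 * Eᵇ)
        ≡⟨ cong (λ p → + y + + 2 * Eᵈ + + 2 * Oᵇ + (+ y + p + + 2 * Oᵈ + + 2 * Eᵇ)) (+2* z) ⟩
      + y + + 2 * Eᵈ + + 2 * Oᵇ + (+ y + + 2 * + z + + 2 * Oᵈ + + 2 * Eᵇ)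
        ≡⟨ eq (+ y) (+ z) Eᵈ Oᵇ Oᵈ Eᵇ ⟩
      (+ y + + z + (Oᵈ + Eᵈ) + (Oᵇ + Eᵇ)) + (+ y + + z + (Oᵈ + Eᵈ) + (Oᵇ + Eᵇ))
        ≡⟨ cong (λ k → k + k) (cong₂ (λ p q → + y + + z + p + q) (cong +_ (sym (sum-oddEven d))) (cong +_ (sym (sum-oddEven b)))) ⟩
      + N + + N ∎)
      where
      eq : ∀ y z e p o q → y + + 2 * e + + 2 * p + (y + + 2 * z + + 2 * o + + 2 * q) ≡ (y + z + (o + e) + (p + q)) + (y + z + (o + e) + (p + q))
      eq = solve-∀

    κ : Kind
    κ = kindAt dn x

    kind-even : ∀ i c → + i ≡ + 2 * c → kindAt dn i ≡ dn
    kind-even i c e = kindℤ-cong {+ i} {+ 0} c (trans e (sym (ℤP.+-identityˡ _)))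

    T-even : + x + + T ≡ + 2 * (+ h + Eᵈ + Oᵇ)
    T-even = trans (cong₂ (λ p q → + x + (+ y + p + q)) (+2* (evenSum d)) (+2* (oddSum b)))
      (trans (eq (+ x) (+ y) Eᵈ Oᵇ) (trans (cong (λ s → s + + 2 * Eᵈ + + 2 * Oᵇ) (cong +_ x+y)) (eq′ (+ h) Eᵈ Oᵇ)))
      where
      eq : ∀ x y e o → x + (y + + 2 * e + + 2 * o) ≡ x + y + + 2 * e + + 2 * o
      eq = solve-∀
      eq′ : ∀ h e o → h + h + + 2 * e + + 2 * o ≡ + 2 * (h + e + o)
      eq′ = solve-∀

    kindT : kindAt κ T ≡ dn
    kindT = trans (sym (kindℤ-+ (+ x) T)) (kind-even (x ℕ.+ T) (+ h + Eᵈ + Oᵇ) T-even)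

    positive : ∀ {e e′} k r → e ≡ + k + r → Pos r → e′ ≡ e → k ≢ 0 → + 1 ≤ e′
    positive zero    r _ _ _ n = contradiction refl n
    positive (suc k) r refl p refl n = by (num k ⊕ p) (eq (+ k) r)
      where
      eq : ∀ k r → k + r ≡ + 1 + k + r - + 1
      eq = solve-∀

    north′ : kindAt κ 0 ≡ up → + 1 ≤ + Dm.W - Dm.top
    north′ e = positive x (+ 2 * Oᵈ + + 2 * Eᵇ) (eq (+ x) Oᵈ Eᵇ) (0≤2* (oddSum d) ⊕ 0≤2* (evenSum b)) Dm.north≡ (λ { q → dn≢up (trans (cong (kindAt dn) (sym q)) e) })
      where
      eq : ∀ x o e → x + + 2 * (o + e) ≡ x + (+ 2 * o + + 2 * e)
      eq = solve-∀
      dn≢up : dn ≢ up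
      dn≢up ()

    south′ : kindAt κ Dm.m ≡ up → + 1 ≤ + Dm.W + + 2 * + z + Dm.bottom
    south′ e = positive (x ℕ.+ f) (+ 2 * Eᵈ + + 2 * Oᵇ) (eq (+ x) (+ f) Eᵈ Oᵇ) (0≤2* (evenSum d) ⊕ 0≤2* (oddSum b)) Dm.south≡ nonzero
      where
      eq : ∀ x f o e → x + f + + 2 * o + + 2 * e ≡ x + f + (+ 2 * o + + 2 * e)
      eq = solve-∀
      dn≢up : dn ≢ up
      dn≢up ()
      nonzero : x ℕ.+ f ≢ 0
      nonzero q = dn≢up (trans (sym (trans (sym (kindℤ-+ (+ x) Dm.m)) (kind-even (x ℕ.+ Dm.m) (+ N) even′))) e)
        where
        even′ : + (x ℕ.+ Dm.m) ≡ + 2 * + N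
        even′ = trans (cong +_ (begin
          x ℕ.+ Dm.m ≡⟨ cong₂ ℕ._+_ (ℕP.m+n≡0⇒m≡0 x q) m≡ ⟩
          T ℕ.+ f ℕ.+ B ≡⟨ cong (λ k → T ℕ.+ k ℕ.+ B) (ℕP.m+n≡0⇒n≡0 x q) ⟩
          T ℕ.+ 0 ℕ.+ B ≡⟨ cong (ℕ._+ B) (ℕP.+-identityʳ T) ⟩
          T ℕ.+ B ≡⟨ even ⟩
          N ℕ.+ N ∎)) (eq′ (+ N))
          where
          eq′ : ∀ n → n + n ≡ + 2 * n
          eq′ = solve-∀

    hexagon : Hexagon
    hexagon = record
      { x = x ; z = z ; f = f ; m = Dm.m ; W = Dm.W ; d = d ; b = b ; top = Dm.top ; bottom = Dm.bottom
      ; height = Dm.height ; 0≤top = Dm.0≤top ; bottom≤0 = Dm.bottom≤0 ; north = Dm.north ; south = Dm.south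
      ; f≤top = Dm.f≤top ; deep = Dm.deep ; east-left = Dm.east-left ; east-up = Dm.east-up ; east-down = Dm.east-down
      ; T = T ; top≡ = top≡T ; kindT = kindT ; north′ = north′ ; south′ = south′ ; E = Oᵈ + Eᵇ ; north≡ = sym Dm.north≡ }

    module A = Assembly hexagon
    module C₀ = Cells hexagon
    module F₀ = Facts hexagon

    S : Region
    S = S¹ x y z (f ∷ d) b

    boxS : List Cell
    boxS = cellsInBox (+ Dm.W) (- (+ Dm.W + + z) , + Dm.W + + z) (Dm.bottom , Dm.top)

    uniqueS : Unique (cells S)
    uniqueS = UniqueP.filter⁺ Dm.inRegion? (cellsInBox-unique (+ Dm.W) (- (+ Dm.W + + z) , + Dm.W + + z) (Dm.bottom , Dm.top))

    inS⁻ : ∀ {c} → c ∈ cells S → F₀.InS c × LatticeVertex (+ Dm.W) (vertex c)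
    inS⁻ {c} i = let (j , q) = ∈-filter⁻ Dm.inRegion? {xs = boxS} i in
      q , cellsInBox-∈⁻ {+ Dm.W} { - (+ Dm.W + + z)} {+ Dm.W + + z} {Dm.bottom} {Dm.top} {c} j

    inS⁺ : ∀ {c} → F₀.InS c → LatticeVertex (+ Dm.W) (vertex c) → c ∈ cells S
    inS⁺ {c} q@(hex , _) v = ∈-filter⁺ Dm.inRegion? (in-box (A.vertex-∈ c hex)) q
      where
      halve : ∀ {a b} → + 2 * a ≤ + 2 * b → a ≤ b
      halve {a} {b} = ℤP.*-cancelˡ-≤-pos a b (+ 2)
      in-box : F₀.InHex (vertex c) → c ∈ boxS
      in-box (p , q , r , s , r′ , s′) = cellsInBox-∈⁺ {+ Dm.W} { - (+ Dm.W + + z)} {+ Dm.W + + z} {Dm.bottom} {Dm.top} {c} v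
        (halve (by (pos r′ ⊕ pos s′) (eq (+ Dm.W) (+ z) (2u (vertex c)) (k (vertex c))))) (halve (by (pos r ⊕ pos s) (eq′ (+ Dm.W) (+ z) (2u (vertex c)) (k (vertex c))))) p q
        where
        eq : ∀ W Z U k → W - k - - U + (W + + 2 * Z + k - - U) ≡ + 2 * U - + 2 * - (W + Z)
        eq = solve-∀
        eq′ : ∀ W Z U k → W - k - U + (W + + 2 * Z + k - U) ≡ + 2 * (W + Z) - + 2 * U
        eq′ = solve-∀

    realization : A.Realization
    realization = record { S = S ; unique = uniqueS ; in⁻ = inS⁻ ; in⁺ = inS⁺ ; weightless = λ _ → refl }

    module Cmp = A.Comparison realization B N m≡ even

    kind-level : ∀ i → kindAt dn ∣ C₀.level′ i ∣ ≡ kindAt (kindAt κ i) f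
    kind-level i = begin
      kindℤ (C₀.level′ i) ≡⟨ kindℤ-cong {C₀.level′ i} {+ x + + i + + f} (+ h + Eᵈ + Oᵇ - + x - + i)
        (trans (cong (_- + i) top≡T) (trans (eq (+ x) (+ T) (+ f) (+ i)) (trans (cong (λ t → t - + x + + f - + i) T-even) (eq′ (+ h + Eᵈ + Oᵇ) (+ x) (+ f) (+ i))))) ⟩
      kindℤ (+ x + + i + + f) ≡⟨ kindℤ-+ (+ x + + i) f ⟩
      kindAt (kindℤ (+ x + + i)) f ≡⟨ cong (λ K → kindAt K f) (kindℤ-+ (+ x) i) ⟩
      kindAt (kindAt κ i) f ∎
      where
      eq : ∀ x t f i → t + f - i ≡ x + t - x + f - i
      eq = solve-∀
      eq′ : ∀ g x f i → + 2 * g - x + f - i ≡ x + i + f + + 2 * (g - x - i)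
      eq′ = solve-∀

    α-even : ∀ t → f ≡ t ℕ.+ t → ∀ s inc {e o} → e ≡ s + zig inc dn → o ≡ s + zig inc up → ∀ i →
      byParity e o ∣ C₀.level′ i ∣ ≡ s + zig inc (kindAt κ i)
    α-even t f≡ s inc {e} {o} refl refl i = begin
      byParity e o ∣ C₀.level′ i ∣ ≡⟨ byParity-choose e o ∣ C₀.level′ i ∣ ⟩
      choose (kindAt dn ∣ C₀.level′ i ∣) e o ≡⟨ cong (λ K → choose K e o) (trans (kind-level i) (trans (cong (kindAt (kindAt κ i)) f≡) (kindAt-double (kindAt κ i) t))) ⟩
      choose (kindAt κ i) e o ≡⟨ pick (kindAt κ i) ⟩
      _ ∎
      where
      pick : ∀ K → choose K e o ≡ s + zig inc K
      pick dn = refl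
      pick up = refl

    α-odd : ∀ t → f ≡ suc (t ℕ.+ t) → ∀ s inc {e o} → e ≡ s + zig inc up → o ≡ s + zig inc dn → ∀ i →
      byParity e o ∣ C₀.level′ i ∣ ≡ s + zig inc (kindAt κ i)
    α-odd t f≡ s inc {e} {o} refl refl i = begin
      byParity e o ∣ C₀.level′ i ∣ ≡⟨ byParity-choose e o ∣ C₀.level′ i ∣ ⟩
      choose (kindAt dn ∣ C₀.level′ i ∣) e o ≡⟨ cong (λ K → choose K e o) (trans (kind-level i) (trans (cong (kindAt (kindAt κ i)) f≡) (kindAt-double (opposite (kindAt κ i)) t))) ⟩
      choose (opposite (kindAt κ i)) e o ≡⟨ pick (kindAt κ i) ⟩
      _ ∎
      where
      pick : ∀ K → choose (opposite K) e o ≡ s + zig inc K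
      pick dn = refl
      pick up = refl

    -- A halved hexagon with first fern triangle t, displaced by s, whose
    -- second argument is half of y + δ.
    module Half′ (x′ y′ t : ℕ) (s δ : ℤ) (x′+y′ : x′ ℕ.+ y′ ≡ h) (2t : + 2 * + t ≡ s + + f) (2y′ : + 2 * + y′ ≡ + y + δ) where

      module H = HalvedHexagon x′ y′ z (t ∷ d) b

      L≡ : + 2 * + H.L ≡ s + + Dm.W
      L≡ = begin
        + 2 * + (x′ ℕ.+ y′ ℕ.+ (t ℕ.+ sum d) ℕ.+ sum b) ≡⟨ cong₂ (λ p q → + 2 * (+ p + (+ t + + q) + + sum b)) x′+y′ (sum-oddEven d) ⟩
        + 2 * (+ h + (+ t + (Oᵈ + Eᵈ)) + + sum b) ≡⟨ cong (λ q → + 2 * (+ h + (+ t + (Oᵈ + Eᵈ)) + + q)) (sum-oddEven b) ⟩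
        + 2 * (+ h + (+ t + (Oᵈ + Eᵈ)) + (Oᵇ + Eᵇ)) ≡⟨ eq (+ h) (+ t) Oᵈ Eᵈ Oᵇ Eᵇ ⟩
        + h + + h + + 2 * + t + + 2 * (Oᵈ + Eᵈ) + + 2 * (Oᵇ + Eᵇ) ≡⟨ cong₂ (λ p q → p + q + + 2 * (Oᵈ + Eᵈ) + + 2 * (Oᵇ + Eᵇ)) (cong +_ (sym x+y)) 2t ⟩
        + x + + y + (s + + f) + + 2 * (Oᵈ + Eᵈ) + + 2 * (Oᵇ + Eᵇ) ≡⟨ eq′ (+ x) (+ y) s (+ f) (Oᵈ + Eᵈ) (Oᵇ + Eᵇ) ⟩
        s + (+ x + + y + (+ f + + 2 * (Oᵈ + Eᵈ)) + + 2 * (Oᵇ + Eᵇ)) ≡⟨ cong (λ w → s + w) (sym Dm.W≡) ⟩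
        s + + Dm.W ∎
        where
        eq : ∀ h t o e p q → + 2 * (h + (t + (o + e)) + (p + q)) ≡ h + h + + 2 * t + + 2 * (o + e) + + 2 * (p + q)
        eq = solve-∀
        eq′ : ∀ x y s f u v → x + y + (s + f) + + 2 * u + + 2 * v ≡ s + (x + y + (f + + 2 * u) + + 2 * v)
        eq′ = solve-∀

      2h≡ : + 2 * + H.h ≡ Dm.top + δ + s
      2h≡ = begin
        + 2 * (+ y′ + (+ t + Eᵈ) + Oᵇ) ≡⟨ eq (+ y′) (+ t) Eᵈ Oᵇ ⟩
        + 2 * + y′ + + 2 * + t + + 2 * Eᵈ + + 2 * Oᵇ ≡⟨ cong₂ (λ p q → p + q + + 2 * Eᵈ + + 2 * Oᵇ) 2y′ 2t ⟩
        + y + δ + (s + + f) + + 2 * Eᵈ + + 2 * Oᵇ ≡⟨ eq′ (+ y) δ s (+ f) Eᵈ Oᵇ ⟩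
        + y + + f + + 2 * Eᵈ + + 2 * Oᵇ + δ + s ≡⟨ cong (λ u → u + δ + s) (sym Dm.top≡) ⟩
        Dm.top + δ + s ∎
        where
        eq : ∀ y t e o → + 2 * (y + (t + e) + o) ≡ + 2 * y + + 2 * t + + 2 * e + + 2 * o
        eq = solve-∀
        eq′ : ∀ y δ s f e o → y + δ + (s + f) + + 2 * e + + 2 * o ≡ y + f + + 2 * e + + 2 * o + δ + s
        eq′ = solve-∀

      2g≡ : + 2 * + H.g ≡ - Dm.bottom + δ
      2g≡ = begin
        + 2 * (+ y′ + + z + Oᵈ + Eᵇ) ≡⟨ eq (+ y′) (+ z) Oᵈ Eᵇ ⟩
        + 2 * + y′ + + 2 * + z + + 2 * Oᵈ + + 2 * Eᵇ ≡⟨ cong (λ p → p + + 2 * + z + + 2 * Oᵈ + + 2 * Eᵇ) 2y′ ⟩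
        + y + δ + + 2 * + z + + 2 * Oᵈ + + 2 * Eᵇ ≡⟨ eq′ (+ y) δ (+ z) Oᵈ Eᵇ ⟩
        - - (+ y + + 2 * + z + + 2 * Oᵈ + + 2 * Eᵇ) + δ ≡⟨ cong (λ u → - u + δ) (sym Dm.bottom≡) ⟩
        - Dm.bottom + δ ∎
        where
        eq : ∀ y z o e → + 2 * (y + z + o + e) ≡ + 2 * y + + 2 * z + + 2 * o + + 2 * e
        eq = solve-∀
        eq′ : ∀ y δ z o e → y + δ + + 2 * z + + 2 * o + + 2 * e ≡ - - (y + + 2 * z + + 2 * o + + 2 * e) + δ
        eq′ = solve-∀

    none⁺ : ∀ p → A.ownOf false false p ≡ true → p ∈ []
    none⁺ upper ()
    none⁺ lower ()

    all⁺ : ∀ p → A.ownOf true true p ≡ true → p ∈ upper ∷ lower ∷ []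
    all⁺ upper _ = here refl
    all⁺ lower _ = there (here refl)

    all⁻ : ∀ p → p ∈ upper ∷ lower ∷ [] → A.ownOf true true p ≡ true
    all⁻ upper _ = refl
    all⁻ lower _ = refl

    upper⁺ : ∀ p → A.ownOf true false p ≡ true → p ∈ upper ∷ []
    upper⁺ upper _ = here refl

    upper⁻ : ∀ p → p ∈ upper ∷ [] → A.ownOf true false p ≡ true
    upper⁻ .upper (here refl) = refl

    lower⁺ : ∀ p → A.ownOf false true p ≡ true → p ∈ lower ∷ []
    lower⁺ lower _ = here refl

    lower⁻ : ∀ p → p ∈ lower ∷ [] → A.ownOf false true p ≡ true
    lower⁻ .lower (here refl) = refl

    double≡ : ∀ {t} → f ≡ t ℕ.+ t → + 2 * + t ≡ + 0 + + f
    double≡ {t} refl = eq (+ t)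
      where
      eq : ∀ t → + 2 * t ≡ + 0 + (t + t)
      eq = solve-∀

    flips-even : ∀ {t} → f ≡ t ℕ.+ t → ∀ o → flips f o ≡ o
    flips-even {t} e o = trans (cong (λ k → flips k o) e) (flipsEven t o)

    flips-odd : ∀ {t} → f ≡ suc (t ℕ.+ t) → ∀ o → flips f o ≡ not o
    flips-odd {t} e o = trans (cong (λ k → flips k o) e) (cong not (flipsEven t o))

    Cut : ℕ → (Bool → Bool) → Set
    Cut ε g = ε ≡ 0 ⊎ (∀ o → g o ≡ not o)

    φ : Bool
    φ = phase {A.n} κ false

    M-H² : ∀ x′ y′ t δ ε g → f ≡ t ℕ.+ t → x′ ℕ.+ y′ ≡ h → + 2 * + y′ ≡ + y + δ → δ - + 1 ≡ - + ε → ε ℕ.≤ 1 → g φ ≡ false → Cut ε g →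
      M (H² x′ y′ z (t ∷ d) b) ≡ Cmp.halfCount g
    M-H² x′ y′ t δ ε g e xy 2y ε≡ ε≤1 g≡ cut = Cmp.WithHalf.M-half
        (record { x′ = x′ ; y′ = y′ ; a′ = t ∷ d ; s = + 0 ; D = H.profileH² ; ε = ε ; uo = false ; lo = false
                ; L≡ = L≡ ; first≡ = double≡ {t} e ; tail≡ = refl
                ; A≡ = trans (cong (_- + 1) 2h≡) (trans (eq Dm.top δ) (cong (λ u → Dm.top + u) ε≡))
                ; B≡ = trans (cong (_- + 1) 2g≡) (trans (eq′ Dm.bottom δ) (cong (λ u → - Dm.bottom + u) ε≡))
                ; α≡ = λ i _ → α-even t e (+ 0) false refl refl i ; β≡ = λ i _ → α-even t e (+ 0) false refl refl i ; ε≤1 = ε≤1 ; s≥ = -≤+ })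
        g g≡ (trans (cong g (flips-even {t} e φ)) g≡) none⁺ (λ _ ()) cut
      where
      open Half′ x′ y′ t (+ 0) δ xy (double≡ {t} e) 2y
      eq : ∀ t δ → t + δ + + 0 - + 1 ≡ t + (δ - + 1)
      eq = solve-∀
      eq′ : ∀ t δ → - t + δ - + 1 ≡ - t + (δ - + 1)
      eq′ = solve-∀

    M-W¹ : ∀ x′ y′ t δ ε g → f ≡ t ℕ.+ t → x′ ℕ.+ y′ ≡ h → + 2 * + y′ ≡ + y + δ → δ ≡ - + ε → ε ℕ.≤ 1 → g φ ≡ true → Cut ε g →
      M (W¹ x′ y′ z (t ∷ d) b) ≡ Cmp.halfCount g
    M-W¹ x′ y′ t δ ε g e xy 2y ε≡ ε≤1 g≡ cut = Cmp.WithHalf.M-half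
        (record { x′ = x′ ; y′ = y′ ; a′ = t ∷ d ; s = + 0 ; D = H.profileW¹ ; ε = ε ; uo = true ; lo = true
                ; L≡ = L≡ ; first≡ = double≡ {t} e ; tail≡ = refl
                ; A≡ = trans 2h≡ (trans (eq Dm.top δ) (cong (λ u → Dm.top + u) ε≡))
                ; B≡ = trans 2g≡ (cong (λ u → - Dm.bottom + u) ε≡)
                ; α≡ = λ i _ → α-even t e (+ 0) true refl refl i ; β≡ = λ i _ → α-even t e (+ 0) true refl refl i ; ε≤1 = ε≤1 ; s≥ = -≤+ })
        g g≡ (trans (cong g (flips-even {t} e φ)) g≡) all⁺ all⁻ cut
      where
      open Half′ x′ y′ t (+ 0) δ xy (double≡ {t} e) 2y
      eq : ∀ t δ → t + δ + + 0 ≡ t + δ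
      eq = solve-∀

    M-N⁴ : ∀ x′ y′ t δ ε g → f ≡ suc (t ℕ.+ t) → x′ ℕ.+ y′ ≡ h → + 2 * + y′ ≡ + y + δ → δ - + 1 ≡ - + ε → ε ℕ.≤ 1 → g φ ≡ false → g (not φ) ≡ true → Cut ε g →
      M (N⁴ x′ y′ z (suc t ∷ d) b) ≡ Cmp.halfCount g
    M-N⁴ x′ y′ t δ ε g e xy 2y ε≡ ε≤1 g≡ g≡′ cut = Cmp.WithHalf.M-half
        (record { x′ = x′ ; y′ = y′ ; a′ = suc t ∷ d ; s = + 1 ; D = H.profileN⁴ ; ε = ε ; uo = false ; lo = true
                ; L≡ = L≡ ; first≡ = 2t ; tail≡ = refl
                ; A≡ = trans (cong (_- + 2) 2h≡) (trans (eq Dm.top δ) (cong (λ u → Dm.top + u) ε≡))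
                ; B≡ = trans (cong (_- + 1) 2g≡) (trans (eq′ Dm.bottom δ) (cong (λ u → - Dm.bottom + u) ε≡))
                ; α≡ = λ i _ → α-odd t e (+ 1) false refl refl i ; β≡ = λ i _ → α-odd t e (+ 1) true refl refl i ; ε≤1 = ε≤1 ; s≥ = -≤+ })
        g g≡ (trans (cong g (flips-odd {t} e φ)) g≡′) lower⁺ lower⁻ cut
      where
      2t : + 2 * + suc t ≡ + 1 + + f
      2t = trans (eq₂ (+ t)) (cong (λ k → + 1 + + k) (sym e))
        where
        eq₂ : ∀ t → + 2 * (+ 1 + t) ≡ + 1 + (+ 1 + (t + t))
        eq₂ = solve-∀
      open Half′ x′ y′ (suc t) (+ 1) δ xy 2t 2y
      eq : ∀ t δ → t + δ + + 1 - + 2 ≡ t + (δ - + 1)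
      eq = solve-∀
      eq′ : ∀ t δ → - t + δ - + 1 ≡ - t + (δ - + 1)
      eq′ = solve-∀

    M-N¹ : ∀ x′ y′ t δ ε g → f ≡ suc (t ℕ.+ t) → x′ ℕ.+ y′ ≡ h → + 2 * + y′ ≡ + y + δ → δ ≡ - + ε → ε ℕ.≤ 1 → g φ ≡ true → g (not φ) ≡ false → Cut ε g →
      M (N¹ x′ y′ z (t ∷ d) b) ≡ Cmp.halfCount g
    M-N¹ x′ y′ t δ ε g e xy 2y ε≡ ε≤1 g≡ g≡′ cut = Cmp.WithHalf.M-half
        (record { x′ = x′ ; y′ = y′ ; a′ = t ∷ d ; s = - + 1 ; D = H.profileN¹ ; ε = ε ; uo = true ; lo = false
                ; L≡ = L≡ ; first≡ = 2t ; tail≡ = refl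
                ; A≡ = trans (cong (_+ + 1) 2h≡) (trans (eq Dm.top δ) (cong (λ u → Dm.top + u) ε≡))
                ; B≡ = trans 2g≡ (cong (λ u → - Dm.bottom + u) ε≡)
                ; α≡ = λ i _ → α-odd t e (- + 1) true refl refl i ; β≡ = λ i _ → α-odd t e (- + 1) false refl refl i ; ε≤1 = ε≤1 ; s≥ = ℤP.≤-refl })
        g g≡ (trans (cong g (flips-odd {t} e φ)) g≡′) upper⁺ upper⁻ cut
      where
      2t : + 2 * + t ≡ - + 1 + + f
      2t = trans (eq₂ (+ t)) (cong (λ k → - + 1 + + k) (sym e))
        where
        eq₂ : ∀ t → + 2 * t ≡ - + 1 + (+ 1 + (t + t))
        eq₂ = solve-∀
      open Half′ x′ y′ t (- + 1) δ xy 2t 2y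
      eq : ∀ t δ → t + δ + - + 1 + + 1 ≡ t + δ
      eq = solve-∀

    K : ℚ
    K = + (2 ℕ.^ N) ℚ./ 1

    halfCount : (Bool → Bool) → ℚ
    halfCount = Cmp.halfCount

    ordered : ∀ {u v} → u ≡ halfCount (λ o → o) → v ≡ halfCount not → M S ≡ K ℚ.* u ℚ.* v
    ordered {u} {v} e e′ = trans Cmp.whole (trans (sym (cong₂ (λ u v → K ℚ.* (u ℚ.* v)) e e′)) (sym (ℚP.*-assoc K u v)))

    swapped : ∀ {u v} → u ≡ halfCount not → v ≡ halfCount (λ o → o) → M S ≡ K ℚ.* u ℚ.* v
    swapped {u} {v} e e′ = trans (ordered e′ e) (trans (ℚP.*-assoc K v u) (trans (cong (K ℚ.*_) (ℚP.*-comm v u)) (sym (ℚP.*-assoc K u v))))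

module Parities where

  open Transfer
  open Rows
  open Embeddings
  open OneSided
  open HalfHexagons
  open import Defs
  open import Data.Bool using (Bool; true; false; not)
  open import Data.Integer using (+_)
  import Data.Integer as ℤ
  open import Data.Integer.Tactic.RingSolver using (solve-∀)
  open import Data.List using (List; _∷_)
  open import Data.Nat using (ℕ; suc; _+_; z≤n; s≤s)
  import Data.Nat.Properties as ℕP
  open import Data.Rational using () renaming (_*_ to _*ℚ_)
  open import Data.Sum using (inj₁; inj₂)
  open import Relation.Binary.PropositionalEquality

  twice-0 : ∀ q → + 2 ℤ.* + q ≡ + (q + q) ℤ.+ + 0
  twice-0 q = eq (+ q)
    where
    eq : ∀ q → + 2 ℤ.* q ≡ q ℤ.+ q ℤ.+ + 0
    eq = solve-∀

  twice-1 : ∀ q → + 2 ℤ.* + suc q ≡ + suc (q + q) ℤ.+ + 1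
  twice-1 q = eq (+ q)
    where
    eq : ∀ q → + 2 ℤ.* (+ 1 ℤ.+ q) ≡ + 1 ℤ.+ (q ℤ.+ q) ℤ.+ + 1
    eq = solve-∀

  twice--1 : ∀ q → + 2 ℤ.* + q ≡ + suc (q + q) ℤ.+ (ℤ.- + 1)
  twice--1 q = eq (+ q)
    where
    eq : ∀ q → + 2 ℤ.* q ≡ + 1 ℤ.+ (q ℤ.+ q) ℤ.+ (ℤ.- + 1)
    eq = solve-∀

  module Pairs (x y z f : ℕ) (d b : List ℕ) (h : ℕ) (x+y : x + y ≡ h + h) (p q t : ℕ) where
    open Concrete x y z f d b h x+y

    phase-x : ∀ {L} → kindAt dn x ≡ L → φ ≡ phase {A.n} L false
    phase-x = cong (λ L → phase {A.n} L false)

    module EvenX (x≡ : x ≡ p + p) (y≡ : y ≡ q + q) (pq : p + q ≡ h) where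
      φ≡ : φ ≡ true
      φ≡ = phase-x (trans (cong (kindAt dn) x≡) (kindAt-double dn p))

      2y : + 2 ℤ.* + q ≡ + y ℤ.+ + 0
      2y = trans (twice-0 q) (cong (λ k → + k ℤ.+ + 0) (sym y≡))

      first-even : f ≡ t + t → M S ≡ K *ℚ M (H² p q z (t ∷ d) b) *ℚ M (W¹ p q z (t ∷ d) b)
      first-even f≡ = swapped (M-H² p q t (+ 0) 1 not f≡ pq 2y refl (s≤s z≤n) (cong not φ≡) (inj₂ λ _ → refl))
        (M-W¹ p q t (+ 0) 0 (λ o → o) f≡ pq 2y refl z≤n φ≡ (inj₁ refl))

      first-odd : f ≡ suc (t + t) → M S ≡ K *ℚ M (N⁴ p q z (suc t ∷ d) b) *ℚ M (N¹ p q z (t ∷ d) b)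
      first-odd f≡ = swapped (M-N⁴ p q t (+ 0) 1 not f≡ pq 2y refl (s≤s z≤n) (cong not φ≡) (cong (λ o → not (not o)) φ≡) (inj₂ λ _ → refl))
        (M-N¹ p q t (+ 0) 0 (λ o → o) f≡ pq 2y refl z≤n φ≡ (cong not φ≡) (inj₁ refl))

    module OddX (x≡ : x ≡ suc (p + p)) (y≡ : y ≡ suc (q + q)) (pq : suc (p + q) ≡ h) where
      φ≡ : φ ≡ false
      φ≡ = phase-x (trans (cong (kindAt dn) x≡) (kindAt-double up p))

      2y : + 2 ℤ.* + suc q ≡ + y ℤ.+ + 1
      2y = trans (twice-1 q) (cong (λ k → + k ℤ.+ + 1) (sym y≡))

      2y′ : + 2 ℤ.* + q ≡ + y ℤ.+ (ℤ.- + 1)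
      2y′ = trans (twice--1 q) (cong (λ k → + k ℤ.+ (ℤ.- + 1)) (sym y≡))

      pq′ : p + suc q ≡ h
      pq′ = trans (ℕP.+-suc p q) pq

      first-even : f ≡ t + t → M S ≡ K *ℚ M (H² p (suc q) z (t ∷ d) b) *ℚ M (W¹ (suc p) q z (t ∷ d) b)
      first-even f≡ = ordered (M-H² p (suc q) t (+ 1) 0 (λ o → o) f≡ pq′ 2y refl z≤n φ≡ (inj₁ refl))
        (M-W¹ (suc p) q t (ℤ.- + 1) 1 not f≡ pq 2y′ refl (s≤s z≤n) (cong not φ≡) (inj₂ λ _ → refl))

      first-odd : f ≡ suc (t + t) → M S ≡ K *ℚ M (N⁴ p (suc q) z (suc t ∷ d) b) *ℚ M (N¹ (suc p) q z (t ∷ d) b)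
      first-odd f≡ = ordered (M-N⁴ p (suc q) t (+ 1) 0 (λ o → o) f≡ pq′ 2y refl z≤n φ≡ (cong not φ≡) (inj₁ refl))
        (M-N¹ (suc p) q t (ℤ.- + 1) 1 not f≡ pq 2y′ refl (s≤s z≤n) (cong not φ≡) (cong (λ o → not (not o)) φ≡) (inj₂ λ _ → refl))

open Parities
open import Defs
open import Data.Integer using (+_)
import Data.Integer as ℤ
import Data.Integer.Properties as ℤP
open import Data.Integer.Tactic.RingSolver using (solve-∀)
open import Data.List using (List; []; _∷_)
open import Data.Nat using (ℕ; zero; suc; _+_; _∸_; _^_; ⌊_/2⌋; ⌈_/2⌉)
open import Data.Nat.DivMod using (_/_; _%_; m*n/n≡m)
open import Data.Nat.ListAction using (sum)
import Data.Nat.Properties as ℕP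
open import Data.Product using (_×_; _,_; ∃)
open import Data.Rational using () renaming (_*_ to _*ℚ_; _/_ to _/ℚ_)
open import Data.Sum using (_⊎_; inj₁; inj₂)
open import Relation.Binary.PropositionalEquality

halves : ∀ n → ∃ λ p → n ≡ p + p ⊎ n ≡ suc (p + p)
halves zero = 0 , inj₁ refl
halves (suc n) with halves n
... | p , inj₁ e = p , inj₂ (cong suc e)
... | p , inj₂ e = suc p , inj₁ (trans (cong suc e) (cong suc (sym (ℕP.+-suc p p))))

even-% : ∀ p → (p + p) % 2 ≡ 0
even-% zero    = refl
even-% (suc p) = trans (cong (λ k → suc k % 2) (ℕP.+-suc p p)) (even-% p)

odd-% : ∀ p → suc (p + p) % 2 ≡ 1
odd-% zero    = refl
odd-% (suc p) = trans (cong (λ k → suc (suc k) % 2) (ℕP.+-suc p p)) (odd-% p)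

even-/ : ∀ p → (p + p) / 2 ≡ p
even-/ p = trans (cong (_/ 2) (sym (trans (ℕP.*-comm p 2) (cong (λ k → p + k) (ℕP.+-identityʳ p))))) (m*n/n≡m p 2)

successor-/ : ∀ p → (suc (p + p) + 1) / 2 ≡ suc p
successor-/ p = trans (cong (_/ 2) (trans (ℕP.+-comm (suc (p + p)) 1) (cong suc (sym (ℕP.+-suc p p))))) (even-/ (suc p))

floor-even : ∀ p → ⌊ p + p /2⌋ ≡ p
floor-even p = sym (ℕP.n≡⌊n+n/2⌋ p)

ceil-even : ∀ p → ⌈ p + p /2⌉ ≡ p
ceil-even p = sym (ℕP.n≡⌈n+n/2⌉ p)

floor-odd : ∀ p → ⌊ suc (p + p) /2⌋ ≡ p
floor-odd = ceil-even

ceil-odd : ∀ p → ⌈ suc (p + p) /2⌉ ≡ suc p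
ceil-odd p = cong suc (floor-even p)

exponent : ∀ y z f s t → y + z + (f + s) + t ∸ f ≡ y + z + s + t
exponent y z f s t = trans (cong (_∸ f) (rearranged)) (ℕP.m+n∸m≡n f (y + z + s + t))
  where
  rearranged : y + z + (f + s) + t ≡ f + (y + z + s + t)
  rearranged = trans (cong (_+ t) (trans (sym (ℕP.+-assoc (y + z) f s)) (trans (cong (_+ s) (ℕP.+-comm (y + z) f)) (ℕP.+-assoc f (y + z) s))))
    (ℕP.+-assoc f (y + z + s) t)

sum-even : ∀ p q → p + p + (q + q) ≡ p + q + (p + q)
sum-even p q = ℤP.+-injective (eq (+ p) (+ q))
  where
  eq : ∀ p q → p ℤ.+ p ℤ.+ (q ℤ.+ q) ≡ p ℤ.+ q ℤ.+ (p ℤ.+ q)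
  eq = solve-∀

sum-odd : ∀ p q → suc (p + p) + suc (q + q) ≡ suc (p + q) + suc (p + q)
sum-odd p q = ℤP.+-injective (eq (+ p) (+ q))
  where
  eq : ∀ p q → + 1 ℤ.+ (p ℤ.+ p) ℤ.+ (+ 1 ℤ.+ (q ℤ.+ q)) ≡ + 1 ℤ.+ (p ℤ.+ q) ℤ.+ (+ 1 ℤ.+ (p ℤ.+ q))
  eq = solve-∀

restated : ∀ {m c c′ i i′ j j′ k k′ l l′ n n′ o o′} (F G : ℕ → ℕ → ℕ → Region) →
  m ≡ c *ℚ M (F i j k) *ℚ M (G l n o) → c ≡ c′ →
  i′ ≡ i → j′ ≡ j → k′ ≡ k → l′ ≡ l → n′ ≡ n → o′ ≡ o →
  m ≡ c′ *ℚ M (F i′ j′ k′) *ℚ M (G l′ n′ o′)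
restated F G e refl refl refl refl refl refl refl = e

S¹-empty : ∀ x y z b → S¹ x y z [] b ≡ S¹ x y z (0 ∷ []) b
S¹-empty x y z b = refl

module _ (z : ℕ) (d b : List ℕ) where

  Even Odd : ℕ → ℕ → ℕ → Set
  Even x y f = M (S¹ x y z (f ∷ d) b)
        ≡ (+ (2 ^ (y + z + sum (f ∷ d) + sum b ∸ f)) /ℚ 1)
          *ℚ M (H² ⌊ x /2⌋ ⌈ y /2⌉ z (f / 2 ∷ d) b)
          *ℚ M (W¹ ⌈ x /2⌉ ⌊ y /2⌋ z (f / 2 ∷ d) b)
  Odd x y f = M (S¹ x y z (f ∷ d) b)
        ≡ (+ (2 ^ (y + z + sum (f ∷ d) + sum b ∸ f)) /ℚ 1)
          *ℚ M (N⁴ ⌊ x /2⌋ ⌈ y /2⌉ z ((f + 1) / 2 ∷ d) b)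
          *ℚ M (N¹ ⌈ x /2⌉ ⌊ y /2⌋ z ((f ∸ 1) / 2 ∷ d) b)

  powers : ∀ y f → (+ (2 ^ (y + z + sum d + sum b)) /ℚ 1) ≡ (+ (2 ^ (y + z + sum (f ∷ d) + sum b ∸ f)) /ℚ 1)
  powers y f = cong (λ e → + (2 ^ e) /ℚ 1) (sym (exponent y z f (sum d) (sum b)))

  even-even : ∀ x y f p q t → x ≡ p + p → y ≡ q + q → f ≡ t + t → Even x y f
  even-even x y f p q t x≡ y≡ f≡ = restated {i = p} {j = q} {k = t} {l = p} {n = q} {o = t} (λ i j k → H² i j z (k ∷ d) b) (λ i j k → W¹ i j z (k ∷ d) b)
    (C.first-even f≡) (powers y f)
    (trans (cong ⌊_/2⌋ x≡) (floor-even p)) (trans (cong ⌈_/2⌉ y≡) (ceil-even q)) (trans (cong (_/ 2) f≡) (even-/ t))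
    (trans (cong ⌈_/2⌉ x≡) (ceil-even p)) (trans (cong ⌊_/2⌋ y≡) (floor-even q)) (trans (cong (_/ 2) f≡) (even-/ t))
    where
    module P = Pairs x y z f d b (p + q) (trans (cong₂ _+_ x≡ y≡) (sum-even p q)) p q t
    module C = P.EvenX x≡ y≡ refl

  even-odd : ∀ x y f p q t → x ≡ p + p → y ≡ q + q → f ≡ suc (t + t) → Odd x y f
  even-odd x y f p q t x≡ y≡ f≡ = restated {i = p} {j = q} {k = suc t} {l = p} {n = q} {o = t} (λ i j k → N⁴ i j z (k ∷ d) b) (λ i j k → N¹ i j z (k ∷ d) b)
    (C.first-odd f≡) (powers y f)
    (trans (cong ⌊_/2⌋ x≡) (floor-even p)) (trans (cong ⌈_/2⌉ y≡) (ceil-even q)) (trans (cong (λ f → (f + 1) / 2) f≡) (successor-/ t))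
    (trans (cong ⌈_/2⌉ x≡) (ceil-even p)) (trans (cong ⌊_/2⌋ y≡) (floor-even q)) (trans (cong (λ f → (f ∸ 1) / 2) f≡) (even-/ t))
    where
    module P = Pairs x y z f d b (p + q) (trans (cong₂ _+_ x≡ y≡) (sum-even p q)) p q t
    module C = P.EvenX x≡ y≡ refl

  odd-even : ∀ x y f p q t → x ≡ suc (p + p) → y ≡ suc (q + q) → f ≡ t + t → Even x y f
  odd-even x y f p q t x≡ y≡ f≡ = restated {i = p} {j = suc q} {k = t} {l = suc p} {n = q} {o = t} (λ i j k → H² i j z (k ∷ d) b) (λ i j k → W¹ i j z (k ∷ d) b)
    (C.first-even f≡) (powers y f)
    (trans (cong ⌊_/2⌋ x≡) (floor-odd p)) (trans (cong ⌈_/2⌉ y≡) (ceil-odd q)) (trans (cong (_/ 2) f≡) (even-/ t))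
    (trans (cong ⌈_/2⌉ x≡) (ceil-odd p)) (trans (cong ⌊_/2⌋ y≡) (floor-odd q)) (trans (cong (_/ 2) f≡) (even-/ t))
    where
    module P = Pairs x y z f d b (suc (p + q)) (trans (cong₂ _+_ x≡ y≡) (sum-odd p q)) p q t
    module C = P.OddX x≡ y≡ refl

  odd-odd : ∀ x y f p q t → x ≡ suc (p + p) → y ≡ suc (q + q) → f ≡ suc (t + t) → Odd x y f
  odd-odd x y f p q t x≡ y≡ f≡ = restated {i = p} {j = suc q} {k = suc t} {l = suc p} {n = q} {o = t} (λ i j k → N⁴ i j z (k ∷ d) b) (λ i j k → N¹ i j z (k ∷ d) b)
    (C.first-odd f≡) (powers y f)
    (trans (cong ⌊_/2⌋ x≡) (floor-odd p)) (trans (cong ⌈_/2⌉ y≡) (ceil-odd q)) (trans (cong (λ f → (f + 1) / 2) f≡) (successor-/ t))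
    (trans (cong ⌈_/2⌉ x≡) (ceil-odd p)) (trans (cong ⌊_/2⌋ y≡) (floor-odd q)) (trans (cong (λ f → (f ∸ 1) / 2) f≡) (even-/ t))
    where
    module P = Pairs x y z f d b (suc (p + q)) (trans (cong₂ _+_ x≡ y≡) (sum-odd p q)) p q t
    module C = P.OddX x≡ y≡ refl

  OfParity : ℕ → ℕ → Set
  OfParity n p = n ≡ p + p ⊎ n ≡ suc (p + p)

  nonempty : ∀ x y f → x % 2 ≡ y % 2 → (f % 2 ≡ 0 → Even x y f) × (f % 2 ≡ 1 → Odd x y f)
  nonempty x y f e = let (p , x≡) = halves x ; (q , y≡) = halves y ; (t , f≡) = halves f in
    even-case p q t x≡ y≡ f≡ , odd-case p q t x≡ y≡ f≡
    where
    residue : ∀ n p → n ≡ p + p → n % 2 ≡ 0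
    residue n p e = trans (cong (_% 2) e) (even-% p)
    residue′ : ∀ n p → n ≡ suc (p + p) → n % 2 ≡ 1
    residue′ n p e = trans (cong (_% 2) e) (odd-% p)
    0≢1 : ∀ {A : Set} → 0 ≡ 1 → A
    0≢1 ()
    even-case : ∀ p q t → OfParity x p → OfParity y q → OfParity f t → f % 2 ≡ 0 → Even x y f
    even-case p q t (inj₁ x≡) (inj₁ y≡) (inj₁ f≡) _ = even-even x y f p q t x≡ y≡ f≡
    even-case p q t (inj₂ x≡) (inj₂ y≡) (inj₁ f≡) _ = odd-even x y f p q t x≡ y≡ f≡
    even-case p q t _ _ (inj₂ f≡) o = 0≢1 (trans (sym o) (residue′ f t f≡))
    even-case p q t (inj₁ x≡) (inj₂ y≡) _ _ = 0≢1 (trans (sym (residue x p x≡)) (trans e (residue′ y q y≡)))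
    even-case p q t (inj₂ x≡) (inj₁ y≡) _ _ = 0≢1 (trans (sym (residue y q y≡)) (trans (sym e) (residue′ x p x≡)))
    odd-case : ∀ p q t → OfParity x p → OfParity y q → OfParity f t → f % 2 ≡ 1 → Odd x y f
    odd-case p q t (inj₁ x≡) (inj₁ y≡) (inj₂ f≡) _ = even-odd x y f p q t x≡ y≡ f≡
    odd-case p q t (inj₂ x≡) (inj₂ y≡) (inj₂ f≡) _ = odd-odd x y f p q t x≡ y≡ f≡
    odd-case p q t _ _ (inj₁ f≡) o = 0≢1 (trans (sym (residue f t f≡)) o)
    odd-case p q t (inj₁ x≡) (inj₂ y≡) _ _ = 0≢1 (trans (sym (residue x p x≡)) (trans e (residue′ y q y≡)))
    odd-case p q t (inj₂ x≡) (inj₁ y≡) _ _ = 0≢1 (trans (sym (residue y q y≡)) (trans (sym e) (residue′ x p x≡)))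

theorem2p20 : (x y z : ℕ) (a b : List ℕ) → x % 2 ≡ y % 2 →
    (first a % 2 ≡ 0 →
    M (S¹ x y z a b)
    ≡ (+ (2 ^ (y + z + sum a + sum b ∸ first a)) /ℚ 1)
    *ℚ M (H² ⌊ x /2⌋ ⌈ y /2⌉ z (replaceFirst (first a / 2) a) b)
    *ℚ M (W¹ ⌈ x /2⌉ ⌊ y /2⌋ z (replaceFirst (first a / 2) a) b))
    × (first a % 2 ≡ 1 →
    M (S¹ x y z a b)
    ≡ (+ (2 ^ (y + z + sum a + sum b ∸ first a)) /ℚ 1)
    *ℚ M (N⁴ ⌊ x /2⌋ ⌈ y /2⌉ z (replaceFirst ((first a + 1) / 2) a) b)
    *ℚ M (N¹ ⌈ x /2⌉ ⌊ y /2⌋ z (replaceFirst ((first a ∸ 1) / 2) a) b))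
theorem2p20 x y z []      b e =
  let (E , O) = nonempty z [] b x y 0 e in
  (λ i → trans (cong M (S¹-empty x y z b)) (E i)) , λ i → trans (cong M (S¹-empty x y z b)) (O i)
theorem2p20 x y z (f ∷ d) b e = nonempty z d b x y f e
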